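{- Fix an integer $r>0$ and let $\beta$ be a partition whose first row has length strictly less than $r$. Then for all partitions $\alpha_1,\alpha_2$, \[ \tau^r_{\alpha_1,\alpha_2}\,\tau^r_{\emptyset,\beta}=\sum_{\gamma}\sum_{T\in\mathrm{RW}_\gamma(\beta*\alpha_2)}\Big(\tau^r_{\alpha_1,\gamma}+\sum_{(\lambda_1,\lambda_2,U)}\tau^r_{\lambda_1,\lambda_2}\Big), \] where $\gamma$ runs over straight shapes, and the inner sum runs over triples with $(\lambda_1,\lambda_2)\neq(\alpha_1,\gamma)$, $\alpha_1\subseteq\lambda_1$, $\lambda_2\subseteq\gamma$, $U\in\mathrm{RW}_{\gamma/\lambda_2}(\lambda_1/\alpha_1)$, such that (a) $U$ satisfies the barred $r$-th row rule: for every label $l$ of $U$, the entry of the $r$-th row rule filling of $\gamma$ at the box of $U$ containing $l$ is at most the row of $l$ in $\mathrm{rl}(\lambda_1/\alpha_1)$; and (b) the diffusion condition $C(T,U)$ holds.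
   Context: Partitions are Young diagrams in English notation (rows numbered $1,2,\dots$ top to bottom, columns left to right); $\alpha/\beta$ is a skew shape; standard tableaux of shape $\alpha/\beta$ are fillings by $1,\dots,|\alpha|-|\beta|$ increasing along rows and down columns. $\mathrm{rl}(\alpha/\beta)$: write $1,\dots,|\alpha|-|\beta|$ into $\alpha/\beta$ right to left along each row, rows top to bottom. $\mathrm{RW}_{\gamma/\delta}(\alpha/\beta)$: standard tableaux $T$ of shape $\gamma/\delta$ such that (i) if $i,i+1$ are in the same row of $\mathrm{rl}(\alpha/\beta)$ then $i+1$ is strictly right of and weakly above $i$ in $T$; (ii) if $i$ is directly above $j$ in a column of $\mathrm{rl}(\alpha/\beta)$ then $j$ is strictly below and weakly left of $i$ in $T$. Bases: $s_{\alpha_1,\alpha_2}=s_{\alpha_1}(x)s_{\alpha_2}(y)$ in $\Lambda_1\otimes_{\mathbb Z}\Lambda_2$ (symmetric functions in two sets of variables). Remmel–Whitney quiver: vertices pairs of partitions; for distinct pairs with $\alpha_1\subseteq\beta_1,\beta_2\subseteq\alpha_2$, one arrow $a_T:(\alpha_1,\alpha_2)\to(\beta_1,\beta_2)$ per $T\in\mathrm{RW}_{\beta_1/\alpha_1}(\alpha_2/\beta_2)$. The $r$-th row rule filling of a partition puts $r+i-j$ in row $i$, column $j$. For such an arrow and $i\in\{1,\dots,|\beta_1|-|\alpha_1|\}$, $R_r(i)$ is the entry of the $r$-th row rule filling of $\alpha_2$ at the box of $\alpha_2/\beta_2$ labelled $i$ in $\mathrm{rl}(\alpha_2/\beta_2)$;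 $a_T$ satisfies the $r$-th row rule if $R_r(i)\le$ (row of $i$ in $T$) for all $i$. The basis $\tau^r$ is defined recursively on $|\alpha_2|$ by $\tau^r_{\alpha_1,\alpha_2}=s_{\alpha_1,\alpha_2}-\sum_a\tau^r_{t(a)}$ over arrows $a$ with source $(\alpha_1,\alpha_2)$ satisfying the $r$-th row rule, $t(a)$ the target. Shape $\beta*\alpha_2$: with $b$ the length of the first row of $\beta$ and $m$ the number of rows of $\alpha_2$, $\beta*\alpha_2=((\alpha_2)_1+b,\dots,(\alpha_2)_m+b,\beta_1,\beta_2,\dots)/(b^m)$; its first $m$ rows form the "$\alpha_2$ part", whose box in row $i$, column $b+j$ corresponds to the box $(i,j)$ of $\alpha_2$. Robinson–Schensted: column insertion of $i$ into a tableau replaces the smallest entry $k>i$ of the first column by $i$ (or appends $i$ at the bottom if none) and then inserts $k$ into the next column, and so on; for a word $w$, $\mathrm{RS}(w)=(P,Q)$ with $P$ obtained by successively column-inserting the letters of $w$ and $Q$ the recording tableau (the box created at step $m$ gets label $m$); $\mathrm{RS}$ is a bijection from permutations to pairs of standard tableaux of equal shape. The reading word of a tableau lists its entries row by row from top to bottom, each row from right to left. Diffusion condition: given $T\in\mathrm{RW}_\gamma(\beta*\alpha_2)$ and $U\in\mathrm{RW}_{\gamma/\lambda_2}(\lambda_1/\alpha_1)$, let $k=|\lambda_2|$; let $\tilde U$ be the standard tableau of shape $\gamma$ whose boxes in $\lambda_2$ carry $1,\dots,k$ row by row (top to bottom, left to right in each row) and whose box carrying $m$ in $U$ carries $k+m$.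 Let $V$ be the tableau of shape $\beta*\alpha_2$ whose reading word is $\mathrm{RS}^{ -1}(\tilde U,T)$ ($\tilde U$ the insertion tableau, $T$ the recording tableau). $C(T,U)$ is the condition: for every box of the $\alpha_2$ part of $V$ whose entry is $k+m$ with $m\ge1$, the entry of the $r$-th row rule filling of $\alpha_2$ at the corresponding box of $\alpha_2$ is strictly greater than the row of the label $m$ in $\mathrm{rl}(\lambda_1/\alpha_1)$ (vacuously true if there is no such box). -}

module Defs where

-- Conventions: rows and columns are 0-indexed internally; a "row" in the
-- sense of the paper (1-indexed) is 1 + internal row index.
-- Everything is computable (Bool-valued predicates, finite enumerations).

open import Data.Bool using (Bool; true; false; _∧_; _∨_; not; if_then_else_; T)
open import Data.Nat as ℕ using (ℕ; zero; suc; _+_; _∸_; _≡ᵇ_; _<ᵇ_; _≤ᵇ_)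
open import Data.Integer as ℤ using (ℤ; +_)
open import Data.List as L using (List; []; _∷_; _++_; map; concatMap; concat;
  filterᵇ; length; foldr; foldl; replicate; reverse; zip; zipWith; splitAt)
open import Data.Maybe using (Maybe; just; nothing; fromMaybe)
open import Data.Product using (_×_; _,_; proj₁; proj₂)

range : ℕ → ℕ → List ℕ
range a b = L.applyUpTo (λ i → a + i) (b ∸ a)

at : List ℕ → ℕ → ℕ
at []       _       = 0
at (x ∷ xs) zero    = x
at (x ∷ xs) (suc i) = at xs i

atM : {A : Set} → List A → ℕ → Maybe A
atM []       _       = nothing
atM (x ∷ xs) zero    = just x
atM (x ∷ xs) (suc i) = atM xs i

sumℕ : List ℕ → ℕ
sumℕ = foldr _+_ 0

eqList : List ℕ → List ℕ → Bool
eqList []       []       = true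
eqList (x ∷ xs) (y ∷ ys) = (x ≡ᵇ y) ∧ eqList xs ys
eqList _        _        = false

allB : {A : Set} → (A → Bool) → List A → Bool
allB p = foldr (λ x b → p x ∧ b) true

count : ℕ → List ℕ → ℕ
count v xs = length (filterᵇ (λ x → x ≡ᵇ v) xs)

allWords : ℕ → ℕ → List (List ℕ)
allWords n zero      = [] ∷ []
allWords n (suc len) = concatMap (λ v → map (v ∷_) (allWords n len)) (range 1 (suc n))

weaklyDecr : List ℕ → Bool
weaklyDecr []           = true
weaklyDecr (x ∷ [])     = true
weaklyDecr (x ∷ y ∷ xs) = (y ≤ᵇ x) ∧ weaklyDecr (y ∷ xs)

isPartition : List ℕ → Bool
isPartition xs = weaklyDecr xs ∧ allB (λ x → 1 ≤ᵇ x) xs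

size : List ℕ → ℕ
size = sumℕ

firstRow : List ℕ → ℕ
firstRow xs = at xs 0

subset : List ℕ → List ℕ → Bool
subset α β = allB (λ i → at α i ≤ᵇ at β i) (range 0 (length α))

-- all partitions of n (every partition of n has at most n parts, each ≤ n)
partitionsOf : ℕ → List (List ℕ)
partitionsOf n = filterᵇ (λ p → isPartition p ∧ (size p ≡ᵇ n))
                         (concatMap (allWords n) (range 0 (suc n)))

partitionsUpTo : ℕ → List (List ℕ)
partitionsUpTo n = concatMap partitionsOf (range 0 (suc n))

record Skew : Set where
  constructor _/ₛ_
  field
    outer : List ℕ
    inner : List ℕ
open Skew public

Cell : Set
Cell = ℕ × ℕ   -- (row, column), 0-indexed

rowLen : Skew → ℕ → ℕ
rowLen sh i = at (outer sh) i ∸ at (inner sh) i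

cells : Skew → List Cell
cells sh = concatMap (λ i → map (λ j → (i , j)) (range (at (inner sh) i) (at (outer sh) i)))
                     (range 0 (length (outer sh)))

nCells : Skew → ℕ
nCells sh = length (cells sh)

eqCell : Cell → Cell → Bool
eqCell (a , b) (c , d) = (a ≡ᵇ c) ∧ (b ≡ᵇ d)

-- A filling of a skew shape sh is a list of entries, listed in the order
-- of `cells sh`.
Filling : Set
Filling = List ℕ

entryAt : Skew → Filling → Cell → Maybe ℕ
entryAt sh e c = go (zip (cells sh) e)
  where
  go : List (Cell × ℕ) → Maybe ℕ
  go []              = nothing
  go ((c' , x) ∷ xs) = if eqCell c c' then just x else go xs

-- position of a label (default (0,0) if absent; never used when absent)
posOf : Skew → Filling → ℕ → Cell
posOf sh e l = go (zip (cells sh) e)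
  where
  go : List (Cell × ℕ) → Cell
  go []              = (0 , 0)
  go ((c , x) ∷ xs)  = if x ≡ᵇ l then c else go xs

rowOf : Skew → Filling → ℕ → ℕ
rowOf sh e l = proj₁ (posOf sh e l)

colOf : Skew → Filling → ℕ → ℕ
colOf sh e l = proj₂ (posOf sh e l)

lessIfPresent : Maybe ℕ → Maybe ℕ → Bool
lessIfPresent (just x) (just y) = x <ᵇ y
lessIfPresent _        _        = true

isStandard : Skew → Filling → Bool
isStandard sh e =
  (length e ≡ᵇ nCells sh)
  ∧ allB (λ v → count v e ≡ᵇ 1) (range 1 (suc (nCells sh)))
  ∧ allB (λ { (i , j) → lessIfPresent (entryAt sh e (i , j)) (entryAt sh e (i , suc j))
                     ∧ lessIfPresent (entryAt sh e (i , j)) (entryAt sh e (suc i , j)) })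
        (cells sh)

permutations : ℕ → List (List ℕ)
permutations n = filterᵇ (λ w → allB (λ v → count v w ≡ᵇ 1) (range 1 (suc n))) (allWords n n)

stdTabs : Skew → List Filling
stdTabs sh = filterᵇ (isStandard sh) (allWords (nCells sh) (nCells sh))

rl : Skew → Filling
rl sh = go 0 (range 0 (length (outer sh)))
  where
  go : ℕ → List ℕ → List ℕ
  go off []       = []
  go off (i ∷ is) = reverse (range (suc off) (suc (off + rowLen sh i)))
                    ++ go (off + rowLen sh i) is

isRW : Skew → Skew → Filling → Bool
isRW sh₁ sh₂ t =
  isStandard sh₁ t ∧ (nCells sh₁ ≡ᵇ nCells sh₂) ∧ condI ∧ condII
  where
  R = rl sh₂
  condI = allB (λ i → if rowOf sh₂ R i ≡ᵇ rowOf sh₂ R (suc i)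
                     then (colOf sh₁ t i <ᵇ colOf sh₁ t (suc i))
                          ∧ (rowOf sh₁ t (suc i) ≤ᵇ rowOf sh₁ t i)
                     else true)
              (range 1 (nCells sh₂))
  condII = allB (λ { (p , q) → check (entryAt sh₂ R (p , q)) (entryAt sh₂ R (suc p , q)) })
               (cells sh₂)
    where
    check : Maybe ℕ → Maybe ℕ → Bool
    check (just i) (just j) = (rowOf sh₁ t i <ᵇ rowOf sh₁ t j) ∧ (colOf sh₁ t j ≤ᵇ colOf sh₁ t i)
    check _        _        = true

RW : Skew → Skew → List Filling
RW sh₁ sh₂ = filterᵇ (isRW sh₁ sh₂) (stdTabs sh₁)

-- r-th row rule filling: entry r + i - j at (1-indexed) row i, column j;
-- with 0-indexed (i , j) this is r + i - j as well.

rowRule : ℕ → Cell → ℤ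
rowRule r (i , j) = (+ (r + i)) ℤ.- (+ j)

_<ᶻ_ : ℤ → ℤ → Bool
x <ᶻ y = not (y ℤ.≤ᵇ x)

row1 : ℕ → ℤ
row1 i = + (suc i)

-- Polynomials in N x-variables and N y-variables with ℤ coefficients.
-- A monomial is an exponent vector (x₁..x_N, y₁..y_N), a polynomial a
-- finite formal sum of terms; equality is coefficientwise.

Mono : Set
Mono = List ℕ

Poly : Set
Poly = List (ℤ × Mono)

coeff : Poly → Mono → ℤ
coeff p m = foldr ℤ._+_ (+ 0) (map proj₁ (filterᵇ (λ t → eqList (proj₂ t) m) p))

_≐_ : Poly → Poly → Set
p ≐ q = ∀ m → coeff p m ≡ coeff q m
  where open import Relation.Binary.PropositionalEquality using (_≡_)

negP : Poly → Poly
negP = map (λ { (c , m) → (ℤ.- c , m) })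

mulP : Poly → Poly → Poly
mulP p q = concatMap (λ { (c , m) → map (λ { (d , n) → (c ℤ.* d , zipWith _+_ m n) }) q }) p

isSSYT : List ℕ → Filling → Bool
isSSYT λ' e =
  (length e ≡ᵇ nCells (λ' /ₛ []))
  ∧ allB (λ { (i , j) → leIfPresent (entryAt (λ' /ₛ []) e (i , j)) (entryAt (λ' /ₛ []) e (i , suc j))
                     ∧ lessIfPresent (entryAt (λ' /ₛ []) e (i , j)) (entryAt (λ' /ₛ []) e (suc i , j)) })
        (cells (λ' /ₛ []))
  where
  leIfPresent : Maybe ℕ → Maybe ℕ → Bool
  leIfPresent (just x) (just y) = x ≤ᵇ y
  leIfPresent _        _        = true

schurX : ℕ → List ℕ → Poly
schurX N λ' = map (λ e → (+ 1 , map (λ v → count v e) (range 1 (suc N)) ++ replicate N 0))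
                  (filterᵇ (isSSYT λ') (allWords N (size λ')))

schurY : ℕ → List ℕ → Poly
schurY N λ' = map (λ e → (+ 1 , replicate N 0 ++ map (λ v → count v e) (range 1 (suc N))))
                  (filterᵇ (isSSYT λ') (allWords N (size λ')))

s2 : ℕ → List ℕ → List ℕ → Poly
s2 N α₁ α₂ = mulP (schurX N α₁) (schurY N α₂)

-- arrow a_T : (α₁,α₂) → (β₁,β₂) satisfies the r-th row rule
rowRuleOK : ℕ → List ℕ → List ℕ → List ℕ → List ℕ → Filling → Bool
rowRuleOK r α₁ α₂ β₁ β₂ t =
  allB (λ i → rowRule r (posOf (α₂ /ₛ β₂) (rl (α₂ /ₛ β₂)) i) ℤ.≤ᵇ row1 (rowOf (β₁ /ₛ α₁) t i))
      (range 1 (suc (nCells (β₁ /ₛ α₁))))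

-- targets of arrows with source (α₁,α₂) satisfying the r-th row rule,
-- listed with multiplicity (one entry per arrow)
ruleTargets : ℕ → List ℕ → List ℕ → List (List ℕ × List ℕ)
ruleTargets r α₁ α₂ =
  concatMap (λ β₂ →
    concatMap (λ β₁ →
      if (eqList β₁ α₁ ∧ eqList β₂ α₂) then []
      else map (λ _ → (β₁ , β₂))
               (filterᵇ (rowRuleOK r α₁ α₂ β₁ β₂) (RW (β₁ /ₛ α₁) (α₂ /ₛ β₂))))
      (filterᵇ (subset α₁) (partitionsOf (size α₁ + (size α₂ ∸ size β₂)))))
    (filterᵇ (λ β₂ → subset β₂ α₂) (partitionsUpTo (size α₂)))

-- recursion on |α₂| (fuel = |α₂| + 1 suffices since targets have smaller |β₂|)
τfuel : ℕ → ℕ → ℕ → List ℕ → List ℕ → Poly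
τfuel zero     N r α₁ α₂ = []
τfuel (suc f)  N r α₁ α₂ =
  s2 N α₁ α₂ ++ negP (concatMap (λ { (β₁ , β₂) → τfuel f N r β₁ β₂ }) (ruleTargets r α₁ α₂))

τ : ℕ → ℕ → List ℕ → List ℕ → Poly
τ N r α₁ α₂ = τfuel (suc (size α₂)) N r α₁ α₂

star : List ℕ → List ℕ → Skew
star β α₂ = (map (λ a → a + firstRow β) α₂ ++ β) /ₛ replicate (length α₂) (firstRow β)

-- Robinson–Schensted by column insertion. Tableaux as lists of columns.

bumpCol : ℕ → List ℕ → List ℕ × Maybe ℕ
bumpCol x []       = (x ∷ [] , nothing)
bumpCol x (y ∷ ys) with x <ᵇ y
... | true  = (x ∷ ys , just y)
... | false with bumpCol x ys
...   | (ys' , b) = (y ∷ ys' , b)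

colInsert : ℕ → List (List ℕ) → List (List ℕ) × ℕ
colInsert x []       = ((x ∷ []) ∷ [] , 0)
colInsert x (c ∷ cs) with bumpCol x c
... | (c' , nothing) = (c' ∷ cs , 0)
... | (c' , just k) with colInsert k cs
...   | (cs' , j) = (c' ∷ cs' , suc j)

addAtCol : ℕ → ℕ → List (List ℕ) → List (List ℕ)
addAtCol zero    m []       = (m ∷ []) ∷ []
addAtCol zero    m (c ∷ cs) = (c ++ m ∷ []) ∷ cs
addAtCol (suc j) m []       = (m ∷ []) ∷ []
addAtCol (suc j) m (c ∷ cs) = c ∷ addAtCol j m cs

RSstep : List (List ℕ) × List (List ℕ) × ℕ → ℕ → List (List ℕ) × List (List ℕ) × ℕ
RSstep (P , Q , m) x with colInsert x P
... | (P' , j) = (P' , addAtCol j (suc m) Q , suc m)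

RScols : List ℕ → List (List ℕ) × List (List ℕ)
RScols w with foldl RSstep ([] , [] , 0) w
... | (P , Q , _) = (P , Q)

-- rows of a tableau given by its columns (columns weakly decreasing in length)
rowsOf : List (List ℕ) → List (List ℕ)
rowsOf cs = L.applyUpTo (λ i → L.mapMaybe (λ c → atM c i) cs) (length (at' cs))
  where
  at' : List (List ℕ) → List ℕ
  at' []      = []
  at' (c ∷ _) = c

sameTableau : List (List ℕ) → List ℕ → Filling → Bool
sameTableau cs λ' e = eqList (map length (rowsOf cs)) λ' ∧ eqList (concat (rowsOf cs)) e

-- filling of a skew shape whose reading word (rows top to bottom, each row
-- right to left) is w
fromReading : Skew → List ℕ → Filling
fromReading sh w = go (range 0 (length (outer sh))) w
  where
  go : List ℕ → List ℕ → List ℕ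
  go []       w = []
  go (i ∷ is) w = reverse (proj₁ (splitAt (rowLen sh i) w)) ++ go is (proj₂ (splitAt (rowLen sh i) w))

-- Ũ: boxes of λ₂ carry 1..k row by row, box carrying m in U carries k+m
Utilde : List ℕ → List ℕ → Filling → Filling
Utilde γ λ₂ u =
  map (λ { (i , j) → if j <ᵇ at λ₂ i
                      then suc (sumℕ (L.take i λ₂) + j)
                      else size λ₂ + fromMaybe 0 (entryAt (γ /ₛ λ₂) u (i , j)) })
      (cells (γ /ₛ []))

diffusion : ℕ → List ℕ → List ℕ → List ℕ → List ℕ → List ℕ → List ℕ
          → Filling → Filling → Bool
diffusion r α₁ α₂ β γ λ₁ λ₂ t u =
  allB (λ w → if sameTableau (proj₁ (RScols w)) γ (Utilde γ λ₂ u)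
                ∧ sameTableau (proj₂ (RScols w)) γ t
             then condV (fromReading (star β α₂) w)
             else true)
      (permutations (size γ))
  where
  k = size λ₂
  b = firstRow β
  condV : Filling → Bool
  condV v = allB (λ { (i , j) → check (i , j) (entryAt (star β α₂) v (i , j)) })
                (filterᵇ (λ c → proj₁ c <ᵇ length α₂) (cells (star β α₂)))
    where
    check : Cell → Maybe ℕ → Bool
    check (i , j) (just e) = if k <ᵇ e
                             then row1 (rowOf (λ₁ /ₛ α₁) (rl (λ₁ /ₛ α₁)) (e ∸ k)) <ᶻ rowRule r (i , j ∸ b)
                             else true
    check _ nothing = true

barredRowRule : ℕ → List ℕ → List ℕ → List ℕ → List ℕ → Filling → Bool
barredRowRule r α₁ γ λ₁ λ₂ u =
  allB (λ l → rowRule r (posOf (γ /ₛ λ₂) u l) ℤ.≤ᵇ row1 (rowOf (λ₁ /ₛ α₁) (rl (λ₁ /ₛ α₁)) l))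
       (range 1 (suc (nCells (γ /ₛ λ₂))))

-- Right-hand side of the theorem:
--   Σ_γ Σ_{T ∈ RW_γ(β*α₂)} ( τ_{α₁,γ} + Σ_{(λ₁,λ₂,U)} τ_{λ₁,λ₂} )
-- γ ranges over partitions of |β|+|α₂| (RW_γ(β*α₂) is empty otherwise);
-- λ₂ over partitions ⊆ γ, λ₁ over partitions ⊇ α₁ with
-- |λ₁/α₁| = |γ/λ₂| (U is empty otherwise), (λ₁,λ₂) ≠ (α₁,γ),
-- U ∈ RW_{γ/λ₂}(λ₁/α₁) with the barred row rule and C(T,U).

innerTriples : ℕ → ℕ → List ℕ → List ℕ → List ℕ → List ℕ → Filling → Poly
innerTriples N r α₁ α₂ β γ t =
  concatMap (λ λ₂ →
    concatMap (λ λ₁ →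
      if (eqList λ₁ α₁ ∧ eqList λ₂ γ) then []
      else concatMap (λ _ → τ N r λ₁ λ₂)
             (filterᵇ (λ u → barredRowRule r α₁ γ λ₁ λ₂ u ∧ diffusion r α₁ α₂ β γ λ₁ λ₂ t u)
                      (RW (γ /ₛ λ₂) (λ₁ /ₛ α₁))))
      (filterᵇ (subset α₁) (partitionsOf (size α₁ + (size γ ∸ size λ₂)))))
    (filterᵇ (λ λ₂ → subset λ₂ γ) (partitionsUpTo (size γ)))

rhs : ℕ → ℕ → List ℕ → List ℕ → List ℕ → Poly
rhs N r α₁ α₂ β =
  concatMap (λ γ →
    concatMap (λ t → τ N r α₁ γ ++ innerTriples N r α₁ α₂ β γ t)
              (RW (γ /ₛ []) (star β α₂)))
    (partitionsOf (size β + size α₂))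

{-# OPTIONS --safe #-}

-- A tableau in RW_{γ/δ}(α/β) is a picture in the sense of Zelevinsky: a bijection of skew shapes
-- that in both directions turns steps right or down into steps forward in the order right to left,
-- top to bottom.  Let Y = β * α₂ and let X be λ₂ placed above and to the right of λ₁/α₁.  A picture
-- γ/λ₂ → λ₁/α₁ extends to a picture γ → X, its insertion tableau being Ũ, and Robinson–Schensted
-- identifies pictures Y → X with pairs of pictures γ → X and γ → Y.  So a pair (T , U) is a picture
-- Y → X, and the diffusion condition says that none of the boxes of α₂ that are sent to λ₁/α₁
-- satisfies the row rule.  In an arbitrary picture Y → X the boxes of α₂ that do satisfy it form a
-- picture α₂/μ₂ → μ₁/α₁, that is, an arrow, and the rest is a picture fulfilling the diffusion
-- condition; conversely the two glue together.  The barred row rule is the same before and after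
-- the splitting: a satisfying entry that is bumped moves right and weakly up, hence still satisfies
-- the rule, so insertion on the remaining entries does not see the satisfying ones.
--
-- The recursion for τ says s = Σ τ over the arrows leaving a vertex, the trivial one included, and
-- τ_{∅,β} = s_{∅,β} because β has fewer than r columns.  Multiplying s_{α₁,α₂} by s_{∅,β} with the
-- Littlewood–Richardson rule and expanding gives the sum over arrows of the claimed identity, and
-- induction on |α₂| isolates the trivial arrow.
module Submission where

-- Pictures ask only for steps forward in ≺, while `RW` asks for positions (strictly right and
-- weakly above, strictly below and weakly left). That the former imply the latter (module `Strong`)
-- is what makes the row rule manageable: the rows of images increase weakly along the rows of α₂
-- and strictly down its columns, so the satisfying boxes are closed under steps right and down, and
-- the other ones form a partition μ₂.
--
-- When α₁ is replaced by μ₁ the labels of X change, and insertions of the two words of labels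
-- cannot be compared. The rows in X do not change, and the rules see nothing else. Insertion is
-- therefore set up for words with repeated letters, and the passage from labels to rows is a weakly
-- monotone relabelling under which it is stable.
--
-- As pictures, the tableau of an arrow and the tableau U of a triple point in opposite directions;
-- inversion turns the row rule into the barred one.
--
-- Pictures are functions on all cells and matter only on their shapes, so the bijection is kept as
-- a relation between enumerated fillings that pictures witness.

open import Defs
open import Data.Bool using (Bool; true; false; _∧_; not; if_then_else_; T)
open import Data.Bool.Properties using (T?)
open import Data.Empty using (⊥; ⊥-elim)
open import Data.Integer as ℤ using (ℤ)
import Data.Integer.Properties as ℤₚ
open import Data.List as L using (List; []; _∷_; _++_; map; concatMap; concat; filterᵇ; length; foldr; foldl; replicate; reverse; zip; zipWith; splitAt; take; drop; applyUpTo)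
open import Data.List.Properties
open import Data.List.Membership.Propositional using (_∈_; _∉_)
open import Data.List.Membership.Propositional.Properties
open import Data.List.Relation.Unary.Any using (here; there)
open import Data.List.Relation.Unary.All as All using (All; []; _∷_)
import Data.List.Relation.Unary.All.Properties as Allₚ
open import Data.List.Relation.Unary.AllPairs using (AllPairs; []; _∷_)
open import Data.List.Relation.Unary.Unique.Propositional using (Unique)
import Data.List.Relation.Unary.Unique.Propositional.Properties as Uₚ
open import Data.List.Relation.Binary.Permutation.Propositional as Perm using (_↭_; ↭-refl; ↭-sym; ↭-trans; prep; swap)
import Data.List.Relation.Binary.Permutation.Propositional.Properties as Permₚ
open import Data.Maybe using (Maybe; just; nothing; fromMaybe)
import Data.Maybe as Maybe
open import Data.Maybe.Properties using (just-injective)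
open import Data.Nat hiding (less; equal; greater; compare; pred)
open import Data.Nat.Properties
open import Data.Product using (Σ; ∃-syntax; _×_; _,_; proj₁; proj₂)
open import Data.Sum using (_⊎_; inj₁; inj₂)
open import Data.Unit using (tt)
open import Function using (_∘_; id; case_of_; _$_)
open import Relation.Binary.Definitions using (tri<; tri≈; tri>)
open import Relation.Binary.PropositionalEquality
open import Relation.Nullary using (¬_; Dec; yes; no)
open import Data.List.Reverse using (Reverse; reverseView; _∶_∶ʳ_) renaming ([] to []ʳ)
open import Data.Nat.DivMod using (m<n⇒m/n≡0; m*n/n≡m; +-distrib-/-∣ˡ; /-monoˡ-≤)
open import Data.Nat.Divisibility using (n∣m*n)
open import Data.List.Membership.DecPropositional _≟_ using (_∈?_)

-- Lists and finite sums

T-∧⁺ : ∀ {a b} → T a → T b → T (a ∧ b)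
T-∧⁺ {true} _ q = q

T-∧ˡ : ∀ {a b} → T (a ∧ b) → T a
T-∧ˡ {true} _ = tt

T-∧ʳ : ∀ {a b} → T (a ∧ b) → T b
T-∧ʳ {true} q = q

T-true : ∀ {b} → T b → b ≡ true
T-true {true} _ = refl

T-false : ∀ {b} → ¬ T b → b ≡ false
T-false {true}  n = ⊥-elim (n tt)
T-false {false} _ = refl

T-not⁺ : ∀ {b} → ¬ T b → T (not b)
T-not⁺ {true}  n = n tt
T-not⁺ {false} _ = tt

T-not⁻ : ∀ {b} → T (not b) → ¬ T b
T-not⁻ {false} _ ()

eqList⇒≡ : ∀ xs ys → T (eqList xs ys) → xs ≡ ys
eqList⇒≡ []       []       _ = refl
eqList⇒≡ (x ∷ xs) (y ∷ ys) h =
  cong₂ _∷_ (≡ᵇ⇒≡ x y (T-∧ˡ h)) (eqList⇒≡ xs ys (T-∧ʳ {x ≡ᵇ y} h))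

eqList-refl : ∀ xs → T (eqList xs xs)
eqList-refl []       = tt
eqList-refl (x ∷ xs) = T-∧⁺ {x ≡ᵇ x} (≡⇒≡ᵇ x x refl) (eqList-refl xs)

module _ {A : Set} where

  allB⁻ : ∀ {p : A → Bool} {xs} → T (allB p xs) → ∀ {x} → x ∈ xs → T (p x)
  allB⁻ {p} {x ∷ xs} h (here refl) = T-∧ˡ h
  allB⁻ {p} {x ∷ xs} h (there m)   = allB⁻ (T-∧ʳ {p x} h) m

  allB⁺ : ∀ {p : A → Bool} xs → (∀ {x} → x ∈ xs → T (p x)) → T (allB p xs)
  allB⁺ []       h = tt
  allB⁺ {p} (x ∷ xs) h = T-∧⁺ {p x} (h (here refl)) (allB⁺ xs (h ∘ there))

  ∈-filterᵇ⁺ : ∀ {p : A → Bool} {x xs} → x ∈ xs → T (p x) → x ∈ filterᵇ p xs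
  ∈-filterᵇ⁺ {p} = ∈-filter⁺ (T? ∘ p)

  ∈-filterᵇ⁻ : ∀ {p : A → Bool} {x xs} → x ∈ filterᵇ p xs → x ∈ xs × T (p x)
  ∈-filterᵇ⁻ {p} = ∈-filter⁻ (T? ∘ p)

  Unique-filterᵇ : ∀ {p : A → Bool} {xs} → Unique xs → Unique (filterᵇ p xs)
  Unique-filterᵇ {p} = Uₚ.filter⁺ (T? ∘ p)

  Unique-head∉ : ∀ {x : A} {xs} → Unique (x ∷ xs) → x ∉ xs
  Unique-head∉ (p ∷ _) m = All.lookup p m refl

  Unique-∷ : ∀ {x : A} {xs} → x ∉ xs → Unique xs → Unique (x ∷ xs)
  Unique-∷ n u = All.tabulate (λ m e → n (subst (_∈ _) (sym e) m)) ∷ u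

  Unique-↭ : ∀ {xs ys : List A} → xs ↭ ys → Unique xs → Unique ys
  Unique-↭ Perm.refl u = u
  Unique-↭ (prep x p) u@(_ ∷ u') =
    Unique-∷ (λ m → Unique-head∉ u (Permₚ.∈-resp-↭ (↭-sym p) m)) (Unique-↭ p u')
  Unique-↭ (swap x y p) ((n ∷ a) ∷ b ∷ u) =
    Unique-∷ (λ { (here e) → n (sym e) ; (there m) → All.lookup b (Permₚ.∈-resp-↭ (↭-sym p) m) refl })
      (Unique-∷ (λ m → All.lookup a (Permₚ.∈-resp-↭ (↭-sym p) m) refl) (Unique-↭ p u))
  Unique-↭ (Perm.trans p q) u = Unique-↭ q (Unique-↭ p u)

  Unique-++⁻ : ∀ (xs : List A) {ys} → Unique (xs ++ ys) → Unique xs × Unique ys × (∀ {x} → x ∈ xs → x ∉ ys)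
  Unique-++⁻ [] u = [] , u , λ ()
  Unique-++⁻ (x ∷ xs) (a ∷ u) with Unique-++⁻ xs u
  ... | p , q , r = Allₚ.++⁻ˡ xs a ∷ p , q ,
    λ { (here refl) m → All.lookup (Allₚ.++⁻ʳ xs a) m refl ; (there h) m → r h m }

  split-∈ : ∀ {x : A} {ys} → x ∈ ys → ∃[ zs ] ys ↭ x ∷ zs
  split-∈ {x} m with ∈-∃++ m
  ... | us , vs , refl = us ++ vs , Permₚ.shift x us vs

  pigeonhole : ∀ {xs ys : List A} → Unique xs → (∀ {z} → z ∈ xs → z ∈ ys) →
    length ys ≤ length xs → xs ↭ ys
  pigeonhole {[]} {[]} u h l = ↭-refl
  pigeonhole {x ∷ xs} {ys} u@(_ ∷ u') h l with split-∈ (h (here refl))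
  ... | zs , p = ↭-trans (prep x (pigeonhole u' h' (s≤s⁻¹ (subst (_≤ _) (Permₚ.↭-length p) l)))) (↭-sym p)
    where
    h' : ∀ {z} → z ∈ xs → z ∈ zs
    h' m with Permₚ.∈-resp-↭ p (h (there m))
    ... | here refl = ⊥-elim (Unique-head∉ u m)
    ... | there m'  = m'

  ↭-same : ∀ {xs ys : List A} → Unique xs → Unique ys →
    (∀ {z} → z ∈ xs → z ∈ ys) → (∀ {z} → z ∈ ys → z ∈ xs) → xs ↭ ys
  ↭-same {[]} {[]} u v f g = ↭-refl
  ↭-same {[]} {y ∷ ys} u v f g with g (here refl)
  ... | ()
  ↭-same {x ∷ xs} {ys} u@(_ ∷ u') v f g with split-∈ (f (here refl))
  ... | zs , p with Unique-↭ p v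
  ...   | w@(_ ∷ w') = ↭-trans (prep x (↭-same u' w' f' g')) (↭-sym p)
    where
    f' : ∀ {z} → z ∈ xs → z ∈ zs
    f' m with Permₚ.∈-resp-↭ p (f (there m))
    ... | here refl = ⊥-elim (Unique-head∉ u m)
    ... | there m'  = m'
    g' : ∀ {z} → z ∈ zs → z ∈ xs
    g' m with g (Permₚ.∈-resp-↭ (↭-sym p) (there m))
    ... | here refl = ⊥-elim (Unique-head∉ w m)
    ... | there m'  = m'

  atM-map : ∀ {B : Set} (f : A → B) xs i → atM (map f xs) i ≡ Maybe.map f (atM xs i)
  atM-map f []       i       = refl
  atM-map f (x ∷ xs) zero    = refl
  atM-map f (x ∷ xs) (suc i) = atM-map f xs i

  atM-< : ∀ (xs : List A) {i} → i < length xs → ∃[ x ] atM xs i ≡ just x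
  atM-< (x ∷ xs) {zero}  _ = x , refl
  atM-< (x ∷ xs) {suc i} h = atM-< xs (s≤s⁻¹ h)

  atM-just : ∀ (xs : List A) {i x} → atM xs i ≡ just x → i < length xs
  atM-just (x ∷ xs) {zero}  _ = s≤s z≤n
  atM-just (x ∷ xs) {suc i} e = s≤s (atM-just xs e)

  atM-≥ : ∀ (xs : List A) {i} → length xs ≤ i → atM xs i ≡ nothing
  atM-≥ []       _ = refl
  atM-≥ (x ∷ xs) {suc i} h = atM-≥ xs (s≤s⁻¹ h)

  atM-∈ : ∀ {xs : List A} {i x} → atM xs i ≡ just x → x ∈ xs
  atM-∈ {x ∷ xs} {zero}  refl = here refl
  atM-∈ {x ∷ xs} {suc i} e    = there (atM-∈ e)

  ∈-atM : ∀ {xs : List A} {x} → x ∈ xs → ∃[ i ] atM xs i ≡ just x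
  ∈-atM (here refl) = 0 , refl
  ∈-atM (there m) with ∈-atM m
  ... | i , e = suc i , e

  atM-ext : ∀ (xs ys : List A) → (∀ i → atM xs i ≡ atM ys i) → xs ≡ ys
  atM-ext []       []       h = refl
  atM-ext []       (y ∷ ys) h with h 0
  ... | ()
  atM-ext (x ∷ xs) []       h with h 0
  ... | ()
  atM-ext (x ∷ xs) (y ∷ ys) h = cong₂ _∷_ (just-injective (h 0)) (atM-ext xs ys (h ∘ suc))

  atM-++ˡ : ∀ (xs ys : List A) {i} → i < length xs → atM (xs ++ ys) i ≡ atM xs i
  atM-++ˡ (x ∷ xs) ys {zero}  _ = refl
  atM-++ˡ (x ∷ xs) ys {suc i} h = atM-++ˡ xs ys (s≤s⁻¹ h)

  atM-++ʳ : ∀ (xs ys : List A) i → atM (xs ++ ys) (length xs + i) ≡ atM ys i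
  atM-++ʳ []       ys i = refl
  atM-++ʳ (x ∷ xs) ys i = atM-++ʳ xs ys i

  atM-applyUpTo : ∀ (f : ℕ → A) n {i} → i < n → atM (applyUpTo f n) i ≡ just (f i)
  atM-applyUpTo f (suc n) {zero}  _ = refl
  atM-applyUpTo f (suc n) {suc i} h = atM-applyUpTo (f ∘ suc) n (s≤s⁻¹ h)

  map-cong-∈ : ∀ {B : Set} {f g : A → B} xs → (∀ {x} → x ∈ xs → f x ≡ g x) → map f xs ≡ map g xs
  map-cong-∈ []       h = refl
  map-cong-∈ (x ∷ xs) h = cong₂ _∷_ (h (here refl)) (map-cong-∈ xs (h ∘ there))

module _ {A B : Set} where

  Unique-map-∈ : ∀ {f : A → B} {xs} → Unique xs →
    (∀ {x y} → x ∈ xs → y ∈ xs → f x ≡ f y → x ≡ y) → Unique (map f xs)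
  Unique-map-∈ {xs = []} u h = []
  Unique-map-∈ {f = f} {x ∷ xs} u@(_ ∷ u') h =
    Unique-∷ n (Unique-map-∈ u' (λ a b → h (there a) (there b)))
    where
    n : f x ∉ map f xs
    n m with ∈-map⁻ f m
    ... | y , y∈ , e = Unique-head∉ u (subst (_∈ xs) (sym (h (here refl) (there y∈) e)) y∈)

applyUpTo-cong : ∀ {A : Set} {f g : ℕ → A} n → (∀ {i} → i < n → f i ≡ g i) → applyUpTo f n ≡ applyUpTo g n
applyUpTo-cong zero    h = refl
applyUpTo-cong (suc n) h = cong₂ _∷_ (h z<s) (applyUpTo-cong n (h ∘ s≤s))

∈-range⁺ : ∀ {a b v} → a ≤ v → v < b → v ∈ range a b
∈-range⁺ {a} {b} {v} a≤v v<b =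
  subst (_∈ range a b) (m+[n∸m]≡n a≤v) (∈-applyUpTo⁺ (λ i → a + i) (∸-monoˡ-< v<b a≤v))

∈-range⁻ : ∀ {a b v} → v ∈ range a b → a ≤ v × v < b
∈-range⁻ {a} {b} m with ∈-applyUpTo⁻ (λ i → a + i) m
... | i , i< , refl = m≤m+n a i , (begin-strict
    a + i        <⟨ +-monoʳ-< a i< ⟩
    a + (b ∸ a)  ≡⟨ m+[n∸m]≡n {a} {b} (<⇒≤ (m<n⇒m≢0∧≤ i<)) ⟩
    b            ∎)
  where
  open ≤-Reasoning
  m<n⇒m≢0∧≤ : ∀ {i} → i < b ∸ a → a < b
  m<n⇒m≢0∧≤ {i} h = ≰⇒> λ b≤a → n≮0 (subst (i <_) (m≤n⇒m∸n≡0 b≤a) h)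

Unique-range : ∀ a b → Unique (range a b)
Unique-range a b = Uₚ.applyUpTo⁺₁ (λ i → a + i) (b ∸ a) (λ i<j _ e → <⇒≢ i<j (+-cancelˡ-≡ a _ _ e))

length-range : ∀ a b → length (range a b) ≡ b ∸ a
length-range a b = length-applyUpTo (λ i → a + i) (b ∸ a)

bind : {A B : Set} → List A → (A → List B) → List (A × B)
bind xs f = concatMap (λ x → map (x ,_) (f x)) xs

module _ {A B : Set} where

  ∈-concatMap : ∀ {f : A → List B} {xs x y} → x ∈ xs → y ∈ f x → y ∈ concatMap f xs
  ∈-concatMap {f} (here refl) m = ∈-++⁺ˡ m
  ∈-concatMap {f} {x ∷ xs} (there h) m = ∈-++⁺ʳ (f x) (∈-concatMap h m)

  concatMap-∈ : ∀ {f : A → List B} xs {y} → y ∈ concatMap f xs → ∃[ x ] x ∈ xs × y ∈ f x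
  concatMap-∈ {f} (x ∷ xs) m with ∈-++⁻ (f x) m
  ... | inj₁ a = x , here refl , a
  ... | inj₂ b with concatMap-∈ xs b
  ...   | x' , h , c = x' , there h , c

  Unique-concatMap : ∀ {f : A → List B} {xs} → Unique xs → (∀ {x} → x ∈ xs → Unique (f x)) →
    (∀ {x x' y} → x ∈ xs → x' ∈ xs → y ∈ f x → y ∈ f x' → x ≡ x') → Unique (concatMap f xs)
  Unique-concatMap {f} {[]} u v d = []
  Unique-concatMap {f} {x ∷ xs} u@(_ ∷ u') v d =
    Uₚ.++⁺ (v (here refl)) (Unique-concatMap u' (v ∘ there) (λ a b → d (there a) (there b))) dis
    where
    dis : ∀ {y} → ¬ (y ∈ f x × y ∈ concatMap f xs)
    dis (a , b) with concatMap-∈ xs b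
    ... | x' , h , c with d (here refl) (there h) a c
    ...   | refl = Unique-head∉ u h

module _ {A B : Set} where

  ∈-bind⁺ : ∀ {f : A → List B} {xs x y} → x ∈ xs → y ∈ f x → (x , y) ∈ bind xs f
  ∈-bind⁺ h m = ∈-concatMap h (∈-map⁺ _ m)

  ∈-bind⁻ : ∀ {f : A → List B} {xs x y} → (x , y) ∈ bind xs f → x ∈ xs × y ∈ f x
  ∈-bind⁻ {xs = xs} m with concatMap-∈ xs m
  ... | x' , h , c with ∈-map⁻ _ c
  ...   | y' , m' , refl = h , m'

  Unique-bind : ∀ {f : A → List B} {xs} → Unique xs → (∀ {x} → x ∈ xs → Unique (f x)) → Unique (bind xs f)
  Unique-bind u v = Unique-concatMap u (λ m → Uₚ.map⁺ (cong proj₂) (v m)) λ _ _ a b → same a b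
    where
    same : ∀ {x x' ys ys'} {p : A × B} → p ∈ map (x ,_) ys → p ∈ map (x' ,_) ys' → x ≡ x'
    same a b with ∈-map⁻ _ a | ∈-map⁻ _ b
    ... | _ , _ , refl | _ , _ , refl = refl

ΣL : {A : Set} → (A → ℤ) → List A → ℤ
ΣL f []       = ℤ.0ℤ
ΣL f (x ∷ xs) = f x ℤ.+ ΣL f xs

module _ {A : Set} where

  ΣL-++ : ∀ (f : A → ℤ) xs ys → ΣL f (xs ++ ys) ≡ ΣL f xs ℤ.+ ΣL f ys
  ΣL-++ f []       ys = sym (ℤₚ.+-identityˡ _)
  ΣL-++ f (x ∷ xs) ys = trans (cong (λ z → f x ℤ.+ z) (ΣL-++ f xs ys)) (sym (ℤₚ.+-assoc (f x) _ _))

  ΣL-cong : ∀ {f g : A → ℤ} xs → (∀ {x} → x ∈ xs → f x ≡ g x) → ΣL f xs ≡ ΣL g xs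
  ΣL-cong []       h = refl
  ΣL-cong (x ∷ xs) h = cong₂ ℤ._+_ (h (here refl)) (ΣL-cong xs (h ∘ there))

  ΣL-↭ : ∀ (f : A → ℤ) {xs ys} → xs ↭ ys → ΣL f xs ≡ ΣL f ys
  ΣL-↭ f Perm.refl = refl
  ΣL-↭ f (prep x p) = cong (λ z → f x ℤ.+ z) (ΣL-↭ f p)
  ΣL-↭ f (swap x y p) = begin
    f x ℤ.+ (f y ℤ.+ _)  ≡⟨ ℤₚ.+-assoc (f x) (f y) _ ⟨
    f x ℤ.+ f y ℤ.+ _    ≡⟨ cong₂ ℤ._+_ (ℤₚ.+-comm (f x) (f y)) (ΣL-↭ f p) ⟩
    f y ℤ.+ f x ℤ.+ _    ≡⟨ ℤₚ.+-assoc (f y) (f x) _ ⟩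
    f y ℤ.+ (f x ℤ.+ _)  ∎
    where open ≡-Reasoning
  ΣL-↭ f (Perm.trans p q) = trans (ΣL-↭ f p) (ΣL-↭ f q)

  ΣL-map : ∀ {B : Set} (f : A → ℤ) (g : B → A) xs → ΣL f (map g xs) ≡ ΣL (f ∘ g) xs
  ΣL-map f g []       = refl
  ΣL-map f g (x ∷ xs) = cong (λ z → f (g x) ℤ.+ z) (ΣL-map f g xs)

  ΣL-concatMap : ∀ {B : Set} (f : A → ℤ) (g : B → List A) xs →
    ΣL f (concatMap g xs) ≡ ΣL (λ x → ΣL f (g x)) xs
  ΣL-concatMap f g []       = refl
  ΣL-concatMap f g (x ∷ xs) = trans (ΣL-++ f (g x) _) (cong (λ z → ΣL f (g x) ℤ.+ z) (ΣL-concatMap f g xs))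

module _ {A B : Set} where

  ΣL-bind : ∀ (f : A × B → ℤ) xs (g : A → List B) →
    ΣL f (bind xs g) ≡ ΣL (λ x → ΣL (λ y → f (x , y)) (g x)) xs
  ΣL-bind f xs g = trans (ΣL-concatMap f _ xs) (ΣL-cong xs λ {x} _ → ΣL-map f (x ,_) (g x))

-- A bijection in the form of a relation: the summands are indexed by fillings, while the
-- correspondence is witnessed by pictures, which are determined only on the boxes of their shapes.
-- The induction matches the head of `xs` with some `y` and deletes both.
ΣL-rel : {A B : Set} (R : A → B → Set) {F : A → ℤ} {G : B → ℤ} {xs : List A} {ys : List B} →
  Unique xs → Unique ys →
  (∀ {x} → x ∈ xs → ∃[ y ] y ∈ ys × R x y) →
  (∀ {y} → y ∈ ys → ∃[ x ] x ∈ xs × R x y) →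
  (∀ {x y y'} → x ∈ xs → y ∈ ys → y' ∈ ys → R x y → R x y' → y ≡ y') →
  (∀ {x x' y} → x ∈ xs → x' ∈ xs → y ∈ ys → R x y → R x' y → x ≡ x') →
  (∀ {x y} → R x y → F x ≡ G y) →
  ΣL F xs ≡ ΣL G ys
ΣL-rel R {xs = []} {[]} u v tot sur fun inj eq = refl
ΣL-rel R {xs = []} {y ∷ ys} u v tot sur fun inj eq with sur (here refl)
... | _ , () , _
ΣL-rel R {F} {G} {x ∷ xs} {ys} u@(_ ∷ u') v tot sur fun inj eq with tot (here refl)
... | y , y∈ , r with split-∈ y∈
...   | zs , p with Unique-↭ p v
...     | w@(_ ∷ w') = trans (cong₂ ℤ._+_ (eq r)
    (ΣL-rel R u' w' tot' sur' (λ a b c → fun (there a) (i b) (i c)) (λ a b c → inj (there a) (there b) (i c)) eq))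
    (sym (ΣL-↭ G p))
  where
  i : ∀ {z} → z ∈ zs → z ∈ ys
  i m = Permₚ.∈-resp-↭ (↭-sym p) (there m)
  tot' : ∀ {x'} → x' ∈ xs → ∃[ y' ] y' ∈ zs × R x' y'
  tot' m with tot (there m)
  ... | y' , h , r' with Permₚ.∈-resp-↭ p h
  ...   | here refl with inj (here refl) (there m) y∈ r r'
  ...     | refl = ⊥-elim (Unique-head∉ u m)
  tot' m | y' , h , r' | there h' = y' , h' , r'
  sur' : ∀ {y'} → y' ∈ zs → ∃[ x' ] x' ∈ xs × R x' y'
  sur' m with sur (i m)
  ... | x' , there h , r' = x' , h , r'
  ... | x' , here refl , r' with fun (here refl) y∈ (i m) r r'
  ...   | refl = ⊥-elim (Unique-head∉ w m)

count-Unique : ∀ {v xs} → Unique xs → v ∈ xs → count v xs ≡ 1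
count-Unique {v} {xs} u m with split-∈ m
... | zs , p with Unique-↭ p u
...   | w@(_ ∷ _) = ≤-antisym hi lo
  where
  ys = filterᵇ (λ x → x ≡ᵇ v) xs
  only : ∀ {z} → z ∈ ys → z ∈ v ∷ []
  only m' = here (≡ᵇ⇒≡ _ _ (proj₂ (∈-filterᵇ⁻ {p = λ x → x ≡ᵇ v} {xs = xs} m')))
  uy : Unique ys
  uy = Unique-filterᵇ u
  q : ys ↭ v ∷ []
  q = ↭-same uy ([] ∷ []) only
        (λ { (here refl) → ∈-filterᵇ⁺ {p = λ x → x ≡ᵇ v} m (≡⇒≡ᵇ v v refl) })
  hi : length ys ≤ 1
  hi = ≤-reflexive (Permₚ.↭-length q)
  lo : 1 ≤ length ys
  lo = ≤-reflexive (sym (Permₚ.↭-length q))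

count-∈ : ∀ v xs → count v xs ≢ 0 → v ∈ xs
count-∈ v xs h with filterᵇ (λ x → x ≡ᵇ v) xs in eq
... | [] = ⊥-elim (h refl)
... | y ∷ ys with ∈-filterᵇ⁻ {p = λ x → x ≡ᵇ v} {y} {xs} (subst (y ∈_) (sym eq) (here refl))
...   | m , t = subst (_∈ xs) (≡ᵇ⇒≡ y v t) m

-- Partitions

Decr : (ℕ → ℕ) → Set
Decr f = ∀ i → f (suc i) ≤ f i

Decr-≤ : ∀ {f} → Decr f → ∀ {i i'} → i ≤ i' → f i' ≤ f i
Decr-≤ {f} d {i} {i'} h = subst (λ k → f k ≤ f i) (m+[n∸m]≡n h) (go (i' ∸ i))
  where
  go : ∀ k → f (i + k) ≤ f i
  go zero    = ≤-reflexive (cong f (+-identityʳ i))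
  go (suc k) = ≤-trans (subst (λ z → f z ≤ f (i + k)) (sym (+-suc i k)) (d (i + k))) (go k)

psum : (ℕ → ℕ) → ℕ → ℕ
psum f zero    = 0
psum f (suc k) = psum f k + f k

psum-cons : ∀ f k → psum f (suc k) ≡ f 0 + psum (f ∘ suc) k
psum-cons f zero    = sym (+-identityʳ _)
psum-cons f (suc k) = trans (cong (_+ f (suc k)) (psum-cons f k)) (+-assoc (f 0) _ _)

psum-cong : ∀ {f g} k → (∀ {i} → i < k → f i ≡ g i) → psum f k ≡ psum g k
psum-cong zero    h = refl
psum-cong (suc k) h = cong₂ _+_ (psum-cong k (h ∘ m<n⇒m<1+n)) (h ≤-refl)

psum-mono : ∀ f {k l} → k ≤ l → psum f k ≤ psum f l
psum-mono f {k} {l} h = subst (λ z → psum f k ≤ psum f z) (m+[n∸m]≡n h) (go (l ∸ k))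
  where
  go : ∀ m → psum f k ≤ psum f (k + m)
  go zero    = ≤-reflexive (cong (psum f) (sym (+-identityʳ k)))
  go (suc m) = subst (λ z → psum f k ≤ psum f z) (sym (+-suc k m)) (≤-trans (go m) (m≤m+n _ _))

psum-+ : ∀ f g k → psum (λ i → f i + g i) k ≡ psum f k + psum g k
psum-+ f g zero    = refl
psum-+ f g (suc k) = begin
  psum (λ i → f i + g i) k + (f k + g k)  ≡⟨ cong (_+ (f k + g k)) (psum-+ f g k) ⟩
  psum f k + psum g k + (f k + g k)       ≡⟨ +-assoc (psum f k) _ _ ⟩
  psum f k + (psum g k + (f k + g k))     ≡⟨ cong (psum f k +_) (+-assoc (psum g k) _ _) ⟨
  psum f k + (psum g k + f k + g k)       ≡⟨ cong (λ z → psum f k + (z + g k)) (+-comm (psum g k) _) ⟩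
  psum f k + (f k + psum g k + g k)       ≡⟨ cong (psum f k +_) (+-assoc (f k) _ _) ⟩
  psum f k + (f k + (psum g k + g k))     ≡⟨ +-assoc (psum f k) _ _ ⟨
  psum f k + f k + (psum g k + g k)       ∎
  where open ≡-Reasoning

psum-split : ∀ f a b → psum f (a + b) ≡ psum f a + psum (λ i → f (a + i)) b
psum-split f a zero    = trans (cong (psum f) (+-identityʳ a)) (sym (+-identityʳ _))
psum-split f a (suc b) = trans (cong (psum f) (+-suc a b))
  (trans (cong (_+ f (a + b)) (psum-split f a b)) (+-assoc (psum f a) _ _))

psum-tail0 : ∀ f a {b} → a ≤ b → (∀ {i} → a ≤ i → f i ≡ 0) → psum f b ≡ psum f a
psum-tail0 f a {b} h z = subst (λ k → psum f k ≡ psum f a) (m+[n∸m]≡n h) (go (b ∸ a))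
  where
  go : ∀ m → psum f (a + m) ≡ psum f a
  go zero    = cong (psum f) (+-identityʳ a)
  go (suc m) = trans (cong (psum f) (+-suc a m))
    (trans (cong (psum f (a + m) +_) (z (m≤m+n a m))) (trans (+-identityʳ _) (go m)))

at-≥ : ∀ xs {i} → length xs ≤ i → at xs i ≡ 0
at-≥ []       _ = refl
at-≥ (x ∷ xs) {suc i} h = at-≥ xs (s≤s⁻¹ h)

at-<length : ∀ xs {i j} → j < at xs i → i < length xs
at-<length xs {i} {j} h = ≰⇒> λ l → n≮0 (subst (j <_) (at-≥ xs l) h)

size-psum : ∀ xs → size xs ≡ psum (at xs) (length xs)
size-psum []       = refl
size-psum (x ∷ xs) = trans (cong (x +_) (size-psum xs)) (sym (psum-cons (at (x ∷ xs)) (length xs)))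

size-psum-≥ : ∀ xs {k} → length xs ≤ k → size xs ≡ psum (at xs) k
size-psum-≥ xs h = trans (size-psum xs) (sym (psum-tail0 (at xs) _ h (at-≥ xs)))

IsPart : List ℕ → Set
IsPart xs = Decr (at xs) × All (1 ≤_) xs

weaklyDecr⁻ : ∀ xs → T (weaklyDecr xs) → Decr (at xs)
weaklyDecr⁻ []           h i       = z≤n
weaklyDecr⁻ (x ∷ [])     h i       = z≤n
weaklyDecr⁻ (x ∷ y ∷ xs) h zero    = ≤ᵇ⇒≤ y x (T-∧ˡ h)
weaklyDecr⁻ (x ∷ y ∷ xs) h (suc i) = weaklyDecr⁻ (y ∷ xs) (T-∧ʳ {y ≤ᵇ x} h) i

weaklyDecr⁺ : ∀ xs → Decr (at xs) → T (weaklyDecr xs)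
weaklyDecr⁺ []           d = tt
weaklyDecr⁺ (x ∷ [])     d = tt
weaklyDecr⁺ (x ∷ y ∷ xs) d = T-∧⁺ {y ≤ᵇ x} (≤⇒≤ᵇ (d 0)) (weaklyDecr⁺ (y ∷ xs) (d ∘ suc))

isPartition⁻ : ∀ xs → T (isPartition xs) → IsPart xs
isPartition⁻ xs h = weaklyDecr⁻ xs (T-∧ˡ h) ,
  All.tabulate λ m → ≤ᵇ⇒≤ 1 _ (allB⁻ {p = λ x → 1 ≤ᵇ x} (T-∧ʳ {weaklyDecr xs} h) m)

isPartition⁺ : ∀ xs → IsPart xs → T (isPartition xs)
isPartition⁺ xs (d , p) = T-∧⁺ {weaklyDecr xs} (weaklyDecr⁺ xs d)
  (allB⁺ {p = λ x → 1 ≤ᵇ x} xs λ m → ≤⇒≤ᵇ (All.lookup p m))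

IsPart-[] : IsPart []
IsPart-[] = (λ _ → z≤n) , []

at-ext : ∀ {xs ys} → IsPart xs → IsPart ys → (∀ i → at xs i ≡ at ys i) → xs ≡ ys
at-ext (_ , p) (_ , q) = go p q
  where
  go : ∀ {xs ys} → All (1 ≤_) xs → All (1 ≤_) ys → (∀ i → at xs i ≡ at ys i) → xs ≡ ys
  go []      []      h = refl
  go []      (q ∷ _) h = ⊥-elim (n≮0 (subst (1 ≤_) (sym (h 0)) q))
  go (p ∷ _) []      h = ⊥-elim (n≮0 (subst (1 ≤_) (h 0) p))
  go (p ∷ ps) (q ∷ qs) h = cong₂ _∷_ (h 0) (go ps qs (h ∘ suc))

subset⁻ : ∀ α β → T (subset α β) → ∀ i → at α i ≤ at β i
subset⁻ α β h i with i <? length α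
... | yes l = ≤ᵇ⇒≤ _ _ (allB⁻ {p = λ i → at α i ≤ᵇ at β i} h (∈-range⁺ z≤n l))
... | no  l = subst (_≤ at β i) (sym (at-≥ α (≮⇒≥ l))) z≤n

subset⁺ : ∀ α β → (∀ i → at α i ≤ at β i) → T (subset α β)
subset⁺ α β h = allB⁺ {p = λ i → at α i ≤ᵇ at β i} (range 0 (length α)) λ _ → ≤⇒≤ᵇ (h _)

mkPart : (ℕ → ℕ) → ℕ → List ℕ
mkPart h zero    = []
mkPart h (suc k) with h 0
... | zero  = []
... | suc m = suc m ∷ mkPart (h ∘ suc) k

mkPart-at : ∀ h k → Decr h → h k ≡ 0 → ∀ i → at (mkPart h k) i ≡ h i
mkPart-at h zero    d e i = sym (n≤0⇒n≡0 (subst (h i ≤_) e (Decr-≤ d z≤n)))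
mkPart-at h (suc k) d e i with h 0 in eq
mkPart-at h (suc k) d e i       | zero  = sym (n≤0⇒n≡0 (subst (h i ≤_) eq (Decr-≤ d z≤n)))
mkPart-at h (suc k) d e zero    | suc m = sym eq
mkPart-at h (suc k) d e (suc i) | suc m = mkPart-at (h ∘ suc) k (d ∘ suc) e i

mkPart-isPart : ∀ h k → Decr h → h k ≡ 0 → IsPart (mkPart h k)
mkPart-isPart h k d e =
  (λ i → subst₂ _≤_ (sym (mkPart-at h k d e (suc i))) (sym (mkPart-at h k d e i)) (d i)) , pos h k
  where
  pos : ∀ h k → All (1 ≤_) (mkPart h k)
  pos h zero    = []
  pos h (suc k) with h 0
  ... | zero  = []
  ... | suc m = s≤s z≤n ∷ pos (h ∘ suc) k

prefixLen : ∀ {P : ℕ → Set} → (∀ j → Dec (P j)) → ℕ → ℕ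
prefixLen d zero    = 0
prefixLen d (suc b) with d 0
... | yes _ = suc (prefixLen (d ∘ suc) b)
... | no  _ = 0

prefixLen⁻ : ∀ {P : ℕ → Set} (d : ∀ j → Dec (P j)) b {j} → j < prefixLen d b → P j
prefixLen⁻ d (suc b) h with d 0
prefixLen⁻ d (suc b) {zero}  h | yes p = p
prefixLen⁻ d (suc b) {suc j} h | yes p = prefixLen⁻ (d ∘ suc) b (s≤s⁻¹ h)

prefixLen⁺ : ∀ {P : ℕ → Set} (d : ∀ j → Dec (P j)) b {j} →
  j < b → (∀ {j'} → j' ≤ j → P j') → j < prefixLen d b
prefixLen⁺ d (suc b) {j} l h with d 0
... | no ¬p = ⊥-elim (¬p (h z≤n))
prefixLen⁺ d (suc b) {zero}  l h | yes p = s≤s z≤n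
prefixLen⁺ d (suc b) {suc j} l h | yes p = s≤s (prefixLen⁺ (d ∘ suc) b (s≤s⁻¹ l) (λ q → h (s≤s q)))

-- The row lengths are those of the initial runs of boxes in `D`, found by bounded search: closure
-- to the left makes each row a run, and closure upwards makes the lengths decrease. Both shapes μ₁
-- and μ₂ of the splitting arise in this way.
ideal : ∀ λ' (D : ℕ → ℕ → Set) → (∀ i j → Dec (D i j)) →
  (∀ {i j} → D i j → j < at λ' i) →
  (∀ {i j} → D (suc i) j → D i j) →
  (∀ {i j} → D i (suc j) → D i j) →
  ∃[ μ ] IsPart μ × (∀ {i j} → j < at μ i → D i j) × (∀ {i j} → D i j → j < at μ i)
ideal λ' D d bd up left = mkPart h (length λ') , mkPart-isPart h _ dec z ,
  (λ {i} l → h⁻ (subst (_ <_) (mkPart-at h _ dec z i) l)) ,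
  (λ {i} x → subst (_ <_) (sym (mkPart-at h _ dec z i)) (h⁺ x))
  where
  h : ℕ → ℕ
  h i = prefixLen (d i) (at λ' i)
  lefts : ∀ {i j j'} → D i j → j' ≤ j → D i j'
  lefts {j = zero} x z≤n = x
  lefts {j = suc j} {j'} x l with m≤n⇒m<n∨m≡n l
  ... | inj₁ l' = lefts (left x) (s≤s⁻¹ l')
  ... | inj₂ refl = x
  h⁻ : ∀ {i j} → j < h i → D i j
  h⁻ {i} l = prefixLen⁻ (d i) (at λ' i) l
  h⁺ : ∀ {i j} → D i j → j < h i
  h⁺ {i} x = prefixLen⁺ (d i) _ (bd x) (lefts x)
  dec : Decr h
  dec i = ≮⇒≥ λ l → <-irrefl refl (h⁺ (up (h⁻ l)))
  z : h (length λ') ≡ 0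
  z = n<1⇒n≡0 (≰⇒> λ l → n≮0 (subst (0 <_) (at-≥ λ' ≤-refl) (bd (h⁻ l))))

∈-allWords⁺ : ∀ {n w} → All (λ v → 1 ≤ v × v ≤ n) w → w ∈ allWords n (length w)
∈-allWords⁺ [] = here refl
∈-allWords⁺ ((a , b) ∷ r) = ∈-concatMap (∈-range⁺ a (s≤s b)) (∈-map⁺ _ (∈-allWords⁺ r))

∈-allWords⁻ : ∀ n l {w} → w ∈ allWords n l → length w ≡ l × All (λ v → 1 ≤ v × v ≤ n) w
∈-allWords⁻ n zero    (here refl) = refl , []
∈-allWords⁻ n (suc l) m with concatMap-∈ (range 1 (suc n)) m
... | v , v∈ , m' with ∈-map⁻ (v ∷_) m'
...   | w' , w'∈ , refl with ∈-allWords⁻ n l w'∈ | ∈-range⁻ v∈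
...     | e , a | x , y = cong suc e , (x , s≤s⁻¹ y) ∷ a

Unique-allWords : ∀ n l → Unique (allWords n l)
Unique-allWords n zero    = [] ∷ []
Unique-allWords n (suc l) = Unique-concatMap (Unique-range 1 (suc n))
  (λ _ → Uₚ.map⁺ ∷-injectiveʳ (Unique-allWords n l)) λ _ _ → same
  where
  same : ∀ {v v' w} {ws : List (List ℕ)} → w ∈ map (v ∷_) ws → w ∈ map (v' ∷_) ws → v ≡ v'
  same a b with ∈-map⁻ _ a | ∈-map⁻ _ b
  ... | _ , _ , refl | _ , _ , refl = refl

-- What completeness of `partitionsOf` needs: its search space consists of the words of at most n
-- letters between 1 and n.
part-bounds : ∀ {p} → All (1 ≤_) p → length p ≤ size p × All (λ v → 1 ≤ v × v ≤ size p) p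
part-bounds [] = z≤n , []
part-bounds {x ∷ p} (h ∷ hs) with part-bounds hs
... | a , b = ≤-trans (s≤s a) (+-monoˡ-≤ (size p) h) ,
  (h , m≤m+n x _) ∷ All.map (λ { (u , v) → u , ≤-trans v (m≤n+m _ x) }) b

∈-partitionsOf⁺ : ∀ {p} → IsPart p → p ∈ partitionsOf (size p)
∈-partitionsOf⁺ {p} h = ∈-filterᵇ⁺ {p = λ q → isPartition q ∧ (size q ≡ᵇ size p)}
  (∈-concatMap {f = allWords (size p)} (∈-range⁺ z≤n (s≤s (proj₁ (part-bounds (proj₂ h))))) (∈-allWords⁺ (proj₂ (part-bounds (proj₂ h)))))
  (T-∧⁺ {isPartition p} (isPartition⁺ p h) (≡⇒≡ᵇ (size p) _ refl))

∈-partitionsOf⁻ : ∀ n {p} → p ∈ partitionsOf n → IsPart p × size p ≡ n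
∈-partitionsOf⁻ n {p} m with ∈-filterᵇ⁻ {p = λ q → isPartition q ∧ (size q ≡ᵇ n)} {xs = concatMap (allWords n) (range 0 (suc n))} m
... | _ , t = isPartition⁻ p (T-∧ˡ t) , ≡ᵇ⇒≡ _ _ (T-∧ʳ {isPartition p} t)

Unique-partitionsOf : ∀ n → Unique (partitionsOf n)
Unique-partitionsOf n = Unique-filterᵇ {p = λ q → isPartition q ∧ (size q ≡ᵇ n)}
  (Unique-concatMap {f = allWords n} (Unique-range 0 (suc n)) (λ {l} _ → Unique-allWords n l)
  λ {l} {l'} _ _ a b → trans (sym (proj₁ (∈-allWords⁻ n l a))) (proj₁ (∈-allWords⁻ n l' b)))

∈-partitionsUpTo⁺ : ∀ {n p} → IsPart p → size p ≤ n → p ∈ partitionsUpTo n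
∈-partitionsUpTo⁺ h l = ∈-concatMap {f = partitionsOf} (∈-range⁺ z≤n (s≤s l)) (∈-partitionsOf⁺ h)

∈-partitionsUpTo⁻ : ∀ n {p} → p ∈ partitionsUpTo n → IsPart p × size p ≤ n
∈-partitionsUpTo⁻ n m with concatMap-∈ (range 0 (suc n)) m
... | k , k∈ , m' with ∈-partitionsOf⁻ k m'
...   | h , refl = h , s≤s⁻¹ (proj₂ (∈-range⁻ {0} {suc n} k∈))

Unique-partitionsUpTo : ∀ n → Unique (partitionsUpTo n)
Unique-partitionsUpTo n = Unique-concatMap {f = partitionsOf} (Unique-range 0 (suc n)) (λ {k} _ → Unique-partitionsOf k)
  λ {k} {k'} _ _ a b → trans (sym (proj₂ (∈-partitionsOf⁻ k a))) (proj₂ (∈-partitionsOf⁻ k' b))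

-- Boxes and fillings of skew shapes

infix 4 _∈ₛ_ _∈ₛ?_ _≺_

record _∈ₛ_ (c : Cell) (sh : Skew) : Set where
  constructor ins
  field
    inner≤ : at (inner sh) (proj₁ c) ≤ proj₂ c
    <outer : proj₂ c < at (outer sh) (proj₁ c)
open _∈ₛ_ public

_∈ₛ?_ : ∀ c sh → Dec (c ∈ₛ sh)
(i , j) ∈ₛ? sh with at (inner sh) i ≤? j | j <? at (outer sh) i
... | yes a | yes b = yes (ins a b)
... | no ¬a | _     = no λ m → ¬a (inner≤ m)
... | yes _ | no ¬b = no λ m → ¬b (<outer m)

∈cells⁺ : ∀ {sh c} → c ∈ₛ sh → c ∈ cells sh
∈cells⁺ {sh} {i , j} (ins a b) =
  ∈-bind⁺ {f = λ i → range (at (inner sh) i) (at (outer sh) i)}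
    (∈-range⁺ z≤n (at-<length (outer sh) b)) (∈-range⁺ a b)

∈cells⁻ : ∀ {sh c} → c ∈ cells sh → c ∈ₛ sh
∈cells⁻ {sh} {i , j} m with ∈-range⁻ {at (inner sh) i} {at (outer sh) i}
  (proj₂ (∈-bind⁻ {f = λ i → range (at (inner sh) i) (at (outer sh) i)} {xs = range 0 (length (outer sh))} m))
... | a , b = ins a b

Unique-cells : ∀ sh → Unique (cells sh)
Unique-cells sh = Unique-bind {f = λ i → range (at (inner sh) i) (at (outer sh) i)}
  (Unique-range 0 (length (outer sh))) (λ {i} _ → Unique-range (at (inner sh) i) (at (outer sh) i))

Convex : Skew → Set
Convex sh = Decr (at (outer sh)) × Decr (at (inner sh))

convex : ∀ {sh i j i' j' a b} → Convex sh → (i , j) ∈ₛ sh → (i' , j') ∈ₛ sh →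
  i ≤ a → a ≤ i' → j ≤ b → b ≤ j' → (a , b) ∈ₛ sh
convex (o , n) (ins p _) (ins _ q) x y u v =
  ins (≤-trans (Decr-≤ n x) (≤-trans p u)) (≤-trans (s≤s v) (≤-trans q (Decr-≤ o y)))

-- The order in which `rl` numbers the boxes.
data _≺_ : Cell → Cell → Set where
  above : ∀ {i j i' j'} → i < i' → (i , j) ≺ (i' , j')
  right : ∀ {i j j'} → j' < j → (i , j) ≺ (i , j')

≺-trans : ∀ {a b c} → a ≺ b → b ≺ c → a ≺ c
≺-trans (above p) (above q) = above (<-trans p q)
≺-trans (above p) (right q) = above p
≺-trans (right p) (above q) = above q
≺-trans (right p) (right q) = right (<-trans q p)

≺⇒ : ∀ {a b} → a ≺ b → proj₁ a < proj₁ b ⊎ (proj₁ a ≡ proj₁ b × proj₂ b < proj₂ a)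
≺⇒ (above p) = inj₁ p
≺⇒ (right p) = inj₂ (refl , p)

⇒≺ : ∀ {a b} → proj₁ a < proj₁ b ⊎ (proj₁ a ≡ proj₁ b × proj₂ b < proj₂ a) → a ≺ b
⇒≺ (inj₁ p) = above p
⇒≺ (inj₂ (refl , p)) = right p

≺-irrefl : ∀ {a b} → a ≡ b → ¬ (a ≺ b)
≺-irrefl refl (above p) = <-irrefl refl p
≺-irrefl refl (right p) = <-irrefl refl p

≺-asym : ∀ {a b} → a ≺ b → ¬ (b ≺ a)
≺-asym p q = ≺-irrefl refl (≺-trans p q)

≺-tri : ∀ a b → a ≺ b ⊎ a ≡ b ⊎ b ≺ a
≺-tri (i , j) (i' , j') with <-cmp i i'
... | tri< p _ _ = inj₁ (above p)
... | tri> _ _ p = inj₂ (inj₂ (above p))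
... | tri≈ _ refl _ with <-cmp j j'
...   | tri< p _ _ = inj₂ (inj₂ (right p))
...   | tri> _ _ p = inj₁ (right p)
...   | tri≈ _ refl _ = inj₂ (inj₁ refl)

_≟ᶜ_ : (a b : Cell) → Dec (a ≡ b)
a ≟ᶜ b with ≺-tri a b
... | inj₁ p = no λ e → ≺-irrefl e p
... | inj₂ (inj₁ e) = yes e
... | inj₂ (inj₂ p) = no λ e → ≺-irrefl (sym e) p

-- `rl` in closed form: the boxes in the rows above, plus those of the same row from column `j` to
-- its right end. On the boxes of the shape it carries ≺ to < and reflects it.
lab : Skew → Cell → ℕ
lab sh (i , j) = psum (rowLen sh) i + (at (outer sh) i ∸ j)

module _ {sh : Skew} where

  lab-hi : ∀ {c} → c ∈ₛ sh → lab sh c ≤ psum (rowLen sh) (suc (proj₁ c))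
  lab-hi {i , j} (ins a b) = +-monoʳ-≤ (psum (rowLen sh) i) (∸-monoʳ-≤ (at (outer sh) i) a)

  lab-lo : ∀ {c} → c ∈ₛ sh → psum (rowLen sh) (proj₁ c) < lab sh c
  lab-lo {i , j} (ins a b) = m<m+n (psum (rowLen sh) i) (m<n⇒0<n∸m b)

  lab-mono : ∀ {c c'} → c ∈ₛ sh → c' ∈ₛ sh → c ≺ c' → lab sh c < lab sh c'
  lab-mono m m' (above p) = ≤-<-trans (lab-hi m) (≤-<-trans (psum-mono (rowLen sh) p) (lab-lo m'))
  lab-mono {i , j} {_ , j'} m m' (right p) =
    +-monoʳ-< (psum (rowLen sh) i) (∸-monoʳ-< p (<⇒≤ (<outer m)))

  lab-≺ : ∀ {c c'} → c ∈ₛ sh → c' ∈ₛ sh → lab sh c < lab sh c' → c ≺ c'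
  lab-≺ {c} {c'} m m' l with ≺-tri c c'
  ... | inj₁ p = p
  ... | inj₂ (inj₁ refl) = ⊥-elim (<-irrefl refl l)
  ... | inj₂ (inj₂ p) = ⊥-elim (<-asym l (lab-mono m' m p))

  lab-inj : ∀ {c c'} → c ∈ₛ sh → c' ∈ₛ sh → lab sh c ≡ lab sh c' → c ≡ c'
  lab-inj {c} {c'} m m' e with ≺-tri c c'
  ... | inj₁ p = ⊥-elim (<-irrefl e (lab-mono m m' p))
  ... | inj₂ (inj₁ q) = q
  ... | inj₂ (inj₂ p) = ⊥-elim (<-irrefl (sym e) (lab-mono m' m p))

  lab-suc : ∀ {i j} → (i , suc j) ∈ₛ sh → lab sh (i , j) ≡ suc (lab sh (i , suc j))
  lab-suc {i} {j} (ins _ b) =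
    trans (cong (psum (rowLen sh) i +_) (+-∸-assoc 1 (<⇒≤ b))) (+-suc (psum (rowLen sh) i) _)

rows-psum : ∀ (f : ℕ → ℕ) {A : Set} (g : ℕ → List A) → (∀ i → length (g i) ≡ f i) →
  ∀ k → length (concat (applyUpTo g k)) ≡ psum f k
rows-psum f g h zero    = refl
rows-psum f g h (suc k) = trans (length-++ (g 0))
  (trans (cong₂ _+_ (h 0) (rows-psum (f ∘ suc) (g ∘ suc) (h ∘ suc) k)) (sym (psum-cons f k)))

cells-rows : ∀ sh → cells sh ≡
  concat (applyUpTo (λ i → map (i ,_) (range (at (inner sh) i) (at (outer sh) i))) (length (outer sh)))
cells-rows sh = cong concat (map-applyUpTo (λ i → i) _ (length (outer sh)))

nCells-psum : ∀ sh → nCells sh ≡ psum (rowLen sh) (length (outer sh))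
nCells-psum sh = trans (cong length (cells-rows sh)) (rows-psum (rowLen sh) _
  (λ i → trans (length-map (i ,_) (range (at (inner sh) i) (at (outer sh) i))) (length-range (at (inner sh) i) (at (outer sh) i))) (length (outer sh)))

lab-range : ∀ {sh c} → c ∈ₛ sh → 1 ≤ lab sh c × lab sh c ≤ nCells sh
lab-range {sh} {i , j} m = ≤-trans (s≤s z≤n) (lab-lo m) ,
  ≤-trans (lab-hi m) (subst (psum (rowLen sh) (suc i) ≤_) (sym (nCells-psum sh))
    (psum-mono (rowLen sh) (at-<length (outer sh) (<outer m))))

-- The function `go` inside `rl` is local and cannot be named from outside. It is recovered by
-- unification: after `with` has turned its arguments into variables, `refl` leaves a pattern
-- equation whose solution is that function. The other local functions of the definitions are
-- reached by the same device.
mutual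
  rlRows : Skew → ℕ → List ℕ → List ℕ
  rlRows = _

  rlRows-rl : ∀ sh → rl sh ≡ rlRows sh 0 (range 0 (length (outer sh)))
  rlRows-rl sh with 0 | range 0 (length (outer sh))
  ... | off | is = refl

reverse-applyUpTo-∸ : ∀ {A : Set} (k : ℕ → A) n → reverse (applyUpTo k n) ≡ applyUpTo (λ t → k (n ∸ suc t)) n
reverse-applyUpTo-∸ k n = trans (reverse-applyUpTo k n) (down n)
  where
  down : ∀ n → L.applyDownFrom k n ≡ applyUpTo (λ t → k (n ∸ suc t)) n
  down zero    = refl
  down (suc n) = cong (k n ∷_) (down n)

reverse-range : ∀ a n → reverse (range (suc a) (suc (a + n))) ≡ applyUpTo (λ t → a + (n ∸ t)) n
reverse-range a n = trans (cong (λ k → reverse (applyUpTo (λ i → suc a + i) k)) (m+n∸m≡n a n))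
  (trans (reverse-applyUpTo-∸ (λ i → suc a + i) n)
    (applyUpTo-cong n λ {t} l → trans (sym (+-suc a _)) (cong (a +_) (sym (+-∸-assoc 1 l)))))

rowLen-∸ : ∀ o n {t} → t < o ∸ n → (o ∸ n) ∸ t ≡ o ∸ (n + t)
rowLen-∸ o n {t} _ = ∸-+-assoc o n t

rl-lab : ∀ sh → rl sh ≡ map (lab sh) (cells sh)
rl-lab sh = trans (rlRows-rl sh) (trans (go 0 (length (outer sh)))
    (concat-map (map row (range 0 (length (outer sh))))))
  where
  row : ℕ → List Cell
  row i = map (i ,_) (range (at (inner sh) i) (at (outer sh) i))
  rowEq : ∀ i → reverse (range (suc (psum (rowLen sh) i)) (suc (psum (rowLen sh) i + rowLen sh i)))
    ≡ map (lab sh) (row i)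
  rowEq i = trans (reverse-range (psum (rowLen sh) i) (rowLen sh i))
    (trans (applyUpTo-cong (rowLen sh i) λ {t} l →
        cong (psum (rowLen sh) i +_) (rowLen-∸ (at (outer sh) i) (at (inner sh) i) l))
    (sym (trans (cong (map (lab sh)) (map-applyUpTo (λ t → at (inner sh) i + t) (i ,_) (rowLen sh i)))
      (map-applyUpTo (λ t → i , at (inner sh) i + t) (lab sh) (rowLen sh i)))))
  -- The running offset of `rl` is a partial sum of row lengths, so the induction starts from an
  -- arbitrary row `a`.
  go : ∀ a k → rlRows sh (psum (rowLen sh) a) (applyUpTo (λ i → a + i) k)
    ≡ concat (map (map (lab sh)) (map row (applyUpTo (λ i → a + i) k)))
  go a zero    = refl
  go a (suc k) = cong₂ _++_
    (subst (λ z → reverse (range (suc (psum (rowLen sh) a)) (suc (psum (rowLen sh) a + rowLen sh z))) ≡ map (lab sh) (row z))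
       (sym (+-identityʳ a)) (rowEq a))
    (subst₂ (λ z l → rlRows sh (psum (rowLen sh) a + rowLen sh z) l ≡ concat (map (map (lab sh)) (map row l)))
       (sym (+-identityʳ a)) (applyUpTo-cong k λ {i} _ → sym (+-suc a i)) (go (suc a) k))

-- Association-list lookups behind `entryAt` and `posOf`

look : Cell → List (Cell × ℕ) → Maybe ℕ
look c []              = nothing
look c ((c' , x) ∷ xs) = if eqCell c c' then just x else look c xs

find : ℕ → List (Cell × ℕ) → Cell
find l []             = (0 , 0)
find l ((c , x) ∷ xs) = if x ≡ᵇ l then c else find l xs

mutual
  lookD : Skew → Filling → Cell → List (Cell × ℕ) → Maybe ℕ
  lookD = _

  entryAt-lookD : ∀ sh e c → entryAt sh e c ≡ lookD sh e c (zip (cells sh) e)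
  entryAt-lookD sh e c with zip (cells sh) e
  ... | zs = refl

mutual
  findD : Skew → Filling → ℕ → List (Cell × ℕ) → Cell
  findD = _

  posOf-findD : ∀ sh e l → posOf sh e l ≡ findD sh e l (zip (cells sh) e)
  posOf-findD sh e l with zip (cells sh) e
  ... | zs = refl

entryAt-look : ∀ sh e c → entryAt sh e c ≡ look c (zip (cells sh) e)
entryAt-look sh e c = trans (entryAt-lookD sh e c) (go (zip (cells sh) e))
  where
  go : ∀ zs → lookD sh e c zs ≡ look c zs
  go []              = refl
  go ((c' , x) ∷ zs) with eqCell c c'
  ... | true  = refl
  ... | false = go zs

posOf-find : ∀ sh e l → posOf sh e l ≡ find l (zip (cells sh) e)
posOf-find sh e l = trans (posOf-findD sh e l) (go (zip (cells sh) e))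
  where
  go : ∀ zs → findD sh e l zs ≡ find l zs
  go []              = refl
  go ((c' , x) ∷ zs) with x ≡ᵇ l
  ... | true  = refl
  ... | false = go zs

eqCell⇒≡ : ∀ c c' → T (eqCell c c') → c ≡ c'
eqCell⇒≡ (a , b) (c , d) t = cong₂ _,_ (≡ᵇ⇒≡ a c (T-∧ˡ t)) (≡ᵇ⇒≡ b d (T-∧ʳ {a ≡ᵇ c} t))

eqCell-refl : ∀ c → T (eqCell c c)
eqCell-refl (a , b) = T-∧⁺ {a ≡ᵇ a} (≡⇒≡ᵇ a a refl) (≡⇒≡ᵇ b b refl)

look-map : ∀ (F : Cell → ℕ) {cs c} → c ∈ cs → look c (zip cs (map F cs)) ≡ just (F c)
look-map F {c' ∷ cs} {c} m with eqCell c c' in eq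
... | true = cong (just ∘ F) (sym (eqCell⇒≡ c c' (subst T (sym eq) tt)))
look-map F {c' ∷ cs} {c} (here refl) | false = ⊥-elim (subst T eq (eqCell-refl c))
look-map F {c' ∷ cs} {c} (there m)   | false = look-map F m

look-∉ : ∀ (F : Cell → ℕ) {cs c} → c ∉ cs → look c (zip cs (map F cs)) ≡ nothing
look-∉ F {[]}      n = refl
look-∉ F {c' ∷ cs} {c} n with eqCell c c' in eq
... | true  = ⊥-elim (n (here (eqCell⇒≡ c c' (subst T (sym eq) tt))))
... | false = look-∉ F (n ∘ there)

find-map : ∀ (F : Cell → ℕ) {cs c} → c ∈ cs → (∀ {a b} → a ∈ cs → b ∈ cs → F a ≡ F b → a ≡ b) →
  find (F c) (zip cs (map F cs)) ≡ c
find-map F {c' ∷ cs} {c} m inj with F c' ≡ᵇ F c in eq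
... | true = inj (here refl) m (≡ᵇ⇒≡ _ _ (subst T (sym eq) tt))
find-map F {c' ∷ cs} {c} (here refl) inj | false = ⊥-elim (subst T eq (≡⇒≡ᵇ (F c) _ refl))
find-map F {c' ∷ cs} {c} (there m)   inj | false = find-map F m (λ a b → inj (there a) (there b))

as-map : ∀ (cs : List Cell) (e : List ℕ) → Unique cs → length e ≡ length cs →
  e ≡ map (λ c → fromMaybe 0 (look c (zip cs e))) cs
as-map []       []      u h = refl
as-map (c ∷ cs) (x ∷ e) u@(_ ∷ u') h with eqCell c c in eq
... | false = ⊥-elim (subst T eq (eqCell-refl c))
... | true  = cong (x ∷_) (trans (as-map cs e u' (suc-injective h)) (map-cong-∈ cs (λ {c'} m → step m)))
  where
  step : ∀ {c'} → c' ∈ cs → fromMaybe 0 (look c' (zip cs e)) ≡ fromMaybe 0 (if eqCell c' c then just x else look c' (zip cs e))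
  step {c'} m with eqCell c' c in eq'
  ... | false = refl
  ... | true with eqCell⇒≡ c' c (subst T (sym eq') tt)
  ...   | refl = ⊥-elim (Unique-head∉ u m)

fill : Skew → (Cell → ℕ) → Filling
fill sh F = map F (cells sh)

module _ {sh : Skew} (F : Cell → ℕ) where

  entry-fill : ∀ {c} → c ∈ₛ sh → entryAt sh (fill sh F) c ≡ just (F c)
  entry-fill m = trans (entryAt-look sh _ _) (look-map F (∈cells⁺ m))

  entry-∉ : ∀ {c} → ¬ (c ∈ₛ sh) → entryAt sh (fill sh F) c ≡ nothing
  entry-∉ n = trans (entryAt-look sh _ _) (look-∉ F (n ∘ ∈cells⁻))

  posOf-fill : ∀ {c} → c ∈ₛ sh → (∀ {a b} → a ∈ₛ sh → b ∈ₛ sh → F a ≡ F b → a ≡ b) →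
    posOf sh (fill sh F) (F c) ≡ c
  posOf-fill m inj = trans (posOf-find sh _ _) (find-map F (∈cells⁺ m) λ a b → inj (∈cells⁻ a) (∈cells⁻ b))

as-fill : ∀ sh e → length e ≡ nCells sh → e ≡ fill sh (λ c → fromMaybe 0 (entryAt sh e c))
as-fill sh e h = trans (as-map (cells sh) e (Unique-cells sh) h)
  (map-cong-∈ (cells sh) λ {c} _ → cong (fromMaybe 0) (sym (entryAt-look sh e c)))

fill-cong : ∀ {sh F G} → (∀ {c} → c ∈ₛ sh → F c ≡ G c) → fill sh F ≡ fill sh G
fill-cong {sh} h = map-cong-∈ (cells sh) (h ∘ ∈cells⁻)

fill-inj : ∀ {sh F G} → fill sh F ≡ fill sh G → ∀ {c} → c ∈ₛ sh → F c ≡ G c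
fill-inj {sh} {F} {G} e {c} m = just-injective
  (trans (sym (entry-fill F m)) (trans (cong (λ z → entryAt sh z c) e) (entry-fill G m)))

cellOf : Skew → ℕ → Cell
cellOf sh l = posOf sh (rl sh) l

rl-entry : ∀ {sh c} → c ∈ₛ sh → entryAt sh (rl sh) c ≡ just (lab sh c)
rl-entry {sh} m = trans (cong (λ e → entryAt sh e _) (rl-lab sh)) (entry-fill (lab sh) m)

rl-entry-∉ : ∀ {sh c} → ¬ (c ∈ₛ sh) → entryAt sh (rl sh) c ≡ nothing
rl-entry-∉ {sh} m = trans (cong (λ e → entryAt sh e _) (rl-lab sh)) (entry-∉ (lab sh) m)

cellOf-lab : ∀ {sh c} → c ∈ₛ sh → cellOf sh (lab sh c) ≡ c
cellOf-lab {sh} {c} m = trans (cong (λ e → posOf sh e (lab sh c)) (rl-lab sh)) (posOf-fill (lab sh) m lab-inj)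

labels : ∀ sh → map (lab sh) (cells sh) ↭ range 1 (suc (nCells sh))
labels sh = pigeonhole (Unique-map-∈ (Unique-cells sh) λ a b → lab-inj (∈cells⁻ {sh} a) (∈cells⁻ b)) inr
    (≤-reflexive (trans (length-range 1 (suc (nCells sh))) (sym (length-map (lab sh) (cells sh)))))
  where
  inr : ∀ {z} → z ∈ map (lab sh) (cells sh) → z ∈ range 1 (suc (nCells sh))
  inr m with ∈-map⁻ (lab sh) m
  ... | c , c∈ , refl with lab-range {sh} (∈cells⁻ c∈)
  ...   | a , b = ∈-range⁺ a (s≤s b)

cell-of-label : ∀ {sh l} → 1 ≤ l → l ≤ nCells sh → ∃[ c ] c ∈ₛ sh × lab sh c ≡ l
cell-of-label {sh} a b with ∈-map⁻ (lab sh) (Permₚ.∈-resp-↭ (↭-sym (labels sh)) (∈-range⁺ a (s≤s b)))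
... | c , c∈ , refl = c , ∈cells⁻ c∈ , refl

cellOf-∈ : ∀ {sh l} → 1 ≤ l → l ≤ nCells sh → cellOf sh l ∈ₛ sh × lab sh (cellOf sh l) ≡ l
cellOf-∈ {sh} a b with cell-of-label {sh} a b
... | c , c∈ , refl = subst (_∈ₛ sh) (sym (cellOf-lab c∈)) c∈ , cong (lab sh) (cellOf-lab c∈)

cellOf-↭ : ∀ sh → applyUpTo (λ i → cellOf sh (suc i)) (nCells sh) ↭ cells sh
cellOf-↭ sh = pigeonhole (Uₚ.applyUpTo⁺₁ _ (nCells sh) λ {i} {j} i<j j< e → <-irrefl
    (suc-injective (trans (sym (proj₂ (cellOf-∈ {sh} (s≤s z≤n) (<-trans i<j j<)))) (trans (cong (lab sh) e) (proj₂ (cellOf-∈ {sh} (s≤s z≤n) j<))))) i<j)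
  (λ h → case ∈-applyUpTo⁻ _ h of λ { (i , i< , refl) → ∈cells⁺ (proj₁ (cellOf-∈ {sh} (s≤s z≤n) i<)) })
  (≤-reflexive (sym (length-applyUpTo _ (nCells sh))))

-- Pictures

-- A bijection between two skew shapes which, in both directions, turns a step to the right
-- or down into a step forward in the order ≺ (Zelevinsky's pictures).
record Pict (A B : Skew) : Set where
  field
    f g : Cell → Cell
    f∈ : ∀ {c} → c ∈ₛ A → f c ∈ₛ B
    g∈ : ∀ {d} → d ∈ₛ B → g d ∈ₛ A
    gf : ∀ {c} → c ∈ₛ A → g (f c) ≡ c
    fg : ∀ {d} → d ∈ₛ B → f (g d) ≡ d
    f→ : ∀ {i j} → (i , j) ∈ₛ A → (i , suc j) ∈ₛ A → f (i , j) ≺ f (i , suc j)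
    f↓ : ∀ {i j} → (i , j) ∈ₛ A → (suc i , j) ∈ₛ A → f (i , j) ≺ f (suc i , j)
    g→ : ∀ {i j} → (i , j) ∈ₛ B → (i , suc j) ∈ₛ B → g (i , j) ≺ g (i , suc j)
    g↓ : ∀ {i j} → (i , j) ∈ₛ B → (suc i , j) ∈ₛ B → g (i , j) ≺ g (suc i , j)

  f-inj : ∀ {a b} → a ∈ₛ A → b ∈ₛ A → f a ≡ f b → a ≡ b
  f-inj p q e = trans (sym (gf p)) (trans (cong g e) (gf q))

flip : ∀ {A B} → Pict A B → Pict B A
flip p = record { f = g ; g = f ; f∈ = g∈ ; g∈ = f∈ ; gf = fg ; fg = gf ; f→ = g→ ; f↓ = g↓ ; g→ = f→ ; g↓ = f↓ }
  where open Pict p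

module Strong {A B : Skew} (cA : Convex A) (cB : Convex B) (p : Pict A B) where
  open Pict p

  rights : ∀ {i j j'} → j < j' → (i , j) ∈ₛ A → (i , j') ∈ₛ A → f (i , j) ≺ f (i , j')
  rights {i} {j} {suc j'} l a b with m≤n⇒m<n∨m≡n (s≤s⁻¹ l)
  ... | inj₂ refl = f→ a b
  ... | inj₁ l' = ≺-trans (rights l' a m) (f→ m b)
    where m = convex cA a b ≤-refl ≤-refl (<⇒≤ l') (n≤1+n j')

  downs : ∀ {i i' j} → i < i' → (i , j) ∈ₛ A → (i' , j) ∈ₛ A → f (i , j) ≺ f (i' , j)
  downs {i} {suc i'} {j} l a b with m≤n⇒m<n∨m≡n (s≤s⁻¹ l)
  ... | inj₂ refl = f↓ a b
  ... | inj₁ l' = ≺-trans (downs l' a m) (f↓ m b)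
    where m = convex cA a b (<⇒≤ l') (n≤1+n i') ≤-refl ≤-refl

  mono : ∀ {i j i' j'} → i ≤ i' → j ≤ j' → (i , j) ≢ (i' , j') → (i , j) ∈ₛ A → (i' , j') ∈ₛ A →
    f (i , j) ≺ f (i' , j')
  mono {i} {j} {i'} {j'} x y n a b with m≤n⇒m<n∨m≡n x | m≤n⇒m<n∨m≡n y
  ... | inj₂ refl | inj₂ refl = ⊥-elim (n refl)
  ... | inj₂ refl | inj₁ l = rights l a b
  ... | inj₁ k | inj₂ refl = downs k a b
  ... | inj₁ k | inj₁ l = ≺-trans (downs k a m) (rights l m b)
    where m = convex cA a b x ≤-refl ≤-refl y

  -- Otherwise the second image lies in a lower row and weakly to the right of the first. Then
  -- `mono` puts (i , j) before (i , suc j), whereas ≺ runs from right to left.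
  g-right : ∀ {i j} → (i , j) ∈ₛ B → (i , suc j) ∈ₛ B →
    proj₁ (g (i , j)) ≤ proj₁ (g (i , suc j)) × proj₂ (g (i , suc j)) < proj₂ (g (i , j))
  g-right {i} {j} a b with g (i , j) in e | g (i , suc j) in e' | g→ a b
  ... | _ | _ | right l = ≤-refl , l
  ... | p₁ , q₁ | p₂ , q₂ | above l = <⇒≤ l , ≰⇒> λ q≤ →
        ≺-asym (subst₂ _≺_ (trans (cong f (sym e)) (fg a)) (trans (cong f (sym e')) (fg b))
          (mono (<⇒≤ l) q≤ (λ { refl → <-irrefl refl l }) (subst (_∈ₛ A) e (g∈ a)) (subst (_∈ₛ A) e' (g∈ b))))
          (right ≤-refl)

  g-rights : ∀ {i j j'} → j < j' → (i , j) ∈ₛ B → (i , j') ∈ₛ B →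
    proj₁ (g (i , j)) ≤ proj₁ (g (i , j')) × proj₂ (g (i , j')) < proj₂ (g (i , j))
  g-rights {i} {j} {suc j'} l a b with m≤n⇒m<n∨m≡n (s≤s⁻¹ l)
  ... | inj₂ refl = g-right a b
  ... | inj₁ l' with g-rights l' a m | g-right m b
    where m = convex cB a b ≤-refl ≤-refl (<⇒≤ l') (n≤1+n j')
  ...   | u , v | u' , v' = ≤-trans u u' , <-trans v' v

  -- By induction on the column: a violation at (i , j) produces one further left.
  g-down : ∀ j {i} → (i , j) ∈ₛ B → (suc i , j) ∈ₛ B → ∀ n → j < n →
    proj₁ (g (i , j)) < proj₁ (g (suc i , j)) × proj₂ (g (suc i , j)) ≤ proj₂ (g (i , j))
  g-down j {i} a b (suc n) h with g (i , j) in e | g (suc i , j) in e' | g↓ a b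
  ... | p₁ , q₁ | p₂ , q₂ | right l = ⊥-elim (≺-asym
        (subst₂ _≺_ (trans (cong f (sym e')) (fg b)) (trans (cong f (sym e)) (fg a))
          (rights l (subst (_∈ₛ A) e' (g∈ b)) (subst (_∈ₛ A) e (g∈ a))))
        (above ≤-refl))
  ... | p₁ , q₁ | p₂ , q₂ | above l = l , ≮⇒≥ bad
    where
    ga = subst (_∈ₛ A) e (g∈ a)
    gb = subst (_∈ₛ A) e' (g∈ b)
    bad : ¬ (q₁ < q₂)
    bad q< = go (f x) refl
        (subst (_≺ f x) (trans (cong f (sym e)) (fg a)) (rights q< ga x∈))
        (subst (f x ≺_) (trans (cong f (sym e')) (fg b)) (downs l x∈ gb))
      where
      -- The box in the row of the first image and the column of the second. Its image under `f`
      -- lies strictly between (i , j) and (suc i , j) in ≺, hence in row i left of column j or in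
      -- row suc i right of it. The second case contradicts `g-rights`, the first the induction
      -- hypothesis in a smaller column.
      x = (p₁ , q₂)
      x∈ : x ∈ₛ A
      x∈ = convex cA ga gb ≤-refl (<⇒≤ l) (<⇒≤ q<) ≤-refl
      go : ∀ y → f x ≡ y → (i , j) ≺ y → y ≺ (suc i , j) → ⊥
      go (i' , j') ex (above u) (above v) = <-irrefl refl (<-≤-trans v u)
      go (i' , j') ex (above _) (right v) = <-irrefl refl (subst₂ (λ s t → proj₂ s < proj₂ t)
        (trans (cong g (sym ex)) (gf x∈)) e'
        (proj₂ (g-rights v b (subst (_∈ₛ B) ex (f∈ x∈)))))
      go (i , j') ex (right v) _ = <-irrefl refl (<-≤-trans
          (subst (λ s → proj₂ s < proj₂ (g (suc i , j'))) e' (proj₂ (g-rights v y'∈ b)))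
          (subst (λ s → proj₂ (g (suc i , j')) ≤ proj₂ s) (trans (cong g (sym ex)) (gf x∈))
            (proj₂ (g-down j' y∈ y'∈ n (≤-trans v (s≤s⁻¹ h))))))
        where
        y∈ : (i , j') ∈ₛ B
        y∈ = subst (_∈ₛ B) ex (f∈ x∈)
        y'∈ : (suc i , j') ∈ₛ B
        y'∈ = ins (≤-trans (proj₂ cB i) (inner≤ y∈)) (<-trans v (<outer b))

pict-↭ : ∀ {A B} (p : Pict A B) → map (Pict.f p) (cells A) ↭ cells B
pict-↭ {A} {B} p = ↭-same (Unique-map-∈ (Unique-cells A) λ a b → f-inj (∈cells⁻ a) (∈cells⁻ b)) (Unique-cells B)
    (λ m → case ∈-map⁻ f m of λ { (c , c∈ , refl) → ∈cells⁺ (f∈ (∈cells⁻ c∈)) })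
    (λ {d} m → subst (_∈ map f (cells A)) (fg (∈cells⁻ m)) (∈-map⁺ f (∈cells⁺ (g∈ (∈cells⁻ m)))))
  where open Pict p

pict-size : ∀ {A B} → Pict A B → nCells A ≡ nCells B
pict-size {A} p = trans (sym (length-map (Pict.f p) (cells A))) (Permₚ.↭-length (pict-↭ p))

tab : ∀ {A B} → Pict A B → Filling
tab {A} {B} p = fill A (λ c → lab B (Pict.f p c))

tab-↭ : ∀ {A B} (p : Pict A B) → tab p ↭ range 1 (suc (nCells B))
tab-↭ {A} {B} p = ↭-trans (subst (_↭ map (lab B) (cells B)) (sym (map-∘ (cells A))) (Permₚ.map⁺ (lab B) (pict-↭ p))) (labels B)

-- Standard fillings, and the tableaux in `RW` as pictures

record Std (sh : Skew) (F : Cell → ℕ) : Set where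
  field
    F-range : ∀ {c} → c ∈ₛ sh → 1 ≤ F c × F c ≤ nCells sh
    F-inj : ∀ {a b} → a ∈ₛ sh → b ∈ₛ sh → F a ≡ F b → a ≡ b
    F-sur : ∀ {l} → 1 ≤ l → l ≤ nCells sh → ∃[ c ] c ∈ₛ sh × F c ≡ l
    F→ : ∀ {i j} → (i , j) ∈ₛ sh → (i , suc j) ∈ₛ sh → F (i , j) < F (i , suc j)
    F↓ : ∀ {i j} → (i , j) ∈ₛ sh → (suc i , j) ∈ₛ sh → F (i , j) < F (suc i , j)

module _ {sh : Skew} {F : Cell → ℕ} where

  fill-∈allWords : (∀ {c} → c ∈ₛ sh → 1 ≤ F c × F c ≤ nCells sh) → fill sh F ∈ allWords (nCells sh) (nCells sh)
  fill-∈allWords h = subst (λ l → fill sh F ∈ allWords (nCells sh) l) (length-map F (cells sh))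
    (∈-allWords⁺ (All.tabulate λ m → case ∈-map⁻ F m of λ { (c , c∈ , refl) → h (∈cells⁻ c∈) }))

  Std⇒isStandard : Std sh F → T (isStandard sh (fill sh F))
  Std⇒isStandard s = T-∧⁺ {length (fill sh F) ≡ᵇ nCells sh} (≡⇒≡ᵇ _ _ (length-map F (cells sh)))
      (T-∧⁺ (allB⁺ (range 1 (suc (nCells sh))) cnt) (allB⁺ (cells sh) λ { {i , j} m → adj m }))
    where
    open Std s
    cnt : ∀ {v} → v ∈ range 1 (suc (nCells sh)) → T (count v (fill sh F) ≡ᵇ 1)
    cnt m with ∈-range⁻ {1} {suc (nCells sh)} m
    ... | a , b with F-sur a (s≤s⁻¹ b)
    ...   | c , c∈ , refl = ≡⇒≡ᵇ _ _ (count-Unique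
            (Unique-map-∈ (Unique-cells sh) λ x y → F-inj (∈cells⁻ x) (∈cells⁻ y)) (∈-map⁺ F (∈cells⁺ c∈)))
    less : ∀ {c d} → c ∈ₛ sh → (d ∈ₛ sh → F c < F d) →
      T (lessIfPresent (entryAt sh (fill sh F) c) (entryAt sh (fill sh F) d))
    less {c} {d} a h with d ∈ₛ? sh
    ... | yes b rewrite entry-fill F a | entry-fill F b = <⇒<ᵇ (h b)
    ... | no ¬b rewrite entry-fill F a | entry-∉ {sh} F ¬b = tt
    adj : ∀ {i j} → (i , j) ∈ cells sh →
      T (lessIfPresent (entryAt sh (fill sh F) (i , j)) (entryAt sh (fill sh F) (i , suc j))
       ∧ lessIfPresent (entryAt sh (fill sh F) (i , j)) (entryAt sh (fill sh F) (suc i , j)))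
    adj {i} {j} m = T-∧⁺
      {lessIfPresent (entryAt sh (fill sh F) (i , j)) (entryAt sh (fill sh F) (i , suc j))}
      (less (∈cells⁻ m) (F→ (∈cells⁻ m))) (less (∈cells⁻ m) (F↓ (∈cells⁻ m)))

isStandard⇒Std : ∀ sh e → T (isStandard sh e) →
  ∃[ F ] e ≡ fill sh F × Std sh F
isStandard⇒Std sh e t = F , ef , record
    { F-range = λ m → let a , b = ∈-range⁻ {1} {suc (nCells sh)} (Permₚ.∈-resp-↭ (↭-sym per) (∈-map⁺ F (∈cells⁺ m))) in a , s≤s⁻¹ b
    ; F-inj = λ {a} {b} x y q → inj (cells sh) (Unique-↭ per (Unique-range 1 (suc (nCells sh)))) (∈cells⁺ x) (∈cells⁺ y) q
    ; F-sur = λ a b → case ∈-map⁻ F (Permₚ.∈-resp-↭ per (∈-range⁺ a (s≤s b))) of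
        λ { (c , c∈ , refl) → c , ∈cells⁻ c∈ , refl }
    ; F→ = λ {i} {j} a b → lt a b (T-∧ˡ {lessIfPresent (en (i , j)) (en (i , suc j))} (adj a))
    ; F↓ = λ {i} {j} a b → lt a b (T-∧ʳ {lessIfPresent (en (i , j)) (en (i , suc j))} (adj a)) }
  where
  en : Cell → Maybe ℕ
  en = entryAt sh e
  F : Cell → ℕ
  F c = fromMaybe 0 (en c)
  len : length e ≡ nCells sh
  len = ≡ᵇ⇒≡ _ _ (T-∧ˡ {length e ≡ᵇ nCells sh} t)
  ef : e ≡ fill sh F
  ef = as-fill sh e len
  t' = T-∧ʳ {length e ≡ᵇ nCells sh} t
  per : range 1 (suc (nCells sh)) ↭ map F (cells sh)
  per = pigeonhole (Unique-range 1 (suc (nCells sh)))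
    (λ {v} m → subst (v ∈_) ef (count-∈ v e λ z → case trans (sym z) (≡ᵇ⇒≡ _ _ (allB⁻ (T-∧ˡ t') m)) of λ ()))
    (≤-reflexive (trans (length-map F (cells sh)) (sym (length-range 1 (suc (nCells sh))))))
  adj : ∀ {i j} → (i , j) ∈ₛ sh → T (lessIfPresent (en (i , j)) (en (i , suc j)) ∧ lessIfPresent (en (i , j)) (en (suc i , j)))
  adj m = allB⁻ (T-∧ʳ {allB (λ v → count v e ≡ᵇ 1) (range 1 (suc (nCells sh)))} t') (∈cells⁺ m)
  enF : ∀ {c} → c ∈ₛ sh → en c ≡ just (F c)
  enF {c} m = trans (cong (λ z → entryAt sh z c) ef) (entry-fill F m)
  lt : ∀ {c d} → c ∈ₛ sh → d ∈ₛ sh → T (lessIfPresent (en c) (en d)) → F c < F d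
  lt {c} {d} a b h = <ᵇ⇒< (F c) (F d) (subst₂ (λ x y → T (lessIfPresent x y)) (enF a) (enF b) h)
  inj : ∀ cs → Unique (map F cs) → ∀ {a b} → a ∈ cs → b ∈ cs → F a ≡ F b → a ≡ b
  inj (c ∷ cs) u (here refl) (here refl) q = refl
  inj (c ∷ cs) u (here refl) (there y) q = ⊥-elim (Unique-head∉ u (subst (_∈ map F cs) (sym q) (∈-map⁺ F y)))
  inj (c ∷ cs) u (there x) (here refl) q = ⊥-elim (Unique-head∉ u (subst (_∈ map F cs) q (∈-map⁺ F x)))
  inj (c ∷ cs) (_ ∷ u) (there x) (there y) q = inj cs u x y q

pict-Std : ∀ {A B} (p : Pict A B) → Std A (λ c → lab B (Pict.f p c))
pict-Std {A} {B} p = record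
    { F-range = λ {c} m → subst (λ n → 1 ≤ lab B (f c) × lab B (f c) ≤ n) (sym (pict-size p)) (lab-range (f∈ m))
    ; F-inj = λ a b e → f-inj a b (lab-inj (f∈ a) (f∈ b) e)
    ; F-sur = λ a b → case cellOf-∈ {B} a (subst (_ ≤_) (pict-size p) b) of λ { (x , y) →
        _ , g∈ x , trans (cong (lab B) (fg x)) y }
    ; F→ = λ a b → lab-mono (f∈ a) (f∈ b) (f→ a b)
    ; F↓ = λ a b → lab-mono (f∈ a) (f∈ b) (f↓ a b) }
  where open Pict p

mutual
  checkRW : Skew → Skew → Filling → Maybe ℕ → Maybe ℕ → Bool
  checkRW = _

  isRW-column : ∀ A B t {i j} → T (isRW A B t) → (i , j) ∈ₛ B →
    checkRW A B t (entryAt B (rl B) (i , j)) (entryAt B (rl B) (suc i , j)) ≡ true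
  isRW-column A B t {i} {j} h m with allB⁻ {xs = cells B} (T-∧ʳ {allB _ (range 1 (nCells B))} (T-∧ʳ {nCells A ≡ᵇ nCells B} (T-∧ʳ {isStandard A t} h))) (∈cells⁺ m)
  ... | z₀ with T-true z₀
  ... | z with entryAt B (rl B) (i , j) | entryAt B (rl B) (suc i , j)
  ...   | x | y = z

if-intro : ∀ {b x} → (T b → T x) → T (if b then x else true)
if-intro {false} h = tt
if-intro {true}  h = h tt

if-true : ∀ {b x : Bool} → T b → T (if b then x else true) → T x
if-true {true} _ h = h

isRW-row : ∀ A B t {i} → T (isRW A B t) → i ∈ range 1 (nCells B) →
  rowOf B (rl B) i ≡ rowOf B (rl B) (suc i) →
  colOf A t i < colOf A t (suc i) × rowOf A t (suc i) ≤ rowOf A t i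
isRW-row A B t {i} h m e = <ᵇ⇒< _ _ (T-∧ˡ z) , ≤ᵇ⇒≤ _ _ (T-∧ʳ {colOf A t i <ᵇ colOf A t (suc i)} z)
  where
  z : T ((colOf A t i <ᵇ colOf A t (suc i)) ∧ (rowOf A t (suc i) ≤ᵇ rowOf A t i))
  z = if-true (≡⇒≡ᵇ _ _ e) (allB⁻ (T-∧ˡ (T-∧ʳ {nCells A ≡ᵇ nCells B} (T-∧ʳ {isStandard A t} h))) m)

up-right : ∀ {c d} → proj₁ c ≤ proj₁ d → proj₂ d < proj₂ c → c ≺ d
up-right u v with m≤n⇒m<n∨m≡n u
... | inj₁ l = above l
... | inj₂ refl = right v

module _ {A B : Skew} (cA : Convex A) (cB : Convex B) where

  -- Labels i and i + 1 in one row of `rl` belong to boxes of which the second lies on the left. So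
  -- condition (i) is `g-rights` read from right to left, and condition (ii) is `g-down`.
  tab∈RW : (p : Pict A B) → tab p ∈ RW A B
  tab∈RW p = ∈-filterᵇ⁺ {p = isRW A B} (∈-filterᵇ⁺ {p = isStandard A} (fill-∈allWords F-range) std)
      (T-∧⁺ {isStandard A t} std (T-∧⁺ {nCells A ≡ᵇ nCells B} (≡⇒≡ᵇ _ _ (pict-size p))
        (T-∧⁺ (allB⁺ (range 1 (nCells B)) condI) (allB⁺ (cells B) λ { {i , j} m → condII m }))))
    where
    open Pict p
    open Std (pict-Std p)
    open Strong cA cB p
    t = tab p
    std = Std⇒isStandard (pict-Std p)
    pos : ∀ {d} → d ∈ₛ B → posOf A t (lab B d) ≡ g d
    pos {d} m = trans (cong (λ z → posOf A t (lab B z)) (sym (fg m))) (posOf-fill _ (g∈ m) F-inj)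
    posL : ∀ {l} → 1 ≤ l → l ≤ nCells B → posOf A t l ≡ g (cellOf B l)
    posL {l} a b with cellOf-∈ {B} a b
    ... | x , y = trans (cong (posOf A t) (sym y)) (pos x)
    step : ∀ {c c'} → c ∈ₛ B → c' ∈ₛ B → suc (lab B c) ≡ lab B c' → proj₁ c ≡ proj₁ c' →
      T ((proj₂ (g c) <ᵇ proj₂ (g c')) ∧ (proj₁ (g c') ≤ᵇ proj₁ (g c)))
    step x x' e refl with lab-≺ x x' (≤-reflexive e)
    ... | above q = ⊥-elim (<-irrefl refl q)
    ... | right q = let u , v = g-rights q x' x in T-∧⁺ (<⇒<ᵇ v) (≤⇒≤ᵇ u)
    condI : ∀ {i} → i ∈ range 1 (nCells B) →
      T (if rowOf B (rl B) i ≡ᵇ rowOf B (rl B) (suc i)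
          then (colOf A t i <ᵇ colOf A t (suc i)) ∧ (rowOf A t (suc i) ≤ᵇ rowOf A t i) else true)
    condI {i} m = let a , b = ∈-range⁻ {1} {nCells B} m
                      x , y = cellOf-∈ {B} a (<⇒≤ b)
                      x' , y' = cellOf-∈ {B} {suc i} (s≤s z≤n) b in
      if-intro λ q → subst₂ (λ p p' → T ((proj₂ p <ᵇ proj₂ p') ∧ (proj₁ p' ≤ᵇ proj₁ p)))
        (sym (posL a (<⇒≤ b))) (sym (posL (s≤s z≤n) b)) (step x x' (trans (cong suc y) (sym y')) (≡ᵇ⇒≡ _ _ q))
    condII : ∀ {i j} → (i , j) ∈ cells B →
      T (checkRW A B t (entryAt B (rl B) (i , j)) (entryAt B (rl B) (suc i , j)))
    condII {i} {j} m with (suc i , j) ∈ₛ? B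
    ... | no ¬b rewrite rl-entry (∈cells⁻ {B} m) | rl-entry-∉ {B} ¬b = tt
    ... | yes b = subst₂ (λ x y → T (checkRW A B t x y)) (sym (rl-entry {B} (∈cells⁻ m))) (sym (rl-entry {B} b))
      (subst₂ (λ x y → T ((proj₁ x <ᵇ proj₁ y) ∧ (proj₂ y ≤ᵇ proj₂ x))) (sym (pos (∈cells⁻ m))) (sym (pos b))
        (let u , v = g-down j (∈cells⁻ m) b (suc j) ≤-refl in T-∧⁺ (<⇒<ᵇ u) (≤⇒≤ᵇ v)))

  -- The two conditions give the steps in ≺ at once: up and to the right is forward for ≺, and so is
  -- strictly below. By `lab-suc` the label of (i , j) is one more than that of (i , suc j), so
  -- condition (i) is applied with the boxes in this order.
  Std⇒pict : ∀ {F} → Std A F → T (isRW A B (fill A F)) → ∃[ p ] fill A F ≡ tab {A} {B} p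
  Std⇒pict {F} s h = p , fill-cong (λ m → sym (lab-F m))
    where
    open Std s
    t = fill A F
    h₂ = T-∧ʳ {isStandard A t} h
    n≡ : nCells A ≡ nCells B
    n≡ = ≡ᵇ⇒≡ _ _ (T-∧ˡ {nCells A ≡ᵇ nCells B} h₂)
    f g : Cell → Cell
    f c = cellOf B (F c)
    g d = posOf A t (lab B d)
    rng : ∀ {c} → c ∈ₛ A → 1 ≤ F c × F c ≤ nCells B
    rng {c} m = subst (λ n → 1 ≤ F c × F c ≤ n) n≡ (F-range m)
    f∈ : ∀ {c} → c ∈ₛ A → f c ∈ₛ B
    f∈ m = proj₁ (cellOf-∈ {B} (proj₁ (rng m)) (proj₂ (rng m)))
    lab-F : ∀ {c} → c ∈ₛ A → lab B (f c) ≡ F c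
    lab-F m = proj₂ (cellOf-∈ {B} (proj₁ (rng m)) (proj₂ (rng m)))
    gF : ∀ {c} → c ∈ₛ A → posOf A t (F c) ≡ c
    gF m = posOf-fill F m F-inj
    sur : ∀ {d} → d ∈ₛ B → ∃[ c ] c ∈ₛ A × F c ≡ lab B d
    sur {d} m = let a , b = lab-range m in F-sur a (subst (lab B d ≤_) (sym n≡) b)
    g∈F : ∀ {d} → d ∈ₛ B → g d ∈ₛ A × F (g d) ≡ lab B d
    g∈F {d} m = let c , c∈ , e = sur m in
      subst (λ z → z ∈ₛ A × F z ≡ lab B d) (sym (trans (cong (posOf A t) (sym e)) (gF c∈))) (c∈ , e)
    condI : ∀ {i j} → (i , j) ∈ₛ B → (i , suc j) ∈ₛ B → g (i , j) ≺ g (i , suc j)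
    condI {i} {j} a b = let u , v = isRW-row A B t h (∈-range⁺ {1} {nCells B} (proj₁ (lab-range b))
                              (subst (_≤ nCells B) (lab-suc b) (proj₂ (lab-range a))))
                              (trans (cong proj₁ (cellOf-lab b)) (sym (cong proj₁ (trans (cong (cellOf B) (sym (lab-suc b))) (cellOf-lab {B} a))))) in
      subst (_≺ g (i , suc j)) (sym (cong (posOf A t) (lab-suc {B} b))) (up-right v u)
    condII : ∀ {i j} → (i , j) ∈ₛ B → (suc i , j) ∈ₛ B → g (i , j) ≺ g (suc i , j)
    condII {i} {j} a b = above (<ᵇ⇒< _ _ (T-∧ˡ {rowOf A t (lab B (i , j)) <ᵇ rowOf A t (lab B (suc i , j))}
      (subst₂ (λ x y → T (checkRW A B t x y)) (rl-entry {B} a) (rl-entry {B} b) (subst T (sym (isRW-column A B t h a)) tt))))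
    p : Pict A B
    p = record { f = f ; g = g ; f∈ = f∈ ; g∈ = λ m → proj₁ (g∈F m)
      ; gf = λ m → trans (cong (posOf A t) (lab-F m)) (gF m)
      ; fg = λ m → trans (cong (cellOf B) (proj₂ (g∈F m))) (cellOf-lab m)
      ; f→ = λ a b → lab-≺ (f∈ a) (f∈ b) (subst₂ _<_ (sym (lab-F a)) (sym (lab-F b)) (F→ a b))
      ; f↓ = λ a b → lab-≺ (f∈ a) (f∈ b) (subst₂ _<_ (sym (lab-F a)) (sym (lab-F b)) (F↓ a b))
      ; g→ = condI ; g↓ = condII }

  RW⇒pict : ∀ {t} → t ∈ RW A B → ∃[ p ] t ≡ tab {A} {B} p
  RW⇒pict {t} m with ∈-filterᵇ⁻ {p = isRW A B} {xs = stdTabs A} m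
  ... | _ , h with isStandard⇒Std A t (T-∧ˡ h)
  ...   | F , refl , s = Std⇒pict s h

Unique-RW : ∀ A B → Unique (RW A B)
Unique-RW A B = Unique-filterᵇ {p = isRW A B} (Unique-filterᵇ {p = isStandard A} (Unique-allWords (nCells A) (nCells A)))

tab≡⇒f≡ : ∀ {A B} {p q : Pict A B} → tab p ≡ tab q → ∀ {c} → c ∈ₛ A → Pict.f p c ≡ Pict.f q c
tab≡⇒f≡ {p = p} {q} e m = lab-inj (Pict.f∈ p m) (Pict.f∈ q m) (fill-inj e m)

f≡⇒g≡ : ∀ {A B} {p q : Pict A B} → (∀ {c} → c ∈ₛ A → Pict.f p c ≡ Pict.f q c) →
  ∀ {d} → d ∈ₛ B → Pict.g p d ≡ Pict.g q d
f≡⇒g≡ {p = p} {q} h m = Pict.f-inj p (Pict.g∈ p m) (Pict.g∈ q m)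
  (trans (Pict.fg p m) (trans (sym (Pict.fg q m)) (sym (h (Pict.g∈ q m)))))

f≡⇒tab≡ : ∀ {A B} {p q : Pict A B} → (∀ {c} → c ∈ₛ A → Pict.f p c ≡ Pict.f q c) → tab p ≡ tab q
f≡⇒tab≡ {B = B} h = fill-cong (λ m → cong (lab B) (h m))

-- Column insertion.  `Ins` bumps the first entry that is ≥ x, so that it also makes sense for
-- words with repeated letters; on distinct letters it agrees with `colInsert`.

Cols : Set
Cols = List (List ℕ)

data Bump (x : ℕ) : List ℕ → List ℕ → Maybe ℕ → Set where
  end  : Bump x [] (x ∷ []) nothing
  hit  : ∀ {y c} → x ≤ y → Bump x (y ∷ c) (x ∷ c) (just y)
  skip : ∀ {y c c' m} → y < x → Bump x c c' m → Bump x (y ∷ c) (y ∷ c') m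

data Ins (x : ℕ) : Cols → Cols → ℕ → Set where
  new : Ins x [] ((x ∷ []) ∷ []) 0
  app : ∀ {c c' cs} → Bump x c c' nothing → Ins x (c ∷ cs) (c' ∷ cs) 0
  rep : ∀ {c c' y cs cs' j} → Bump x c c' (just y) → Ins y cs cs' j → Ins x (c ∷ cs) (c' ∷ cs') (suc j)

bump : ∀ x c → ∃[ c' ] ∃[ m ] Bump x c c' m
bump x [] = _ , _ , end
bump x (y ∷ c) with y <? x
... | yes l = let _ , _ , b = bump x c in _ , _ , skip l b
... | no ¬l = _ , _ , hit (≮⇒≥ ¬l)

insertR : ∀ x cs → ∃[ cs' ] ∃[ j ] Ins x cs cs' j
insertR x [] = _ , _ , new
insertR x (c ∷ cs) with bump x c
... | _ , nothing , b = _ , _ , app b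
... | _ , just y  , b = let _ , _ , i = insertR y cs in _ , _ , rep b i

insert : ℕ → Cols → Cols
insert x cs = proj₁ (insertR x cs)

insertAt : ℕ → Cols → ℕ
insertAt x cs = proj₁ (proj₂ (insertR x cs))

insert-Ins : ∀ x cs → Ins x cs (insert x cs) (insertAt x cs)
insert-Ins x cs = proj₂ (proj₂ (insertR x cs))

Bump-fun : ∀ {x c c₁ c₂ m₁ m₂} → Bump x c c₁ m₁ → Bump x c c₂ m₂ → c₁ ≡ c₂ × m₁ ≡ m₂
Bump-fun end end = refl , refl
Bump-fun (hit _) (hit _) = refl , refl
Bump-fun (hit p) (skip q _) = ⊥-elim (<⇒≱ q p)
Bump-fun (skip q _) (hit p) = ⊥-elim (<⇒≱ q p)
Bump-fun (skip _ a) (skip _ b) with Bump-fun a b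
... | refl , refl = refl , refl

Ins-fun : ∀ {x cs cs₁ cs₂ j₁ j₂} → Ins x cs cs₁ j₁ → Ins x cs cs₂ j₂ → cs₁ ≡ cs₂ × j₁ ≡ j₂
Ins-fun new new = refl , refl
Ins-fun (app a) (app b) with Bump-fun a b
... | refl , _ = refl , refl
Ins-fun (app a) (rep b _) with Bump-fun a b
... | _ , ()
Ins-fun (rep a _) (app b) with Bump-fun a b
... | _ , ()
Ins-fun (rep a i) (rep b k) with Bump-fun a b
... | refl , refl with Ins-fun i k
...   | refl , refl = refl , refl

insert-fun : ∀ {x cs cs' j} → Ins x cs cs' j → insert x cs ≡ cs' × insertAt x cs ≡ j
insert-fun = Ins-fun (insert-Ins _ _)

bumpCol-Bump : ∀ {x c c' m} → x ∉ c → Bump x c c' m → bumpCol x c ≡ (c' , m)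
bumpCol-Bump n end = refl
bumpCol-Bump {x} {y ∷ c} n (hit p) rewrite T-true (<⇒<ᵇ (≤∧≢⇒< p (n ∘ here))) = refl
bumpCol-Bump {x} {y ∷ c} n (skip q b)
  rewrite T-false {x <ᵇ y} (λ t → <-asym q (<ᵇ⇒< x y t)) | bumpCol-Bump (n ∘ there) b = refl

Bump-↭ : ∀ {x c c' m} → Bump x c c' m → c' ++ L.fromMaybe m ↭ x ∷ c
Bump-↭ end = ↭-refl
Bump-↭ (hit {y} {c} _) = prep _ (Permₚ.++-comm c (y ∷ []))
Bump-↭ (skip _ b) = ↭-trans (prep _ (Bump-↭ b)) (swap _ _ ↭-refl)

Bump-∈ : ∀ {x c c' y} → Bump x c c' (just y) → y ∈ c
Bump-∈ (hit _) = here refl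
Bump-∈ (skip _ b) = there (Bump-∈ b)

Bump-x∈ : ∀ {x c c' m} → Bump x c c' m → x ∈ c'
Bump-x∈ end = here refl
Bump-x∈ (hit _) = here refl
Bump-x∈ (skip _ b) = there (Bump-x∈ b)

Bump-≤ : ∀ {x c c' y} → Bump x c c' (just y) → x ≤ y
Bump-≤ (hit p) = p
Bump-≤ (skip _ b) = Bump-≤ b

Bump-nothing : ∀ {x c c'} → Bump x c c' nothing → c' ≡ c ++ x ∷ [] × All (_< x) c
Bump-nothing end = refl , []
Bump-nothing (skip q b) with Bump-nothing b
... | refl , a = refl , q ∷ a

Bump-append : ∀ {x c} → All (_< x) c → Bump x c (c ++ x ∷ []) nothing
Bump-append [] = end
Bump-append (p ∷ a) = skip p (Bump-append a)

Ins-↭ : ∀ {x cs cs' j} → Ins x cs cs' j → concat cs' ↭ x ∷ concat cs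
Ins-↭ new = ↭-refl
Ins-↭ (app {c} {c'} {cs} b) = Permₚ.++⁺ʳ (concat cs) (↭-trans (subst (c' ↭_) (sym (++-identityʳ c')) ↭-refl) (Bump-↭ b))
Ins-↭ {x} (rep {c} {c'} {y} {cs} {cs'} b i) =
  ↭-trans (Permₚ.++⁺ˡ c' (Ins-↭ i))
    (↭-trans (subst (_↭ (c' ++ y ∷ []) ++ concat cs) (++-assoc c' (y ∷ []) (concat cs)) ↭-refl)
      (Permₚ.++⁺ʳ (concat cs) (Bump-↭ b)))

colInsert-Ins : ∀ {x cs cs' j} → x ∉ concat cs → Unique (concat cs) → Ins x cs cs' j → colInsert x cs ≡ (cs' , j)
colInsert-Ins n u new = refl
colInsert-Ins n u (app b) rewrite bumpCol-Bump (n ∘ ∈-++⁺ˡ) b = refl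
colInsert-Ins n u (rep {c} {c'} {y} {cs} b i)
  rewrite bumpCol-Bump (n ∘ ∈-++⁺ˡ) b
  | colInsert-Ins (proj₂ (proj₂ (Unique-++⁻ c u)) (Bump-∈ b)) (proj₁ (proj₂ (Unique-++⁻ c u))) i = refl

-- Semistandard tableaux, given by their columns

Inc : List ℕ → Set
Inc = AllPairs _<_

-- The relation between neighbouring columns of a tableau: the right one is not longer, and rows
-- increase weakly.
data _⊑_ : List ℕ → List ℕ → Set where
  []  : ∀ {c} → c ⊑ []
  _∷_ : ∀ {x y c d} → x ≤ y → c ⊑ d → (x ∷ c) ⊑ (y ∷ d)

hd : Cols → List ℕ
hd []      = []
hd (c ∷ _) = c

data SS : Cols → Set where
  []   : SS []
  cons : ∀ {c cs} → Inc c → c ≢ [] → c ⊑ hd cs → SS cs → SS (c ∷ cs)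

Bump-All : ∀ {R : ℕ → Set} {x c c' m} → Bump x c c' m → All R c → R x → All R c'
Bump-All end a r = r ∷ []
Bump-All (hit _) (_ ∷ a) r = r ∷ a
Bump-All (skip _ b) (p ∷ a) r = p ∷ Bump-All b a r

Bump-Inc : ∀ {x c c' m} → Bump x c c' m → Inc c → Inc c'
Bump-Inc end i = [] ∷ []
Bump-Inc (hit p) (a ∷ i) = All.map (≤-<-trans p) a ∷ i
Bump-Inc (skip q b) (a ∷ i) = Bump-All b a q ∷ Bump-Inc b i

Bump-≢[] : ∀ {x c c' m} → Bump x c c' m → c' ≢ []
Bump-≢[] end ()
Bump-≢[] (hit _) ()
Bump-≢[] (skip _ _) ()

Bump-⊑ : ∀ {x c c' m d} → Bump x c c' m → c ⊑ d → c' ⊑ d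
Bump-⊑ b [] = []
Bump-⊑ (hit p) (q ∷ r) = ≤-trans p q ∷ r
Bump-⊑ (skip _ b) (q ∷ r) = q ∷ Bump-⊑ b r

-- The entry of the next column beside y, if there is one, is at least y, so y lands weakly above
-- its old row. The entries of the new left column from that old row upwards are at most y, hence
-- fit beside it.
Bump-⊑-Bump : ∀ {x c c' y d d' m} → Inc c → Bump x c c' (just y) → c ⊑ d → Bump y d d' m → c' ⊑ d'
Bump-⊑-Bump i (hit p) [] end = p ∷ []
Bump-⊑-Bump i (hit p) (q ∷ r) (hit _) = p ∷ r
Bump-⊑-Bump i (hit p) (q ∷ r) (skip z _) = ⊥-elim (<⇒≱ z q)
Bump-⊑-Bump (a ∷ i) (skip _ b) [] end = <⇒≤ (All.lookup a (Bump-∈ b)) ∷ []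
Bump-⊑-Bump (a ∷ i) (skip _ b) (q ∷ r) (hit _) = <⇒≤ (All.lookup a (Bump-∈ b)) ∷ Bump-⊑ b r
Bump-⊑-Bump (a ∷ i) (skip _ b) (q ∷ r) (skip _ b') = q ∷ Bump-⊑-Bump i b r b'

Ins-hd : ∀ {x cs cs' j} → Ins x cs cs' j → ∃[ m ] Bump x (hd cs) (hd cs') m
Ins-hd new = _ , end
Ins-hd (app b) = _ , b
Ins-hd (rep b _) = _ , b

Ins-SS : ∀ {x cs cs' j} → Ins x cs cs' j → SS cs → SS cs'
Ins-SS new s = cons ([] ∷ []) (λ ()) [] []
Ins-SS (app b) (cons i n r s) = cons (Bump-Inc b i) (Bump-≢[] b) (Bump-⊑ b r) s
Ins-SS (rep b k) (cons i n r s) =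
  cons (Bump-Inc b i) (Bump-≢[] b) (Bump-⊑-Bump i b r (proj₂ (Ins-hd k))) (Ins-SS k s)

grow : ℕ → List ℕ → List ℕ
grow zero    []       = 1 ∷ []
grow zero    (l ∷ ls) = suc l ∷ ls
grow (suc j) []       = 1 ∷ []
grow (suc j) (l ∷ ls) = l ∷ grow j ls

shape : Cols → List ℕ
shape = map length

Bump-length : ∀ {x c c' y} → Bump x c c' (just y) → length c' ≡ length c
Bump-length (hit _) = refl
Bump-length (skip _ b) = cong suc (Bump-length b)

length-∷ʳ' : ∀ {A : Set} (c : List A) {x} → length (c ++ x ∷ []) ≡ suc (length c)
length-∷ʳ' c = trans (length-++ c) (+-comm (length c) 1)

Ins-shape : ∀ {x cs cs' j} → Ins x cs cs' j → shape cs' ≡ grow j (shape cs)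
Ins-shape new = refl
Ins-shape (app {c} b) with Bump-nothing b
... | refl , _ = cong (_∷ _) (length-∷ʳ' c)
Ins-shape (rep b i) = cong₂ _∷_ (Bump-length b) (Ins-shape i)

Ins-index : ∀ {x cs cs' j} → Ins x cs cs' j → j ≤ length cs
Ins-index new = z≤n
Ins-index (app _) = z≤n
Ins-index (rep _ i) = s≤s (Ins-index i)

addAtCol-shape : ∀ j m cs → shape (addAtCol j m cs) ≡ grow j (shape cs)
addAtCol-shape zero    m []       = refl
addAtCol-shape zero    m (c ∷ cs) = cong (_∷ _) (length-∷ʳ' c)
addAtCol-shape (suc j) m []       = refl
addAtCol-shape (suc j) m (c ∷ cs) = cong (length c ∷_) (addAtCol-shape j m cs)

-- Reverse insertion

-- The entry y cannot have landed below the row it left, since the entries of c below y exceed y and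
-- would have to be at most y. From the landing row down to the old row the entries of d are at
-- least y and those of c at most y; in the other rows nothing has changed.
unbump-⊑ : ∀ {x c c' y d d' m} → Inc c → Inc d → Bump x c c' (just y) → Bump y d d' m → c' ⊑ d' → c ⊑ d
unbump-⊑ ic id b end r = []
unbump-⊑ ic id (hit p) (hit q) (_ ∷ r) = q ∷ r
unbump-⊑ (a ∷ ic) id (hit p) (skip q b') (_ ∷ r) = ⊥-elim (go a b' r)
  where
  go : ∀ {y c d d' m} → All (y <_) c → Bump y d d' m → c ⊑ d' → ⊥
  go (a ∷ _) end (q ∷ _) = <⇒≱ a q
  go (a ∷ _) (hit _) (q ∷ _) = <⇒≱ a q
  go (_ ∷ as) (skip _ b) (_ ∷ r) = go as b r
unbump-⊑ ic (a ∷ id) (skip p b) (hit q) (s ∷ r) = ≤-trans s q ∷ go b (All.map (λ h → <⇒≤ (≤-<-trans q h)) a) r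
  where
  go : ∀ {x c c' y d} → Bump x c c' (just y) → All (y ≤_) d → c' ⊑ d → c ⊑ d
  go b [] [] = []
  go (hit p) (h ∷ hs) (_ ∷ r) = h ∷ r
  go (skip p b) (h ∷ hs) (q ∷ r) = q ∷ go b hs r
unbump-⊑ (_ ∷ ic) (_ ∷ id) (skip _ b) (skip _ b') (s ∷ r) = s ∷ unbump-⊑ ic id b b' r

-- The letter y returns to the place of the lowest entry that is at most y, and that entry is the x
-- that had pushed it out. There is such an entry because the top one qualifies; in a tableau this
-- is `⊑-head`.
unbump : ∀ {y z} c → Inc (z ∷ c) → z ≤ y → ∃[ x ] ∃[ d ] Bump x d (z ∷ c) (just y) × Inc d
unbump {y} {z} [] i h = z , y ∷ [] , hit h , [] ∷ []
unbump {y} {z} (w ∷ c) (a ∷ i) h with w ≤? y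
... | yes p with unbump c i p
...   | x , d , b , id = x , z ∷ d , skip (All.lookup a (Bump-x∈ b)) b ,
          All.tabulate (λ m → big (Permₚ.∈-resp-↭ (↭-sym (Bump-↭ b)) (there m))) ∷ id
  where
  big : ∀ {v} → v ∈ (w ∷ c) ++ y ∷ [] → z < v
  big m with ∈-++⁻ (w ∷ c) m
  ... | inj₁ q = All.lookup a q
  ... | inj₂ (here refl) = <-≤-trans (All.head a) p
unbump {y} {z} (w ∷ c) (a ∷ (b ∷ i)) h | no ¬p =
  z , y ∷ w ∷ c , hit h , (≰⇒> ¬p ∷ All.map (<-trans (≰⇒> ¬p)) b) ∷ b ∷ i

⊑-length : ∀ {c d} → c ⊑ d → length d ≤ length c
⊑-length [] = z≤n
⊑-length (_ ∷ r) = s≤s (⊑-length r)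

⊑-head : ∀ {z c d y} → Inc (z ∷ c) → (z ∷ c) ⊑ d → y ∈ d → z ≤ y
⊑-head i (p ∷ _) (here refl) = p
⊑-head {c = w ∷ c} ((a ∷ _) ∷ i) (p ∷ r) (there m) = ≤-trans (<⇒≤ a) (⊑-head i r m)
⊑-head {c = []} i (p ∷ []) (there ())

⊑-init : ∀ c {y d} → (c ++ y ∷ []) ⊑ d → length d ≤ length c → c ⊑ d
⊑-init [] {d = []} r l = []
⊑-init (x ∷ c) [] l = []
⊑-init (x ∷ c) (p ∷ r) (s≤s l) = p ∷ ⊑-init c r l

Inc-init : ∀ c {y} → Inc (c ++ y ∷ []) → Inc c × All (_< y) c
Inc-init [] i = [] , []
Inc-init (x ∷ c) (a ∷ i) with Inc-init c i
... | i' , b = Allₚ.++⁻ˡ c a ∷ i' , All.head (Allₚ.++⁻ʳ c a) ∷ b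

data Shape : List ℕ → Set where
  []   : Shape []
  cons : ∀ {l ls} → 1 ≤ l → at ls 0 ≤ l → Shape ls → Shape (l ∷ ls)

hd-shape : ∀ cs → at (shape cs) 0 ≡ length (hd cs)
hd-shape []      = refl
hd-shape (c ∷ _) = refl

length-pos : ∀ {A : Set} {c : List A} → c ≢ [] → 1 ≤ length c
length-pos {c = []} n = ⊥-elim (n refl)
length-pos {c = _ ∷ _} _ = s≤s z≤n

SS-Shape : ∀ {cs} → SS cs → Shape (shape cs)
SS-Shape [] = []
SS-Shape (cons {c} {cs} i n r s) =
  cons (length-pos n) (subst (_≤ length c) (sym (hd-shape cs)) (⊑-length r)) (SS-Shape s)

-- Reverse insertion, starting from the box by which the shape exceeds `ls`, the foot of column j.
-- The columns behind the first are restored before it and hand back the letter y that re-enters the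
-- first one.
delete : ∀ {cs'} j ls → SS cs' → Shape ls → j ≤ length ls → shape cs' ≡ grow j ls →
  ∃[ x ] ∃[ cs ] Ins x cs cs' j × SS cs × shape cs ≡ ls
delete {(x ∷ []) ∷ []} zero [] s h l e = x , [] , new , [] , refl
delete {c' ∷ cs'} zero (l ∷ ls) (cons i n r s) (cons p q h) _ e with L.initLast c'
... | c L.∷ʳ′ y = y , c ∷ cs' , app (Bump-append (proj₂ (Inc-init c i))) ,
      cons (proj₁ (Inc-init c i)) (λ z → n≮0 (subst (1 ≤_) (trans (sym lc) (cong length z)) p))
        (⊑-init c r (≤-trans (≤-reflexive (trans (sym (hd-shape cs')) (cong (λ z → at z 0) (∷-injectiveʳ e)))) (subst (at ls 0 ≤_) (sym lc) q))) s ,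
      cong₂ _∷_ lc (∷-injectiveʳ e)
  where
  lc : length c ≡ l
  lc = suc-injective (trans (sym (length-∷ʳ' c)) (∷-injectiveˡ e))
... | L.[] = ⊥-elim (n refl)
delete {c' ∷ cs'} (suc j) (l ∷ ls) (cons i n r s) (cons p q h) (s≤s j≤) e
  with delete j ls s h j≤ (∷-injectiveʳ e)
delete {[] ∷ cs'} (suc j) (l ∷ ls) (cons i n r s) (cons p q h) (s≤s j≤) e | _ = ⊥-elim (n refl)
delete {(z ∷ c₁) ∷ cs'} (suc j) (l ∷ ls) (cons i n r s) (cons p q h) (s≤s j≤) e | y , cs , k , s₁ , e₁
  with unbump c₁ i (⊑-head i r (Bump-x∈ (proj₂ (Ins-hd k))))
... | x , c , b , ic = x , c ∷ cs , rep b k ,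
      cons ic (nonempty b) (unbump-⊑ ic (hdInc s₁) b (proj₂ (Ins-hd k)) r) s₁ ,
      cong₂ _∷_ (trans (sym (Bump-length b)) (∷-injectiveˡ e)) e₁
  where
  hdInc : ∀ {cs} → SS cs → Inc (hd cs)
  hdInc [] = []
  hdInc (cons i _ _ _) = i
  nonempty : ∀ {x c c' y} → Bump x c c' (just y) → c ≢ []
  nonempty (hit _) ()
  nonempty (skip _ _) ()

unbump-fun : ∀ {x₁ x₂ c₁ c₂ c' y} → Inc c₁ → Inc c₂ → Bump x₁ c₁ c' (just y) → Bump x₂ c₂ c' (just y) →
  x₁ ≡ x₂ × c₁ ≡ c₂
unbump-fun i k (hit p) (hit q) = refl , refl
unbump-fun (a ∷ i) k (hit p) (skip q b) = ⊥-elim (<⇒≱ (All.lookup a (Bump-x∈ b)) (Bump-≤ b))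
unbump-fun i (a ∷ k) (skip q b) (hit p) = ⊥-elim (<⇒≱ (All.lookup a (Bump-x∈ b)) (Bump-≤ b))
unbump-fun (_ ∷ i) (_ ∷ k) (skip _ a) (skip _ b) with unbump-fun i k a b
... | refl , refl = refl , refl

delete-fun : ∀ {x₁ x₂ cs₁ cs₂ cs' j} → SS cs₁ → SS cs₂ → Ins x₁ cs₁ cs' j → Ins x₂ cs₂ cs' j →
  x₁ ≡ x₂ × cs₁ ≡ cs₂
delete-fun s t new new = refl , refl
delete-fun s (cons _ n _ _) new (app end) = ⊥-elim (n refl)
delete-fun (cons _ n _ _) t (app end) new = ⊥-elim (n refl)
delete-fun s t (app {c₁} a) (app {c₂} b) with Bump-nothing a | Bump-nothing b
... | refl , _ | e , _ with ∷ʳ-injective c₁ c₂ e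
...   | refl , refl = refl , refl
delete-fun (cons i _ _ s) (cons k _ _ t) (rep a i₁) (rep b i₂) with delete-fun s t i₁ i₂
... | refl , refl with unbump-fun i k a b
...   | refl , refl = refl , refl

module _ {l : ℕ} where

  Bump-below : ∀ {x c c' y} → Bump x c c' (just y) → Bump x (c ++ l ∷ []) (c' ++ l ∷ []) (just y)
  Bump-below (hit p) = hit p
  Bump-below (skip q b) = skip q (Bump-below b)

  Bump-max : ∀ {x c c'} → Bump x c c' nothing → x < l → Bump x (c ++ l ∷ []) c' (just l)
  Bump-max end h = hit (<⇒≤ h)
  Bump-max (skip q b) h = skip q (Bump-max b h)

  Ins-top : ∀ {cs} → All (All (_< l)) cs → Ins l cs (addAtCol 0 l cs) 0
  Ins-top [] = new
  Ins-top (a ∷ _) = app (Bump-append a)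

  -- The heart of the symmetry of the correspondence. The largest letter l at the foot of column B
  -- is in the way of an insertion only if the new box would be its own, that is if A = B; then it
  -- is pushed to the foot of column suc B. Otherwise the insertion takes the same path as without
  -- l.
  Ins-max : ∀ {x cs cs' A} B → All (All (_< l)) cs → x < l → B ≤ length cs → Ins x cs cs' A →
    (A ≢ B × Ins x (addAtCol B l cs) (addAtCol B l cs') A)
    ⊎ (A ≡ B × Ins x (addAtCol B l cs) (addAtCol (suc B) l cs') (suc B))
  Ins-max zero a h b new = inj₂ (refl , rep (hit (<⇒≤ h)) new)
  Ins-max zero (_ ∷ a) h b (app p) = inj₂ (refl , rep (Bump-max p h) (Ins-top a))
  Ins-max zero a h b (rep p i) = inj₁ ((λ ()) , rep (Bump-below p) i)
  Ins-max (suc B) a h (s≤s b) (app p) = inj₁ ((λ ()) , app p)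
  Ins-max (suc B) (c ∷ a) h (s≤s b) (rep p i) with Ins-max B a (All.lookup c (Bump-∈ p)) b i
  ... | inj₁ (n , k) = inj₁ (n ∘ suc-injective , rep p k)
  ... | inj₂ (refl , k) = inj₂ (refl , rep p k)

-- The Robinson–Schensted correspondence for points (time , value), and its symmetry

RSstepᵖ : Cols × Cols → ℕ × ℕ → Cols × Cols
RSstepᵖ (P , Q) (t , x) = insert x P , addAtCol (insertAt x P) t Q

RSᵖ : List (ℕ × ℕ) → Cols × Cols
RSᵖ = foldl RSstepᵖ ([] , [])

RSᵖ-∷ʳ : ∀ L p → RSᵖ (L ++ p ∷ []) ≡ RSstepᵖ (RSᵖ L) p
RSᵖ-∷ʳ L p = foldl-++ RSstepᵖ ([] , []) L (p ∷ [])

addAtCol-↭ : ∀ j m cs → j ≤ length cs → concat (addAtCol j m cs) ↭ m ∷ concat cs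
addAtCol-↭ zero m [] h = ↭-refl
addAtCol-↭ zero m (c ∷ cs) h = Permₚ.++⁺ʳ (concat cs) (Permₚ.++-comm c (m ∷ []))
addAtCol-↭ (suc j) m (c ∷ cs) (s≤s h) = ↭-trans (Permₚ.++⁺ˡ c (addAtCol-↭ j m cs h)) (Permₚ.shift m c (concat cs))

shape-length : ∀ {cs ds : Cols} → shape cs ≡ shape ds → length cs ≡ length ds
shape-length {cs} {ds} e = trans (sym (length-map length cs)) (trans (cong length e) (length-map length ds))

record RSinv (L : List (ℕ × ℕ)) : Set where
  field
    P-SS : SS (proj₁ (RSᵖ L))
    same-shape : shape (proj₁ (RSᵖ L)) ≡ shape (proj₂ (RSᵖ L))
    P-↭ : concat (proj₁ (RSᵖ L)) ↭ map proj₂ L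
    Q-↭ : concat (proj₂ (RSᵖ L)) ↭ map proj₁ L

RSᵖ-inv : ∀ L → RSinv L
RSᵖ-inv L = go L (reverseView L)
  where
  go : ∀ L → Reverse L → RSinv L
  go .[] []ʳ = record { P-SS = [] ; same-shape = refl ; P-↭ = ↭-refl ; Q-↭ = ↭-refl }
  go .(L ++ (t , x) ∷ []) (L ∶ r ∶ʳ (t , x)) = record
    { P-SS = subst (SS ∘ proj₁) (sym e) (Ins-SS i P-SS)
    ; same-shape = subst (λ z → shape (proj₁ z) ≡ shape (proj₂ z)) (sym e)
        (trans (Ins-shape i) (trans (cong (grow A) same-shape) (sym (addAtCol-shape A t (proj₂ (RSᵖ L))))))
    ; P-↭ = subst (λ z → concat (proj₁ z) ↭ map proj₂ (L ++ (t , x) ∷ [])) (sym e)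
        (↭-trans (Ins-↭ i) (↭-trans (prep x P-↭) (snoc proj₂)))
    ; Q-↭ = subst (λ z → concat (proj₂ z) ↭ map proj₁ (L ++ (t , x) ∷ [])) (sym e)
        (↭-trans (addAtCol-↭ A t (proj₂ (RSᵖ L)) (≤-trans (Ins-index i) (≤-reflexive (shape-length same-shape))))
          (↭-trans (prep t Q-↭) (snoc proj₁))) }
    where
    open RSinv (go L r)
    e = RSᵖ-∷ʳ L (t , x)
    A = insertAt x (proj₁ (RSᵖ L))
    i = insert-Ins x (proj₁ (RSᵖ L))
    snoc : ∀ (f : ℕ × ℕ → ℕ) → f (t , x) ∷ map f L ↭ map f (L ++ (t , x) ∷ [])
    snoc f = subst (f (t , x) ∷ map f L ↭_) (sym (map-++ f L ((t , x) ∷ []))) (Permₚ.++-comm (f (t , x) ∷ []) (map f L))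

All²-↭ : ∀ {R : ℕ → Set} cs {xs} → concat cs ↭ xs → All R xs → All (All R) cs
All²-↭ cs p a = Allₚ.concat⁻ (Permₚ.All-resp-↭ (↭-sym p) a)

-- A largest value l arriving at time p acts on the recording tableau of the other points as the
-- insertion of p. The induction removes the last point behind it; `Ins-max` is applied to P, in
-- which l is largest, and to Q, in which the last time t is largest.
RSᵖ-max : ∀ u v p l → All (λ q → proj₂ q < l) (u ++ v) → All (λ q → proj₁ q < p) u →
  All (λ q → p < proj₁ q) v → AllPairs (λ q q' → proj₁ q < proj₁ q') (u ++ v) →
  RSᵖ (u ++ (p , l) ∷ v) ≡
    (addAtCol (insertAt p (proj₂ (RSᵖ (u ++ v)))) l (proj₁ (RSᵖ (u ++ v))) , insert p (proj₂ (RSᵖ (u ++ v))))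
RSᵖ-max u v p l = go v (reverseView v)
  where
  go : ∀ v → Reverse v → All (λ q → proj₂ q < l) (u ++ v) → All (λ q → proj₁ q < p) u →
    All (λ q → p < proj₁ q) v → AllPairs (λ q q' → proj₁ q < proj₁ q') (u ++ v) →
    RSᵖ (u ++ (p , l) ∷ v) ≡
      (addAtCol (insertAt p (proj₂ (RSᵖ (u ++ v)))) l (proj₁ (RSᵖ (u ++ v))) , insert p (proj₂ (RSᵖ (u ++ v))))
  go .[] []ʳ big u< v> inc rewrite ++-identityʳ u | RSᵖ-∷ʳ u (p , l) =
    trans (cong₂ (λ c j → c , addAtCol j p Q) (proj₁ P-top) (proj₂ P-top))
      (sym (cong₂ (λ c j → addAtCol j l P , c) (proj₁ Q-top) (proj₂ Q-top)))
    where
    open RSinv (RSᵖ-inv u)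
    P = proj₁ (RSᵖ u)
    Q = proj₂ (RSᵖ u)
    P-top = insert-fun (Ins-top (All²-↭ P P-↭ (Allₚ.map⁺ big)))
    Q-top = insert-fun (Ins-top (All²-↭ Q Q-↭ (Allₚ.map⁺ u<)))
  go .(v ++ (t , x) ∷ []) (v ∶ r ∶ʳ (t , x)) big u< v> inc = begin
      RSᵖ (u ++ (p , l) ∷ v ++ (t , x) ∷ [])      ≡⟨ cong RSᵖ (++-assoc u ((p , l) ∷ v) _) ⟨
      RSᵖ ((u ++ (p , l) ∷ v) ++ (t , x) ∷ [])    ≡⟨ RSᵖ-∷ʳ (u ++ (p , l) ∷ v) (t , x) ⟩
      RSstepᵖ (RSᵖ (u ++ (p , l) ∷ v)) (t , x)    ≡⟨ cong (λ z → RSstepᵖ z (t , x)) (go v r big' u< (Allₚ.++⁻ˡ v v>) (APₚ-init inc')) ⟩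
      RSstepᵖ (addAtCol B l P , insert p Q) (t , x)  ≡⟨ both ⟩
      (addAtCol (insertAt p Q₂) l P₂ , insert p Q₂)   ≡⟨ cong (λ z → addAtCol (insertAt p (proj₂ z)) l (proj₁ z) , insert p (proj₂ z)) (sym e) ⟩
      (addAtCol (insertAt p (proj₂ (RSᵖ (u ++ v ++ (t , x) ∷ [])))) l (proj₁ (RSᵖ (u ++ v ++ (t , x) ∷ [])))
        , insert p (proj₂ (RSᵖ (u ++ v ++ (t , x) ∷ []))))  ∎
    where
    open ≡-Reasoning
    open RSinv (RSᵖ-inv (u ++ v))
    big₀ : All (λ q → proj₂ q < l) ((u ++ v) ++ (t , x) ∷ [])
    big₀ = subst (All _) (sym (++-assoc u v _)) big
    big' = Allₚ.++⁻ˡ (u ++ v) big₀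
    inc' : AllPairs (λ q q' → proj₁ q < proj₁ q') ((u ++ v) ++ (t , x) ∷ [])
    inc' = subst (AllPairs _) (sym (++-assoc u v _)) inc
    APₚ-init : ∀ {w z} → AllPairs (λ (q q' : ℕ × ℕ) → proj₁ q < proj₁ q') (w ++ z ∷ []) → AllPairs (λ q q' → proj₁ q < proj₁ q') w
    APₚ-init {[]} _ = []
    APₚ-init {_ ∷ w} (a ∷ b) = Allₚ.++⁻ˡ w a ∷ APₚ-init b
    APₚ-last : ∀ {w z} → AllPairs (λ (q q' : ℕ × ℕ) → proj₁ q < proj₁ q') (w ++ z ∷ []) → All (λ q → proj₁ q < proj₁ z) w
    APₚ-last {[]} _ = []
    APₚ-last {_ ∷ w} (a ∷ b) = All.head (Allₚ.++⁻ʳ w a) ∷ APₚ-last b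
    P = proj₁ (RSᵖ (u ++ v))
    Q = proj₂ (RSᵖ (u ++ v))
    A = insertAt x P
    B = insertAt p Q
    P₂ = insert x P
    Q₂ = addAtCol A t Q
    e : RSᵖ (u ++ v ++ (t , x) ∷ []) ≡ (P₂ , Q₂)
    e = trans (cong RSᵖ (sym (++-assoc u v _))) (RSᵖ-∷ʳ (u ++ v) (t , x))
    lenPQ = shape-length same-shape
    -- `A` is the column where x ends in P and where t is recorded in Q; `B` is the column where p
    -- ends in Q and where l stands in P. Both calls decide whether A = B, so their alternatives
    -- match.
    kP = Ins-max B (All²-↭ P P-↭ (Allₚ.map⁺ big')) (All.head (Allₚ.++⁻ʳ (u ++ v) big₀))
      (≤-trans (Ins-index (insert-Ins p Q)) (≤-reflexive (sym lenPQ))) (insert-Ins x P)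
    kQ = Ins-max A (All²-↭ Q Q-↭ (Allₚ.map⁺ (APₚ-last inc'))) (All.head (Allₚ.++⁻ʳ v v>))
      (≤-trans (Ins-index (insert-Ins x P)) (≤-reflexive lenPQ)) (insert-Ins p Q)
    both : RSstepᵖ (addAtCol B l P , insert p Q) (t , x) ≡ (addAtCol (insertAt p Q₂) l P₂ , insert p Q₂)
    both with kP | kQ
    ... | inj₁ (n , i) | inj₂ (e' , _) = ⊥-elim (n (sym e'))
    ... | inj₂ (e' , _) | inj₁ (n , _) = ⊥-elim (n (sym e'))
    ... | inj₁ (_ , i) | inj₁ (_ , k) with insert-fun i | insert-fun k
    ...   | a , b | c , d = trans (cong₂ (λ z j → z , addAtCol j t (insert p Q)) a b)
                              (sym (cong₂ (λ z j → addAtCol j l P₂ , z) c d))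
    both | inj₂ (e₁ , i) | inj₂ (e₂ , k) with insert-fun i | insert-fun k
    ...   | a , b | c , d = trans (cong₂ (λ z j → z , addAtCol j t (insert p Q)) a b)
        (sym (trans (cong₂ (λ z j → addAtCol j l P₂ , z) c d)
          (cong (λ j → addAtCol (suc j) l P₂ , addAtCol (suc j) t (insert p Q)) e₁)))

swapᵖ : ℕ × ℕ → ℕ × ℕ
swapᵖ (a , b) = b , a

-- The list `s` has the same points with coordinates exchanged, ordered by value. Its last point is
-- the one of largest value, and `RSᵖ-max` says what this point does in the middle of `L`.
RSᵖ-sym : ∀ L s → AllPairs (λ q q' → proj₁ q < proj₁ q') L → AllPairs (λ q q' → proj₁ q < proj₁ q') s →
  L ↭ map swapᵖ s → RSᵖ L ≡ (proj₂ (RSᵖ s) , proj₁ (RSᵖ s))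
RSᵖ-sym L s = go L s (reverseView s)
  where
  _◃_ : ℕ × ℕ → ℕ × ℕ → Set
  q ◃ q' = proj₁ q < proj₁ q'
  last : ∀ w {z} → AllPairs _◃_ (w ++ z ∷ []) → AllPairs _◃_ w × All (_◃ z) w
  last [] _ = [] , []
  last (_ ∷ w) (a ∷ b) with last w b
  ... | c , d = Allₚ.++⁻ˡ w a ∷ c , All.head (Allₚ.++⁻ʳ w a) ∷ d
  middle : ∀ u {z v} → AllPairs _◃_ (u ++ z ∷ v) → AllPairs _◃_ (u ++ v) × All (_◃ z) u × All (z ◃_) v
  middle [] (a ∷ b) = b , [] , a
  middle (_ ∷ u) (a ∷ b) with middle u b
  ... | c , d , e = Allₚ.++⁺ (Allₚ.++⁻ˡ u a) (All.tail (Allₚ.++⁻ʳ u a)) ∷ c , All.head (Allₚ.++⁻ʳ u a) ∷ d , e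
  go : ∀ L s → Reverse s → AllPairs _◃_ L → AllPairs _◃_ s → L ↭ map swapᵖ s →
    RSᵖ L ≡ (proj₂ (RSᵖ s) , proj₁ (RSᵖ s))
  go L .[] []ʳ iL is π with Permₚ.↭-empty-inv π
  ... | refl = refl
  go L .(s ++ (l , p) ∷ []) (s ∶ r ∶ʳ (l , p)) iL is π
    with ∈-∃++ (Permₚ.∈-resp-↭ (↭-sym π) (∈-map⁺ swapᵖ (∈-++⁺ʳ s (here refl))))
  ... | u , v , refl with middle u iL | last s is
  ...   | iuv , u< , v> | is' , s< = begin
      RSᵖ (u ++ (p , l) ∷ v)  ≡⟨ RSᵖ-max u v p l (Permₚ.All-resp-↭ (↭-sym π') (Allₚ.map⁺ s<)) u< v> iuv ⟩
      (addAtCol (insertAt p (proj₂ (RSᵖ (u ++ v)))) l (proj₁ (RSᵖ (u ++ v))) , insert p (proj₂ (RSᵖ (u ++ v))))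
        ≡⟨ cong (λ z → addAtCol (insertAt p (proj₂ z)) l (proj₁ z) , insert p (proj₂ z)) (go (u ++ v) s r iuv is' π') ⟩
      (proj₂ (RSstepᵖ (RSᵖ s) (l , p)) , proj₁ (RSstepᵖ (RSᵖ s) (l , p)))
        ≡⟨ cong (λ z → proj₂ z , proj₁ z) (RSᵖ-∷ʳ s (l , p)) ⟨
      (proj₂ (RSᵖ (s ++ (l , p) ∷ [])) , proj₁ (RSᵖ (s ++ (l , p) ∷ [])))  ∎
    where
    open ≡-Reasoning
    π' : u ++ v ↭ map swapᵖ s
    π' = subst (u ++ v ↭_) (++-identityʳ (map swapᵖ s))
      (Permₚ.drop-mid u (map swapᵖ s) (subst (u ++ (p , l) ∷ v ↭_) (map-++ swapᵖ s ((l , p) ∷ [])) π))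

-- Words as lists of points

pts : ℕ → List ℕ → List (ℕ × ℕ)
pts m []      = []
pts m (x ∷ w) = (suc m , x) ∷ pts (suc m) w

RSʷ : List ℕ → Cols × Cols
RSʷ w = RSᵖ (pts 0 w)

pts-++ : ∀ m u v → pts m (u ++ v) ≡ pts m u ++ pts (m + length u) v
pts-++ m []      v = cong (λ k → pts k v) (sym (+-identityʳ m))
pts-++ m (x ∷ u) v = cong ((suc m , x) ∷_) (trans (pts-++ (suc m) u v) (cong (λ k → pts (suc m) u ++ pts k v) (sym (+-suc m (length u)))))

pts-values : ∀ m w → map proj₂ (pts m w) ≡ w
pts-values m []      = refl
pts-values m (x ∷ w) = cong (x ∷_) (pts-values (suc m) w)

pts-times : ∀ m w → map proj₁ (pts m w) ≡ applyUpTo (λ i → suc m + i) (length w)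
pts-times m []      = refl
pts-times m (x ∷ w) = cong₂ _∷_ (sym (+-identityʳ (suc m)))
  (trans (pts-times (suc m) w) (applyUpTo-cong (length w) λ {i} _ → sym (+-suc (suc m) i)))

pts-sorted : ∀ m w → AllPairs (λ q q' → proj₁ q < proj₁ q') (pts m w)
pts-sorted m []      = []
pts-sorted m (x ∷ w) = later (suc m) w ≤-refl ∷ pts-sorted (suc m) w
  where
  later : ∀ k w → suc m ≤ k → All (λ q → suc m < proj₁ q) (pts k w)
  later k []      h = []
  later k (y ∷ w) h = s≤s h ∷ later (suc k) w (m≤n⇒m≤1+n h)

∈-pts⁺ : ∀ m w i {x} → atM w i ≡ just x → (suc m + i , x) ∈ pts m w
∈-pts⁺ m (y ∷ w) zero    refl = here (cong (_, y) (+-identityʳ (suc m)))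
∈-pts⁺ m (y ∷ w) (suc i) {x} e = there (subst (λ k → (k , x) ∈ pts (suc m) w) (sym (+-suc (suc m) i)) (∈-pts⁺ (suc m) w i e))

RSʷ-∷ʳ : ∀ w x → RSʷ (w ++ x ∷ []) ≡ RSstepᵖ (RSʷ w) (suc (length w) , x)
RSʷ-∷ʳ w x = trans (cong RSᵖ (pts-++ 0 w (x ∷ []))) (RSᵖ-∷ʳ (pts 0 w) _)

RScols-RSʷ : ∀ w → Unique w → RScols w ≡ RSʷ w
RScols-RSʷ w u with go [] [] 0 w u [] (λ _ ())
  where
  go : ∀ P Q m w → Unique w → Unique (concat P) → (∀ {x} → x ∈ w → x ∉ concat P) →
    ∃[ k ] foldl RSstep (P , Q , m) w ≡ (proj₁ (foldl RSstepᵖ (P , Q) (pts m w)) , proj₂ (foldl RSstepᵖ (P , Q) (pts m w)) , k)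
  go P Q m [] u v d = m , refl
  go P Q m (x ∷ w) u@(_ ∷ u') v d
    rewrite colInsert-Ins (d (here refl)) v (insert-Ins x P) =
    go (insert x P) (addAtCol (insertAt x P) (suc m) Q) (suc m) w u'
      (Unique-↭ (↭-sym (Ins-↭ (insert-Ins x P))) (Unique-∷ (d (here refl)) v)) d'
    where
    d' : ∀ {y} → y ∈ w → y ∉ concat (insert x P)
    d' m h with Permₚ.∈-resp-↭ (Ins-↭ (insert-Ins x P)) h
    ... | here refl = Unique-head∉ u m
    ... | there h' = d (there m) h'
... | k , e rewrite e = refl

-- The new entry n marks the column to which it was added. Non-emptiness distinguishes a column that
-- was created for n from an empty one that received it.
addAtCol-inj : ∀ {n} j j' Q Q' → n ∉ concat Q → n ∉ concat Q' → j ≤ length Q → j' ≤ length Q' →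
  All (_≢ []) Q → All (_≢ []) Q' → addAtCol j n Q ≡ addAtCol j' n Q' → j ≡ j' × Q ≡ Q'
addAtCol-inj zero zero [] [] _ _ _ _ _ _ e = refl , refl
addAtCol-inj zero zero [] (c ∷ Q') _ _ _ _ _ (n ∷ _) e with ∷ʳ-injective [] c (∷-injectiveˡ e)
... | refl , _ = ⊥-elim (n refl)
addAtCol-inj zero zero (c ∷ Q) [] _ _ _ _ (n ∷ _) _ e with ∷ʳ-injective c [] (∷-injectiveˡ e)
... | refl , _ = ⊥-elim (n refl)
addAtCol-inj zero zero (c ∷ Q) (c' ∷ Q') _ _ _ _ _ _ e with ∷ʳ-injective c c' (∷-injectiveˡ e)
... | refl , _ = refl , cong (c ∷_) (∷-injectiveʳ e)
addAtCol-inj zero (suc j') [] (c' ∷ Q') _ d _ _ _ _ e = ⊥-elim (d (∈-++⁺ˡ (subst (_ ∈_) (∷-injectiveˡ e) (here refl))))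
addAtCol-inj zero (suc j') (c ∷ Q) (c' ∷ Q') _ d _ _ _ _ e =
  ⊥-elim (d (∈-++⁺ˡ (subst (_ ∈_) (∷-injectiveˡ e) (∈-++⁺ʳ c (here refl)))))
addAtCol-inj (suc j) zero (c ∷ Q) [] d _ _ _ _ _ e = ⊥-elim (d (∈-++⁺ˡ (subst (_ ∈_) (sym (∷-injectiveˡ e)) (here refl))))
addAtCol-inj (suc j) zero (c ∷ Q) (c' ∷ Q') d _ _ _ _ _ e =
  ⊥-elim (d (∈-++⁺ˡ (subst (_ ∈_) (sym (∷-injectiveˡ e)) (∈-++⁺ʳ c' (here refl)))))
addAtCol-inj (suc j) (suc j') (c ∷ Q) (c' ∷ Q') d d' (s≤s h) (s≤s h') (_ ∷ s) (_ ∷ s') e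
  with addAtCol-inj j j' Q Q' (d ∘ ∈-++⁺ʳ c) (d' ∘ ∈-++⁺ʳ c') h h' s s' (∷-injectiveʳ e)
... | refl , refl = refl , cong (_∷ Q) (∷-injectiveˡ e)

shape-nonempty : ∀ {P Q : Cols} → shape P ≡ shape Q → All (_≢ []) P → All (_≢ []) Q
shape-nonempty {[]} {[]} e [] = []
shape-nonempty {[] ∷ P} {c ∷ Q} e (n ∷ a) = ⊥-elim (n refl)
shape-nonempty {(_ ∷ _) ∷ P} {[] ∷ Q} e (n ∷ a) = case ∷-injectiveˡ e of λ ()
shape-nonempty {(_ ∷ _) ∷ P} {(_ ∷ _) ∷ Q} e (n ∷ a) = (λ ()) ∷ shape-nonempty (∷-injectiveʳ e) a

SS-nonempty : ∀ {cs} → SS cs → All (_≢ []) cs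
SS-nonempty [] = []
SS-nonempty (cons _ n _ s) = n ∷ SS-nonempty s

module RSw (w : List ℕ) where
  open RSinv (RSᵖ-inv (pts 0 w)) public
  P Q : Cols
  P = proj₁ (RSʷ w)
  Q = proj₂ (RSʷ w)
  P-entries : concat P ↭ w
  P-entries = subst (concat P ↭_) (pts-values 0 w) P-↭
  Q-entries : concat Q ↭ range 1 (suc (length w))
  Q-entries = subst (concat Q ↭_) (pts-times 0 w) Q-↭
  Q-nonempty : All (_≢ []) Q
  Q-nonempty = shape-nonempty same-shape (SS-nonempty P-SS)
  new-time : suc (length w) ∉ concat Q
  new-time m = <-irrefl refl (proj₂ (∈-range⁻ {1} {suc (length w)} (Permₚ.∈-resp-↭ Q-entries m)))
  index≤ : ∀ x → insertAt x P ≤ length Q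
  index≤ x = ≤-trans (Ins-index (insert-Ins x P)) (≤-reflexive (shape-length same-shape))

-- The largest label of Q marks the box where the last insertion ended; by `delete-fun` the letter
-- and the tableau before it are determined.
RSʷ-inj : ∀ w w' → RSʷ w ≡ RSʷ w' → w ≡ w'
RSʷ-inj w w' = go w w' (reverseView w) (reverseView w')
  where
  len : ∀ w w' → RSʷ w ≡ RSʷ w' → length w ≡ length w'
  len w w' e = trans (sym (Permₚ.↭-length (RSw.P-entries w)))
    (trans (cong (length ∘ concat ∘ proj₁) e) (Permₚ.↭-length (RSw.P-entries w')))
  go : ∀ w w' → Reverse w → Reverse w' → RSʷ w ≡ RSʷ w' → w ≡ w'
  go .[] .[] []ʳ []ʳ e = refl
  go .[] .(w' ++ x' ∷ []) []ʳ (w' ∶ _ ∶ʳ x') e with trans (len [] (w' ++ x' ∷ []) e) (length-∷ʳ' w')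
  ... | ()
  go .(w ++ x ∷ []) .[] (w ∶ _ ∶ʳ x) []ʳ e with trans (sym (len (w ++ x ∷ []) [] e)) (length-∷ʳ' w)
  ... | ()
  go .(w ++ x ∷ []) .(w' ++ x' ∷ []) (w ∶ r ∶ʳ x) (w' ∶ r' ∶ʳ x') e
    with suc-injective (trans (sym (length-∷ʳ' w)) (trans (len (w ++ x ∷ []) (w' ++ x' ∷ []) e) (length-∷ʳ' w')))
  ... | l with trans (sym (RSʷ-∷ʳ w x)) (trans e (RSʷ-∷ʳ w' x'))
  ...   | e' with addAtCol-inj (insertAt x (RSw.P w)) (insertAt x' (RSw.P w')) (RSw.Q w) (RSw.Q w')
        (RSw.new-time w) (subst (λ k → suc k ∉ concat (RSw.Q w')) (sym l) (RSw.new-time w'))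
        (RSw.index≤ w x) (RSw.index≤ w' x') (RSw.Q-nonempty w) (RSw.Q-nonempty w')
        (trans (cong proj₂ e') (cong (λ k → addAtCol (insertAt x' (RSw.P w')) (suc k) (RSw.Q w')) (sym l)))
  ...     | ej , eQ with delete-fun (RSw.P-SS w) (RSw.P-SS w') (insert-Ins x (RSw.P w))
        (subst₂ (λ c j → Ins x' (RSw.P w') c j) (sym (cong proj₁ e')) (sym ej) (insert-Ins x' (RSw.P w')))
  ...       | refl , eP = cong (_++ x ∷ []) (go w w' r r' (cong₂ _,_ eP eQ))

⊑-initʳ : ∀ {c} d {y} → c ⊑ (d ++ y ∷ []) → c ⊑ d
⊑-initʳ [] _ = []
⊑-initʳ (x ∷ d) (p ∷ r) = p ∷ ⊑-initʳ d r

split-last : ∀ {n} c → Inc c → n ∈ c → All (_≤ n) c → ∃[ c₀ ] c ≡ c₀ ++ n ∷ []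
split-last (x ∷ []) i (here refl) b = [] , refl
split-last (x ∷ y ∷ c) ((a ∷ _) ∷ i) (here refl) (_ ∷ b ∷ _) = ⊥-elim (<⇒≱ a b)
split-last (x ∷ c) (_ ∷ i) (there m) (_ ∷ b) with split-last c i m b
... | c₀ , refl = x ∷ c₀ , refl

⊑-last : ∀ c {n d} → (c ++ n ∷ []) ⊑ d → All (_< n) d → length d ≤ length c
⊑-last [] [] b = z≤n
⊑-last [] (p ∷ _) (q ∷ _) = ⊥-elim (<⇒≱ q p)
⊑-last (x ∷ c) [] b = z≤n
⊑-last (x ∷ c) (_ ∷ r) (_ ∷ b) = s≤s (⊑-last c r b)

-- The largest entry ends its column. The entries of the next column are smaller, so that column
-- does not reach the row of n, and a tableau remains when n is removed.
remove-max : ∀ {n Q} → SS Q → Unique (concat Q) → n ∈ concat Q → All (_≤ n) (concat Q) →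
  ∃[ j ] ∃[ Q₀ ] Q ≡ addAtCol j n Q₀ × SS Q₀ × j ≤ length Q₀
remove-max {n} {c ∷ Q} (cons i e r s) u m b with ∈-++⁻ c m
... | inj₁ m' with split-last c i m' (Allₚ.++⁻ˡ c b)
...   | c₀ , refl = corner c₀ refl
  where
  small : All (_< n) (hd Q)
  small = All.tabulate λ {z} h → let h' = hd-∈ Q h in
    ≤∧≢⇒< (All.lookup (Allₚ.++⁻ʳ c b) h') λ { refl → proj₂ (proj₂ (Unique-++⁻ c u)) m' h' }
    where
    hd-∈ : ∀ Q {z} → z ∈ hd Q → z ∈ concat Q
    hd-∈ (d ∷ Q) h = ∈-++⁺ˡ h
  corner : ∀ c₁ → c₀ ≡ c₁ →
    ∃[ j ] ∃[ Q₀ ] (c₀ ++ n ∷ []) ∷ Q ≡ addAtCol j n Q₀ × SS Q₀ × j ≤ length Q₀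
  corner (x ∷ c₁) refl = 0 , c₀ ∷ Q , refl ,
    cons (proj₁ (Inc-init c₀ i)) (λ ()) (⊑-init c₀ r (⊑-last c₀ r small)) s , z≤n
  -- A column that consists of n alone is the last one. It disappears altogether, and `addAtCol`
  -- creates it again behind the empty list.
  corner [] refl = 0 , [] , cong ((n ∷ []) ∷_) (empty s (⊑-last [] r small)) , [] , z≤n
    where
    empty : ∀ {Q} → SS Q → length (hd Q) ≤ 0 → Q ≡ []
    empty [] _ = refl
    empty (cons {[]} _ e _ _) _ = ⊥-elim (e refl)
remove-max {n} {c ∷ Q} (cons i e r s) u m b | inj₂ m'
  with remove-max s (proj₁ (proj₂ (Unique-++⁻ c u))) m' (Allₚ.++⁻ʳ c b)
... | j , Q₀ , refl , s₀ , h = suc j , c ∷ Q₀ , refl , cons i e (rest j Q₀ r) s₀ , s≤s h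
  where
  rest : ∀ j Q₀ → c ⊑ hd (addAtCol j n Q₀) → c ⊑ hd Q₀
  rest zero [] r = []
  rest zero (d ∷ Q₀) r = ⊑-initʳ d r
  rest (suc j) [] r = []
  rest (suc j) (d ∷ Q₀) r = r

-- The largest label of Q says where reverse insertion into P starts. Only Q has to be standard: P
-- may have repeated entries, which is the case needed for products of Schur polynomials.
RSʷ-sur : ∀ n P Q → SS P → SS Q → shape P ≡ shape Q → concat Q ↭ range 1 (suc n) →
  ∃[ w ] RSʷ w ≡ (P , Q) × length w ≡ n
RSʷ-sur zero [] [] sP sQ e π = [] , refl , refl
RSʷ-sur zero P (c ∷ Q) sP (cons _ ne _ _) e π = ⊥-elim (ne (++-conicalˡ c (concat Q) (Permₚ.↭-empty-inv π)))
RSʷ-sur (suc n) P Q sP sQ e π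
  with remove-max sQ (Unique-↭ (↭-sym π) (Unique-range 1 (2 + n)))
    (Permₚ.∈-resp-↭ (↭-sym π) (∈-range⁺ {1} {2 + n} (s≤s z≤n) ≤-refl))
    (Permₚ.All-resp-↭ (↭-sym π) (All.tabulate λ m → s≤s⁻¹ (proj₂ (∈-range⁻ {1} {2 + n} m))))
... | j , Q₀ , refl , s₀ , h
  with delete j (shape Q₀) sP (SS-Shape s₀) (subst (j ≤_) (sym (length-map length Q₀)) h) (trans e (addAtCol-shape j (suc n) Q₀))
...   | x , P₀ , k , sP₀ , eP with RSʷ-sur n P₀ Q₀ sP₀ s₀ eP π₀
  where
  range-∷ʳ : range 1 (2 + n) ≡ range 1 (suc n) ++ suc n ∷ []
  range-∷ʳ = sym (applyUpTo-∷ʳ (λ i → 1 + i) n)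
  π₀ : concat Q₀ ↭ range 1 (suc n)
  π₀ = Permₚ.drop-∷ (↭-trans (↭-sym (addAtCol-↭ j (suc n) Q₀ h)) (↭-trans (subst (concat (addAtCol j (suc n) Q₀) ↭_) range-∷ʳ π)
         (Permₚ.++-comm (range 1 (suc n)) (suc n ∷ []))))
...     | w , e₀ , refl = w ++ x ∷ [] ,
        trans (RSʷ-∷ʳ w x) (trans (cong (λ z → RSstepᵖ z (suc (length w) , x)) e₀)
          (cong₂ (λ a b → a , addAtCol b (suc (length w)) Q₀) (proj₁ (insert-fun k)) (proj₂ (insert-fun k)))) ,
        length-∷ʳ' w

-- Relabelling by a weakly monotone map

module Relabel (φ : ℕ → ℕ) (φ-mono : ∀ {x y} → x ≤ y → φ x ≤ φ y) where

  -- Insertion only tests whether x ≤ y. A weakly monotone φ may merge letters, and `Refl x y` says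
  -- that this test has the same answer after φ.
  Refl : ℕ → ℕ → Set
  Refl x y = φ x ≤ φ y → x ≤ y

  -- The tests that later bumps can cause among entries already present. An entry leaving its column
  -- is compared with those of the columns to the right; pairs within one column are included
  -- because either of them may be bumped to the right of the other.
  data Coherent : Cols → Set where
    []   : Coherent []
    cons : ∀ {c cs} → (∀ {a z} → a ∈ c → z ∈ c → Refl a z) →
      (∀ {a z} → a ∈ c → z ∈ concat cs → Refl a z) → Coherent cs → Coherent (c ∷ cs)

  Bump-φ : ∀ {x c c' m} → (∀ {y} → y ∈ c → Refl x y) → Bump x c c' m →
    Bump (φ x) (map φ c) (map φ c') (Maybe.map φ m)
  Bump-φ h end = end
  Bump-φ h (hit p) = hit (φ-mono p)
  Bump-φ h (skip q b) = skip (≰⇒> λ l → <⇒≱ q (h (here refl) l)) (Bump-φ (h ∘ there) b)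

  Bump-column : ∀ {x c c' m} → Inc c → (∀ {y} → y ∈ c → Refl x y) →
    (∀ {a z} → a ∈ c → z ∈ c → Refl a z) → Bump x c c' m → ∀ {a} → a ∈ c' → Refl a x
  Bump-column i h d end (here refl) l = ≤-refl
  Bump-column i h d (hit p) (here refl) l = ≤-refl
  Bump-column (ay ∷ i) h d (hit {y} p) (there m) l =
    ⊥-elim (<⇒≱ (All.lookup ay m) (d (there m) (here refl) (≤-trans l (φ-mono p))))
  Bump-column i h d (skip q b) (here refl) l = <⇒≤ q
  Bump-column (_ ∷ i) h d (skip q b) (there m) l =
    Bump-column i (h ∘ there) (λ u v → d (there u) (there v)) b m l

  Bump-members : ∀ {x c c' m} → Bump x c c' m → ∀ {a} → a ∈ c' → a ≡ x ⊎ a ∈ c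
  Bump-members {c' = c'} b h with Permₚ.∈-resp-↭ (Bump-↭ b) (∈-++⁺ˡ h)
  ... | here e = inj₁ e
  ... | there m = inj₂ m

  Ins-φ : ∀ {x cs cs' j} → SS cs → Coherent cs → (∀ {y} → y ∈ concat cs → Refl x y) → Ins x cs cs' j →
    Ins (φ x) (map (map φ) cs) (map (map φ) cs') j × Coherent cs'
  Ins-φ s k h new = new , cons (λ { (here refl) (here refl) _ → ≤-refl }) (λ _ ()) []
  Ins-φ {x} (cons i _ _ s) (cons {c} {cs} d e k) h (app {c' = c'} b) =
    app (Bump-φ (h ∘ ∈-++⁺ˡ) b) , cons d' e' k
    where
    d' : ∀ {a z} → a ∈ c' → z ∈ c' → Refl a z
    d' m n with Bump-members b n
    ... | inj₁ refl = Bump-column i (h ∘ ∈-++⁺ˡ) d b m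
    ... | inj₂ n' with Bump-members b m
    ...   | inj₁ refl = h (∈-++⁺ˡ n')
    ...   | inj₂ m' = d m' n'
    e' : ∀ {a z} → a ∈ c' → z ∈ concat cs → Refl a z
    e' m n with Bump-members b m
    ... | inj₁ refl = h (∈-++⁺ʳ c n)
    ... | inj₂ m' = e m' n
  Ins-φ {x} (cons i _ _ s) (cons {c} {cs} d e k) h (rep {c' = c'} {y} {cs' = cs'} b r)
    with Ins-φ s k (e (Bump-∈ b)) r
  ... | r' , k' = rep (Bump-φ (h ∘ ∈-++⁺ˡ) b) r' , cons d' e' k'
    where
    d' : ∀ {a z} → a ∈ c' → z ∈ c' → Refl a z
    d' m n with Bump-members b n
    ... | inj₁ refl = Bump-column i (h ∘ ∈-++⁺ˡ) d b m
    ... | inj₂ n' with Bump-members b m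
    ...   | inj₁ refl = h (∈-++⁺ˡ n')
    ...   | inj₂ m' = d m' n'
    e' : ∀ {a z} → a ∈ c' → z ∈ concat cs' → Refl a z
    e' m n with Bump-members b m | Permₚ.∈-resp-↭ (Ins-↭ r) n
    ... | inj₁ refl | here refl = h (∈-++⁺ˡ (Bump-∈ b))
    ... | inj₁ refl | there n' = h (∈-++⁺ʳ c n')
    ... | inj₂ m' | here refl = d m' (Bump-∈ b)
    ... | inj₂ m' | there n' = e m' n'

  -- As φ is monotone, the hypothesis amounts to this: letters with the same image decrease weakly
  -- along the word. Then every test made during the insertions is reflected by φ.
  RSʷ-φ : ∀ w → AllPairs (λ y x → Refl x y) w → RSʷ (map φ w) ≡ (map (map φ) (proj₁ (RSʷ w)) , proj₂ (RSʷ w))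
  RSʷ-φ w h = proj₁ (go w (reverseView w) h)
    where
    last : ∀ w {x} → AllPairs (λ y x → Refl x y) (w ++ x ∷ []) → AllPairs (λ y x → Refl x y) w × All (Refl x) w
    last [] _ = [] , []
    last (_ ∷ w) (a ∷ b) with last w b
    ... | c , d = Allₚ.++⁻ˡ w a ∷ c , All.head (Allₚ.++⁻ʳ w a) ∷ d
    go : ∀ w → Reverse w → AllPairs (λ y x → Refl x y) w →
      RSʷ (map φ w) ≡ (map (map φ) (proj₁ (RSʷ w)) , proj₂ (RSʷ w)) × Coherent (proj₁ (RSʷ w))
    go .[] []ʳ _ = refl , []
    go .(w ++ x ∷ []) (w ∶ r ∶ʳ x) h with last w h
    ... | h₁ , h₂ with go w r h₁
    ...   | e , k with Ins-φ (RSw.P-SS w) k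
              (λ m → All.lookup h₂ (Permₚ.∈-resp-↭ (RSw.P-entries w) m)) (insert-Ins x (RSw.P w))
    ...     | i , k' = (begin
        RSʷ (map φ (w ++ x ∷ []))  ≡⟨ cong RSʷ (map-++ φ w (x ∷ [])) ⟩
        RSʷ (map φ w ++ φ x ∷ [])  ≡⟨ RSʷ-∷ʳ (map φ w) (φ x) ⟩
        RSstepᵖ (RSʷ (map φ w)) (suc (length (map φ w)) , φ x)
          ≡⟨ cong₂ (λ z l → RSstepᵖ z (suc l , φ x)) e (length-map φ w) ⟩
        RSstepᵖ (map (map φ) (RSw.P w) , RSw.Q w) (suc (length w) , φ x)
          ≡⟨ cong₂ (λ c j → c , addAtCol j (suc (length w)) (RSw.Q w)) (proj₁ (insert-fun i)) (proj₂ (insert-fun i)) ⟩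
        _  ≡⟨ cong (λ z → map (map φ) (proj₁ z) , proj₂ z) (sym (RSʷ-∷ʳ w x)) ⟩
        _ ∎) , subst (Coherent ∘ proj₁) (sym (RSʷ-∷ʳ w x)) k'
      where open ≡-Reasoning

-- Rows and columns of a tableau

ent : Cols → Cell → Maybe ℕ
ent []       _             = nothing
ent (c ∷ cs) (i , zero)    = atM c i
ent (c ∷ cs) (i , suc j)   = ent cs (i , j)

row : Cols → ℕ → List ℕ
row cs i = L.mapMaybe (λ c → atM c i) cs

rows : ℕ → Cols → List (List ℕ)
rows k cs = applyUpTo (row cs) k

rowsOf-rows : ∀ cs → rowsOf cs ≡ rows (length (hd cs)) cs
rowsOf-rows []       = refl
rowsOf-rows (c ∷ cs) = refl

Shape⇒IsPart : ∀ {ls} → Shape ls → IsPart ls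
Shape⇒IsPart [] = IsPart-[]
Shape⇒IsPart (cons p q s) with Shape⇒IsPart s
... | d , a = (λ { zero → q ; (suc i) → d i }) , p ∷ a

IsPart⇒Shape : ∀ {ls} → IsPart ls → Shape ls
IsPart⇒Shape {[]} _ = []
IsPart⇒Shape {l ∷ ls} (d , p ∷ a) = cons p (d 0) (IsPart⇒Shape (d ∘ suc , a))

OK : Cols → Set
OK cs = Shape (shape cs)

ent-tall : ∀ {cs} → OK cs → ∀ {i} j → length (hd cs) ≤ i → ent cs (i , j) ≡ nothing
ent-tall {[]} s j h = refl
ent-tall {c ∷ cs} s zero h = atM-≥ c h
ent-tall {c ∷ cs} (cons p q s) (suc j) h = ent-tall s j (≤-trans (subst (_≤ length c) (hd-shape cs) q) h)

-- `mapMaybe` closes gaps, so this depends on the columns being ordered by length: behind a column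
-- that is too short for row i there are only such columns.
row-at : ∀ {cs} → OK cs → ∀ i j → atM (row cs i) j ≡ ent cs (i , j)
row-at {[]} s i j = refl
row-at {c ∷ cs} (cons p q s) i j with atM c i in e
row-at {c ∷ cs} (cons p q s) i zero    | just x = sym e
row-at {c ∷ cs} (cons p q s) i (suc j) | just x = row-at s i j
row-at {c ∷ cs} (cons p q s) i zero    | nothing = trans (row-at s i 0)
  (trans (ent-tall s 0 (≤-trans (subst (_≤ length c) (hd-shape cs) q) (≮⇒≥ λ l → case trans (sym (proj₂ (atM-< c l))) e of λ ()))) (sym e))
row-at {c ∷ cs} (cons p q s) i (suc j) | nothing = trans (row-at s i (suc j))
  (trans (ent-tall s (suc j) big) (sym (ent-tall s j big)))
  where
  big : length (hd cs) ≤ i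
  big = ≤-trans (subst (_≤ length c) (hd-shape cs) q) (≮⇒≥ λ l → case trans (sym (proj₂ (atM-< c l))) e of λ ())

ent-down : ∀ {cs i j x} → ent cs (suc i , j) ≡ just x → ∃[ y ] ent cs (i , j) ≡ just y
ent-down {c ∷ cs} {i} {zero} e = atM-< c (<-trans (n<1+n i) (atM-just c e))
ent-down {c ∷ cs} {i} {suc j} e = ent-down {cs} e

ent-∈ : ∀ {cs c x} → ent cs c ≡ just x → x ∈ concat cs
ent-∈ {c ∷ cs} {i , zero} e = ∈-++⁺ˡ (atM-∈ {xs = c} {i} e)
ent-∈ {c ∷ cs} {i , suc j} e = ∈-++⁺ʳ c (ent-∈ {cs} e)

∈-ent : ∀ {cs x} → x ∈ concat cs → ∃[ c ] ent cs c ≡ just x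
∈-ent {c ∷ cs} m with ∈-++⁻ c m
... | inj₁ a with ∈-atM a
...   | i , e = (i , 0) , e
∈-ent {c ∷ cs} m | inj₂ b with ∈-ent {cs} b
... | (i , j) , e = (i , suc j) , e

ent-ext : ∀ {cs ds} → OK cs → OK ds → (∀ i j → ent cs (i , j) ≡ ent ds (i , j)) → cs ≡ ds
ent-ext {[]} {[]} s t h = refl
ent-ext {[]} {d ∷ ds} s (cons p _ _) h = case trans (h 0 0) (proj₂ (atM-< d p)) of λ ()
ent-ext {c ∷ cs} {[]} (cons p _ _) t h = case trans (sym (h 0 0)) (proj₂ (atM-< c p)) of λ ()
ent-ext {c ∷ cs} {d ∷ ds} (cons _ _ s) (cons _ _ t) h =
  cong₂ _∷_ (atM-ext c d (λ i → h i 0)) (ent-ext s t (λ i j → h i (suc j)))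

shapeOf : Cols → List ℕ
shapeOf cs = map length (rowsOf cs)

module _ {cs : Cols} (s : OK cs) where

  row-[] : ∀ {i} → length (hd cs) ≤ i → length (row cs i) ≡ 0
  row-[] {i} h with row cs i in e
  ... | [] = refl
  ... | x ∷ _ = case trans (sym (ent-tall s 0 h)) (trans (sym (row-at s i 0)) (cong (λ r → atM r 0) e)) of λ ()

  at-shapeOf : ∀ i → at (shapeOf cs) i ≡ length (row cs i)
  at-shapeOf i rewrite rowsOf-rows cs = go (row cs) (length (hd cs)) i (λ h → row-[] h)
    where
    go : ∀ (r : ℕ → List ℕ) k i → (k ≤ i → length (r i) ≡ 0) → at (map length (applyUpTo r k)) i ≡ length (r i)
    go r zero    i       h = sym (h z≤n)
    go r (suc k) zero    h = refl
    go r (suc k) (suc i) h = go (r ∘ suc) k i (h ∘ s≤s)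

  ent-shapeOf : ∀ {i j} → (i , j) ∈ₛ (shapeOf cs /ₛ []) → ∃[ x ] ent cs (i , j) ≡ just x
  ent-shapeOf {i} {j} (ins _ h) with atM-< (row cs i) (subst (j <_) (at-shapeOf i) h)
  ... | x , e = x , trans (sym (row-at s i j)) e

  shapeOf-ent : ∀ {i j x} → ent cs (i , j) ≡ just x → (i , j) ∈ₛ (shapeOf cs /ₛ [])
  shapeOf-ent {i} {j} e = ins z≤n (subst (j <_) (sym (at-shapeOf i)) (atM-just (row cs i) (trans (row-at s i j) e)))

  length-shapeOf : length (shapeOf cs) ≡ length (hd cs)
  length-shapeOf rewrite rowsOf-rows cs = trans (length-map length (rows (length (hd cs)) cs)) (length-applyUpTo (row cs) (length (hd cs)))

  shapeOf-isPart : IsPart (shapeOf cs)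
  shapeOf-isPart = decr , pos
    where
    decr : Decr (at (shapeOf cs))
    decr i = ≮⇒≥ λ l → case ent-shapeOf (ins z≤n l) of λ { (x , e) → case ent-down {cs} e of λ { (y , e') →
      <-irrefl refl (<outer (shapeOf-ent e')) } }
    first : ∀ {cs i} → i < length (hd cs) → ∃[ x ] ent cs (i , 0) ≡ just x
    first {c ∷ cs} h = atM-< c h
    pos : All (1 ≤_) (shapeOf cs)
    pos rewrite rowsOf-rows cs = Allₚ.map⁺ (Allₚ.applyUpTo⁺₁ (row cs) (length (hd cs)) λ {i} h →
      ≤-trans (s≤s z≤n) (atM-just (row cs i) (trans (row-at s i 0) (proj₂ (first {cs} h)))))

  value : Cell → ℕ
  value c = fromMaybe 0 (ent cs c)

  ent-value : ∀ {c} → c ∈ₛ (shapeOf cs /ₛ []) → ent cs c ≡ just (value c)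
  ent-value {c} m with ent cs c | ent-shapeOf m
  ... | just x | _ = refl
  ... | nothing | _ , ()

  value-ent : ∀ {c x} → ent cs c ≡ just x → value c ≡ x
  value-ent e = cong (fromMaybe 0) e

  rowsOf-fill : concat (rowsOf cs) ≡ fill (shapeOf cs /ₛ []) value
  rowsOf-fill = trans (cong concat (trans (rowsOf-rows cs) (eqs (length (hd cs)))))
    (trans (cong (λ k → concat (map (map value) (applyUpTo (λ i → map (i ,_) (range 0 (at (shapeOf cs) i))) k))) (sym length-shapeOf))
    (trans (concat-map {f = value} (applyUpTo (λ i → map (i ,_) (range 0 (at (shapeOf cs) i))) (length (shapeOf cs))))
      (cong (map value) (sym (cells-rows (shapeOf cs /ₛ []))))))
    where
    self : ∀ (r : List ℕ) → r ≡ applyUpTo (λ j → fromMaybe 0 (atM r j)) (length r)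
    self [] = refl
    self (x ∷ r) = cong (x ∷_) (self r)
    rowEq : ∀ i → row cs i ≡ map value (map (i ,_) (range 0 (at (shapeOf cs) i)))
    rowEq i = trans (self (row cs i)) (trans (applyUpTo-cong (length (row cs i)) (λ {j} _ → cong (fromMaybe 0) (row-at s i j)))
      (trans (cong (applyUpTo (λ j → value (i , j))) (sym (at-shapeOf i)))
      (trans (sym (map-applyUpTo (i ,_) value (at (shapeOf cs) i)))
        (cong (map value) (sym (map-applyUpTo id (i ,_) (at (shapeOf cs) i)))))))
    eqs : ∀ k → applyUpTo (row cs) k ≡ map (map value) (applyUpTo (λ i → map (i ,_) (range 0 (at (shapeOf cs) i))) k)
    eqs k = trans (applyUpTo-cong k (λ {i} _ → rowEq i)) (sym (map-applyUpTo _ (map value) k))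

  rowsOf-↭ : concat (rowsOf cs) ↭ concat cs
  rowsOf-↭ rewrite rowsOf-rows cs = go cs (length (hd cs)) (tall s ≤-refl)
    where
    tall : ∀ {cs k} → OK cs → length (hd cs) ≤ k → All (λ c → length c ≤ k) cs
    tall {[]} s h = []
    tall {c ∷ cs} (cons p q s) h = h ∷ tall s (≤-trans (subst (_≤ length c) (hd-shape cs) q) h)
    merge : ∀ (a b : ℕ → List ℕ) k → concat (applyUpTo (λ i → a i ++ b i) k) ↭ concat (applyUpTo a k) ++ concat (applyUpTo b k)
    merge a b zero = ↭-refl
    merge a b (suc k) = ↭-trans (Permₚ.++⁺ˡ (a 0 ++ b 0) (merge (a ∘ suc) (b ∘ suc) k)) (shuffle (a 0) (b 0) _ _)
      where
      shuffle : ∀ (p q x y : List ℕ) → (p ++ q) ++ (x ++ y) ↭ (p ++ x) ++ (q ++ y)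
      shuffle p q x y = subst₂ _↭_ (sym (++-assoc p q (x ++ y))) (sym (++-assoc p x (q ++ y)))
        (Permₚ.++⁺ˡ p (subst₂ _↭_ (++-assoc q x y) (++-assoc x q y) (Permₚ.++⁺ʳ y (Permₚ.++-comm q x))))
    single : ∀ c k → length c ≤ k → concat (applyUpTo (λ i → L.fromMaybe (atM c i)) k) ≡ c
    single [] zero h = refl
    single [] (suc k) h = single [] k z≤n
    single (x ∷ c) (suc k) (s≤s h) = cong (x ∷_) (single c k h)
    cons-row : ∀ c cs i → row (c ∷ cs) i ≡ L.fromMaybe (atM c i) ++ row cs i
    cons-row c cs i with atM c i
    ... | just x = refl
    ... | nothing = refl
    empty : ∀ k → concat (applyUpTo (row []) k) ≡ []
    empty zero = refl
    empty (suc k) = empty k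
    go : ∀ cs k → All (λ c → length c ≤ k) cs → concat (applyUpTo (row cs) k) ↭ concat cs
    go [] k _ = subst (_↭ []) (sym (empty k)) ↭-refl
    go (c ∷ cs) k (h ∷ hs) = subst (_↭ c ++ concat cs) (cong concat (applyUpTo-cong k λ {i} _ → sym (cons-row c cs i)))
      (↭-trans (merge (λ i → L.fromMaybe (atM c i)) (row cs) k)
        (subst (λ z → z ++ concat (applyUpTo (row cs) k) ↭ c ++ concat cs) (sym (single c k h)) (Permₚ.++⁺ˡ c (go cs k hs))))

  size-shapeOf : size (shapeOf cs) ≡ length (concat cs)
  size-shapeOf = trans (sym (length-concat' (rowsOf cs))) (Permₚ.↭-length rowsOf-↭)
    where
    length-concat' : ∀ (xs : List (List ℕ)) → length (concat xs) ≡ size (map length xs)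
    length-concat' [] = refl
    length-concat' (x ∷ xs) = trans (length-++ x) (cong (length x +_) (length-concat' xs))

  ent-rowsOf : ∀ i j → ent (rowsOf cs) (j , i) ≡ ent cs (i , j)
  ent-rowsOf i j rewrite rowsOf-rows cs = trans (go (row cs) (length (hd cs)) i j
      (λ h → trans (row-at s i j) (ent-tall s j h))) (row-at s i j)
    where
    go : ∀ (r : ℕ → List ℕ) k i j → (k ≤ i → atM (r i) j ≡ nothing) → ent (applyUpTo r k) (j , i) ≡ atM (r i) j
    go r zero i j h = sym (h z≤n)
    go r (suc k) zero j h = refl
    go r (suc k) (suc i) j h = go (r ∘ suc) k i j (h ∘ s≤s)

  rowsOf-OK : OK (rowsOf cs)
  rowsOf-OK = IsPart⇒Shape shapeOf-isPart

rowsOf² : ∀ {cs} → OK cs → rowsOf (rowsOf cs) ≡ cs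
rowsOf² {cs} s = ent-ext (rowsOf-OK (rowsOf-OK s)) s λ i j →
  trans (ent-rowsOf (rowsOf-OK s) j i) (ent-rowsOf s i j)

module _ (γ : List ℕ) (F : Cell → ℕ) (γP : IsPart γ) where

  rowList : List (List ℕ)
  rowList = applyUpTo (λ i → applyUpTo (λ j → F (i , j)) (at γ i)) (length γ)

  -- `rowsOf` is the transposition of a list of lists, and so it also turns a list of rows into the
  -- list of columns.
  colsOf : Cols
  colsOf = rowsOf rowList

  rowList-shape : map length rowList ≡ γ
  rowList-shape = trans (map-applyUpTo _ length (length γ))
      (trans (applyUpTo-cong (length γ) (λ {i} _ → length-applyUpTo (λ j → F (i , j)) (at γ i))) (self γ))
    where
    self : ∀ γ → applyUpTo (at γ) (length γ) ≡ γ
    self [] = refl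
    self (x ∷ γ) = cong (x ∷_) (self γ)

  rowList-OK : OK rowList
  rowList-OK = subst Shape (sym rowList-shape) (IsPart⇒Shape γP)

  colsOf-OK : OK colsOf
  colsOf-OK = rowsOf-OK rowList-OK

  colsOf-rows : rowsOf colsOf ≡ rowList
  colsOf-rows = rowsOf² rowList-OK

  colsOf-shape : shapeOf colsOf ≡ γ
  colsOf-shape = trans (cong (map length) colsOf-rows) rowList-shape

  colsOf-ent : ∀ {i j} → (i , j) ∈ₛ (γ /ₛ []) → ent colsOf (i , j) ≡ just (F (i , j))
  colsOf-ent {i} {j} (ins _ h) = trans (ent-rowsOf rowList-OK j i)
      (go (λ i → applyUpTo (λ j → F (i , j)) (at γ i)) (length γ) i (at-<length γ h) (atM-applyUpTo (λ j → F (i , j)) (at γ i) h))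
    where
    go : ∀ (r : ℕ → List ℕ) k i → i < k → ∀ {x} → atM (r i) j ≡ just x → ent (applyUpTo r k) (j , i) ≡ just x
    go r (suc k) zero h e = e
    go r (suc k) (suc i) h e = go (r ∘ suc) k i (s≤s⁻¹ h) e

  ent-colsOf : ∀ {c x} → ent colsOf c ≡ just x → c ∈ₛ (γ /ₛ []) × x ≡ F c
  ent-colsOf {c} e = m , just-injective (trans (sym e) (colsOf-ent m))
    where m = subst (λ z → c ∈ₛ (z /ₛ [])) colsOf-shape (shapeOf-ent colsOf-OK e)

  colsOf-value : ∀ {c} → c ∈ₛ (γ /ₛ []) → value colsOf-OK c ≡ F c
  colsOf-value m = value-ent colsOf-OK (colsOf-ent m)

  colsOf-fill : concat (rowsOf colsOf) ≡ fill (γ /ₛ []) F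
  colsOf-fill = trans (rowsOf-fill colsOf-OK) (trans (cong (λ g → fill (g /ₛ []) (value colsOf-OK)) colsOf-shape)
    (fill-cong {γ /ₛ []} colsOf-value))

  colsOf-SS : (∀ {i j} → (i , j) ∈ₛ (γ /ₛ []) → (i , suc j) ∈ₛ (γ /ₛ []) → F (i , j) ≤ F (i , suc j)) →
    (∀ {i j} → (i , j) ∈ₛ (γ /ₛ []) → (suc i , j) ∈ₛ (γ /ₛ []) → F (i , j) < F (suc i , j)) → SS colsOf
  colsOf-SS r d = go colsOf-OK
      (λ {i} {j} p q → let a , b = ent-colsOf p ; a' , b' = ent-colsOf q in subst₂ _≤_ (sym b) (sym b') (r a a'))
      (λ {i} {j} p q → let a , b = ent-colsOf p ; a' , b' = ent-colsOf q in subst₂ _<_ (sym b) (sym b') (d a a'))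
    where
    inc : ∀ c → (∀ {i x y} → atM c i ≡ just x → atM c (suc i) ≡ just y → x < y) → Inc c
    inc [] h = []
    inc (x ∷ []) h = [] ∷ []
    inc (x ∷ y ∷ c) h with inc (y ∷ c) (λ {i} → h {suc i})
    ... | a ∷ b = (h {0} refl refl ∷ All.map (<-trans (h {0} refl refl)) a) ∷ a ∷ b
    dom : ∀ c d → length d ≤ length c → (∀ {i x y} → atM c i ≡ just x → atM d i ≡ just y → x ≤ y) → c ⊑ d
    dom c [] l h = []
    dom (x ∷ c) (y ∷ d) (s≤s l) h = h {0} refl refl ∷ dom c d l (λ {i} → h {suc i})
    hd-ent : ∀ cs {i x} → atM (hd cs) i ≡ just x → ent cs (i , 0) ≡ just x
    hd-ent (c ∷ cs) e = e
    go : ∀ {cs} → OK cs → (∀ {i j x y} → ent cs (i , j) ≡ just x → ent cs (i , suc j) ≡ just y → x ≤ y) →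
      (∀ {i j x y} → ent cs (i , j) ≡ just x → ent cs (suc i , j) ≡ just y → x < y) → SS cs
    go {[]} s r d = []
    go {c ∷ cs} (cons p q s) r d = cons (inc c (λ {i} → d {i} {0})) (λ { refl → case p of λ () })
      (dom c (hd cs) (subst (_≤ length c) (hd-shape cs) q) (λ {i} a b → r {i} {0} a (hd-ent cs b)))
      (go s (λ {i} {j} → r {i} {suc j}) (λ {i} {j} → d {i} {suc j}))

SS-right : ∀ {cs i j x y} → SS cs → ent cs (i , j) ≡ just x → ent cs (i , suc j) ≡ just y → x ≤ y
SS-right {c ∷ d ∷ cs} {i} {zero} (cons _ _ r _) = go i r
  where
  go : ∀ {c d x y} i → c ⊑ d → atM c i ≡ just x → atM d i ≡ just y → x ≤ y
  go zero (p ∷ _) refl refl = p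
  go (suc i) (_ ∷ r) a b = go i r a b
SS-right {c ∷ cs} {i} {suc j} (cons _ _ _ s) a b = SS-right {cs} s a b

SS-down : ∀ {cs i j x y} → SS cs → ent cs (i , j) ≡ just x → ent cs (suc i , j) ≡ just y → x < y
SS-down {c ∷ cs} {i} {zero} (cons k _ _ _) = go i k
  where
  go : ∀ {c x y} i → Inc c → atM c i ≡ just x → atM c (suc i) ≡ just y → x < y
  go {c = _ ∷ _ ∷ _} zero (a ∷ _) refl refl = All.head a
  go {c = _ ∷ _} (suc i) (_ ∷ k) a b = go i k a b
SS-down {c ∷ cs} {i} {suc j} (cons _ _ _ s) a b = SS-down {cs} s a b

ent-distinct : ∀ {cs a b x} → Unique (concat cs) → ent cs a ≡ just x → ent cs b ≡ just x → a ≡ b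
ent-distinct {c ∷ cs} {i , zero} {i' , zero} u p q = cong (_, 0) (col (proj₁ (Unique-++⁻ c u)) p q)
  where
  col : ∀ {c i i' x} → Unique c → atM c i ≡ just x → atM c i' ≡ just x → i ≡ i'
  col {y ∷ c} {zero} {zero} u p q = refl
  col {y ∷ c} {zero} {suc i'} u refl q = ⊥-elim (Unique-head∉ u (atM-∈ {xs = c} {i'} q))
  col {y ∷ c} {suc i} {zero} u p refl = ⊥-elim (Unique-head∉ u (atM-∈ {xs = c} {i} p))
  col {y ∷ c} {suc i} {suc i'} (_ ∷ u) p q = cong suc (col u p q)
ent-distinct {c ∷ cs} {i , zero} {i' , suc j'} u p q = ⊥-elim (proj₂ (proj₂ (Unique-++⁻ c u)) (atM-∈ {xs = c} {i} p) (ent-∈ {cs} q))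
ent-distinct {c ∷ cs} {i , suc j} {i' , zero} u p q = ⊥-elim (proj₂ (proj₂ (Unique-++⁻ c u)) (atM-∈ {xs = c} {i'} q) (ent-∈ {cs} p))
ent-distinct {c ∷ cs} {i , suc j} {i' , suc j'} u p q with ent-distinct {cs} (proj₁ (proj₂ (Unique-++⁻ c u))) p q
... | refl = refl

sameTableau⁻ : ∀ cs γ e → T (sameTableau cs γ e) → shapeOf cs ≡ γ × concat (rowsOf cs) ≡ e
sameTableau⁻ cs γ e t = eqList⇒≡ _ _ (T-∧ˡ t) , eqList⇒≡ _ _ (T-∧ʳ {eqList (shapeOf cs) γ} t)

sameTableau⁺ : ∀ cs γ e → shapeOf cs ≡ γ → concat (rowsOf cs) ≡ e → T (sameTableau cs γ e)
sameTableau⁺ cs γ e refl refl = T-∧⁺ {eqList γ γ} (eqList-refl γ) (eqList-refl e)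

OK-fill-inj : ∀ {cs ds} → OK cs → OK ds → shapeOf cs ≡ shapeOf ds → concat (rowsOf cs) ≡ concat (rowsOf ds) → cs ≡ ds
OK-fill-inj {cs} {ds} s t e e' = ent-ext s t pointwise
  where
  values : ∀ {c} → c ∈ₛ (shapeOf cs /ₛ []) → value s c ≡ value t c
  values = fill-inj (trans (sym (rowsOf-fill s)) (trans e' (trans (rowsOf-fill t) (cong (λ g → fill (g /ₛ []) (value t)) (sym e)))))
  pointwise : ∀ i j → ent cs (i , j) ≡ ent ds (i , j)
  pointwise i j with (i , j) ∈ₛ? (shapeOf cs /ₛ [])
  ... | yes m = trans (ent-value s m) (trans (cong just (values m)) (sym (ent-value t (subst (λ g → (i , j) ∈ₛ (g /ₛ [])) e m))))
  ... | no n with ent cs (i , j) in p | ent ds (i , j) in q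
  ...   | nothing | nothing = refl
  ...   | just x | _ = ⊥-elim (n (shapeOf-ent s p))
  ...   | nothing | just y = ⊥-elim (n (subst (λ g → (i , j) ∈ₛ (g /ₛ [])) (sym e) (shapeOf-ent t q)))

-- Lattice words and Knuth equivalence

data Bef (p q : ℕ) : List ℕ → Set where
  now   : ∀ {w} → q ∈ w → Bef p q (p ∷ w)
  later : ∀ {x w} → Bef p q w → Bef p q (x ∷ w)

Bef-∈ˡ : ∀ {p q w} → Bef p q w → p ∈ w
Bef-∈ˡ (now _) = here refl
Bef-∈ˡ (later b) = there (Bef-∈ˡ b)

Bef-∈ʳ : ∀ {p q w} → Bef p q w → q ∈ w
Bef-∈ʳ (now m) = there m
Bef-∈ʳ (later b) = there (Bef-∈ʳ b)

Bef-asym : ∀ {p q w} → Unique w → Bef p q w → Bef q p w → ⊥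
Bef-asym u (now m) (now m') = Unique-head∉ u m
Bef-asym u (now m) (later b) = Unique-head∉ u (Bef-∈ʳ b)
Bef-asym u (later b) (now m) = Unique-head∉ u (Bef-∈ʳ b)
Bef-asym (_ ∷ u) (later b) (later b') = Bef-asym u b b'

Bef-++ʳ : ∀ u {p q w} → Bef p q w → Bef p q (u ++ w)
Bef-++ʳ [] b = b
Bef-++ʳ (x ∷ u) b = later (Bef-++ʳ u b)

Bef-++ˡ : ∀ {p q u} w → Bef p q u → Bef p q (u ++ w)
Bef-++ˡ w (now m) = now (∈-++⁺ˡ m)
Bef-++ˡ w (later b) = later (Bef-++ˡ w b)

Bef-cross : ∀ {p q u w} → p ∈ u → q ∈ w → Bef p q (u ++ w)
Bef-cross {u = _ ∷ u} (here refl) m = now (∈-++⁺ʳ u m)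
Bef-cross (there h) m = later (Bef-cross h m)

Bef-++⁻ : ∀ u {p q w} → Bef p q (u ++ w) → Bef p q u ⊎ (p ∈ u × q ∈ w) ⊎ Bef p q w
Bef-++⁻ [] b = inj₂ (inj₂ b)
Bef-++⁻ (x ∷ u) (now m) with ∈-++⁻ u m
... | inj₁ h = inj₁ (now h)
... | inj₂ h = inj₂ (inj₁ (here refl , h))
Bef-++⁻ (x ∷ u) (later b) with Bef-++⁻ u b
... | inj₁ h = inj₁ (later h)
... | inj₂ (inj₁ (h , k)) = inj₂ (inj₁ (there h , k))
... | inj₂ (inj₂ h) = inj₂ (inj₂ h)

Bef-swap : ∀ u {a b v p q} → Bef p q (u ++ a ∷ b ∷ v) → (p ≡ a × q ≡ b) ⊎ Bef p q (u ++ b ∷ a ∷ v)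
Bef-swap [] (now (here refl)) = inj₁ (refl , refl)
Bef-swap [] (now (there m)) = inj₂ (later (now m))
Bef-swap [] (later (now m)) = inj₂ (now (there m))
Bef-swap [] (later (later b)) = inj₂ (later (later b))
Bef-swap (x ∷ u) {a} {b} {v} (now m) = inj₂ (now (Permₚ.∈-resp-↭ (Permₚ.++⁺ˡ u (swap a b ↭-refl)) m))
Bef-swap (x ∷ u) (later h) with Bef-swap u h
... | inj₁ e = inj₁ e
... | inj₂ k = inj₂ (later k)

Bef-between : ∀ u {a b c v m} → Unique (u ++ a ∷ b ∷ c ∷ v) → Bef a m (u ++ a ∷ b ∷ c ∷ v) → Bef m c (u ++ a ∷ b ∷ c ∷ v) → m ≡ b
Bef-between [] w (now (here refl)) _ = refl
Bef-between [] w (later h) _ = ⊥-elim (Unique-head∉ w (Bef-∈ˡ h))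
Bef-between [] w (now (there m)) (now _) = ⊥-elim (Unique-head∉ w (there m))
Bef-between [] (_ ∷ w) (now (there m)) (later (now _)) = refl
Bef-between [] (_ ∷ _ ∷ w) (now (there m)) (later (later k)) with k
... | now h = ⊥-elim (Unique-head∉ w h)
... | later h = ⊥-elim (Unique-head∉ w (Bef-∈ʳ h))
Bef-between (x ∷ u) w (now m) _ = ⊥-elim (Unique-head∉ w (∈-++⁺ʳ u (here refl)))
Bef-between (x ∷ u) w (later h) (now _) = ⊥-elim (Unique-head∉ w (Bef-∈ʳ h))
Bef-between (x ∷ u) (_ ∷ w) (later h) (later k) = Bef-between u w h k

data Knuth : List ℕ → List ℕ → Set where
  stepA : ∀ u {x y z} v → x < y → y < z → Knuth (u ++ x ∷ z ∷ y ∷ v) (u ++ z ∷ x ∷ y ∷ v)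
  stepB : ∀ u {x y z} v → x < y → y < z → Knuth (u ++ y ∷ z ∷ x ∷ v) (u ++ y ∷ x ∷ z ∷ v)
  K-refl : ∀ {w} → Knuth w w
  K-sym : ∀ {w w'} → Knuth w w' → Knuth w' w
  K-trans : ∀ {w w' w''} → Knuth w w' → Knuth w' w'' → Knuth w w''

Knuth-↭ : ∀ {w w'} → Knuth w w' → w ↭ w'
Knuth-↭ (stepA u v _ _) = Permₚ.++⁺ˡ u (swap _ _ ↭-refl)
Knuth-↭ (stepB u v _ _) = Permₚ.++⁺ˡ u (prep _ (swap _ _ ↭-refl))
Knuth-↭ K-refl = ↭-refl
Knuth-↭ (K-sym k) = ↭-sym (Knuth-↭ k)
Knuth-↭ (K-trans k l) = ↭-trans (Knuth-↭ k) (Knuth-↭ l)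

Knuth-ctx : ∀ a b {w w'} → Knuth w w' → Knuth (a ++ w ++ b) (a ++ w' ++ b)
Knuth-ctx a b (stepA u {x} {y} {z} v p q) = subst₂ Knuth (assoc _) (assoc _) (stepA (a ++ u) (v ++ b) p q)
  where
  assoc : ∀ t → (a ++ u) ++ t ++ b ≡ a ++ (u ++ t) ++ b
  assoc t = trans (++-assoc a u (t ++ b)) (cong (a ++_) (sym (++-assoc u t b)))
Knuth-ctx a b (stepB u {x} {y} {z} v p q) = subst₂ Knuth (assoc _) (assoc _) (stepB (a ++ u) (v ++ b) p q)
  where
  assoc : ∀ t → (a ++ u) ++ t ++ b ≡ a ++ (u ++ t) ++ b
  assoc t = trans (++-assoc a u (t ++ b)) (cong (a ++_) (sym (++-assoc u t b)))
Knuth-ctx a b K-refl = K-refl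
Knuth-ctx a b (K-sym k) = K-sym (Knuth-ctx a b k)
Knuth-ctx a b (K-trans k l) = K-trans (Knuth-ctx a b k) (Knuth-ctx a b l)

Knuth-right : ∀ y R x → x < y → Inc (y ∷ R) → Knuth (y ∷ R ++ x ∷ []) (y ∷ x ∷ R)
Knuth-right y [] x p i = K-refl
Knuth-right y (r ∷ R) x p ((q ∷ _) ∷ i) = K-trans
  (subst₂ Knuth (cong (y ∷_) (++-identityʳ _)) (cong (y ∷_) (++-identityʳ _)) (Knuth-ctx (y ∷ []) [] (Knuth-right r R x (<-trans p q) i)))
  (stepB [] R p q)

-- The letter x moves left through the entries below the place of y by `stepB`, the entry in front
-- being the third letter of each move. Then y moves left through the smaller entries by `stepA`,
-- the third letter being the entry that follows, which is less than y.
Knuth-Bump : ∀ {x c c' y} → x ∉ c → Inc c → Bump x c c' (just y) → Knuth (c ++ x ∷ []) (y ∷ c')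
Knuth-Bump {x} n i (hit {y} {c} p) = Knuth-right y c x (≤∧≢⇒< p (n ∘ here)) i
Knuth-Bump {x} {l ∷ c} {_ ∷ c'} {y} n (a ∷ i) (skip q b) = K-trans
    (subst₂ Knuth (cong (l ∷_) (++-identityʳ _)) (cong (l ∷_) (++-identityʳ _)) (Knuth-ctx (l ∷ []) [] (Knuth-Bump (n ∘ there) i b)))
    (step b (Bump-Inc b i) (Bump-All b a q))
  where
  step : ∀ {c'} → Bump x c c' (just y) → Inc c' → All (l <_) c' → Knuth (l ∷ y ∷ c') (y ∷ l ∷ c')
  step {t ∷ c'} b _ (h ∷ _) = stepA [] c' h (first b)
    where
    first : ∀ {c} → Bump x c (t ∷ c') (just y) → t < y
    first (hit _) = ≤∧≢⇒< (Bump-≤ b) λ { refl → n (there (Bump-∈ b)) }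
    first (skip r b') = <-≤-trans r (Bump-≤ b')

colread : Cols → List ℕ
colread []       = []
colread (c ∷ cs) = colread cs ++ c

colread-↭ : ∀ cs → colread cs ↭ concat cs
colread-↭ [] = ↭-refl
colread-↭ (c ∷ cs) = ↭-trans (Permₚ.++-comm (colread cs) c) (Permₚ.++⁺ˡ c (colread-↭ cs))

Knuth-Ins : ∀ {x cs cs' j} → SS cs → x ∉ concat cs → Unique (concat cs) → Ins x cs cs' j →
  Knuth (colread cs ++ x ∷ []) (colread cs')
Knuth-Ins s n u new = K-refl
Knuth-Ins {x} s n u (app {c} {c'} {cs} b) with Bump-nothing b
... | refl , _ = subst (λ z → Knuth z (colread cs ++ c ++ x ∷ [])) (sym (++-assoc (colread cs) c _)) K-refl
Knuth-Ins {x} (cons i _ _ s) n u (rep {c} {c'} {y} {cs} {cs'} b r) with Unique-++⁻ c u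
... | _ , u' , d = K-trans
  (subst₂ Knuth (trans (cong (colread cs ++_) (++-identityʳ _)) (sym (++-assoc (colread cs) c _))) (cong (colread cs ++_) (++-identityʳ _))
    (Knuth-ctx (colread cs) [] (Knuth-Bump (n ∘ ∈-++⁺ˡ) i b)))
  (subst (λ z → Knuth z (colread cs' ++ c')) (++-assoc (colread cs) (y ∷ []) c')
    (Knuth-ctx [] c' (Knuth-Ins s (d (Bump-∈ b)) u' r)))

Knuth-RSʷ : ∀ w → Unique w → Knuth w (colread (proj₁ (RSʷ w)))
Knuth-RSʷ w = go w (reverseView w)
  where
  go : ∀ w → Reverse w → Unique w → Knuth w (colread (proj₁ (RSʷ w)))
  go .[] []ʳ u = K-refl
  go .(w ++ x ∷ []) (w ∶ r ∶ʳ x) u with Unique-++⁻ w u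
  ... | uw , _ , d = subst (λ z → Knuth (w ++ x ∷ []) (colread (proj₁ z))) (sym (RSʷ-∷ʳ w x))
    (K-trans (Knuth-ctx [] (x ∷ []) (go w r uw))
      (Knuth-Ins (RSw.P-SS w) (λ m → d (Permₚ.∈-resp-↭ (RSw.P-entries w) m) (here refl))
        (Unique-↭ (↭-sym (RSw.P-entries w)) uw) (insert-Ins x (RSw.P w))))

data Con (X : Skew) : ℕ → ℕ → Set where
  rowC : ∀ {i j j'} → (i , j) ∈ₛ X → (i , j') ∈ₛ X → j < j' → Con X (lab X (i , j)) (lab X (i , j'))
  colC : ∀ {i j} → (i , j) ∈ₛ X → (suc i , j) ∈ₛ X → Con X (lab X (i , j)) (lab X (suc i , j))

-- The positions of the labels in the word increase to the right and downwards in X. For a straight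
-- shape and a word containing each label once, replacing labels by their rows gives a Yamanouchi
-- word.
Lat : Skew → List ℕ → Set
Lat X w = ∀ {p q} → Con X p q → Bef p q w

IsLab : Skew → ℕ → Set
IsLab X y = ∃[ e ] e ∈ₛ X × y ≡ lab X e

module _ {X : Skew} (cX : Convex X) where

  Con-row : ∀ {x y z} → x < y → y < z → IsLab X y → Con X z x → Con X z y × Con X y x
  Con-row p q ((i' , b) , e∈ , refl) (rowC {i} {j} {j'} m n l) with lab-≺ n e∈ p | lab-≺ e∈ m q
  ... | above h | above k = ⊥-elim (<-asym h k)
  ... | above h | right k = ⊥-elim (<-irrefl refl h)
  ... | right h | above k = ⊥-elim (<-irrefl refl k)
  ... | right h | right k = rowC m e∈ k , rowC e∈ n h
  Con-row p q _ (colC m n) = ⊥-elim (<-asym (<-trans p q) (lab-mono m n (above ≤-refl)))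

  -- A label between those of a box and of the box below it belongs to the row of the upper box,
  -- further left, or to the row of the lower box, further right. The fourth corner of the
  -- rectangle, z' or y', is a letter that the lattice condition forces to stand between two others.
  Con-col : ∀ {x y z} → x < y → y < z → IsLab X y → Con X x z →
    (Con X y x × ∃[ z' ] Con X y z' × Con X z' z × z' ≢ x)
    ⊎ (Con X z y × ∃[ y' ] Con X x y' × Con X y' y × y' ≢ z)
  Con-col p q _ (rowC m n l) = ⊥-elim (<-asym (<-trans p q) (lab-mono n m (right l)))
  Con-col p q ((i' , b) , e∈ , refl) (colC {i} {j} m n) with lab-≺ m e∈ p | lab-≺ e∈ n q
  ... | above h | above k = ⊥-elim (<-irrefl refl (<-≤-trans k h))
  ... | right h | above k = inj₁ (rowC e∈ m h , _ , colC e∈ d , rowC d n h ,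
        λ e → <-irrefl (sym e) (lab-mono m d (above ≤-refl)))
    where
    d : (suc i , b) ∈ₛ X
    d = ins (≤-trans (proj₂ cX i) (inner≤ e∈)) (<-trans h (<outer n))
  ... | above h | right k = inj₂ (rowC n e∈ k , _ , rowC m d k , colC d e∈ ,
        λ e → <-irrefl e (lab-mono d n (above ≤-refl)))
    where
    d : (i , b) ∈ₛ X
    d = ins (≤-trans (inner≤ m) (<⇒≤ k)) (<-≤-trans (<outer e∈) (proj₁ cX i))

  Lat-swap : ∀ u {a b v} → ¬ Con X a b → Lat X (u ++ a ∷ b ∷ v) → Lat X (u ++ b ∷ a ∷ v)
  Lat-swap u n h c with Bef-swap u (h c)
  ... | inj₁ (refl , refl) = ⊥-elim (n c)
  ... | inj₂ k = k

  -- A Knuth move exchanges x and z, so it can break only a constraint between these two. Such a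
  -- constraint would put y on the other side of the pair, or it would require the auxiliary letter
  -- of `Con-col` at a place where a single, different letter stands.
  Lat-Knuth : ∀ {w w'} → Knuth w w' → Unique w → All (IsLab X) w → (Lat X w → Lat X w') × (Lat X w' → Lat X w)
  Lat-Knuth (stepA u {x} {y} {z} v p q) uq a =
      (λ h → Lat-swap u (λ c → no₁ h c) h) , (λ h → Lat-swap u (λ c → no₂ h c) h)
    where
    y∈ : IsLab X y
    y∈ = All.lookup a (∈-++⁺ʳ u (there (there (here refl))))
    uq' = Unique-↭ (Knuth-↭ (stepA u v p q)) uq
    no₁ : Lat X (u ++ x ∷ z ∷ y ∷ v) → ¬ Con X x z
    no₁ h c with Con-col p q y∈ c
    ... | inj₁ (k , _) = Bef-asym uq (h k) (Bef-++ʳ u (now (there (here refl))))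
    ... | inj₂ (_ , y' , k , l , n) = n (Bef-between u uq (h k) (h l))
    no₂ : Lat X (u ++ z ∷ x ∷ y ∷ v) → ¬ Con X z x
    no₂ h c = Bef-asym uq' (h (proj₂ (Con-row p q y∈ c))) (Bef-++ʳ u (later (now (here refl))))
  Lat-Knuth (stepB u {x} {y} {z} v p q) uq a =
      (λ h → subst (Lat X) (++-assoc u (y ∷ []) _) (Lat-swap (u ++ y ∷ []) (no₁ h) (subst (Lat X) (sym (++-assoc u (y ∷ []) _)) h)))
    , (λ h → subst (Lat X) (++-assoc u (y ∷ []) _) (Lat-swap (u ++ y ∷ []) (no₂ h) (subst (Lat X) (sym (++-assoc u (y ∷ []) _)) h)))
    where
    y∈ : IsLab X y
    y∈ = All.lookup a (∈-++⁺ʳ u (here refl))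
    uq' = Unique-↭ (Knuth-↭ (stepB u v p q)) uq
    no₁ : Lat X (u ++ y ∷ z ∷ x ∷ v) → ¬ Con X z x
    no₁ h c = Bef-asym uq (h (proj₁ (Con-row p q y∈ c))) (Bef-++ʳ u (now (here refl)))
    no₂ : Lat X (u ++ y ∷ x ∷ z ∷ v) → ¬ Con X x z
    no₂ h c with Con-col p q y∈ c
    ... | inj₁ (_ , z' , k , l , n) = n (Bef-between u uq' (h k) (h l))
    ... | inj₂ (k , _) = Bef-asym uq' (h k) (Bef-++ʳ u (now (there (here refl))))
  Lat-Knuth K-refl uq a = id , id
  Lat-Knuth (K-sym k) uq a with Lat-Knuth k (Unique-↭ (↭-sym (Knuth-↭ k)) uq) (Permₚ.All-resp-↭ (↭-sym (Knuth-↭ k)) a)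
  ... | f , g = g , f
  Lat-Knuth (K-trans k l) uq a
    with Lat-Knuth k uq a | Lat-Knuth l (Unique-↭ (Knuth-↭ k) uq) (Permₚ.All-resp-↭ (Knuth-↭ k) a)
  ... | f , g | f' , g' = f' ∘ f , g ∘ g'

  Lat-RSʷ : ∀ {w} → Unique w → All (IsLab X) w →
    (Lat X w → Lat X (colread (proj₁ (RSʷ w)))) × (Lat X (colread (proj₁ (RSʷ w))) → Lat X w)
  Lat-RSʷ u a = Lat-Knuth (Knuth-RSʷ _ u) u a

-- The column reading order of boxes

data _⊏_ : Cell → Cell → Set where
  left  : ∀ {i j i' j'} → j' < j → (i , j) ⊏ (i' , j')
  below : ∀ {i i' j} → i < i' → (i , j) ⊏ (i' , j)

⊏-suc : ∀ {i j i' j'} → (i , j) ⊏ (i' , j') → (i , suc j) ⊏ (i' , suc j')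
⊏-suc (left p) = left (s≤s p)
⊏-suc (below p) = below p

Bef-column⁻ : ∀ {c p q} → Bef p q c → ∃[ i ] ∃[ i' ] atM c i ≡ just p × atM c i' ≡ just q × i < i'
Bef-column⁻ (now m) with ∈-atM m
... | i , e = 0 , suc i , refl , e , s≤s z≤n
Bef-column⁻ (later b) with Bef-column⁻ b
... | i , i' , e , e' , l = suc i , suc i' , e , e' , s≤s l

Bef-column⁺ : ∀ {c p q} i i' → atM c i ≡ just p → atM c i' ≡ just q → i < i' → Bef p q c
Bef-column⁺ {x ∷ c} zero (suc i') refl e l = now (atM-∈ {xs = c} {i'} e)
Bef-column⁺ {x ∷ c} (suc i) (suc i') e e' l = later (Bef-column⁺ i i' e e' (s≤s⁻¹ l))

Bef-colread⁻ : ∀ cs {p q} → Bef p q (colread cs) → ∃[ a ] ∃[ b ] ent cs a ≡ just p × ent cs b ≡ just q × a ⊏ b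
Bef-colread⁻ (c ∷ cs) h with Bef-++⁻ (colread cs) h
... | inj₁ k with Bef-colread⁻ cs k
...   | (i , j) , (i' , j') , e , e' , l = (i , suc j) , (i' , suc j') , e , e' , ⊏-suc l
Bef-colread⁻ (c ∷ cs) h | inj₂ (inj₁ (k , l)) with ∈-ent {cs} (Permₚ.∈-resp-↭ (colread-↭ cs) k) | ∈-atM l
... | (i , j) , e | i' , e' = (i , suc j) , (i' , 0) , e , e' , left (s≤s z≤n)
Bef-colread⁻ (c ∷ cs) h | inj₂ (inj₂ k) with Bef-column⁻ k
... | i , i' , e , e' , l = (i , 0) , (i' , 0) , e , e' , below l

Bef-colread⁺ : ∀ cs {p q} a b → ent cs a ≡ just p → ent cs b ≡ just q → a ⊏ b → Bef p q (colread cs)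
Bef-colread⁺ (c ∷ cs) (i , zero) (i' , .0) e e' (below l) = Bef-++ʳ (colread cs) (Bef-column⁺ i i' e e' l)
Bef-colread⁺ (c ∷ cs) (i , suc j) (i' , zero) e e' (left l) =
  Bef-cross (Permₚ.∈-resp-↭ (↭-sym (colread-↭ cs)) (ent-∈ {cs} e)) (atM-∈ {xs = c} {i'} e')
Bef-colread⁺ (c ∷ cs) (i , suc j) (i' , suc j') e e' (left l) = Bef-++ˡ c (Bef-colread⁺ cs (i , j) (i' , j') e e' (left (s≤s⁻¹ l)))
Bef-colread⁺ (c ∷ cs) (i , suc j) (i' , .(suc j)) e e' (below l) = Bef-++ˡ c (Bef-colread⁺ cs (i , j) (i' , j) e e' (below l))

-- The Robinson–Schensted correspondence for pictures

≤-from-< : ∀ {a b} → (∀ {j} → j < a → j < b) → a ≤ b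
≤-from-< h = ≮⇒≥ λ l → <-irrefl refl (h l)

ent-shape⁺ : ∀ cs {i j x} → ent cs (i , j) ≡ just x → i < at (shape cs) j
ent-shape⁺ (c ∷ cs) {i} {zero} e = atM-just c e
ent-shape⁺ (c ∷ cs) {i} {suc j} e = ent-shape⁺ cs e

ent-shape⁻ : ∀ cs {i j} → i < at (shape cs) j → ∃[ x ] ent cs (i , j) ≡ just x
ent-shape⁻ (c ∷ cs) {i} {zero} h = atM-< c h
ent-shape⁻ (c ∷ cs) {i} {suc j} h = ent-shape⁻ cs h

shape⇒shapeOf : ∀ {cs ds} → OK cs → OK ds → shape cs ≡ shape ds → shapeOf cs ≡ shapeOf ds
shape⇒shapeOf {cs} {ds} s t e = at-ext (shapeOf-isPart s) (shapeOf-isPart t)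
    λ i → ≤-antisym (≤-from-< (go s t e)) (≤-from-< (go t s (sym e)))
  where
  go : ∀ {cs ds} (s : OK cs) (t : OK ds) → shape cs ≡ shape ds → ∀ {i j} → j < at (shapeOf cs) i → j < at (shapeOf ds) i
  go {cs} {ds} s t e {i} {j} h with ent-shapeOf s (ins z≤n h)
  ... | x , p with ent-shape⁻ ds (subst (λ z → i < at z j) e (ent-shape⁺ cs p))
  ...   | y , q = <outer (shapeOf-ent t q)

shapeOf⇒shape : ∀ {cs ds} → OK cs → OK ds → shapeOf cs ≡ shapeOf ds → shape cs ≡ shape ds
shapeOf⇒shape {cs} {ds} s t e = at-ext (Shape⇒IsPart s) (Shape⇒IsPart t)
    λ j → ≤-antisym (≤-from-< (go s t e)) (≤-from-< (go t s (sym e)))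
  where
  go : ∀ {cs ds} (s : OK cs) (t : OK ds) → shapeOf cs ≡ shapeOf ds → ∀ {i j} → i < at (shape cs) j → i < at (shape ds) j
  go {cs} {ds} s t e {i} {j} h with ent-shape⁻ cs h
  ... | x , p with ent-shapeOf t (subst (λ g → (i , j) ∈ₛ (g /ₛ [])) e (shapeOf-ent s p))
  ...   | y , q = ent-shape⁺ ds q

straight-convex : ∀ {γ} → IsPart γ → Convex (γ /ₛ [])
straight-convex (d , _) = d , λ _ → z≤n

in-up : ∀ {γ i i' j} → IsPart γ → i' ≤ i → (i , j) ∈ₛ (γ /ₛ []) → (i' , j) ∈ₛ (γ /ₛ [])
in-up (d , _) h (ins _ q) = ins z≤n (<-≤-trans q (Decr-≤ d h))

in-left : ∀ {γ i j j'} → j' ≤ j → (i , j) ∈ₛ (γ /ₛ []) → (i , j') ∈ₛ (γ /ₛ [])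
in-left h (ins _ q) = ins z≤n (≤-<-trans h q)

module Standard {P : Cols} (sP : SS P) (uP : Unique (concat P)) where

  okP : OK P
  okP = SS-Shape sP

  γ : List ℕ
  γ = shapeOf P

  γP : IsPart γ
  γP = shapeOf-isPart okP

  val : Cell → ℕ
  val = value okP

  ent-val : ∀ {c} → c ∈ₛ (γ /ₛ []) → ent P c ≡ just (val c)
  ent-val = ent-value okP

  val-inj : ∀ {a b} → a ∈ₛ (γ /ₛ []) → b ∈ₛ (γ /ₛ []) → val a ≡ val b → a ≡ b
  val-inj m n e = ent-distinct {P} uP (ent-val m) (trans (ent-val n) (cong just (sym e)))

  val-right : ∀ {i j} → (i , suc j) ∈ₛ (γ /ₛ []) → val (i , j) < val (i , suc j)
  val-right {i} {j} m = ≤∧≢⇒< (SS-right {P} sP (ent-val m') (ent-val m)) λ e → case val-inj m' m e of λ ()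
    where m' = in-left (n≤1+n j) m

  val-down : ∀ {i j} → (suc i , j) ∈ₛ (γ /ₛ []) → val (i , j) < val (suc i , j)
  val-down {i} m = SS-down {P} sP (ent-val (in-up γP (n≤1+n i) m)) (ent-val m)

  val-rights : ∀ {i j j'} → j ≤ j' → (i , j') ∈ₛ (γ /ₛ []) → val (i , j) ≤ val (i , j')
  val-rights {j' = zero} z≤n m = ≤-refl
  val-rights {j = j} {suc j'} h m with m≤n⇒m<n∨m≡n h
  ... | inj₂ refl = ≤-refl
  ... | inj₁ l = ≤-trans (val-rights (s≤s⁻¹ l) (in-left (n≤1+n j') m)) (<⇒≤ (val-right m))

  val-downs : ∀ {i i' j} → i ≤ i' → (i' , j) ∈ₛ (γ /ₛ []) → val (i , j) ≤ val (i' , j)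
  val-downs {i' = zero} z≤n m = ≤-refl
  val-downs {i = i} {suc i'} h m with m≤n⇒m<n∨m≡n h
  ... | inj₂ refl = ≤-refl
  ... | inj₁ l = ≤-trans (val-downs (s≤s⁻¹ l) (in-up γP (n≤1+n i') m)) (<⇒≤ (val-down m))

  val-mono : ∀ {i j i' j'} → i ≤ i' → j ≤ j' → (i' , j') ∈ₛ (γ /ₛ []) → val (i , j) ≤ val (i' , j')
  val-mono h k m = ≤-trans (val-rights k (in-up γP h m)) (val-downs h m)

  module _ {X : Skew} (cX : Convex X) (labP : concat P ↭ range 1 (suc (nCells X))) where

    -- An entry of P is read as a label of X. The lattice condition orders the boxes `g d` by ⊏;
    -- this implies ≺ unless the second box lies strictly above and strictly to the left of the
    -- first, and the entries of a standard tableau exclude that.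
    Lat⇒pict : Lat X (colread P) → ∃[ p ] tab {γ /ₛ []} {X} p ≡ concat (rowsOf P)
    Lat⇒pict lat = p , trans (fill-cong (λ m → lab-f m)) (sym (rowsOf-fill okP))
      where
      f : Cell → Cell
      f c = cellOf X (val c)
      rng : ∀ {c} → c ∈ₛ (γ /ₛ []) → 1 ≤ val c × val c ≤ nCells X
      rng m with ∈-range⁻ {1} {suc (nCells X)} (Permₚ.∈-resp-↭ labP (ent-∈ {P} (ent-val m)))
      ... | a , b = a , s≤s⁻¹ b
      f∈ : ∀ {c} → c ∈ₛ (γ /ₛ []) → f c ∈ₛ X
      f∈ m = proj₁ (cellOf-∈ {X} (proj₁ (rng m)) (proj₂ (rng m)))
      lab-f : ∀ {c} → c ∈ₛ (γ /ₛ []) → lab X (f c) ≡ val c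
      lab-f m = proj₂ (cellOf-∈ {X} (proj₁ (rng m)) (proj₂ (rng m)))
      pos : ∀ l → Σ Cell λ c → l ∈ concat P → ent P c ≡ just l
      pos l with l ∈? concat P
      ... | yes m = let c , e = ∈-ent {P} m in c , λ _ → e
      ... | no n = (0 , 0) , λ m → ⊥-elim (n m)
      g : Cell → Cell
      g d = proj₁ (pos (lab X d))
      ent-g : ∀ {d} → d ∈ₛ X → ent P (g d) ≡ just (lab X d)
      ent-g {d} m = proj₂ (pos (lab X d)) (Permₚ.∈-resp-↭ (↭-sym labP)
        (∈-range⁺ {1} {suc (nCells X)} (proj₁ (lab-range m)) (s≤s (proj₂ (lab-range m)))))
      g∈ : ∀ {d} → d ∈ₛ X → g d ∈ₛ (γ /ₛ [])
      g∈ m = shapeOf-ent okP (ent-g m)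
      val-g : ∀ {d} → d ∈ₛ X → val (g d) ≡ lab X d
      val-g m = value-ent okP (ent-g m)
      order : ∀ {d d'} → d ∈ₛ X → d' ∈ₛ X → Con X (lab X d) (lab X d') → g d ⊏ g d'
      order m m' c with Bef-colread⁻ P (lat c)
      ... | a , b , e , e' , l = subst₂ _⊏_ (ent-distinct {P} uP e (ent-g m)) (ent-distinct {P} uP e' (ent-g m')) l
      g→ : ∀ {i j} → (i , j) ∈ₛ X → (i , suc j) ∈ₛ X → g (i , j) ≺ g (i , suc j)
      g→ {i} {j} m m' with g (i , j) | g (i , suc j) | order m m' (rowC m m' ≤-refl) | g∈ m | g∈ m' | val-g m | val-g m'
      ... | r , c | r' , c' | below l | _ | _ | _ | _ = above l
      ... | r , c | r' , c' | left l | a | b | e | e' with <-cmp r r'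
      ...   | tri< h _ _ = above h
      ...   | tri≈ _ refl _ = right l
      -- From (r' , c') to (r , c) there is at least one step right and one step down, so the
      -- entries differ by at least 2, while the labels of (i , suc j) and (i , j) are consecutive.
      ...   | tri> _ _ h = ⊥-elim (<-irrefl refl (begin-strict
              lab X (i , j)            ≡⟨ lab-suc m' ⟩
              suc (lab X (i , suc j))  ≡⟨ cong suc (sym e') ⟩
              suc (val (r' , c'))      ≤⟨ <-≤-trans (val-right (in-left l corner)) (val-rights l corner) ⟩
              val (r' , c)             <⟨ <-≤-trans (val-down (in-up γP h a)) (val-downs h a) ⟩
              val (r , c)              ≡⟨ e ⟩
              lab X (i , j)            ∎))
        where
        open ≤-Reasoning
        corner = in-up γP (<⇒≤ h) a
      g↓ : ∀ {i j} → (i , j) ∈ₛ X → (suc i , j) ∈ₛ X → g (i , j) ≺ g (suc i , j)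
      g↓ {i} {j} m m' with g (i , j) | g (suc i , j) | order m m' (colC m m') | g∈ m | g∈ m' | val-g m | val-g m'
      ... | r , c | r' , c' | below l | _ | _ | _ | _ = above l
      ... | r , c | r' , c' | left l | a | b | e | e' with <-cmp r r'
      ...   | tri< h _ _ = above h
      ...   | tri≈ _ refl _ = right l
      ...   | tri> _ _ h = ⊥-elim (<⇒≱ (lab-mono m m' (above ≤-refl))
                (subst₂ _≤_ e' e (val-mono (<⇒≤ h) (<⇒≤ l) a)))
      p : Pict (γ /ₛ []) X
      p = record { f = f ; g = g ; f∈ = f∈ ; g∈ = g∈
        ; gf = λ m → val-inj (g∈ (f∈ m)) m (trans (val-g (f∈ m)) (lab-f m))
        ; fg = λ m → trans (cong (cellOf X) (val-g m)) (cellOf-lab m)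
        ; f→ = λ a b → lab-≺ (f∈ a) (f∈ b) (subst₂ _<_ (sym (lab-f a)) (sym (lab-f b)) (val-right b))
        ; f↓ = λ a b → lab-≺ (f∈ a) (f∈ b) (subst₂ _<_ (sym (lab-f a)) (sym (lab-f b)) (val-down b))
        ; g→ = g→ ; g↓ = g↓ }

    pict⇒Lat : (p : Pict (γ /ₛ []) X) → tab p ≡ concat (rowsOf P) → Lat X (colread P)
    pict⇒Lat p e = go
      where
      open Pict p
      open Strong (straight-convex γP) cX p
      ent-g : ∀ {d} → d ∈ₛ X → ent P (g d) ≡ just (lab X d)
      ent-g m = trans (ent-val (g∈ m)) (cong just (trans
        (sym (fill-inj {γ /ₛ []} {λ c → lab X (f c)} (trans e (rowsOf-fill okP)) (g∈ m))) (cong (lab X) (fg m))))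
      go : Lat X (colread P)
      go (rowC {i} {j} {j'} m n l) = Bef-colread⁺ P _ _ (ent-g m) (ent-g n) (left (proj₂ (g-rights l m n)))
      go (colC {i} {j} m n) with g (i , j) | g (suc i , j) | ent-g m | ent-g n | g-down j m n (suc j) ≤-refl
      ... | r , c | r' , c' | x | y | h , k with m≤n⇒m<n∨m≡n k
      ...   | inj₁ l = Bef-colread⁺ P _ _ x y (left l)
      ...   | inj₂ refl = Bef-colread⁺ P _ _ x y (below h)

-- Sorting points by value

insPt : ℕ × ℕ → List (ℕ × ℕ) → List (ℕ × ℕ)
insPt p [] = p ∷ []
insPt p (q ∷ s) with proj₁ p <? proj₁ q
... | yes _ = p ∷ q ∷ s
... | no _  = q ∷ insPt p s

sortPt : List (ℕ × ℕ) → List (ℕ × ℕ)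
sortPt = foldr insPt []

insPt-↭ : ∀ p s → insPt p s ↭ p ∷ s
insPt-↭ p [] = ↭-refl
insPt-↭ p (q ∷ s) with proj₁ p <? proj₁ q
... | yes _ = ↭-refl
... | no _  = ↭-trans (prep q (insPt-↭ p s)) (swap q p ↭-refl)

sortPt-↭ : ∀ s → sortPt s ↭ s
sortPt-↭ [] = ↭-refl
sortPt-↭ (p ∷ s) = ↭-trans (insPt-↭ p (sortPt s)) (prep p (sortPt-↭ s))

sortPt-sorted : ∀ s → Unique (map proj₁ s) → AllPairs (λ q q' → proj₁ q < proj₁ q') (sortPt s)
sortPt-sorted [] u = []
sortPt-sorted (p ∷ s) (a ∷ u) = go (sortPt s) (sortPt-sorted s u)
    (Permₚ.All-resp-↭ (↭-sym (sortPt-↭ s)) (Allₚ.map⁻ a))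
  where
  go : ∀ t → AllPairs (λ q q' → proj₁ q < proj₁ q') t → All (λ q → proj₁ p ≢ proj₁ q) t →
    AllPairs (λ q q' → proj₁ q < proj₁ q') (insPt p t)
  go [] i n = [] ∷ []
  go (q ∷ t) (b ∷ i) (n ∷ ns) with proj₁ p <? proj₁ q
  ... | yes l = (l ∷ All.map (<-trans l) b) ∷ b ∷ i
  ... | no ¬l = Permₚ.All-resp-↭ (↭-sym (insPt-↭ p t)) (≤∧≢⇒< (≮⇒≥ ¬l) (n ∘ sym) ∷ b) ∷ go t i ns

RSᵖ-P : ∀ L → proj₁ (RSᵖ L) ≡ proj₁ (RSʷ (map proj₂ L))
RSᵖ-P L = go L (pts 0 (map proj₂ L)) (sym (pts-values 0 (map proj₂ L))) [] []  []
  where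
  go : ∀ L L' → map proj₂ L ≡ map proj₂ L' → ∀ P Q Q' →
    proj₁ (foldl RSstepᵖ (P , Q) L) ≡ proj₁ (foldl RSstepᵖ (P , Q') L')
  go [] [] e P Q Q' = refl
  go ((t , x) ∷ L) ((t' , y) ∷ L') e P Q Q' with ∷-injectiveˡ e
  ... | refl = go L L' (∷-injectiveʳ e) (insert x P) _ _

-- The filling of Y with reading word `w` increases along rows and down columns. Position p of the
-- word, counted from 0, is the box with label p + 1.
Increasing : Skew → List ℕ → Set
Increasing Y w = ∀ {p q x y} → Con Y (suc p) (suc q) → atM w p ≡ just x → atM w q ≡ just y → x < y

-- Q(w) is P of the inverse word, so its shape and lattice property follow from those of P.
module Recording (w : List ℕ) (u : Unique w) where

  s : List (ℕ × ℕ)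
  s = sortPt (map swapᵖ (pts 0 w))

  s-↭ : s ↭ map swapᵖ (pts 0 w)
  s-↭ = sortPt-↭ _

  swap-values : map proj₁ (map swapᵖ (pts 0 w)) ≡ w
  swap-values = trans (sym (map-∘ (pts 0 w))) (pts-values 0 w)

  swap-times : map proj₂ (map swapᵖ (pts 0 w)) ≡ range 1 (suc (length w))
  swap-times = trans (sym (map-∘ (pts 0 w))) (pts-times 0 w)

  s-sorted : AllPairs (λ q q' → proj₁ q < proj₁ q') s
  s-sorted = sortPt-sorted _ (subst Unique (sym swap-values) u)

  inv : List ℕ
  inv = map proj₂ s

  inv-↭ : inv ↭ range 1 (suc (length w))
  inv-↭ = subst (inv ↭_) swap-times (Permₚ.map⁺ proj₂ s-↭)

  inv-unique : Unique inv
  inv-unique = Unique-↭ (↭-sym inv-↭) (Unique-range 1 (suc (length w)))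

  Q≡ : proj₂ (RSʷ w) ≡ proj₁ (RSʷ inv)
  Q≡ = trans (cong proj₂ (RSᵖ-sym (pts 0 w) s (pts-sorted 0 w) s-sorted
      (↭-trans (subst (pts 0 w ↭_) (sym (trans (sym (map-∘ (pts 0 w))) (map-id (pts 0 w)))) ↭-refl)
        (Permₚ.map⁺ swapᵖ (↭-sym s-↭)))))
    (RSᵖ-P s)

  Q-SS : SS (proj₂ (RSʷ w))
  Q-SS = subst SS (sym Q≡) (RSw.P-SS inv)

  module _ {Y : Skew} (cY : Convex Y) (n≡ : length w ≡ nCells Y) where

    inv-labels : All (IsLab Y) inv
    inv-labels = All.tabulate λ m → case ∈-range⁻ {1} {suc (length w)} (Permₚ.∈-resp-↭ inv-↭ m) of λ { (a , b) →
      case cell-of-label {Y} a (subst (_ ≤_) n≡ (s≤s⁻¹ b)) of λ { (c , c∈ , e) → c , c∈ , sym e } }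

    Inc⇒Lat : Increasing Y w → Lat Y inv
    Inc⇒Lat h {p} {q} c = bef s s-sorted (mem (lab' c)) (mem (lab'' c)) (h (subst₂ (Con Y) (proj₁ (proj₂ (lab' c))) (proj₁ (proj₂ (lab'' c))) c)
        (proj₂ (proj₂ (proj₂ (lab' c)))) (proj₂ (proj₂ (proj₂ (lab'' c)))))
      where
      info : ∀ {l d} → d ∈ₛ Y → l ≡ lab Y d → ∃[ i ] l ≡ suc i × ∃[ x ] atM w i ≡ just x
      info {l} {d} m refl with lab Y d in e | lab-range m
      ... | suc i | a , b = i , refl , atM-< w (subst (i <_) (sym n≡) b)
      lab' : ∀ {p q} → Con Y p q → ∃[ i ] p ≡ suc i × ∃[ x ] atM w i ≡ just x
      lab' (rowC m n _) = info m refl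
      lab' (colC m n) = info m refl
      lab'' : ∀ {p q} → Con Y p q → ∃[ i ] q ≡ suc i × ∃[ x ] atM w i ≡ just x
      lab'' (rowC m n _) = info n refl
      lab'' (colC m n) = info n refl
      mem : ∀ {l} (z : ∃[ i ] l ≡ suc i × ∃[ x ] atM w i ≡ just x) → (proj₁ (proj₂ (proj₂ z)) , l) ∈ s
      mem (i , refl , x , e) = Permₚ.∈-resp-↭ (↭-sym s-↭) (∈-map⁺ swapᵖ (∈-pts⁺ 0 w i e))
      bef : ∀ s → AllPairs (λ q q' → proj₁ q < proj₁ q') s → ∀ {x y p q} → (x , p) ∈ s → (y , q) ∈ s → x < y → Bef p q (map proj₂ s)
      bef (_ ∷ s) (a ∷ i) (here refl) (here refl) l = ⊥-elim (<-irrefl refl l)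
      bef (_ ∷ s) (a ∷ i) (here refl) (there n) l = now (∈-map⁺ proj₂ n)
      bef (_ ∷ s) (a ∷ i) (there m) (here refl) l = ⊥-elim (<-asym l (All.lookup a m))
      bef (_ ∷ s) (a ∷ i) (there m) (there n) l = later (bef s i m n l)

    Lat⇒Inc : Lat Y inv → Increasing Y w
    Lat⇒Inc h c e e' = lt s s-sorted inv-unique (mem e) (mem e') (h c)
      where
      mem : ∀ {i x} → atM w i ≡ just x → (x , suc i) ∈ s
      mem {i} e = Permₚ.∈-resp-↭ (↭-sym s-↭) (∈-map⁺ swapᵖ (∈-pts⁺ 0 w i e))
      lt : ∀ s → AllPairs (λ q q' → proj₁ q < proj₁ q') s → Unique (map proj₂ s) →
        ∀ {x y p q} → (x , p) ∈ s → (y , q) ∈ s → Bef p q (map proj₂ s) → x < y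
      lt (_ ∷ s) (a ∷ i) u (here refl) (here refl) b = ⊥-elim (Bef-asym u b b)
      lt (_ ∷ s) (a ∷ i) u (here refl) (there n) b = All.lookup a n
      lt (_ ∷ s) (a ∷ i) u (there m) (here refl) (now k) = ⊥-elim (Unique-head∉ u k)
      lt (_ ∷ s) (a ∷ i) u (there m) (here refl) (later b) = ⊥-elim (Unique-head∉ u (Bef-∈ʳ b))
      lt (_ ∷ s) (a ∷ i) u (there m) (there n) (now k) = ⊥-elim (Unique-head∉ u (∈-map⁺ proj₂ m))
      lt (_ ∷ s) (a ∷ i) (_ ∷ u) (there m) (there n) (later b) = lt s i u m n b

    γ : List ℕ
    γ = shapeOf (proj₂ (RSʷ w))

    Q-unique : Unique (concat (proj₂ (RSʷ w)))
    Q-unique = Unique-↭ (↭-sym (RSw.Q-entries w)) (Unique-range 1 (suc (length w)))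

    Q-labels : concat (proj₂ (RSʷ w)) ↭ range 1 (suc (nCells Y))
    Q-labels = subst (λ n → concat (proj₂ (RSʷ w)) ↭ range 1 (suc n)) n≡ (RSw.Q-entries w)

    Inc⇒Q : Increasing Y w → ∃[ p ] tab {γ /ₛ []} {Y} p ≡ concat (rowsOf (proj₂ (RSʷ w)))
    Inc⇒Q h = Standard.Lat⇒pict Q-SS Q-unique cY Q-labels
      (subst (λ z → Lat Y (colread z)) (sym Q≡) (proj₁ (Lat-RSʷ cY inv-unique inv-labels) (Inc⇒Lat h)))

    Q⇒Inc : (p : Pict (γ /ₛ []) Y) → tab p ≡ concat (rowsOf (proj₂ (RSʷ w))) → Increasing Y w
    Q⇒Inc p e = Lat⇒Inc (proj₂ (Lat-RSʷ cY inv-unique inv-labels)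
      (subst (λ z → Lat Y (colread z)) Q≡ (Standard.pict⇒Lat Q-SS Q-unique cY Q-labels p e)))

-- Pictures as words

atM-inj : ∀ {c : List ℕ} {i i' x} → Unique c → atM c i ≡ just x → atM c i' ≡ just x → i ≡ i'
atM-inj {y ∷ c} {zero} {zero} u p q = refl
atM-inj {y ∷ c} {zero} {suc i'} u refl q = ⊥-elim (Unique-head∉ u (atM-∈ {xs = c} {i'} q))
atM-inj {y ∷ c} {suc i} {zero} u p refl = ⊥-elim (Unique-head∉ u (atM-∈ {xs = c} {i} p))
atM-inj {y ∷ c} {suc i} {suc i'} (_ ∷ u) p q = cong suc (atM-inj u p q)

index : ℕ → List ℕ → ℕ
index l [] = 0
index l (x ∷ w) with x ≟ l
... | yes _ = 0
... | no _  = suc (index l w)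

atM-index : ∀ {l w} → l ∈ w → atM w (index l w) ≡ just l
atM-index {l} {x ∷ w} m with x ≟ l
... | yes refl = refl
atM-index {l} {x ∷ w} (here refl) | no n = ⊥-elim (n refl)
atM-index {l} {x ∷ w} (there m)   | no n = atM-index m

Bef-atM⁻ : ∀ {p q w} → Unique w → Bef p q w → ∀ {i i'} → atM w i ≡ just p → atM w i' ≡ just q → i < i'
Bef-atM⁻ u b e e' with Bef-column⁻ b
... | j , j' , h , h' , l = subst₂ _<_ (atM-inj u h e) (atM-inj u h' e') l

lab-suc∸ : ∀ {Y c} → c ∈ₛ Y → suc (lab Y c ∸ 1) ≡ lab Y c
lab-suc∸ m = m+[n∸m]≡n (proj₁ (lab-range m))

lab∸< : ∀ {Y c} → c ∈ₛ Y → lab Y c ∸ 1 < nCells Y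
lab∸< {Y} m = subst (_≤ nCells Y) (sym (lab-suc∸ m)) (proj₂ (lab-range m))

label-pos : ∀ {Y i} → i < nCells Y → ∃[ c ] c ∈ₛ Y × lab Y c ∸ 1 ≡ i
label-pos {Y} h with cell-of-label {Y} (s≤s z≤n) h
... | c , m , e = c , m , cong (_∸ 1) e

lab-ext : ∀ {X} {u v : List ℕ} → length u ≡ nCells X → length v ≡ nCells X →
  (∀ {c} → c ∈ₛ X → atM u (lab X c ∸ 1) ≡ atM v (lab X c ∸ 1)) → u ≡ v
lab-ext {X} {u} {v} p q h = atM-ext u v λ i → case i <? nCells X of λ
  { (yes l) → case label-pos {X} l of λ { (c , c∈ , refl) → h c∈ }
  ; (no l) → trans (atM-≥ u (subst (_≤ i) (sym p) (≮⇒≥ l))) (sym (atM-≥ v (subst (_≤ i) (sym q) (≮⇒≥ l)))) }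

lab∸-≺ : ∀ {Y c c'} → c ∈ₛ Y → c' ∈ₛ Y → c ≺ c' → lab Y c ∸ 1 < lab Y c' ∸ 1
lab∸-≺ {Y} m m' p = s≤s⁻¹ (subst₂ _<_ (sym (lab-suc∸ {Y} m)) (sym (lab-suc∸ {Y} m')) (lab-mono m m' p))

word : ∀ {Y X} → Pict Y X → List ℕ
word {Y} {X} p = applyUpTo (λ i → lab X (Pict.f p (cellOf Y (suc i)))) (nCells Y)

module Word {Y X : Skew} (cY : Convex Y) (cX : Convex X) (p : Pict Y X) where
  open Pict p

  w : List ℕ
  w = word p

  w-length : length w ≡ nCells Y
  w-length = length-applyUpTo _ (nCells Y)

  w-at : ∀ {c} → c ∈ₛ Y → atM w (lab Y c ∸ 1) ≡ just (lab X (f c))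
  w-at {c} m = trans (atM-applyUpTo _ (nCells Y) (lab∸< m))
    (cong (λ l → just (lab X (f l))) (trans (cong (cellOf Y) (lab-suc∸ m)) (cellOf-lab m)))

  w-↭ : w ↭ range 1 (suc (nCells X))
  w-↭ = subst (_↭ range 1 (suc (nCells X))) (map-applyUpTo (λ i → cellOf Y (suc i)) (λ c → lab X (f c)) (nCells Y))
    (↭-trans (Permₚ.map⁺ (λ c → lab X (f c)) (cellOf-↭ Y)) (tab-↭ p))

  w-unique : Unique w
  w-unique = Unique-↭ (↭-sym w-↭) (Unique-range 1 (suc (nCells X)))

  w-increasing : Increasing Y w
  w-increasing c e e' = go c refl refl e e'
    where
    open Strong cY cX p
    val : ∀ {p c x} → c ∈ₛ Y → lab Y c ≡ suc p → atM w p ≡ just x → x ≡ lab X (f c)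
    val {p} m q e = just-injective (trans (sym e) (trans (cong (λ l → atM w (l ∸ 1)) (sym q)) (w-at m)))
    go : ∀ {a b p q x y} → Con Y a b → a ≡ suc p → b ≡ suc q → atM w p ≡ just x → atM w q ≡ just y → x < y
    go (rowC m n l) a b e e' = subst₂ _<_ (sym (val m a e)) (sym (val n b e')) (lab-mono (f∈ m) (f∈ n) (rights l m n))
    go (colC m n) a b e e' = subst₂ _<_ (sym (val m a e)) (sym (val n b e')) (lab-mono (f∈ m) (f∈ n) (f↓ m n))

  w-lattice : Lat X w
  w-lattice = go
    where
    open Strong cX cY (flip p)
    at-g : ∀ {d} → d ∈ₛ X → atM w (lab Y (g d) ∸ 1) ≡ just (lab X d)
    at-g m = trans (w-at (g∈ m)) (cong (just ∘ lab X) (fg m))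
    go : Lat X w
    go (rowC m n l) = Bef-column⁺ _ _ (at-g m) (at-g n) (lab∸-≺ (g∈ m) (g∈ n) (rights l m n))
    go (colC m n) = Bef-column⁺ _ _ (at-g m) (at-g n) (lab∸-≺ (g∈ m) (g∈ n) (g↓ m n))

word-inj : ∀ {Y X} (cY : Convex Y) (cX : Convex X) (p q : Pict Y X) → word p ≡ word q → ∀ {c} → c ∈ₛ Y → Pict.f p c ≡ Pict.f q c
word-inj cY cX p q e m = lab-inj (Pict.f∈ p m) (Pict.f∈ q m) (just-injective
  (trans (sym (Word.w-at cY cX p m)) (trans (cong (λ w → atM w _) e) (Word.w-at cY cX q m))))

word-cong : ∀ {Y X} (p q : Pict Y X) → (∀ {c} → c ∈ₛ Y → Pict.f p c ≡ Pict.f q c) → word p ≡ word q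
word-cong {Y} {X} p q h = applyUpTo-cong (nCells Y) λ i< → cong (lab X) (h (proj₁ (cellOf-∈ {Y} (s≤s z≤n) i<)))

-- Together with `Word` this identifies pictures Y → X with the permutations that are lattice for X
-- and increasing for Y. By `Lat-RSʷ` the first property depends on the insertion tableau only, and
-- by `Recording` the second on the recording tableau only; hence a picture splits into two.
module FromWord {Y X : Skew} (cY : Convex Y) (cX : Convex X) (w : List ℕ) (len : length w ≡ nCells Y)
  (w-↭ : w ↭ range 1 (suc (nCells X))) (lat : Lat X w) (inc : Increasing Y w) where

  private
    u : Unique w
    u = Unique-↭ (↭-sym w-↭) (Unique-range 1 (suc (nCells X)))
    v : Cell → ℕ
    v c = fromMaybe 0 (atM w (lab Y c ∸ 1))
    f g : Cell → Cell
    f c = cellOf X (v c)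
    g d = cellOf Y (suc (index (lab X d) w))
    at-v : ∀ {c} → c ∈ₛ Y → atM w (lab Y c ∸ 1) ≡ just (v c)
    at-v {c} m with atM w (lab Y c ∸ 1) | atM-< w (subst (lab Y c ∸ 1 <_) (sym len) (lab∸< m))
    ... | just x | _ = refl
    ... | nothing | _ , ()
    v-range : ∀ {c} → c ∈ₛ Y → 1 ≤ v c × v c ≤ nCells X
    v-range {c} m with ∈-range⁻ {1} {suc (nCells X)} (Permₚ.∈-resp-↭ w-↭ (atM-∈ {xs = w} {lab Y c ∸ 1} (at-v m)))
    ... | a , b = a , s≤s⁻¹ b
    f∈ : ∀ {c} → c ∈ₛ Y → f c ∈ₛ X
    f∈ m = proj₁ (cellOf-∈ {X} (proj₁ (v-range m)) (proj₂ (v-range m)))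
    lab-f : ∀ {c} → c ∈ₛ Y → lab X (f c) ≡ v c
    lab-f m = proj₂ (cellOf-∈ {X} (proj₁ (v-range m)) (proj₂ (v-range m)))
    at-i : ∀ {d} → d ∈ₛ X → atM w (index (lab X d) w) ≡ just (lab X d)
    at-i m = atM-index (Permₚ.∈-resp-↭ (↭-sym w-↭) (∈-range⁺ (proj₁ (lab-range m)) (s≤s (proj₂ (lab-range m)))))
    i< : ∀ {d} → d ∈ₛ X → index (lab X d) w < nCells Y
    i< m = subst (_ <_) len (atM-just w (at-i m))
    g∈ : ∀ {d} → d ∈ₛ X → g d ∈ₛ Y
    g∈ m = proj₁ (cellOf-∈ {Y} (s≤s z≤n) (i< m))
    lab-g : ∀ {d} → d ∈ₛ X → lab Y (g d) ≡ suc (index (lab X d) w)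
    lab-g m = proj₂ (cellOf-∈ {Y} (s≤s z≤n) (i< m))
    gf : ∀ {c} → c ∈ₛ Y → g (f c) ≡ c
    gf {c} m = lab-inj (g∈ (f∈ m)) m (trans (lab-g (f∈ m)) (trans (cong suc
      (atM-inj u (at-i (f∈ m)) (trans (at-v m) (cong just (sym (lab-f m)))))) (lab-suc∸ m)))
    v-g : ∀ {d} → d ∈ₛ X → v (g d) ≡ lab X d
    v-g {d} m = cong (fromMaybe 0) (trans (cong (λ l → atM w (l ∸ 1)) (lab-g m)) (at-i m))
    order : ∀ {d e} → d ∈ₛ X → e ∈ₛ X → Con X (lab X d) (lab X e) → g d ≺ g e
    order m n c = lab-≺ (g∈ m) (g∈ n) (subst₂ _<_ (sym (lab-g m)) (sym (lab-g n))
      (s≤s (Bef-atM⁻ u (lat c) (at-i m) (at-i n))))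
    incr : ∀ {c d} → c ∈ₛ Y → d ∈ₛ Y → Con Y (lab Y c) (lab Y d) → f c ≺ f d
    incr {c} {d} m n k = lab-≺ (f∈ m) (f∈ n) (subst₂ _<_ (sym (lab-f m)) (sym (lab-f n))
      (inc (subst₂ (Con Y) (sym (lab-suc∸ m)) (sym (lab-suc∸ n)) k) (at-v m) (at-v n)))

  pict : Pict Y X
  pict = record { f = f ; g = g ; f∈ = f∈ ; g∈ = g∈ ; gf = gf
    ; fg = λ m → trans (cong (cellOf X) (v-g m)) (cellOf-lab m)
    ; f→ = λ a b → incr a b (rowC a b ≤-refl) ; f↓ = λ a b → incr a b (colC a b)
    ; g→ = λ a b → order a b (rowC a b ≤-refl) ; g↓ = λ a b → order a b (colC a b) }

  pict-word : word pict ≡ w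
  pict-word = lab-ext {Y} (Word.w-length cY cX pict) len λ m →
    trans (Word.w-at cY cX pict m) (trans (cong just (lab-f m)) (sym (at-v m)))

-- p corresponds to the pair (e , t) of tableaux of shape γ.
record RSrel {Y X : Skew} (p : Pict Y X) (γ : List ℕ) (e t : Filling) : Set where
  constructor rs
  field
    shape≡ : shapeOf (proj₁ (RSʷ (word p))) ≡ γ
    insertion≡ : concat (rowsOf (proj₁ (RSʷ (word p)))) ≡ e
    recording≡ : concat (rowsOf (proj₂ (RSʷ (word p)))) ≡ t

RS-same : ∀ {w w'} →
  shapeOf (proj₁ (RSʷ w)) ≡ shapeOf (proj₁ (RSʷ w')) →
  concat (rowsOf (proj₁ (RSʷ w))) ≡ concat (rowsOf (proj₁ (RSʷ w'))) →
  concat (rowsOf (proj₂ (RSʷ w))) ≡ concat (rowsOf (proj₂ (RSʷ w'))) → w ≡ w'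
RS-same {w} {w'} a b c = RSʷ-inj w w' (cong₂ _,_ (OK-fill-inj (okP w) (okP w') a b)
    (OK-fill-inj (okQ w) (okQ w') (trans (sh w) (trans a (sym (sh w')))) c))
  where
  okP : ∀ w → OK (proj₁ (RSʷ w))
  okP w = SS-Shape (RSw.P-SS w)
  okQ : ∀ w → OK (proj₂ (RSʷ w))
  okQ w = subst Shape (RSw.same-shape w) (okP w)
  sh : ∀ w → shapeOf (proj₂ (RSʷ w)) ≡ shapeOf (proj₁ (RSʷ w))
  sh w = shape⇒shapeOf (okQ w) (okP w) (sym (RSw.same-shape w))

pictCols : ∀ {γ Z} → IsPart γ → Pict (γ /ₛ []) Z → Cols
pictCols {γ} {Z} γP z = colsOf γ (λ c → lab Z (Pict.f z c)) γP

pictCols-SS : ∀ {γ Z} (γP : IsPart γ) (z : Pict (γ /ₛ []) Z) → SS (pictCols γP z)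
pictCols-SS {γ} γP z = colsOf-SS γ _ γP (λ a b → <⇒≤ (Std.F→ (pict-Std z) a b)) (Std.F↓ (pict-Std z))

pictCols-↭ : ∀ {γ Z} (γP : IsPart γ) (z : Pict (γ /ₛ []) Z) → concat (pictCols γP z) ↭ range 1 (suc (nCells Z))
pictCols-↭ {γ} {Z} γP z = ↭-trans (↭-sym (rowsOf-↭ (colsOf-OK γ _ γP)))
  (subst (_↭ range 1 (suc (nCells Z))) (sym (colsOf-fill γ (λ c → lab Z (Pict.f z c)) γP)) (tab-↭ z))

module RSPict {Y X : Skew} (cY : Convex Y) (cX : Convex X) where

  module Fwd (p : Pict Y X) where
    open Word cY cX p
    open Recording w w-unique using (Q-SS; Inc⇒Q)
    P Q : Cols
    P = proj₁ (RSʷ w)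
    Q = proj₂ (RSʷ w)
    P-SS : SS P
    P-SS = RSw.P-SS w
    P-unique : Unique (concat P)
    P-unique = Unique-↭ (↭-sym (RSw.P-entries w)) w-unique
    γ : List ℕ
    γ = shapeOf P
    γ-part : IsPart γ
    γ-part = shapeOf-isPart (SS-Shape P-SS)
    γ-size : size γ ≡ nCells Y
    γ-size = trans (size-shapeOf (SS-Shape P-SS)) (trans (Permₚ.↭-length (RSw.P-entries w)) w-length)
    P-pict : ∃[ q ] tab {γ /ₛ []} {X} q ≡ concat (rowsOf P)
    P-pict = Standard.Lat⇒pict P-SS P-unique cX (↭-trans (RSw.P-entries w) w-↭)
      (proj₁ (Lat-RSʷ cX w-unique labels') w-lattice)
      where
      labels' : All (IsLab X) w
      labels' = All.tabulate λ m → case ∈-range⁻ {1} {suc (nCells X)} (Permₚ.∈-resp-↭ w-↭ m) of λ { (a , b) →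
        case cell-of-label {X} a (s≤s⁻¹ b) of λ { (c , c∈ , e) → c , c∈ , sym e } }
    Q-pict : ∃[ q ] tab {γ /ₛ []} {Y} q ≡ concat (rowsOf Q)
    Q-pict = subst (λ g → ∃[ q ] tab {g /ₛ []} {Y} q ≡ concat (rowsOf Q))
      (shape⇒shapeOf (SS-Shape Q-SS) (SS-Shape P-SS) (sym (RSw.same-shape w))) (Inc⇒Q cY w-length w-increasing)
    rel : RSrel p γ (tab (proj₁ P-pict)) (tab (proj₁ Q-pict))
    rel = rs refl (sym (proj₂ P-pict)) (sym (proj₂ Q-pict))

  RS-bwd : ∀ {γ} → IsPart γ → (q : Pict (γ /ₛ []) X) (r : Pict (γ /ₛ []) Y) → ∃[ p ] RSrel {Y} {X} p γ (tab q) (tab r)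
  RS-bwd {γ} γP q r = pict , rs (trans (cong (shapeOf ∘ proj₁) w-RS) (colsOf-shape γ FP γP))
      (trans (cong (concat ∘ rowsOf ∘ proj₁) w-RS) (colsOf-fill γ FP γP))
      (trans (cong (concat ∘ rowsOf ∘ proj₂) w-RS) (colsOf-fill γ FQ γP))
    where
    FP FQ : Cell → ℕ
    FP c = lab X (Pict.f q c)
    FQ c = lab Y (Pict.f r c)
    P Q : Cols
    P = colsOf γ FP γP
    Q = colsOf γ FQ γP
    sP = pictCols-SS γP q
    sQ = pictCols-SS γP r
    same : shapeOf P ≡ shapeOf Q
    same = trans (colsOf-shape γ FP γP) (sym (colsOf-shape γ FQ γP))
    found = RSʷ-sur (nCells Y) P Q sP sQ (shapeOf⇒shape (SS-Shape sP) (SS-Shape sQ) same) (pictCols-↭ γP r)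
    w = proj₁ found
    RS≡ : RSʷ w ≡ (P , Q)
    RS≡ = proj₁ (proj₂ found)
    len : length w ≡ nCells Y
    len = proj₂ (proj₂ found)
    wP : w ↭ range 1 (suc (nCells X))
    wP = ↭-trans (↭-sym (RSw.P-entries w)) (subst (λ z → concat z ↭ _) (sym (cong proj₁ RS≡)) (pictCols-↭ γP q))
    uw : Unique w
    uw = Unique-↭ (↭-sym wP) (Unique-range 1 (suc (nCells X)))
    labs : All (IsLab X) w
    labs = All.tabulate λ m → case ∈-range⁻ {1} {suc (nCells X)} (Permₚ.∈-resp-↭ wP m) of λ { (a , b) →
      case cell-of-label {X} a (s≤s⁻¹ b) of λ { (c , c∈ , e) → c , c∈ , sym e } }
    -- The shape of `C` equals γ only propositionally, so the picture has to be moved before the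
    -- results on tableaux apply to it.
    transport : ∀ {Z} {C : Cols} (z : Pict (γ /ₛ []) Z) → shapeOf C ≡ γ → tab z ≡ concat (rowsOf C) →
      Σ (Pict (shapeOf C /ₛ []) Z) λ z' → tab z' ≡ concat (rowsOf C)
    transport z refl e = z , e
    lat : Lat X w
    lat = proj₂ (Lat-RSʷ cX uw labs) (subst (λ z → Lat X (colread z)) (sym (cong proj₁ RS≡))
      (let z , e = transport {C = P} q (colsOf-shape γ FP γP) (sym (colsOf-fill γ FP γP)) in
        Standard.pict⇒Lat sP (Unique-↭ (↭-sym (pictCols-↭ γP q)) (Unique-range 1 (suc (nCells X)))) cX (pictCols-↭ γP q) z e))
    inc : Increasing Y w
    inc = let z , e = transport {C = proj₂ (RSʷ w)} r (trans (cong (shapeOf ∘ proj₂) RS≡) (colsOf-shape γ FQ γP))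
                (sym (trans (cong (concat ∘ rowsOf ∘ proj₂) RS≡) (colsOf-fill γ FQ γP))) in
      Recording.Q⇒Inc w uw cY len z e
    open FromWord cY cX w len wP lat inc
    w-RS : RSʷ (word pict) ≡ (P , Q)
    w-RS = trans (cong RSʷ pict-word) RS≡

  RS-inj : ∀ {γ e t} (p q : Pict Y X) → RSrel p γ e t → RSrel q γ e t → ∀ {c} → c ∈ₛ Y → Pict.f p c ≡ Pict.f q c
  RS-inj p q (rs a b c) (rs a' b' c') = word-inj cY cX p q
    (RS-same (trans a (sym a')) (trans b (sym b')) (trans c (sym c')))

-- The shape obtained by placing λ₂ above and to the right of λ₁/α₁

at-++ˡ : ∀ (xs ys : List ℕ) {i} → i < length xs → at (xs ++ ys) i ≡ at xs i
at-++ˡ (x ∷ xs) ys {zero}  _ = refl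
at-++ˡ (x ∷ xs) ys {suc i} h = at-++ˡ xs ys (s≤s⁻¹ h)

at-++ʳ : ∀ (xs ys : List ℕ) i → at (xs ++ ys) (length xs + i) ≡ at ys i
at-++ʳ []       ys i = refl
at-++ʳ (x ∷ xs) ys i = at-++ʳ xs ys i

at-map+ : ∀ b xs {i} → i < length xs → at (map (λ a → a + b) xs) i ≡ at xs i + b
at-map+ b (x ∷ xs) {zero}  _ = refl
at-map+ b (x ∷ xs) {suc i} h = at-map+ b xs (s≤s⁻¹ h)

at-replicate : ∀ m b {i} → i < m → at (replicate m b) i ≡ b
at-replicate (suc m) b {zero}  _ = refl
at-replicate (suc m) b {suc i} h = at-replicate m b (s≤s⁻¹ h)

Star : List ℕ → List ℕ → List ℕ → Skew
Star λ₂ λ₁ α₁ = (map (λ a → a + firstRow λ₁) λ₂ ++ λ₁) /ₛ (replicate (length λ₂) (firstRow λ₁) ++ α₁)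

star≡Star : ∀ β α₂ → star β α₂ ≡ Star α₂ β []
star≡Star β α₂ = cong ((map (λ a → a + firstRow β) α₂ ++ β) /ₛ_) (sym (++-identityʳ (replicate (length α₂) (firstRow β))))

module StarShape (λ₂ λ₁ α₁ : List ℕ) where

  m b : ℕ
  m = length λ₂
  b = firstRow λ₁

  X L H : Skew
  X = Star λ₂ λ₁ α₁
  H = λ₂ /ₛ []
  L = λ₁ /ₛ α₁

  hi lo hi⁻ lo⁻ : Cell → Cell
  hi (i , j) = i , j + b
  lo (i , j) = m + i , j
  hi⁻ (i , j) = i , j ∸ b
  lo⁻ (i , j) = i ∸ m , j

  hi⁻hi : ∀ c → hi⁻ (hi c) ≡ c
  hi⁻hi (i , j) = cong (i ,_) (m+n∸n≡m j b)

  lo⁻lo : ∀ c → lo⁻ (lo c) ≡ c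
  lo⁻lo (i , j) = cong (_, j) (m+n∸m≡n m i)

  outer-hi : ∀ {i} → i < m → at (outer X) i ≡ at λ₂ i + b
  outer-hi h = trans (at-++ˡ (map (λ a → a + b) λ₂) λ₁ (subst (_ <_) (sym (length-map (λ a → a + b) λ₂)) h)) (at-map+ b λ₂ h)

  inner-hi : ∀ {i} → i < m → at (inner X) i ≡ b
  inner-hi h = trans (at-++ˡ (replicate m b) α₁ (subst (_ <_) (sym (length-replicate m)) h)) (at-replicate m b h)

  outer-lo : ∀ i → at (outer X) (m + i) ≡ at λ₁ i
  outer-lo i = trans (cong (λ k → at (outer X) (k + i)) (sym (length-map (λ a → a + b) λ₂))) (at-++ʳ (map (λ a → a + b) λ₂) λ₁ i)

  inner-lo : ∀ i → at (inner X) (m + i) ≡ at α₁ i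
  inner-lo i = trans (cong (λ k → at (inner X) (k + i)) (sym (length-replicate m))) (at-++ʳ (replicate m b) α₁ i)

  hi< : ∀ {c} → c ∈ₛ H → proj₁ c < m
  hi< m∈ = at-<length λ₂ (<outer m∈)

  hi∈ : ∀ {c} → c ∈ₛ H → hi c ∈ₛ X
  hi∈ {i , j} m∈ = ins (subst (_≤ j + b) (sym (inner-hi (hi< m∈))) (m≤n+m b j))
    (subst (j + b <_) (sym (outer-hi (hi< m∈))) (+-monoˡ-< b (<outer m∈)))

  lo∈ : ∀ {c} → c ∈ₛ L → lo c ∈ₛ X
  lo∈ {i , j} (ins p q) = ins (subst (_≤ j) (sym (inner-lo i)) p) (subst (j <_) (sym (outer-lo i)) q)

  data View : Cell → Set where
    isHi : ∀ {c} → c ∈ₛ H → View (hi c)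
    isLo : ∀ {c} → c ∈ₛ L → View (lo c)

  view : ∀ {c} → c ∈ₛ X → View c
  view {i , j} (ins p q) with i <? m
  ... | yes h = subst (λ k → View (i , k)) (m∸n+n≡m b≤)
      (isHi {i , j ∸ b} (ins z≤n (+-cancelʳ-< b _ _ (subst₂ _<_ (sym (m∸n+n≡m b≤)) (outer-hi h) q))))
    where
    b≤ : b ≤ j
    b≤ = subst (_≤ j) (inner-hi h) p
  ... | no h = subst (λ k → View (k , j)) i≡
      (isLo {i ∸ m , j} (ins (subst (_≤ j) (trans (cong (at (inner X)) (sym i≡)) (inner-lo (i ∸ m))) p)
        (subst (j <_) (trans (cong (at (outer X)) (sym i≡)) (outer-lo (i ∸ m))) q)))
    where
    i≡ : m + (i ∸ m) ≡ i
    i≡ = m+[n∸m]≡n (≮⇒≥ h)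

  lo-row≥ : ∀ c → m ≤ proj₁ (lo c)
  lo-row≥ (i , j) = m≤m+n m i

  hi∈⁻ : ∀ {c} → proj₁ c < m → hi c ∈ₛ X → c ∈ₛ H
  hi∈⁻ {i , j} h (ins p q) = ins z≤n (+-cancelʳ-< b _ _ (subst (j + b <_) (outer-hi h) q))

  lo∈⁻ : ∀ {c} → lo c ∈ₛ X → c ∈ₛ L
  lo∈⁻ {i , j} (ins p q) = ins (subst (_≤ j) (inner-lo i) p) (subst (j <_) (outer-lo i) q)

  hi≢lo : ∀ {c d} → c ∈ₛ H → hi c ≢ lo d
  hi≢lo {c} {d} p e = <⇒≱ (hi< p) (subst (λ z → m ≤ proj₁ z) (sym e) (lo-row≥ d))

  hi≺lo : ∀ {c d} → c ∈ₛ H → hi c ≺ lo d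
  hi≺lo {c} {d} p = above (<-≤-trans (hi< p) (lo-row≥ d))

  hi-≺ : ∀ {c d} → c ≺ d → hi c ≺ hi d
  hi-≺ (above p) = above p
  hi-≺ (right p) = right (+-monoˡ-< b p)

  hi-≺⁻ : ∀ {c d} → hi c ≺ hi d → c ≺ d
  hi-≺⁻ h with ≺⇒ h
  ... | inj₁ p = above p
  ... | inj₂ (refl , p) = right (+-cancelʳ-< b _ _ p)

  lo-≺ : ∀ {c d} → c ≺ d → lo c ≺ lo d
  lo-≺ (above p) = above (+-monoʳ-< m p)
  lo-≺ (right p) = right p

  lo-≺⁻ : ∀ {c d} → lo c ≺ lo d → c ≺ d
  lo-≺⁻ h with ≺⇒ h
  ... | inj₁ p = above (+-cancelˡ-< m _ _ p)
  ... | inj₂ (e , p) = ⇒≺ (inj₂ (+-cancelˡ-≡ m _ _ e , p))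

  rowLen-hi : ∀ {i} → i < m → rowLen X i ≡ at λ₂ i
  rowLen-hi h = trans (cong₂ _∸_ (outer-hi h) (inner-hi h)) (m+n∸n≡m _ b)

  rowLen-lo : ∀ i → rowLen X (m + i) ≡ rowLen L i
  rowLen-lo i = cong₂ _∸_ (outer-lo i) (inner-lo i)

  lab-hi-star : ∀ {c} → c ∈ₛ H → lab X (hi c) ≡ lab H c
  lab-hi-star {i , j} m∈ = cong₂ _+_ (psum-cong i λ k → trans (rowLen-hi (<-trans k (hi< m∈))) refl)
    (trans (cong (_∸ (j + b)) (outer-hi (hi< m∈))) (trans (cong₂ _∸_ (+-comm (at λ₂ i) b) (+-comm j b)) ([m+n]∸[m+o]≡n∸o b (at λ₂ i) j)))

  cellOf-hi : ∀ {c l} → c ∈ₛ H → lab H c ≡ l → cellOf X l ≡ hi c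
  cellOf-hi {c} m∈ refl = trans (cong (cellOf X) (sym (lab-hi-star m∈))) (cellOf-lab (hi∈ {c} m∈))

  psum-lo : ∀ k → psum (rowLen X) (m + k) ≡ size λ₂ + psum (rowLen L) k
  psum-lo k = trans (psum-split (rowLen X) m k) (cong₂ _+_
    (trans (psum-cong m rowLen-hi) (sym (size-psum λ₂))) (psum-cong k λ {i} _ → rowLen-lo i))

  -- The upper part comes first in `rl`: it has the labels up to |λ₂|, and those of the lower part
  -- are shifted by |λ₂|. This is where k and k + m in the definition of Ũ come from.
  lab-lo-star : ∀ c → lab X (lo c) ≡ size λ₂ + lab L c
  lab-lo-star (i , j) = trans (cong₂ _+_ (psum-lo i) (cong (_∸ j) (outer-lo i))) (+-assoc (size λ₂) _ _)

  cellOf-lo : ∀ {c l} → c ∈ₛ L → lab L c ≡ l → cellOf X (size λ₂ + l) ≡ lo c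
  cellOf-lo {c} m∈ refl = trans (cong (cellOf X) (sym (lab-lo-star c))) (cellOf-lab (lo∈ {c} m∈))

  nCells-star : nCells X ≡ size λ₂ + nCells L
  nCells-star = trans (nCells-psum X) (trans (cong (psum (rowLen X)) len) (trans (psum-lo (length λ₁)) (cong (size λ₂ +_) (sym (nCells-psum L)))))
    where
    len : length (outer X) ≡ m + length λ₁
    len = trans (length-++ (map (λ a → a + b) λ₂)) (cong (_+ length λ₁) (length-map (λ a → a + b) λ₂))

  data →View : ℕ → ℕ → Set where
    hi→ : ∀ {i j} → (i , j) ∈ₛ H → (i , suc j) ∈ₛ H → →View i (j + b)
    lo→ : ∀ {i j} → (i , j) ∈ₛ L → (i , suc j) ∈ₛ L → →View (m + i) j

  view→ : ∀ {i j} → (i , j) ∈ₛ X → (i , suc j) ∈ₛ X → →View i j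
  view→ p q with view p
  ... | isHi {i , j} h = hi→ h (hi∈⁻ (hi< h) q)
  ... | isLo l = lo→ l (lo∈⁻ q)

  module _ (P₂ : IsPart λ₂) (P₁ : IsPart λ₁) (Pα : IsPart α₁) (α⊆λ : ∀ i → at α₁ i ≤ at λ₁ i) where

    data ↓View : ℕ → ℕ → Set where
      hi↓ : ∀ {i j} → (i , j) ∈ₛ H → (suc i , j) ∈ₛ H → ↓View i (j + b)
      lo↓ : ∀ {i j} → (i , j) ∈ₛ L → (suc i , j) ∈ₛ L → ↓View (m + i) j

    private
      lo-col< : ∀ {i j} → (i , j) ∈ₛ L → j < b
      lo-col< (ins _ q) = <-≤-trans q (Decr-≤ (proj₁ P₁) z≤n)

    -- The two parts have no column in common: the lower one lies to the left of column b, the upper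
    -- one begins there. So a vertical step stays within one part.
    view↓ : ∀ {i j} → (i , j) ∈ₛ X → (suc i , j) ∈ₛ X → ↓View i j
    view↓ p q with view p
    ... | isLo {i , j} l = lo↓ l (lo∈⁻ (subst (λ k → (k , j) ∈ₛ X) (sym (+-suc m i)) q))
    ... | isHi {i , j} h with suc i <? m
    ...   | yes l = hi↓ h (hi∈⁻ l q)
    ...   | no ¬l = ⊥-elim (m+n≮n j b (lo-col< (lo∈⁻ {suc i ∸ m , j + b}
              (subst (λ k → (k , j + b) ∈ₛ X) (sym (m+[n∸m]≡n (≮⇒≥ ¬l))) q))))

    convex-star : Convex X
    convex-star = (λ i → glue (at (outer X)) outer-hi outer-lo (λ k → +-monoˡ-≤ b (proj₁ P₂ k)) (m≤n+m b _) (proj₁ P₁) i)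
      , λ i → glue (at (inner X)) {u = λ _ → b} inner-hi inner-lo (λ _ → ≤-refl) ≤-refl' (proj₁ Pα) i
      where
      ≤-refl' : at α₁ 0 ≤ b
      ≤-refl' = α⊆λ 0
      glue : ∀ (F : ℕ → ℕ) {u v : ℕ → ℕ} → (∀ {i} → i < m → F i ≡ u i) → (∀ i → F (m + i) ≡ v i) →
        Decr u → (∀ {i} → v 0 ≤ u i) → Decr v → Decr F
      glue F hu hv du j dv i with <-cmp (suc i) m
      ... | tri< l _ _ = subst₂ _≤_ (sym (hu l)) (sym (hu (<-trans (n<1+n i) l))) (du i)
      ... | tri≈ _ e _ = subst₂ _≤_ (sym (trans (cong F (trans e (sym (+-identityʳ m)))) (hv 0)))
                            (sym (hu (≤-reflexive e))) j
      ... | tri> _ _ g = subst₂ (λ x y → F x ≤ F y) (trans (+-suc m (i ∸ m)) (cong suc i≡)) i≡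
                            (subst₂ _≤_ (sym (hv (suc (i ∸ m)))) (sym (hv (i ∸ m))) (dv (i ∸ m)))
        where
        i≡ : m + (i ∸ m) ≡ i
        i≡ = m+[n∸m]≡n (s≤s⁻¹ g)

-- The tableau Ũ

sum-take : ∀ i xs → sumℕ (take i xs) ≡ psum (at xs) i
sum-take zero    xs       = refl
sum-take (suc i) []       = sym (psum-tail0 (at []) 0 {suc i} z≤n (λ _ → refl))
sum-take (suc i) (x ∷ xs) = trans (cong (x +_) (sum-take i xs)) (sym (psum-cons (at (x ∷ xs)) i))

entryU : List ℕ → List ℕ → Filling → Cell → ℕ
entryU γ λ₂ u (i , j) = if j <ᵇ at λ₂ i then suc (sumℕ (take i λ₂) + j)
  else size λ₂ + fromMaybe 0 (entryAt (γ /ₛ λ₂) u (i , j))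

Utilde-fill : ∀ γ λ₂ u → Utilde γ λ₂ u ≡ fill (γ /ₛ []) (entryU γ λ₂ u)
Utilde-fill γ λ₂ u = map-cong-∈ (cells (γ /ₛ [])) λ { {i , j} _ → refl }

if-yes : ∀ {A : Set} {b} {x y : A} → T b → (if b then x else y) ≡ x
if-yes {b = true} _ = refl

if-no : ∀ {A : Set} {b} {x y : A} → ¬ T b → (if b then x else y) ≡ y
if-no {b = true}  n = ⊥-elim (n tt)
if-no {b = false} _ = refl

entryU-in : ∀ {γ λ₂ u i j} → j < at λ₂ i → entryU γ λ₂ u (i , j) ≡ suc (psum (at λ₂) i + j)
entryU-in {λ₂ = λ₂} {i = i} {j} h = trans (if-yes (<⇒<ᵇ h)) (cong (λ z → suc (z + j)) (sum-take i λ₂))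

entryU-out : ∀ {γ λ₂ u i j} → ¬ (j < at λ₂ i) →
  entryU γ λ₂ u (i , j) ≡ size λ₂ + fromMaybe 0 (entryAt (γ /ₛ λ₂) u (i , j))
entryU-out h = if-no (h ∘ <ᵇ⇒< _ _)

mirror : ℕ → ℕ → ℕ
mirror n j = n ∸ suc j

mirror< : ∀ {n j} → j < n → mirror n j < n
mirror< {suc n} {j} h = s≤s (m∸n≤m n j)

mirror² : ∀ {n j} → j < n → mirror n (mirror n j) ≡ j
mirror² {suc n} {j} h = m∸[m∸n]≡n (s≤s⁻¹ h)

module Tilde (λ₂ λ₁ α₁ γ : List ℕ) (P₂ : IsPart λ₂) (P₁ : IsPart λ₁) (Pα : IsPart α₁) (Pγ : IsPart γ)
  (α⊆λ : ∀ i → at α₁ i ≤ at λ₁ i) where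

  open StarShape λ₂ λ₁ α₁

  G S : Skew
  G = γ /ₛ []
  S = γ /ₛ λ₂

  cX : Convex X
  cX = convex-star P₂ P₁ Pα α⊆λ

  -- Ũ numbers the rows of λ₂ from left to right and `rl` from right to left, so the canonical
  -- picture of λ₂ reverses each row.
  flipRow : Cell → Cell
  flipRow (i , j) = i , mirror (at λ₂ i) j

  flipRow∈ : ∀ {c} → c ∈ₛ H → flipRow c ∈ₛ H
  flipRow∈ (ins _ q) = ins z≤n (mirror< q)

  flipRow² : ∀ {c} → c ∈ₛ H → flipRow (flipRow c) ≡ c
  flipRow² {i , j} (ins _ q) = cong (i ,_) (mirror² q)

  -- q is canonical on λ₂ and equal to p elsewhere.
  record Extends (q : Pict G X) (p : Pict S L) : Set where
    field
      on-λ : ∀ {c} → c ∈ₛ H → c ∈ₛ G × Pict.f q c ≡ hi (flipRow c)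
      off-λ : ∀ {c} → c ∈ₛ S → Pict.f q c ≡ lo (Pict.f p c)

  S⊆G : ∀ {c} → c ∈ₛ S → c ∈ₛ G
  S⊆G (ins _ q) = ins z≤n q

  split : ∀ {c} → c ∈ₛ G → c ∈ₛ H ⊎ c ∈ₛ S
  split {i , j} (ins _ q) with j <? at λ₂ i
  ... | yes h = inj₁ (ins z≤n h)
  ... | no ¬h = inj₂ (ins (≮⇒≥ ¬h) q)

  H∉S : ∀ {c} → c ∈ₛ H → ¬ (c ∈ₛ S)
  H∉S (ins _ q) (ins p _) = <⇒≱ q p

  extends-tab : ∀ {q p} → Extends q p → tab q ≡ Utilde γ λ₂ (tab p)
  extends-tab {q} {p} e = trans (fill-cong {G} pointwise) (sym (Utilde-fill γ λ₂ (tab p)))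
    where
    open Extends e
    pointwise : ∀ {c} → c ∈ₛ G → lab X (Pict.f q c) ≡ entryU γ λ₂ (tab p) c
    pointwise {i , j} m∈ with split m∈
    ... | inj₁ h = trans (cong (lab X) (proj₂ (on-λ h))) (trans (lab-hi-star (flipRow∈ h))
        (trans (cong (psum (rowLen H) i +_) flip-col) (trans (+-suc _ j) (sym (entryU-in {γ} {λ₂} {tab p} {i} (<outer h))))))
      where
      flip-col : at λ₂ i ∸ mirror (at λ₂ i) j ≡ suc j
      flip-col = m∸[m∸n]≡n (<outer h)
    ... | inj₂ s = trans (cong (lab X) (off-λ s)) (trans (lab-lo-star (Pict.f p (i , j)))
        (trans (cong (λ z → size λ₂ + fromMaybe 0 z) (sym (entry-fill _ s)))
          (sym (entryU-out {γ} {λ₂} {tab p} {i} {j} (≤⇒≯ (inner≤ s))))))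

  Utilde-inj : ∀ {p p' : Pict S L} → Utilde γ λ₂ (tab p) ≡ Utilde γ λ₂ (tab p') → tab p ≡ tab p'
  Utilde-inj {p} {p'} e = fill-cong {S} λ { {i , j} s → +-cancelˡ-≡ (size λ₂) _ _
    (trans (sym (at-S p s)) (trans (fill-inj {G} (trans (sym (Utilde-fill γ λ₂ (tab p))) (trans e (Utilde-fill γ λ₂ (tab p')))) (S⊆G s)) (at-S p' s))) }
    where
    at-S : ∀ (p : Pict S L) {c} → c ∈ₛ S → entryU γ λ₂ (tab p) c ≡ size λ₂ + lab L (Pict.f p c)
    at-S p {i , j} s = trans (entryU-out {γ} {λ₂} {tab p} {i} {j} (≤⇒≯ (inner≤ s)))
      (cong (λ z → size λ₂ + fromMaybe 0 z) (entry-fill _ s))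

  module Extend (λ⊆γ : ∀ i → at λ₂ i ≤ at γ i) (p : Pict S L) where
    module p = Pict p

    H⊆G : ∀ {c} → c ∈ₛ H → c ∈ₛ G
    H⊆G (ins _ q) = ins z≤n (<-≤-trans q (λ⊆γ _))

    f g : Cell → Cell
    f (i , j) = if j <ᵇ at λ₂ i then hi (flipRow (i , j)) else lo (p.f (i , j))
    g c = if proj₁ c <ᵇ m then flipRow (hi⁻ c) else p.g (lo⁻ c)

    f-H : ∀ {c} → c ∈ₛ H → f c ≡ hi (flipRow c)
    f-H h = if-yes (<⇒<ᵇ (<outer h))

    f-S : ∀ {c} → c ∈ₛ S → f c ≡ lo (p.f c)
    f-S {i , j} s = if-no λ t → <⇒≱ (<ᵇ⇒< j (at λ₂ i) t) (inner≤ s)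

    g-hi : ∀ {c} → c ∈ₛ H → g (hi c) ≡ flipRow c
    g-hi {c} h = trans (if-yes (<⇒<ᵇ (hi< h))) (cong flipRow (hi⁻hi c))

    g-lo : ∀ {c} → c ∈ₛ L → g (lo c) ≡ p.g c
    g-lo {c} l = trans (if-no λ t → <⇒≱ (<ᵇ⇒< _ m t) (lo-row≥ c)) (cong p.g (lo⁻lo c))

    q : Pict G X
    q = record
      { f = f ; g = g
      ; f∈ = λ m∈ → case split m∈ of λ
          { (inj₁ h) → subst (_∈ₛ X) (sym (f-H h)) (hi∈ (flipRow∈ h))
          ; (inj₂ s) → subst (_∈ₛ X) (sym (f-S s)) (lo∈ (p.f∈ s)) }
      ; g∈ = λ m∈ → case view m∈ of λ
          { (isHi h) → subst (_∈ₛ G) (sym (g-hi h)) (H⊆G (flipRow∈ h))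
          ; (isLo l) → subst (_∈ₛ G) (sym (g-lo l)) (S⊆G (p.g∈ l)) }
      ; gf = λ m∈ → case split m∈ of λ
          { (inj₁ h) → trans (cong g (f-H h)) (trans (g-hi (flipRow∈ h)) (flipRow² h))
          ; (inj₂ s) → trans (cong g (f-S s)) (trans (g-lo (p.f∈ s)) (p.gf s)) }
      ; fg = λ m∈ → case view m∈ of λ
          { (isHi h) → trans (cong f (g-hi h)) (trans (f-H (flipRow∈ h)) (cong hi (flipRow² h)))
          ; (isLo l) → trans (cong f (g-lo l)) (trans (f-S (p.g∈ l)) (cong lo (p.fg l))) }
      ; f→ = λ a b → step a b (λ h h' → hi-≺ (right (∸-monoʳ-< ≤-refl (<outer h')))) p.f→ (λ h → in-left (n≤1+n _) h)
      ; f↓ = λ a b → step a b (λ h h' → hi-≺ (above ≤-refl)) p.f↓ (in-up P₂ (n≤1+n _))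
      ; g→ = λ a b → g-right (view→ a b)
      ; g↓ = λ a b → g-down (view↓ P₂ P₁ Pα α⊆λ a b) }
      where
      step : ∀ {c d} → c ∈ₛ G → d ∈ₛ G → (c ∈ₛ H → d ∈ₛ H → hi (flipRow c) ≺ hi (flipRow d)) →
        (c ∈ₛ S → d ∈ₛ S → p.f c ≺ p.f d) → (d ∈ₛ H → c ∈ₛ H) → f c ≺ f d
      step a b hh ss dh with split a | split b
      ... | inj₁ h | inj₁ h' = subst₂ _≺_ (sym (f-H h)) (sym (f-H h')) (hh h h')
      ... | inj₁ h | inj₂ s = subst₂ _≺_ (sym (f-H h)) (sym (f-S s)) (hi≺lo (flipRow∈ h))
      ... | inj₂ s | inj₁ h = ⊥-elim (H∉S (dh h) s)
      ... | inj₂ s | inj₂ s' = subst₂ _≺_ (sym (f-S s)) (sym (f-S s')) (lo-≺ (ss s s'))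
      g-right : ∀ {i j} → →View i j → g (i , j) ≺ g (i , suc j)
      g-right (hi→ h h') = subst₂ _≺_ (sym (g-hi h)) (sym (g-hi h')) (right (∸-monoʳ-< ≤-refl (<outer h')))
      g-right (lo→ l l') = subst₂ _≺_ (sym (g-lo l)) (sym (g-lo l')) (p.g→ l l')
      g-down : ∀ {i j} → ↓View P₂ P₁ Pα α⊆λ i j → g (i , j) ≺ g (suc i , j)
      g-down (hi↓ h h') = subst₂ _≺_ (sym (g-hi h)) (sym (g-hi h')) (above ≤-refl)
      g-down (lo↓ {i} {j} l l') = subst₂ _≺_ (sym (g-lo l))
        (sym (trans (cong (λ k → g (k , j)) (sym (+-suc m i))) (g-lo l'))) (p.g↓ l l')

    extends : Extends q p
    extends = record { on-λ = λ h → H⊆G h , f-H h ; off-λ = f-S }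

  -- A picture γ → X preserves the rows of λ₂, since neither direction can decrease the row.
  module Restrict (q : Pict G X) where
    open Pict q
    module F = Strong (straight-convex Pγ) cX q
    module B = Strong cX (straight-convex Pγ) (flip q)

    row-f : ∀ i j → (i , j) ∈ₛ G → i ≤ proj₁ (f (i , j))
    row-f zero    j _  = z≤n
    row-f (suc i) j m∈ = ≤-<-trans (row-f i j m') (proj₁ (B.g-down j m' m∈ (suc j) ≤-refl))
      where m' = in-up Pγ (n≤1+n i) m∈

    row-g : ∀ i j → (i , j) ∈ₛ H → i ≤ proj₁ (g (hi (i , j)))
    row-g zero    j _ = z≤n
    row-g (suc i) j h = ≤-<-trans (row-g i j h') (proj₁ (F.g-down (j + b) (hi∈ h') (hi∈ h) (suc (j + b)) ≤-refl))
      where h' = in-up P₂ (n≤1+n i) h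

    row≡ : ∀ {i j} → (i , j) ∈ₛ H → proj₁ (g (hi (i , j))) ≡ i
    row≡ {i} {j} h = ≤-antisym (subst (λ z → proj₁ (g (hi (i , j))) ≤ proj₁ z) (fg (hi∈ h)) (row-f _ _ (g∈ (hi∈ h)))) (row-g i j h)

    col-g : ∀ i t j → j + suc t ≡ at λ₂ i → (i , j) ∈ₛ H → t ≤ proj₂ (g (hi (i , j)))
    col-g i zero    j e h = z≤n
    col-g i (suc t) j e h = ≤-<-trans (col-g i t (suc j) e' h') (proj₂ (F.g-right (hi∈ h) (hi∈ h')))
      where
      e' = trans (sym (+-suc j (suc t))) e
      h' : (i , suc j) ∈ₛ H
      h' = ins z≤n (subst (suc j <_) e' (m<m+n (suc j) {suc t} (s≤s z≤n)))

    col-f : ∀ {i} y → (i , y) ∈ₛ G → proj₁ (f (i , y)) ≡ i → i < m → proj₂ (f (i , y)) + y < at λ₂ i + b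
    col-f {i} zero m∈ e i< = subst₂ _<_ (sym (+-identityʳ _)) (trans (cong (at (outer X)) e) (outer-hi i<)) (<outer (f∈ m∈))
    col-f {i} (suc y) m∈ e i< with B.g-right (in-left (n≤1+n y) m∈) m∈
    ... | u , v = ≤-<-trans (subst (_≤ proj₂ (f (i , y)) + y) (sym (+-suc _ y)) (+-monoˡ-≤ y v))
        (col-f y (in-left (n≤1+n y) m∈) (≤-antisym (≤-trans u (≤-reflexive e)) (row-f i y (in-left (n≤1+n y) m∈))) i<)

    -- Rows are preserved by `row≡`, and within a row a step right becomes a step left. The bound
    -- from below counts the boxes of λ₂ to the right of (i , j), whose images lie further left; the
    -- bound from above counts the boxes to the left of the image, which `f` sends further right.
    canon : ∀ {i j} → (i , j) ∈ₛ H → g (hi (i , j)) ≡ flipRow (i , j)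
    canon {i} {j} h = cong₂ _,_ (row≡ h) (≤-antisym upper
        (col-g i (mirror (at λ₂ i) j) j (trans (+-suc j _) (m+[n∸m]≡n (<outer h))) h))
      where
      y = proj₂ (g (hi (i , j)))
      gy : g (hi (i , j)) ≡ (i , y)
      gy = cong (_, y) (row≡ h)
      f-y : f (i , y) ≡ hi (i , j)
      f-y = trans (cong f (sym gy)) (fg (hi∈ h))
      bound : j + b + y < at λ₂ i + b
      bound = subst (λ z → proj₂ z + y < at λ₂ i + b) f-y
        (col-f y (subst (_∈ₛ G) gy (g∈ (hi∈ h))) (cong proj₁ f-y) (hi< h))
      upper : y ≤ mirror (at λ₂ i) j
      upper = m+n≤o⇒m≤o∸n y (subst (_≤ at λ₂ i) (+-comm (suc j) y) (+-cancelʳ-≤ b _ _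
        (subst (λ z → suc z ≤ at λ₂ i + b) (trans (+-assoc j b y) (trans (cong (j +_) (+-comm b y)) (sym (+-assoc j y b)))) bound)))

    on-λ : ∀ {c} → c ∈ₛ H → c ∈ₛ G × f c ≡ hi (flipRow c)
    on-λ {c} h = subst (_∈ₛ G) e (g∈ (hi∈ (flipRow∈ h))) , trans (cong f (sym e)) (fg (hi∈ (flipRow∈ h)))
      where
      e : g (hi (flipRow c)) ≡ c
      e = trans (canon (flipRow∈ h)) (flipRow² h)

    λ⊆γ : ∀ i → at λ₂ i ≤ at γ i
    λ⊆γ i = ≤-from-< λ h → <outer (proj₁ (on-λ {i , _} (ins z≤n h)))

    f-S : ∀ {c} → c ∈ₛ S → lo⁻ (f c) ∈ₛ L × f c ≡ lo (lo⁻ (f c))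
    f-S {c} s with f c in e | f∈ (S⊆G s)
    ... | d | d∈ with view d∈
    ...   | isLo {d} l = subst (_∈ₛ L) (sym (lo⁻lo d)) l , cong lo (sym (lo⁻lo d))
    ...   | isHi {d} h = ⊥-elim (H∉S (subst (_∈ₛ H) (trans (sym (canon h)) (trans (cong g (sym e)) (gf (S⊆G s)))) (flipRow∈ h)) s)

    g-L : ∀ {d} → d ∈ₛ L → g (lo d) ∈ₛ S
    g-L {d} l with split (g∈ (lo∈ l))
    ... | inj₂ s = s
    ... | inj₁ h = ⊥-elim (hi≢lo (flipRow∈ h) (trans (sym (proj₂ (on-λ h))) (fg (lo∈ l))))

    p : Pict S L
    p = record
      { f = lo⁻ ∘ f ; g = g ∘ lo
      ; f∈ = λ s → proj₁ (f-S s) ; g∈ = g-L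
      ; gf = λ s → trans (cong g (sym (proj₂ (f-S s)))) (gf (S⊆G s))
      ; fg = λ {d} l → trans (cong lo⁻ (fg (lo∈ l))) (lo⁻lo d)
      ; f→ = λ a a' → lo-≺⁻ (subst₂ _≺_ (proj₂ (f-S a)) (proj₂ (f-S a')) (f→ (S⊆G a) (S⊆G a')))
      ; f↓ = λ a a' → lo-≺⁻ (subst₂ _≺_ (proj₂ (f-S a)) (proj₂ (f-S a')) (f↓ (S⊆G a) (S⊆G a')))
      ; g→ = λ a a' → g→ (lo∈ a) (lo∈ a')
      ; g↓ = λ {i} {j} a a' → subst (λ k → g (m + i , j) ≺ g (k , j)) (sym (+-suc m i))
          (g↓ (lo∈ a) (subst (λ k → (k , j) ∈ₛ X) (+-suc m i) (lo∈ a'))) }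

    extends : Extends q p
    extends = record { on-λ = on-λ ; off-λ = λ s → proj₂ (f-S s) }

-- Truncated tableaux

insertAll : Cols → List ℕ → Cols
insertAll = foldl (λ P x → insert x P)

RSʷ-insertAll : ∀ w → proj₁ (RSʷ w) ≡ insertAll [] w
RSʷ-insertAll w = go (pts 0 w) w (pts-values 0 w) [] []
  where
  go : ∀ L w → map proj₂ L ≡ w → ∀ P Q → proj₁ (foldl RSstepᵖ (P , Q) L) ≡ insertAll P w
  go [] .[] refl P Q = refl
  go ((t , x) ∷ L) .(x ∷ map proj₂ L) refl P Q = go L (map proj₂ L) refl (insert x P) _

insertAll-SS : ∀ {P} w → SS P → SS (insertAll P w)
insertAll-SS [] s = s
insertAll-SS {P} (x ∷ w) s = insertAll-SS w (Ins-SS (insert-Ins x P) s)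

tl : Cols → Cols
tl [] = []
tl (_ ∷ cs) = cs

col : ℕ → Cols → List ℕ
col zero    cs = hd cs
col (suc t) cs = col t (tl cs)

ent-col : ∀ cs i j → ent cs (i , j) ≡ atM (col j cs) i
ent-col [] i zero = refl
ent-col [] i (suc j) = ent-col [] i j
ent-col (c ∷ cs) i zero = refl
ent-col (c ∷ cs) i (suc j) = ent-col cs i j

SS-tl : ∀ {cs} → SS cs → SS (tl cs)
SS-tl [] = []
SS-tl (cons _ _ _ s) = s

SS-hd : ∀ {cs} → SS cs → Inc (hd cs)
SS-hd [] = []
SS-hd (cons i _ _ _) = i

SS-⊑ : ∀ {cs} → SS cs → hd cs ⊑ hd (tl cs)
SS-⊑ [] = []
SS-⊑ (cons _ _ r _) = r

SS-col : ∀ {cs} t → SS cs → Inc (col t cs)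
SS-col zero s = SS-hd s
SS-col (suc t) s = SS-col t (SS-tl s)

⊑-at : ∀ {c d} → c ⊑ d → ∀ {i x v} → atM c i ≡ just x → atM d i ≡ just v → x ≤ v
⊑-at (p ∷ _) {zero} refl refl = p
⊑-at (_ ∷ r) {suc i} a b = ⊑-at r {i} a b

data InsStep (x : ℕ) (cs cs' : Cols) : ℕ → Set where
  halt : Bump x (hd cs) (hd cs') nothing → tl cs' ≡ tl cs → InsStep x cs cs' 0
  pass : ∀ {y j} → Bump x (hd cs) (hd cs') (just y) → Ins y (tl cs) (tl cs') j → InsStep x cs cs' (suc j)

insStep : ∀ {x cs cs' j} → Ins x cs cs' j → InsStep x cs cs' j
insStep new = halt end refl
insStep (app b) = halt b refl
insStep (rep b i) = pass b i

-- Boxes where an entry is `sat` form the outer part of a tableau.  The complementary inner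
-- part of P ← x depends only on the inner part of P, since a sat entry that is bumped moves
-- to the right and weakly up, hence stays sat.
module Truncation (sat : ℕ → ℕ → ℕ → Set) (sat? : ∀ v i j → Dec (sat v i j))
  (sat-val : ∀ {v v' i j} → v ≤ v' → sat v i j → sat v' i j)
  (sat-right : ∀ {v i j} → sat v i j → sat v i (suc j))
  (sat-up : ∀ {v i j} → sat v (suc i) j → sat v i j)
  (sat-diag : ∀ {v v' i j} → v < v' → sat v i j → sat v' (suc i) j) where

  sat-ups : ∀ {v i i' j} → i' ≤ i → sat v i j → sat v i' j
  sat-ups {i = zero} z≤n s = s
  sat-ups {i = suc i} h s with m≤n⇒m<n∨m≡n h
  ... | inj₁ l = sat-ups (s≤s⁻¹ l) (sat-up s)
  ... | inj₂ refl = s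

  -- The part of column `j`, read from row i downwards, in front of its first sat entry. In a
  -- strictly increasing column all entries below that one are sat as well, by `sat-diag`.
  ns : ℕ → ℕ → List ℕ → List ℕ
  ns j i [] = []
  ns j i (v ∷ c) with sat? v i j
  ... | yes _ = []
  ... | no _  = v ∷ ns j (suc i) c

  ns-sat : ∀ {j i v} c → sat v i j → ns j i (v ∷ c) ≡ []
  ns-sat {j} {i} {v} c s with sat? v i j
  ... | yes _ = refl
  ... | no n  = ⊥-elim (n s)

  ns-nonsat : ∀ {j i v} c → ¬ sat v i j → ns j i (v ∷ c) ≡ v ∷ ns j (suc i) c
  ns-nonsat {j} {i} {v} c n with sat? v i j
  ... | yes s = ⊥-elim (n s)
  ... | no _  = refl

  sat-below : ∀ {j i v} c → Inc (v ∷ c) → sat v i j → ∀ {k x} → atM (v ∷ c) k ≡ just x → sat x (i + k) j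
  sat-below {j} {i} c _ s {zero} refl = subst (λ z → sat _ z j) (sym (+-identityʳ i)) s
  sat-below {j} {i} (w ∷ c) ((a ∷ _) ∷ I) s {suc k} {x} e =
    subst (λ z → sat x z j) (sym (+-suc i k)) (sat-below c I (sat-diag a s) {k} e)

  ns-at : ∀ {j} i c {k v} → atM (ns j i c) k ≡ just v → atM c k ≡ just v × ¬ sat v (i + k) j
  ns-at {j} i (x ∷ c) e with sat? x i j
  ns-at {j} i (x ∷ c) {zero} refl | no n = refl , λ s → n (subst (λ z → sat x z j) (+-identityʳ i) s)
  ns-at {j} i (x ∷ c) {suc k} {v} e | no n with ns-at (suc i) c {k} e
  ... | a , b = a , λ s → b (subst (λ z → sat v z j) (+-suc i k) s)

  at-ns : ∀ {j} i c → Inc c → ∀ {k v} → atM c k ≡ just v → ¬ sat v (i + k) j → atM (ns j i c) k ≡ just v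
  at-ns {j} i (x ∷ c) I {k} e n with sat? x i j
  ... | yes s = ⊥-elim (n (sat-below c I s {k} e))
  at-ns {j} i (x ∷ c) I {zero} e n | no _ = e
  at-ns {j} i (x ∷ c) (_ ∷ I) {suc k} {v} e n | no _ = at-ns (suc i) c I {k} e (λ s → n (subst (λ z → sat v z j) (sym (+-suc i k)) s))

  Moving : ℕ → ℕ → List ℕ → Maybe ℕ → Set
  Moving j i c m = ∀ {y} → m ≡ just y → ∃[ k ] atM c k ≡ just y × sat y (i + k) j

  stopAt : ℕ → ℕ → ℕ → List ℕ → List ℕ
  stopAt x j i []      = ns j i (x ∷ [])
  stopAt x j i (y ∷ e) = y ∷ stopAt x j (suc i) e

  -- Either the bump happens among the non-sat entries and is visible there, or x exceeds all of
  -- them. In the second case the new non-sat part is `stopAt`, which depends only on x and on the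
  -- old one, and an entry that is bumped is sat.
  ns-Bump : ∀ {x c c' m} j i → Inc c → Bump x c c' m →
    (∃[ y ] m ≡ just y × Bump x (ns j i c) (ns j i c') (just y))
    ⊎ (All (_< x) (ns j i c) × ns j i c' ≡ stopAt x j i (ns j i c) × Moving j i c m)
  ns-Bump j i I end = inj₂ ([] , refl , λ ())
  ns-Bump {x} j i I (hit {y} {c} p) with sat? y i j
  ... | no n = inj₁ (y , refl , subst (λ z → Bump x (y ∷ ns j (suc i) c) z (just y))
                 (sym (ns-nonsat c (n ∘ sat-val p))) (hit p))
  ... | yes s = inj₂ ([] , first , λ { refl → 0 , refl , subst (λ z → sat y z j) (sym (+-identityʳ i)) s })
    where
    tail[] : ∀ c → Inc (y ∷ c) → ns j (suc i) c ≡ []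
    tail[] [] _ = refl
    tail[] (z ∷ c) ((a ∷ _) ∷ _) = ns-sat c (sat-diag a s)
    first : ns j i (x ∷ c) ≡ ns j i (x ∷ [])
    first with sat? x i j
    ... | yes _ = refl
    ... | no _ = cong (x ∷_) (tail[] c I)
  ns-Bump {x} j i (a ∷ I) (skip {y} {c} {c'} q b) with sat? y i j
  ... | yes s = inj₂ ([] , sym (ns-sat [] (sat-val (<⇒≤ q) s)) ,
      λ { {v} refl → let k , e = ∈-atM (Bump-∈ b) in suc k , e , sat-below c (a ∷ I) s {suc k} e })
  ... | no n with ns-Bump j (suc i) I b
  ...   | inj₁ (z , e , b') = inj₁ (z , e , skip q b')
  ...   | inj₂ (l , e , mv) = inj₂ (q ∷ l , cong (y ∷_) e ,
      λ {v} h → let k , e' , s = mv h in suc k , e' , subst (λ z → sat v z j) (sym (+-suc i k)) s)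

  NS : ℕ → Cols → Cols → Set
  NS j cs ds = ∀ t → ns (t + j) 0 (col t cs) ≡ ns (t + j) 0 (col t ds)

  NS-tl : ∀ {j cs ds} → NS j cs ds → NS (suc j) (tl cs) (tl ds)
  NS-tl {j} {cs} {ds} h t = subst (λ k → ns k 0 (col t (tl cs)) ≡ ns k 0 (col t (tl ds))) (sym (+-suc t j)) (h (suc t))

  NS-cons : ∀ {j cs ds} → ns j 0 (hd cs) ≡ ns j 0 (hd ds) → NS (suc j) (tl cs) (tl ds) → NS j cs ds
  NS-cons e h zero = e
  NS-cons {j} {cs} {ds} e h (suc t) = subst (λ k → ns k 0 (col t (tl cs)) ≡ ns k 0 (col t (tl ds))) (+-suc t j) (h t)

  -- The arriving entry z comes from row i (counted from `i₀`) of the column on the left and meets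
  -- there an entry not smaller than itself, so it lands in that row or above, where it is still
  -- sat. The non-sat part of the column stays as it was, and an entry that z bumps is sat in turn.
  ns-moving : ∀ {z c c' m} j i₀ i → Bump z c c' m → Inc c → sat z (i₀ + i) j → (∀ {v} → atM c i ≡ just v → z ≤ v) →
    ns j i₀ c' ≡ ns j i₀ c × Moving j i₀ c m
  ns-moving j i₀ i end I s h = ns-sat [] (sat-ups (m≤m+n i₀ i) s) , λ ()
  ns-moving j i₀ i (hit {y} {c} p) I s h =
    trans (ns-sat c s') (sym (ns-sat c (sat-val p s'))) ,
    λ { refl → 0 , refl , subst (λ k → sat y k j) (sym (+-identityʳ i₀)) (sat-val p s') }
    where s' = sat-ups (m≤m+n i₀ i) s
  ns-moving j i₀ zero (skip q b) I s h = ⊥-elim (<⇒≱ q (h refl))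
  ns-moving {z} j i₀ (suc i) (skip {y} q b) (_ ∷ I) s h
    with ns-moving j (suc i₀) i b I (subst (λ k → sat z k j) (+-suc i₀ i) s) h
  ... | e , mv = both , λ {v} g → let k , e' , s' = mv g in suc k , e' , subst (λ l → sat v l j) (sym (+-suc i₀ k)) s'
    where
    both : ns j i₀ (y ∷ _) ≡ ns j i₀ (y ∷ _)
    both with sat? y i₀ j
    ... | yes _ = refl
    ... | no _ = cong (y ∷_) e

  NS-moving : ∀ a {z cs cs'} j i → Ins z cs cs' a → SS cs → sat z i j → (∀ {v} → atM (hd cs) i ≡ just v → z ≤ v) → NS j cs' cs
  NS-moving a {z} {cs} {cs'} j i I s st h with insStep I
  ... | halt b e = NS-cons (proj₁ (ns-moving j 0 i b (SS-hd s) st h))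
        (λ t → cong (λ X → ns (t + suc j) 0 (col t X)) e)
  NS-moving (suc a) {z} {cs} {cs'} j i I s st h | pass {y} b I' with ns-moving j 0 i b (SS-hd s) st h
  ... | e , mv with mv refl
  ...   | k , e' , s' = NS-cons e (NS-moving a (suc j) k I' (SS-tl s) (sat-right s') (⊑-at (SS-⊑ s) {k} e'))

  after-moving : ∀ {x cs cs' a} j → Ins x cs cs' a → SS cs →
    (∀ {m} → Bump x (hd cs) (hd cs') m → Moving j 0 (hd cs) m) → NS (suc j) (tl cs') (tl cs)
  after-moving j I s mv with insStep I
  ... | halt b e = λ t → cong (λ X → ns (t + suc j) 0 (col t X)) e
  ... | pass b I' with mv b refl
  ...   | k , e' , s' = NS-moving _ (suc j) k I' (SS-tl s) (sat-right s') (⊑-at (SS-⊑ s) {k} e')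

  stepBump : ∀ {x cs cs' j} → InsStep x cs cs' j → ∃[ m ] Bump x (hd cs) (hd cs') m
  stepBump (halt b _) = _ , b
  stepBump (pass b _) = _ , b

  not-below : ∀ {x e e' y} → Bump x e e' (just y) → All (_< x) e → ⊥
  not-below b a = <⇒≱ (All.lookup a (Bump-∈ b)) (Bump-≤ b)

  -- Insertions of the same letter into tableaux with the same non-sat part run in parallel as long
  -- as the bumps happen inside that part. Once they leave it, only sat entries move, and
  -- `NS-moving` shows that nothing changes there any more.
  NS-Ins : ∀ a {x cs cs' ds ds' b} j → Ins x cs cs' a → Ins x ds ds' b → SS cs → SS ds → NS j cs ds → NS j cs' ds'
  NS-Ins a {x} {cs} {cs'} {ds} {ds'} j I J s t h with stepBump (insStep I) | stepBump (insStep J)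
  ... | m , p | m' , q with ns-Bump j 0 (SS-hd s) p | ns-Bump j 0 (SS-hd t) q
  ...   | inj₁ (_ , _ , u) | inj₂ (l , _) = ⊥-elim (not-below u (subst (All (_< x)) (sym (h 0)) l))
  ...   | inj₂ (l , _) | inj₁ (_ , _ , u) = ⊥-elim (not-below u (subst (All (_< x)) (h 0) l))
  ...   | inj₂ (_ , e , mv) | inj₂ (_ , e' , mv') = NS-cons (trans e (trans (cong (stopAt x j 0) (h 0)) (sym e')))
      λ k → trans (after-moving j I s (λ b → same b p mv) k) (trans (NS-tl {cs = cs} {ds} h k) (sym (after-moving j J t (λ b → same b q mv') k)))
    where
    same : ∀ {c c' m₁ m₂} → Bump x c c' m₁ → Bump x c c' m₂ → Moving j 0 c m₂ → Moving j 0 c m₁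
    same b₁ b₂ mv with Bump-fun b₁ b₂
    ... | _ , refl = mv
  NS-Ins a {x} {cs} {cs'} {ds} {ds'} j I J s t h | m , p | m' , q | inj₁ (y , refl , u) | inj₁ (z , refl , v)
    with Bump-fun u (subst (λ c → Bump x c _ (just z)) (sym (h 0)) v)
  ... | e , refl = NS-cons e (rest a (insStep I) (insStep J))
    where
    rest : ∀ a {b} → InsStep x cs cs' a → InsStep x ds ds' b → NS (suc j) (tl cs') (tl ds')
    rest zero (halt b _) _ = case proj₂ (Bump-fun b p) of λ ()
    rest (suc a) (pass b I') (halt b' _) = case proj₂ (Bump-fun b' q) of λ ()
    rest (suc a) (pass b I') (pass b' J') with Bump-fun b p | Bump-fun b' q
    ... | _ , refl | _ , refl = NS-Ins a (suc j) I' J' (SS-tl s) (SS-tl t) (NS-tl {cs = cs} {ds} h)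

  NS-insertAll : ∀ w {P P'} → SS P → SS P' → NS 0 P P' → NS 0 (insertAll P w) (insertAll P' w)
  NS-insertAll [] s t h = h
  NS-insertAll (x ∷ w) {P} {P'} s t h = NS-insertAll w (Ins-SS (insert-Ins x P) s) (Ins-SS (insert-Ins x P') t)
    (NS-Ins _ 0 (insert-Ins x P) (insert-Ins x P') s t h)

  _⊆ⁿ_ : Cols → Cols → Set
  P ⊆ⁿ P' = ∀ {i j v} → ent P (i , j) ≡ just v → ¬ sat v i j → ent P' (i , j) ≡ just v

  NS⇒⊆ⁿ : ∀ {P P'} → SS P → NS 0 P P' → P ⊆ⁿ P'
  NS⇒⊆ⁿ {P} {P'} s h {i} {j} {v} e n = trans (ent-col P' i j) (proj₁ (ns-at {j + 0} 0 (col j P') {i}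
    (trans (cong (λ c → atM c i) (sym (h j))) (at-ns {j + 0} 0 (col j P) (SS-col j s) {i} (trans (sym (ent-col P i j)) e)
      (λ q → n (subst (sat v i) (+-identityʳ j) q))))))

  ⊆ⁿ⇒NS : ∀ {P P'} → SS P → SS P' → P ⊆ⁿ P' → P' ⊆ⁿ P → NS 0 P P'
  ⊆ⁿ⇒NS {P} {P'} s s' h h' t = atM-ext _ _ λ k → ext k (one s s' h {k}) (one s' s h' {k})
    where
    ext : ∀ k → (∀ {v} → atM (ns (t + 0) 0 (col t P)) k ≡ just v → atM (ns (t + 0) 0 (col t P')) k ≡ just v) →
      (∀ {v} → atM (ns (t + 0) 0 (col t P')) k ≡ just v → atM (ns (t + 0) 0 (col t P)) k ≡ just v) →
      atM (ns (t + 0) 0 (col t P)) k ≡ atM (ns (t + 0) 0 (col t P')) k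
    ext k f g with atM (ns (t + 0) 0 (col t P)) k | atM (ns (t + 0) 0 (col t P')) k
    ... | just v | _ = sym (f refl)
    ... | nothing | just v = g refl
    ... | nothing | nothing = refl
    one : ∀ {P P'} → SS P → SS P' → P ⊆ⁿ P' → ∀ {k v} →
      atM (ns (t + 0) 0 (col t P)) k ≡ just v → atM (ns (t + 0) 0 (col t P')) k ≡ just v
    one {P} {P'} s s' h {k} {v} e with ns-at {t + 0} 0 (col t P) {k} e
    ... | a , n = at-ns {t + 0} 0 (col t P') (SS-col t s') {k}
      (trans (sym (ent-col P' k t)) (h (trans (ent-col P k t) a) (λ q → n (subst (sat v k) (sym (+-identityʳ t)) q)))) n

-- Inserting the reading word of a tableau

addRow : List ℕ → Cols → Cols
addRow []       P        = P
addRow (y ∷ ys) []       = (y ∷ []) ∷ addRow ys []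
addRow (y ∷ ys) (c ∷ cs) = (c ++ y ∷ []) ∷ addRow ys cs

Fits : List ℕ → Cols → Set
Fits ys P = ∀ {i j v y} → ent P (i , j) ≡ just v → atM ys j ≡ just y → v < y

Sorted : List ℕ → Set
Sorted ys = ∀ {j x y} → atM ys j ≡ just x → atM ys (suc j) ≡ just y → x ≤ y

-- When a row is read from right to left, each letter enters at the foot of the first column and
-- shifts the letters read before it one column to the right.
Ins-addRow : ∀ x ys P → Sorted (x ∷ ys) → Fits (x ∷ ys) P → ∃[ j ] Ins x (addRow ys P) (addRow (x ∷ ys) P) j
Ins-addRow x [] [] s f = _ , new
Ins-addRow x [] (c ∷ P) s f = _ , app (Bump-append (All.tabulate λ m → let i , e = ∈-atM m in f {i} {0} e refl))
Ins-addRow x (y ∷ ys) [] s f =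
  let _ , i = Ins-addRow y ys [] (λ {j} → s {suc j}) (λ ()) in _ , rep (hit (s {0} refl refl)) i
Ins-addRow x (y ∷ ys) (c ∷ P) s f =
  let _ , i = Ins-addRow y ys P (λ {j} → s {suc j}) (λ {i} {j} → f {i} {suc j}) in
  _ , rep (replace c (All.tabulate λ m → let i , e = ∈-atM m in f {i} {0} e refl)) i
  where
  replace : ∀ c → All (_< x) c → Bump x (c ++ y ∷ []) (c ++ x ∷ []) (just y)
  replace [] _ = hit (s {0} refl refl)
  replace (z ∷ c) (p ∷ a) = skip p (replace c a)

Fits-tail : ∀ {x} ys P → Sorted (x ∷ ys) → Fits (x ∷ ys) P → Fits ys P
Fits-tail ys P s f {j = j} e e' with atM-< (_ ∷ ys) {j} (<-trans (atM-just ys e') (n<1+n _))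
... | z , ez = <-≤-trans (f {j = j} e ez) (s {j} ez e')

insertAll-++ : ∀ P u v → insertAll P (u ++ v) ≡ insertAll (insertAll P u) v
insertAll-++ P u v = foldl-++ (λ P x → insert x P) P u v

insert-row : ∀ ys P → Sorted ys → Fits ys P → insertAll P (reverse ys) ≡ addRow ys P
insert-row [] P s f = refl
insert-row (x ∷ ys) P s f = begin
    insertAll P (reverse (x ∷ ys))        ≡⟨ cong (insertAll P) (unfold-reverse x ys) ⟩
    insertAll P (reverse ys ++ x ∷ [])    ≡⟨ insertAll-++ P (reverse ys) (x ∷ []) ⟩
    insert x (insertAll P (reverse ys))   ≡⟨ cong (insert x) (insert-row ys P (λ {j} → s {suc j}) (Fits-tail ys P s f)) ⟩
    insert x (addRow ys P)                ≡⟨ proj₁ (insert-fun (proj₂ (Ins-addRow x ys P s f))) ⟩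
    addRow (x ∷ ys) P                     ∎
  where open ≡-Reasoning

addRow-new : ∀ n ys P → (∀ {j} → j < length ys → at (shape P) j ≡ n) → ∀ j {y} → atM ys j ≡ just y → ent (addRow ys P) (n , j) ≡ just y
addRow-new n (y ∷ ys) [] f zero refl = cong (λ k → atM (y ∷ []) k) (sym (f {0} (s≤s z≤n)))
addRow-new n (y ∷ ys) [] f (suc j) e = addRow-new n ys [] (λ {j} h → f {suc j} (s≤s h)) j e
addRow-new n (y ∷ ys) (c ∷ P) f zero refl = trans (cong (atM (c ++ y ∷ [])) (sym (trans (+-identityʳ _) (f {0} (s≤s z≤n))))) (atM-++ʳ c (y ∷ []) 0)
addRow-new n (y ∷ ys) (c ∷ P) f (suc j) e = addRow-new n ys P (λ {j} h → f {suc j} (s≤s h)) j e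

addRow-old : ∀ ys P i j {v} → ent P (i , j) ≡ just v → ent (addRow ys P) (i , j) ≡ just v
addRow-old [] P i j e = e
addRow-old (y ∷ ys) (c ∷ P) i zero e = trans (atM-++ˡ c (y ∷ []) (atM-just c e)) e
addRow-old (y ∷ ys) (c ∷ P) i (suc j) e = addRow-old ys P i j e

addRow-inv : ∀ n ys P → (∀ {j} → j < length ys → at (shape P) j ≡ n) → ∀ i j {v} → ent (addRow ys P) (i , j) ≡ just v →
  ent P (i , j) ≡ just v ⊎ (i ≡ n × atM ys j ≡ just v)
addRow-inv n [] P f i j e = inj₁ e
addRow-inv n (y ∷ ys) [] f zero zero e = inj₂ (f {0} (s≤s z≤n) , e)
addRow-inv n (y ∷ ys) [] f i (suc j) e with addRow-inv n ys [] (λ {j} h → f {suc j} (s≤s h)) i j e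
... | inj₂ q = inj₂ q
addRow-inv n (y ∷ ys) (c ∷ P) f i zero e with i <? length c
... | yes h = inj₁ (trans (sym (atM-++ˡ c (y ∷ []) h)) e)
... | no h = inj₂ (last (≤-antisym (s≤s⁻¹ (subst (i <_) (length-∷ʳ' c) (atM-just (c ++ y ∷ []) e))) (≮⇒≥ h)))
  where
  last : i ≡ length c → i ≡ n × just y ≡ just _
  last refl = f {0} (s≤s z≤n) , trans (sym (trans (cong (atM (c ++ y ∷ [])) (sym (+-identityʳ _))) (atM-++ʳ c (y ∷ []) 0))) e
addRow-inv n (y ∷ ys) (c ∷ P) f i (suc j) e = addRow-inv n ys P (λ {j} h → f {suc j} (s≤s h)) i j e

applyUpTo-∷ʳ' : ∀ {A : Set} (f : ℕ → A) n → applyUpTo f (suc n) ≡ applyUpTo f n ++ f n ∷ []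
applyUpTo-∷ʳ' f n = sym (applyUpTo-∷ʳ f n)

module ReadTableau (α : List ℕ) (Pα : IsPart α) (V : Cell → ℕ)
  (V-right : ∀ {i j} → (i , suc j) ∈ₛ (α /ₛ []) → V (i , j) ≤ V (i , suc j))
  (V-down : ∀ {i j} → (suc i , j) ∈ₛ (α /ₛ []) → V (i , j) < V (suc i , j)) where

  rowV : ℕ → List ℕ
  rowV i = applyUpTo (λ j → V (i , j)) (at α i)

  reading : ℕ → List ℕ
  reading k = concat (applyUpTo (reverse ∘ rowV) k)

  V-downs : ∀ {i i' j} → i < i' → (i' , j) ∈ₛ (α /ₛ []) → V (i , j) < V (i' , j)
  V-downs {i} {suc i'} l m with m≤n⇒m<n∨m≡n (s≤s⁻¹ l)
  ... | inj₂ refl = V-down m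
  ... | inj₁ l' = <-trans (V-downs l' (in-up Pα (n≤1+n i') m)) (V-down m)

  rowV-at : ∀ i {j v} → atM (rowV i) j ≡ just v → j < at α i × v ≡ V (i , j)
  rowV-at i {j} e = h , just-injective (trans (sym e) (atM-applyUpTo (λ j → V (i , j)) (at α i) h))
    where h = subst (j <_) (length-applyUpTo (λ j → V (i , j)) (at α i)) (atM-just (rowV i) e)

  record Rows (k : ℕ) (P : Cols) : Set where
    field
      sound : ∀ {i j v} → ent P (i , j) ≡ just v → i < k × (i , j) ∈ₛ (α /ₛ []) × v ≡ V (i , j)
      complete : ∀ {i j} → i < k → (i , j) ∈ₛ (α /ₛ []) → ent P (i , j) ≡ just (V (i , j))

  rows-of : ∀ k → Rows k (insertAll [] (reading k))
  rows-of zero = record { sound = λ () ; complete = λ () }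
  rows-of (suc k) = subst (Rows (suc k)) (sym eq) next
    where
    open Rows (rows-of k)
    P : Cols
    P = insertAll [] (reading k)
    sorted : Sorted (rowV k)
    sorted {j} e e' with rowV-at k {j} e | rowV-at k {suc j} e'
    ... | h , refl | h' , refl = V-right (ins z≤n h')
    fits : Fits (rowV k) P
    fits {i} {j} e e' with sound e | rowV-at k {j} e'
    ... | i<k , _ , refl | h , refl = V-downs i<k (ins z≤n h)
    eq : insertAll [] (reading (suc k)) ≡ addRow (rowV k) P
    eq = trans (cong (insertAll []) (trans (cong concat (applyUpTo-∷ʳ' (reverse ∘ rowV) k))
        (trans (sym (concat-++ (applyUpTo (reverse ∘ rowV) k) _)) (cong (reading k ++_) (++-identityʳ _)))))
      (trans (insertAll-++ [] (reading k) (reverse (rowV k))) (insert-row (rowV k) P sorted fits))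
    full : ∀ {j} → j < length (rowV k) → at (shape P) j ≡ k
    full {j} h = ≤-antisym
        (≤-from-< λ l → proj₁ (sound (proj₂ (ent-shape⁻ P l))))
        (≤-from-< λ l → ent-shape⁺ P (complete l (in-up Pα (<⇒≤ l) (ins z≤n h'))))
      where h' = subst (j <_) (length-applyUpTo _ (at α k)) h
    next : Rows (suc k) (addRow (rowV k) P)
    next = record
      { sound = λ {i} {j} e → case addRow-inv k (rowV k) P full i j e of λ
          { (inj₁ q) → let a , b , c = sound q in m<n⇒m<1+n a , b , c
          ; (inj₂ (refl , q)) → let a , b = rowV-at k {j} q in ≤-refl , ins z≤n a , b }
      ; complete = λ {i} {j} l m → case m≤n⇒m<n∨m≡n (s≤s⁻¹ l) of λ
          { (inj₁ l') → addRow-old (rowV k) P i j (complete l' m)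
          ; (inj₂ refl) → addRow-new k (rowV k) P full j (atM-applyUpTo (λ j → V (k , j)) (at α k) (<outer m)) } }

  Tab : Cols
  Tab = insertAll [] (reading (length α))

  T-sound : ∀ {i j v} → ent Tab (i , j) ≡ just v → (i , j) ∈ₛ (α /ₛ []) × v ≡ V (i , j)
  T-sound e = proj₂ (Rows.sound (rows-of (length α)) e)

  T-complete : ∀ {i j} → (i , j) ∈ₛ (α /ₛ []) → ent Tab (i , j) ≡ just (V (i , j))
  T-complete m = Rows.complete (rows-of (length α)) (at-<length α (<outer m)) m

-- The row rule and insertion

-- The row rule r + i - j ≤ a + 1 for the box (i , j) and the row a, without subtraction.
Sat : ℕ → ℕ → ℕ → ℕ → Set
Sat r i j a = r + i ≤ suc a + j

-- The row in which the label l lies, for row lengths f and k rows; weakly monotone in l.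
rowIdx : (ℕ → ℕ) → ℕ → ℕ → ℕ
rowIdx f zero    l = 0
rowIdx f (suc k) l = (if psum f (suc k) <ᵇ l then 1 else 0) + rowIdx f k l

rowIdx-mono : ∀ f k {x y} → x ≤ y → rowIdx f k x ≤ rowIdx f k y
rowIdx-mono f zero    h = z≤n
rowIdx-mono f (suc k) {x} {y} h = +-mono-≤ (step (psum f (suc k))) (rowIdx-mono f k h)
  where
  step : ∀ s → (if s <ᵇ x then 1 else 0) ≤ (if s <ᵇ y then 1 else 0)
  step s with s <ᵇ x in e | s <ᵇ y in e'
  ... | false | _ = z≤n
  ... | true  | true = ≤-refl
  ... | true  | false = ⊥-elim (subst T e' (<⇒<ᵇ (<-≤-trans (<ᵇ⇒< s x (subst T (sym e) tt)) h)))

-- The truncation at `k` makes the statement inductive in the number of rows counted so far.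
rowIdx-⊓ : ∀ f {i l} → psum f i < l → l ≤ psum f (suc i) → ∀ k → rowIdx f k l ≡ i ⊓ k
rowIdx-⊓ f {i} p q zero = sym (⊓-zeroʳ i)
rowIdx-⊓ f {i} {l} p q (suc k) with k <? i
... | yes h = trans (cong₂ _+_ (if-yes {x = 1} {0} (<⇒<ᵇ (≤-<-trans (psum-mono f h) p))) (rowIdx-⊓ f p q k))
      (trans (cong suc (m≥n⇒m⊓n≡n (<⇒≤ h))) (sym (m≥n⇒m⊓n≡n h)))
... | no h = trans (cong₂ _+_ (if-no {b = psum f (suc k) <ᵇ l} {1} {0} (λ t → <⇒≱ (<ᵇ⇒< _ l t) (≤-trans q (psum-mono f (s≤s (≮⇒≥ h))))))
        (rowIdx-⊓ f p q k))
      (trans (m≤n⇒m⊓n≡m (≮⇒≥ h)) (sym (m≤n⇒m⊓n≡m (m≤n⇒m≤1+n (≮⇒≥ h)))))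

rowNo : Skew → ℕ → ℕ
rowNo X = rowIdx (rowLen X) (length (outer X))

rowNo-lab : ∀ {X c} → c ∈ₛ X → rowNo X (lab X c) ≡ proj₁ c
rowNo-lab {X} {i , j} m = trans (rowIdx-⊓ (rowLen X) (lab-lo m) (lab-hi m) (length (outer X)))
  (m≤n⇒m⊓n≡m (<⇒≤ (at-<length (outer X) (<outer m))))

AllPairs-Bef : ∀ {R : ℕ → ℕ → Set} w → (∀ {y x} → Bef y x w → R y x) → AllPairs R w
AllPairs-Bef [] h = []
AllPairs-Bef (x ∷ w) h = All.tabulate (λ m → h (now m)) ∷ AllPairs-Bef w (h ∘ later)

applyUpTo-+ : ∀ {A : Set} (h : ℕ → A) a b → applyUpTo h (a + b) ≡ applyUpTo h a ++ applyUpTo (λ t → h (a + t)) b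
applyUpTo-+ h zero    b = refl
applyUpTo-+ h (suc a) b = cong (h 0 ∷_) (applyUpTo-+ (h ∘ suc) a b)

rowWord : ∀ {Y X} → Pict Y X → List ℕ
rowWord {Y} p = applyUpTo (λ i → proj₁ (Pict.f p (cellOf Y (suc i)))) (nCells Y)

-- Applied to a tableau whose entries are rows of X, with `m` the number of rows of λ₂: then v ∸ m
-- is a row of λ₁/α₁, and the entries below m come from λ₂ and are not constrained.
Barred : ℕ → ℕ → Cols → Set
Barred r m cs = ∀ {i j v} → ent cs (i , j) ≡ just v → m ≤ v → Sat r i j (v ∸ m)

ent-map : ∀ (φ : ℕ → ℕ) cs c → ent (map (map φ) cs) c ≡ Maybe.map φ (ent cs c)
ent-map φ [] c = refl
ent-map φ (c ∷ cs) (i , zero) = atM-map φ c i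
ent-map φ (c ∷ cs) (i , suc j) = ent-map φ cs (i , j)

ent-map⁻ : ∀ (φ : ℕ → ℕ) cs {c v} → ent (map (map φ) cs) c ≡ just v → ∃[ y ] ent cs c ≡ just y × v ≡ φ y
ent-map⁻ φ cs {c} e with ent cs c | trans (sym (ent-map φ cs c)) e
... | just y | q = y , refl , just-injective (sym q)

module _ {Y X : Skew} (cY : Convex Y) (cX : Convex X) (p : Pict Y X) where
  open Pict p
  open Word cY cX p

  rowWord-map : map (rowNo X) (word p) ≡ rowWord p
  rowWord-map = trans (map-applyUpTo _ (rowNo X) (nCells Y))
    (applyUpTo-cong (nCells Y) λ i< → rowNo-lab (f∈ (proj₁ (cellOf-∈ {Y} (s≤s z≤n) i<))))

  -- In a lattice word the labels of one row of X occur from the left box to the right one, that is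
  -- in decreasing order. This is what `RSʷ-φ` asks of the letters merged by `rowNo`.
  rowWord-P : insertAll [] (rowWord p) ≡ map (map (rowNo X)) (proj₁ (RSʷ (word p)))
  rowWord-P = trans (sym (RSʷ-insertAll (rowWord p))) (trans (cong (proj₁ ∘ RSʷ) (sym rowWord-map))
      (cong proj₁ (Relabel.RSʷ-φ (rowNo X) (rowIdx-mono (rowLen X) (length (outer X))) (word p) (AllPairs-Bef (word p) refl'))))
    where
    is-lab : ∀ {y} → y ∈ word p → ∃[ c ] c ∈ₛ X × lab X c ≡ y
    is-lab m with ∈-range⁻ {1} {suc (nCells X)} (Permₚ.∈-resp-↭ w-↭ m)
    ... | a , b = cell-of-label {X} a (s≤s⁻¹ b)
    bad : ∀ {c d} → c ∈ₛ X → d ∈ₛ X → Bef (lab X c) (lab X d) (word p) → proj₁ d ≤ proj₁ c → ¬ (c ≺ d)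
    bad c∈ d∈ b h (above q) = <⇒≱ q h
    bad c∈ d∈ b h (right q) = Bef-asym w-unique b (w-lattice (rowC d∈ c∈ q))
    compare' : ∀ {y x} → ∃[ c ] c ∈ₛ X × lab X c ≡ y → ∃[ d ] d ∈ₛ X × lab X d ≡ x →
      Bef y x (word p) → rowNo X x ≤ rowNo X y → x ≤ y
    compare' (c , c∈ , refl) (d , d∈ , refl) b h = ≮⇒≥ λ l →
      bad c∈ d∈ b (subst₂ _≤_ (rowNo-lab d∈) (rowNo-lab c∈) h) (lab-≺ c∈ d∈ l)
    refl' : ∀ {y x} → Bef y x (word p) → rowNo X x ≤ rowNo X y → x ≤ y
    refl' b h = compare' (is-lab (Bef-∈ˡ b)) (is-lab (Bef-∈ʳ b)) b h

  barred⇒ : ∀ {r m γ} (q : Pict (γ /ₛ []) X) → shapeOf (proj₁ (RSʷ (word p))) ≡ γ →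
    concat (rowsOf (proj₁ (RSʷ (word p)))) ≡ tab q → Barred r m (insertAll [] (rowWord p)) →
    ∀ {i j} → (i , j) ∈ₛ (γ /ₛ []) → m ≤ proj₁ (Pict.f q (i , j)) → Sat r i j (proj₁ (Pict.f q (i , j)) ∸ m)
  barred⇒ {r} {m} q refl e h {i} {j} c∈ = h (trans (cong (λ z → ent z (i , j)) rowWord-P)
    (trans (ent-map (rowNo X) P (i , j)) (trans (cong (Maybe.map (rowNo X)) (trans (ent-value okP c∈) (cong just val)))
      (cong just (rowNo-lab (Pict.f∈ q c∈))))))
    where
    P = proj₁ (RSʷ (word p))
    okP = SS-Shape (RSw.P-SS (word p))
    val : value okP (i , j) ≡ lab X (Pict.f q (i , j))
    val = fill-inj (trans (sym (rowsOf-fill okP)) e) c∈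

  barred⇐ : ∀ {r m γ} (q : Pict (γ /ₛ []) X) → shapeOf (proj₁ (RSʷ (word p))) ≡ γ →
    concat (rowsOf (proj₁ (RSʷ (word p)))) ≡ tab q →
    (∀ {i j} → (i , j) ∈ₛ (γ /ₛ []) → m ≤ proj₁ (Pict.f q (i , j)) → Sat r i j (proj₁ (Pict.f q (i , j)) ∸ m)) →
    Barred r m (insertAll [] (rowWord p))
  barred⇐ {r} {m} q refl e h {i} {j} x =
      let y , eq , v≡ = ent-map⁻ (rowNo X) P (trans (cong (λ z → ent z (i , j)) (sym rowWord-P)) x)
          c∈ = shapeOf-ent okP eq
      in subst (λ v → m ≤ v → Sat r i j (v ∸ m))
           (sym (trans v≡ (trans (cong (rowNo X) (trans (sym (value-ent okP eq)) (entry c∈))) (rowNo-lab (Pict.f∈ q c∈))))) (h c∈)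
    where
    P = proj₁ (RSʷ (word p))
    okP = SS-Shape (RSw.P-SS (word p))
    entry : ∀ {c} → c ∈ₛ (shapeOf P /ₛ []) → value okP c ≡ lab X (Pict.f q c)
    entry = fill-inj (trans (sym (rowsOf-fill okP)) e)

module StarWord (α₂ β : List ℕ) (Pα : IsPart α₂) {X : Skew} (cY : Convex (Star α₂ β [])) (cX : Convex X)
  (p : Pict (Star α₂ β []) X) where

  open StarShape α₂ β [] renaming (X to Y; L to B) hiding (m; b)
  open Pict p
  open Strong cX cY (flip p)

  V : Cell → ℕ
  V c = proj₁ (f (hi c))

  β-word : List ℕ
  β-word = applyUpTo (λ t → proj₁ (f (lo (cellOf B (suc t))))) (nCells B)

  private
    in-H : ∀ {i j} → (i , suc j) ∈ₛ H → (i , j) ∈ₛ H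
    in-H = in-left (n≤1+n _)

  open ReadTableau α₂ Pα V
    (λ h → proj₁ (g-right (hi∈ (in-H h)) (hi∈ h)))
    (λ {i} {j} h → proj₁ (g-down _ (hi∈ (in-up Pα (n≤1+n i) h)) (hi∈ h) _ ≤-refl)) public

  rowWord-split : rowWord p ≡ reading (length α₂) ++ β-word
  rowWord-split = trans (cong (applyUpTo h) nCells-star) (trans (applyUpTo-+ h (size α₂) (nCells B))
      (cong₂ _++_ (trans (cong (applyUpTo h) (size-psum α₂)) (upper (length α₂) ≤-refl))
        (applyUpTo-cong (nCells B) λ {t} t< → cong (proj₁ ∘ f) (β-cell t<))))
    where
    h : ℕ → ℕ
    h i = proj₁ (f (cellOf Y (suc i)))
    β-cell : ∀ {t} → t < nCells B → cellOf Y (suc (size α₂ + t)) ≡ lo (cellOf B (suc t))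
    β-cell {t} t< = trans (cong (cellOf Y) (sym (+-suc (size α₂) t)))
      (cellOf-lo {cellOf B (suc t)} (proj₁ c∈) (proj₂ c∈))
      where c∈ = cellOf-∈ {B} {suc t} (s≤s z≤n) t<
    α-cell : ∀ k {t} → t < at α₂ k → cellOf Y (suc (psum (at α₂) k + t)) ≡ hi (k , mirror (at α₂ k) t)
    α-cell k {t} t< = cellOf-hi {k , mirror (at α₂ k) t} (ins z≤n (mirror< t<))
      (trans (cong (psum (at α₂) k +_) (m∸[m∸n]≡n t<)) (+-suc (psum (at α₂) k) t))
    upper : ∀ k → k ≤ length α₂ → applyUpTo h (psum (at α₂) k) ≡ reading k
    upper zero _ = refl
    upper (suc k) k< = begin
      applyUpTo h (psum (at α₂) k + at α₂ k)
        ≡⟨ applyUpTo-+ h (psum (at α₂) k) (at α₂ k) ⟩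
      applyUpTo h (psum (at α₂) k) ++ applyUpTo (λ t → h (psum (at α₂) k + t)) (at α₂ k)
        ≡⟨ cong₂ _++_ (upper k (<⇒≤ k<)) (trans (applyUpTo-cong (at α₂ k) λ t< → cong (proj₁ ∘ f) (α-cell k t<))
             (sym (reverse-applyUpTo-∸ (λ j → V (k , j)) (at α₂ k)))) ⟩
      reading k ++ reverse (rowV k)
        ≡⟨ cong (reading k ++_) (++-identityʳ _) ⟨
      reading k ++ concat (reverse (rowV k) ∷ [])
        ≡⟨ concat-++ (applyUpTo (reverse ∘ rowV) k) _ ⟩
      concat (applyUpTo (reverse ∘ rowV) k ++ reverse (rowV k) ∷ [])
        ≡⟨ cong concat (applyUpTo-∷ʳ' (reverse ∘ rowV) k) ⟨
      reading (suc k) ∎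
      where open ≡-Reasoning

  -- After the letters of the α₂ part the tableau is the filling V of α₂ itself, so its boxes can be
  -- compared with those of α₂. Only the word of β is inserted into it afterwards.
  insert-split : insertAll [] (rowWord p) ≡ insertAll Tab β-word
  insert-split = trans (cong (insertAll []) rowWord-split) (insertAll-++ [] (reading (length α₂)) β-word)

-- Rows agree for `p` and `p'` on μ₂ and β, and `p` has in addition the boxes of α₂/μ₂, all of them
-- sat. So the tableaux into which the common word of β is inserted have the same non-sat part, and
-- `Truncation` carries this through the insertions.
module Invariance (r m : ℕ) (α₂ μ₂ β : List ℕ) (Pα : IsPart α₂) (Pμ : IsPart μ₂) {X X' : Skew}
  (cY : Convex (Star α₂ β [])) (cY' : Convex (Star μ₂ β [])) (cX : Convex X) (cX' : Convex X')
  (p : Pict (Star α₂ β []) X) (p' : Pict (Star μ₂ β []) X') where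

  private
    module A = StarWord α₂ β Pα cY cX p
    module M = StarWord μ₂ β Pμ cY' cX' p'

  sat : ℕ → ℕ → ℕ → Set
  sat v i j = m ≤ v × Sat r i j (v ∸ m)

  sat? : ∀ v i j → Dec (sat v i j)
  sat? v i j with m ≤? v | r + i ≤? suc (v ∸ m) + j
  ... | yes a | yes b = yes (a , b)
  ... | no ¬a | _ = no (¬a ∘ proj₁)
  ... | yes _ | no ¬b = no (¬b ∘ proj₂)

  open Truncation sat sat?
    (λ {v} {v'} {i} {j} h (a , b) → ≤-trans a h , ≤-trans b (s≤s (+-monoˡ-≤ j (∸-monoˡ-≤ m h))))
    (λ {v} {i} {j} (a , b) → a , ≤-trans b (+-monoʳ-≤ (suc (v ∸ m)) (n≤1+n j)))
    (λ {v} {i} {j} (a , b) → a , ≤-trans (+-monoʳ-≤ r (n≤1+n i)) b)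
    (λ {v} {v'} {i} {j} h (a , b) → ≤-trans a (<⇒≤ h) , subst (_≤ suc (v' ∸ m) + j) (sym (+-suc r i))
      (≤-trans (s≤s b) (s≤s (+-monoˡ-≤ j (∸-monoˡ-< h a)))))

  module _ (μ⊆α : ∀ i → at μ₂ i ≤ at α₂ i)
    (V≡ : ∀ {c} → c ∈ₛ (μ₂ /ₛ []) → M.V c ≡ A.V c)
    (β≡ : ∀ {c} → c ∈ₛ (β /ₛ []) → proj₁ (Pict.f p' (StarShape.lo μ₂ β [] c)) ≡ proj₁ (Pict.f p (StarShape.lo α₂ β [] c)))
    (inside : ∀ {i j} → (i , j) ∈ₛ (μ₂ /ₛ []) → ¬ sat (A.V (i , j)) i j)
    (outside : ∀ {i j} → (i , j) ∈ₛ (α₂ /ₛ μ₂) → sat (A.V (i , j)) i j) where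

    private
      β-words : A.β-word ≡ M.β-word
      β-words = applyUpTo-cong (nCells (β /ₛ [])) λ {t} t< → sym (β≡ {cellOf (β /ₛ []) (suc t)} (proj₁ (cellOf-∈ {β /ₛ []} (s≤s z≤n) t<)))

      there' : A.Tab ⊆ⁿ M.Tab
      there' {i} {j} e n with A.T-sound {i} {j} e
      ... | c∈ , refl with j <? at μ₂ i
      ...   | yes h = trans (M.T-complete (ins z≤n h)) (cong just (V≡ (ins z≤n h)))
      ...   | no h = ⊥-elim (n (outside (ins (≮⇒≥ h) (<outer c∈))))

      back : M.Tab ⊆ⁿ A.Tab
      back {i} {j} e n with M.T-sound {i} {j} e
      ... | c∈ , refl = trans (A.T-complete (ins z≤n (<-≤-trans (<outer c∈) (μ⊆α i)))) (cong just (sym (V≡ c∈)))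

      sA : SS A.Tab
      sA = insertAll-SS (A.reading (length α₂)) []
      sM : SS M.Tab
      sM = insertAll-SS (M.reading (length μ₂)) []

      final : NS 0 (insertAll [] (rowWord p)) (insertAll [] (rowWord p'))
      final = subst₂ (NS 0) (sym A.insert-split) (trans (cong (insertAll M.Tab) β-words) (sym M.insert-split))
        (NS-insertAll A.β-word {A.Tab} {M.Tab} sA sM (⊆ⁿ⇒NS {A.Tab} {M.Tab} sA sM (λ {i} {j} → there' {i} {j}) (λ {i} {j} → back {i} {j})))

      IP IP' : Cols
      IP = insertAll [] (rowWord p)
      IP' = insertAll [] (rowWord p')

      -- A sat entry obeys the rule by its definition, so only the other entries matter, and these
      -- occur in both tableaux.
      transfer : ∀ {P P'} → P' ⊆ⁿ P → Barred r m P → Barred r m P'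
      transfer h b {i} {j} {v} e k with sat? v i j
      ... | yes s = proj₂ s
      ... | no n = b (h e n) k

    barred⇒' : Barred r m (insertAll [] (rowWord p)) → Barred r m (insertAll [] (rowWord p'))
    barred⇒' = transfer {IP} {IP'} (NS⇒⊆ⁿ {IP'} {IP} (insertAll-SS (rowWord p') []) λ t → sym (final t))

    barred⇐' : Barred r m (insertAll [] (rowWord p')) → Barred r m (insertAll [] (rowWord p))
    barred⇐' = transfer {IP'} {IP} (NS⇒⊆ⁿ {IP} {IP'} (insertAll-SS (rowWord p) []) final)

-- Splitting off the boxes satisfying the row rule

SatV : ℕ → ℕ → ℕ → ℕ → ℕ → Set
SatV r m v i j = m ≤ v × Sat r i j (v ∸ m)

SatV? : ∀ r m v i j → Dec (SatV r m v i j)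
SatV? r m v i j with m ≤? v | r + i ≤? suc (v ∸ m) + j
... | yes a | yes b = yes (a , b)
... | no ¬a | _ = no (¬a ∘ proj₁)
... | yes _ | no ¬b = no (¬b ∘ proj₂)

SatV-right : ∀ {r m v v' i j} → v ≤ v' → SatV r m v i j → SatV r m v' i (suc j)
SatV-right {m = m} h (a , b) = ≤-trans a h , ≤-trans b (+-mono-≤ (s≤s (∸-monoˡ-≤ m h)) (n≤1+n _))

-- One row further down raises r + i by one, and the strict increase of the entry makes up for it.
-- With `SatV-right` this makes the satisfying boxes of a semistandard filling its outer part.
SatV-down : ∀ {r m v v' i j} → v < v' → SatV r m v i j → SatV r m v' (suc i) j
SatV-down {r} {m} {v} {v'} {i} {j} h (a , b) = ≤-trans a (<⇒≤ h) ,
  subst (_≤ suc (v' ∸ m) + j) (sym (+-suc r i)) (≤-trans (s≤s b) (s≤s (+-monoˡ-≤ j (∸-monoˡ-< h a))))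

module Pieces (r : ℕ) (α₁ α₂ β λ₁ λ₂ : List ℕ) where
  open StarShape λ₂ λ₁ α₁ public using (X; m; lo; lo⁻) renaming (hi to hiX; L to L₀)
  open StarShape α₂ β [] public using () renaming (X to Y; m to n; hi to hi; lo to loY; hi⁻ to hi⁻; lo⁻ to lo⁻Y; H to A)

  B : Skew
  B = β /ₛ []

  -- p consists of p' (on μ₂ and β), where no box of μ₂ satisfies the row rule, and of a, where every
  -- box does.
  record Glued (μ₁ μ₂ : List ℕ) (p : Pict Y X) (p' : Pict (Star μ₂ β []) (Star λ₂ λ₁ μ₁))
    (a : Pict (α₂ /ₛ μ₂) (μ₁ /ₛ α₁)) : Set where
    field
      μ⊆α : ∀ i → at μ₂ i ≤ at α₂ i
      on-μ : ∀ {c} → c ∈ₛ (μ₂ /ₛ []) → Pict.f p (hi c) ≡ Pict.f p' (hi c)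
      on-β : ∀ {c} → c ∈ₛ B → Pict.f p (loY c) ≡ Pict.f p' (StarShape.lo μ₂ β [] c)
      on-a : ∀ {c} → c ∈ₛ (α₂ /ₛ μ₂) → Pict.f p (hi c) ≡ lo (Pict.f a c)
      rule : ∀ {i j} → (i , j) ∈ₛ (α₂ /ₛ μ₂) → Sat r i j (proj₁ (Pict.f a (i , j)))
      no-rule : ∀ {i j} → (i , j) ∈ₛ (μ₂ /ₛ []) → ¬ SatV r m (proj₁ (Pict.f p' (hi (i , j)))) i j

    V : Cell → ℕ
    V c = proj₁ (Pict.f p (hi c))

    inside : ∀ {i j} → (i , j) ∈ₛ (μ₂ /ₛ []) → ¬ SatV r m (V (i , j)) i j
    inside {i} {j} c∈ s = no-rule c∈ (subst (λ d → SatV r m (proj₁ d) i j) (on-μ c∈) s)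

    outside : ∀ {i j} → (i , j) ∈ₛ (α₂ /ₛ μ₂) → SatV r m (V (i , j)) i j
    outside {i} {j} c∈ = subst (λ d → SatV r m (proj₁ d) i j) (sym (on-a c∈))
      (m≤m+n m _ , subst (Sat r i j) (sym (m+n∸m≡n m _)) (rule c∈))

  split-α : ∀ {μ₂ c} → c ∈ₛ A → c ∈ₛ (μ₂ /ₛ []) ⊎ c ∈ₛ (α₂ /ₛ μ₂)
  split-α {μ₂} {i , j} (ins _ q) with j <? at μ₂ i
  ... | yes h = inj₁ (ins z≤n h)
  ... | no ¬h = inj₂ (ins (≮⇒≥ ¬h) q)

  in-α : ∀ {μ₂ c} → c ∈ₛ (α₂ /ₛ μ₂) → c ∈ₛ A
  in-α (ins _ q) = ins z≤n q

  lo-inj : ∀ {c d} → lo c ≡ lo d → c ≡ d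
  lo-inj {c} {d} e = trans (sym (StarShape.lo⁻lo λ₂ λ₁ α₁ c)) (trans (cong lo⁻ e) (StarShape.lo⁻lo λ₂ λ₁ α₁ d))

  Glued-p-fun : ∀ {μ₁ μ₂ p q p' a} → Glued μ₁ μ₂ p p' a → Glued μ₁ μ₂ q p' a → ∀ {c} → c ∈ₛ Y → Pict.f p c ≡ Pict.f q c
  Glued-p-fun {μ₂ = μ₂} G G' c∈ with StarShape.view α₂ β [] c∈
  ... | StarShape.isLo l = trans (Glued.on-β G l) (sym (Glued.on-β G' l))
  ... | StarShape.isHi h with split-α {μ₂} h
  ...   | inj₁ k = trans (Glued.on-μ G k) (sym (Glued.on-μ G' k))
  ...   | inj₂ k = trans (Glued.on-a G k) (sym (Glued.on-a G' k))

  Glued-p'-fun : ∀ {μ₁ μ₂ p p' q' a b} → Glued μ₁ μ₂ p p' a → Glued μ₁ μ₂ p q' b → ∀ {c} → c ∈ₛ Star μ₂ β [] → Pict.f p' c ≡ Pict.f q' c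
  Glued-p'-fun {μ₂ = μ₂} G G' c∈ with StarShape.view μ₂ β [] c∈
  ... | StarShape.isLo l = trans (sym (Glued.on-β G l)) (Glued.on-β G' l)
  ... | StarShape.isHi h = trans (sym (Glued.on-μ G h)) (Glued.on-μ G' h)

  Glued-a-fun : ∀ {μ₁ μ₂ p p' q' a b} → Glued μ₁ μ₂ p p' a → Glued μ₁ μ₂ p q' b → ∀ {c} → c ∈ₛ (α₂ /ₛ μ₂) → Pict.f a c ≡ Pict.f b c
  Glued-a-fun G G' c∈ = lo-inj (trans (sym (Glued.on-a G c∈)) (Glued.on-a G' c∈))

  -- The shape μ₂ can be read off from p: its boxes are those boxes of α₂ that do not satisfy the
  -- rule. In the same way μ₁ is α₁ with the images of the other boxes added.
  Glued-μ₂-fun : ∀ {μ₁ μ₂ ν₁ ν₂ p p' q' a b} → IsPart μ₂ → IsPart ν₂ → Glued μ₁ μ₂ p p' a → Glued ν₁ ν₂ p q' b → μ₂ ≡ ν₂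
  Glued-μ₂-fun P Q G G' = at-ext P Q λ i → ≤-antisym (≤-from-< (go G G')) (≤-from-< (go G' G))
    where
    go : ∀ {μ₁ μ₂ ν₁ ν₂ p p' q' a b} → Glued μ₁ μ₂ p p' a → Glued ν₁ ν₂ p q' b → ∀ {i j} → j < at μ₂ i → j < at ν₂ i
    go {ν₂ = ν₂} G G' {i} {j} h with split-α {ν₂} {i , j} (ins z≤n (<-≤-trans h (Glued.μ⊆α G i)))
    ... | inj₁ k = <outer k
    ... | inj₂ k = ⊥-elim (Glued.inside G (ins z≤n h) (Glued.outside G' k))

  Glued-μ₁-fun : ∀ {μ₁ μ₂ ν₁ p p' q' a b} → IsPart μ₁ → IsPart ν₁ → (∀ i → at α₁ i ≤ at μ₁ i) → (∀ i → at α₁ i ≤ at ν₁ i) →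
    Glued μ₁ μ₂ p p' a → Glued ν₁ μ₂ p q' b → μ₁ ≡ ν₁
  Glued-μ₁-fun P Q le le' G G' = at-ext P Q λ i → ≤-antisym (≤-from-< (go le' G G')) (≤-from-< (go le G' G))
    where
    go : ∀ {μ₁ μ₂ ν₁ p p' q' a b} → (∀ i → at α₁ i ≤ at ν₁ i) → Glued μ₁ μ₂ p p' a → Glued ν₁ μ₂ p q' b → ∀ {i j} → j < at μ₁ i → j < at ν₁ i
    go {a = a} {b} le G G' {i} {j} h with j <? at α₁ i
    ... | yes k = <-≤-trans k (le i)
    ... | no ¬k = <outer (subst (_∈ₛ _) (lo-inj (trans (sym (Glued.on-a G' g∈)) (trans (Glued.on-a G g∈) (cong lo (Pict.fg a c∈))))) (Pict.f∈ b g∈))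
      where
      c∈ = ins (≮⇒≥ ¬k) h
      g∈ = Pict.g∈ a c∈

  module _ (Pα₁ : IsPart α₁) (Pα₂ : IsPart α₂) (Pβ : IsPart β) (Pλ₁ : IsPart λ₁) (Pλ₂ : IsPart λ₂)
    (α⊆λ : ∀ i → at α₁ i ≤ at λ₁ i) where

    module SY = StarShape α₂ β []
    module SX = StarShape λ₂ λ₁ α₁

    cY : Convex Y
    cY = SY.convex-star Pα₂ Pβ IsPart-[] (λ _ → z≤n)

    cX : Convex X
    cX = SX.convex-star Pλ₂ Pλ₁ Pα₁ α⊆λ

    module Unglue (p : Pict Y X) where
      open Pict p
      module F = Strong cX cY (flip p)
      module G = Strong cY cX p

      V : Cell → ℕ
      V c = proj₁ (f (hi c))

      V-right : ∀ {i j} → (i , suc j) ∈ₛ A → V (i , j) ≤ V (i , suc j)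
      V-right h = proj₁ (F.g-right (SY.hi∈ (in-left (n≤1+n _) h)) (SY.hi∈ h))

      V-down : ∀ {i j} → (suc i , j) ∈ₛ A → V (i , j) < V (suc i , j)
      V-down h = proj₁ (F.g-down _ (SY.hi∈ (in-up Pα₂ (n≤1+n _) h)) (SY.hi∈ h) _ ≤-refl)

      sat? : ∀ i j → Dec (SatV r m (V (i , j)) i j)
      sat? i j = SatV? r m (V (i , j)) i j

      D₂ : ℕ → ℕ → Set
      D₂ i j = (i , j) ∈ₛ A × ¬ SatV r m (V (i , j)) i j

      D₂? : ∀ i j → Dec (D₂ i j)
      D₂? i j with (i , j) ∈ₛ? A | sat? i j
      ... | yes h | no ¬s = yes (h , ¬s)
      ... | no ¬h | _ = no (¬h ∘ proj₁)
      ... | yes _ | yes s = no λ d → proj₂ d s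

      ideal₂ : ∃[ μ ] IsPart μ × (∀ {i j} → j < at μ i → D₂ i j) × (∀ {i j} → D₂ i j → j < at μ i)
      ideal₂ = ideal α₂ D₂ D₂? (λ d → <outer (proj₁ d))
        (λ {i} {j} d → in-up Pα₂ (n≤1+n i) (proj₁ d) , λ s → proj₂ d (SatV-down {r} (V-down (proj₁ d)) s))
        (λ {i} {j} d → in-left (n≤1+n j) (proj₁ d) , λ s → proj₂ d (SatV-right {r} (V-right (proj₁ d)) s))

      μ₂ : List ℕ
      μ₂ = proj₁ ideal₂

      μ₂P : IsPart μ₂
      μ₂P = proj₁ (proj₂ ideal₂)

      -- The box of α₂ (if any) mapped to (i , j) satisfies the row rule.
      R : ℕ → ℕ → Set
      R i j = proj₁ (g (lo (i , j))) < n × Sat r (proj₁ (g (lo (i , j)))) (proj₂ (hi⁻ (g (lo (i , j))))) i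

      -- μ₁ has to be α₁ together with the images of the satisfying boxes of α₂. This is closed
      -- upwards and to the left within λ₁: a step left moves the preimage weakly up and to the
      -- right, and a step up, which costs one in the rule, moves it up by at least one row and
      -- weakly to the right.
      D₁ : ℕ → ℕ → Set
      D₁ i j = j < at α₁ i ⊎ ((i , j) ∈ₛ L₀ × R i j)

      D₁? : ∀ i j → Dec (D₁ i j)
      D₁? i j with j <? at α₁ i | (i , j) ∈ₛ? L₀ | proj₁ (g (lo (i , j))) <? n
        | r + proj₁ (g (lo (i , j))) ≤? suc i + proj₂ (hi⁻ (g (lo (i , j))))
      ... | yes h | _ | _ | _ = yes (inj₁ h)
      ... | no ¬h | yes a | yes b | yes c = yes (inj₂ (a , b , c))
      ... | no ¬h | no ¬a | _ | _ = no λ { (inj₁ h) → ¬h h ; (inj₂ (a , _)) → ¬a a }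
      ... | no ¬h | yes _ | no ¬b | _ = no λ { (inj₁ h) → ¬h h ; (inj₂ (_ , b , _)) → ¬b b }
      ... | no ¬h | yes _ | yes _ | no ¬c = no λ { (inj₁ h) → ¬h h ; (inj₂ (_ , _ , c)) → ¬c c }

      ideal₁ : ∃[ μ ] IsPart μ × (∀ {i j} → j < at μ i → D₁ i j) × (∀ {i j} → D₁ i j → j < at μ i)
      ideal₁ = ideal λ₁ D₁ D₁? bound up left'
        where
        bound : ∀ {i j} → D₁ i j → j < at λ₁ i
        bound {i} (inj₁ h) = <-≤-trans h (α⊆λ i)
        bound (inj₂ (h , _)) = <outer h
        up : ∀ {i j} → D₁ (suc i) j → D₁ i j
        up {i} (inj₁ h) = inj₁ (<-≤-trans h (proj₁ Pα₁ i))
        up {i} {j} (inj₂ (h , a , b)) with j <? at α₁ i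
        ... | yes k = inj₁ k
        ... | no ¬k = inj₂ (k , <-trans (proj₁ s) a , s≤s⁻¹ (≤-trans (≤-reflexive (sym (+-suc r _)))
              (≤-trans (+-monoʳ-≤ r (proj₁ s)) (≤-trans b (+-monoʳ-≤ (suc (suc i)) (∸-monoˡ-≤ (firstRow β) (proj₂ s)))))))
          where
          k : (i , j) ∈ₛ L₀
          k = ins (≮⇒≥ ¬k) (<-≤-trans (<outer h) (proj₁ Pλ₁ i))
          s : proj₁ (g (lo (i , j))) < proj₁ (g (lo (suc i , j))) × proj₂ (g (lo (suc i , j))) ≤ proj₂ (g (lo (i , j)))
          s = subst (λ z → proj₁ (g (lo (i , j))) < proj₁ (g (z , j)) × proj₂ (g (z , j)) ≤ proj₂ (g (lo (i , j)))) (sym (+-suc m i))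
            (G.g-down j (SX.lo∈ k) (subst (λ z → (z , j) ∈ₛ X) (+-suc m i) (SX.lo∈ h)) _ ≤-refl)
        left' : ∀ {i j} → D₁ i (suc j) → D₁ i j
        left' (inj₁ h) = inj₁ (<-trans (n<1+n _) h)
        left' {i} {j} (inj₂ (h , a , b)) with j <? at α₁ i
        ... | yes k = inj₁ k
        ... | no ¬k = inj₂ (k , ≤-<-trans (proj₁ s) a ,
              ≤-trans (+-monoʳ-≤ r (proj₁ s)) (≤-trans b (+-monoʳ-≤ (suc i) (∸-monoˡ-≤ (firstRow β) (<⇒≤ (proj₂ s))))))
          where
          k : (i , j) ∈ₛ L₀
          k = ins (≮⇒≥ ¬k) (<-trans (n<1+n j) (<outer h))
          s = G.g-right (SX.lo∈ k) (SX.lo∈ h)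

      μ₁ : List ℕ
      μ₁ = proj₁ ideal₁

      μ₁P : IsPart μ₁
      μ₁P = proj₁ (proj₂ ideal₁)

      μ₁⁻ : ∀ {i j} → j < at μ₁ i → D₁ i j
      μ₁⁻ = proj₁ (proj₂ (proj₂ ideal₁))

      μ₁⁺ : ∀ {i j} → D₁ i j → j < at μ₁ i
      μ₁⁺ = proj₂ (proj₂ (proj₂ ideal₁))

      μ₂⁻ : ∀ {i j} → j < at μ₂ i → D₂ i j
      μ₂⁻ = proj₁ (proj₂ (proj₂ ideal₂))

      μ₂⁺ : ∀ {i j} → D₂ i j → j < at μ₂ i
      μ₂⁺ = proj₂ (proj₂ (proj₂ ideal₂))

      α⊆μ : ∀ i → at α₁ i ≤ at μ₁ i
      α⊆μ i = ≤-from-< λ h → μ₁⁺ (inj₁ h)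

      μ⊆λ : ∀ i → at μ₁ i ≤ at λ₁ i
      μ⊆λ i = ≤-from-< λ h → case μ₁⁻ h of λ { (inj₁ k) → <-≤-trans k (α⊆λ i) ; (inj₂ (k , _)) → <outer k }

      μ⊆α : ∀ i → at μ₂ i ≤ at α₂ i
      μ⊆α i = ≤-from-< λ h → <outer (proj₁ (μ₂⁻ h))

      module SY' = StarShape μ₂ β []
      module SX' = StarShape λ₂ λ₁ μ₁

      out-sat : ∀ {i j} → (i , j) ∈ₛ (α₂ /ₛ μ₂) → SatV r m (V (i , j)) i j
      out-sat {i} {j} h with sat? i j
      ... | yes s = s
      ... | no ¬s = ⊥-elim (<⇒≱ (μ₂⁺ (in-α h , ¬s)) (inner≤ h))

      sat⇒R : ∀ {c d} → c ∈ₛ A → f (hi c) ≡ lo d → SatV r m (V c) (proj₁ c) (proj₂ c) → R (proj₁ d) (proj₂ d)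
      sat⇒R {c} {d} h e (_ , s) = subst (λ y → proj₁ y < n × Sat r (proj₁ y) (proj₂ (hi⁻ y)) (proj₁ d))
        (trans (sym (gf (SY.hi∈ h))) (cong g e))
        (SY.hi< h , subst₂ (λ c' v → Sat r (proj₁ c') (proj₂ c') v) (sym (SY.hi⁻hi c))
          (trans (cong (λ z → proj₁ z ∸ m) e) (m+n∸m≡n m (proj₁ d))) s)

      R⇒sat : ∀ {d} → d ∈ₛ L₀ → R (proj₁ d) (proj₂ d) → ∃[ c ] g (lo d) ≡ hi c × c ∈ₛ A × SatV r m (V c) (proj₁ c) (proj₂ c)
      R⇒sat {d} l (a , s) with g (lo d) in e | SY.view (g∈ (SX.lo∈ l))
      ... | _ | SY.isLo {c} k = ⊥-elim (<⇒≱ a (SY.lo-row≥ c))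
      ... | _ | SY.isHi {c} h = c , refl , h , subst (λ v → SatV r m (proj₁ v) (proj₁ c) (proj₂ c)) (sym (trans (cong f (sym e)) (fg (SX.lo∈ l))))
              (m≤m+n m _ , subst₂ (λ c' v → Sat r (proj₁ c') (proj₂ c') v) (SY.hi⁻hi c) (sym (m+n∸m≡n m (proj₁ d))) s)

      -- Boxes of Y with their copies in the smaller shape. Both shapes shift the upper part by the
      -- first row of β, so boxes of μ₂ keep their coordinates, whereas β begins in row `length μ₂`
      -- instead of `length α₂`.
      data Kept : Cell → Cell → Set where
        μ-box : ∀ {c} → c ∈ₛ (μ₂ /ₛ []) → Kept (hi c) (hi c)
        β-box : ∀ {c} → c ∈ₛ B → Kept (loY c) (SY'.lo c)

      ι ι⁻ : Cell → Cell
      ι c = if proj₁ c <ᵇ SY'.m then c else loY (SY'.lo⁻ c)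
      ι⁻ c = if proj₁ c <ᵇ n then c else SY'.lo (lo⁻Y c)

      ι-kept : ∀ {c c'} → Kept c c' → ι c' ≡ c × ι⁻ c ≡ c'
      ι-kept (μ-box h) = if-yes (<⇒<ᵇ (SY'.hi< h)) , if-yes (<⇒<ᵇ (SY.hi< {_} (ins z≤n (<-≤-trans (<outer h) (μ⊆α _)))))
      ι-kept (β-box {c} h) = trans (if-no λ t → <⇒≱ (<ᵇ⇒< _ SY'.m t) (SY'.lo-row≥ c)) (cong loY (SY'.lo⁻lo c))
        , trans (if-no λ t → <⇒≱ (<ᵇ⇒< _ n t) (SY.lo-row≥ c)) (cong SY'.lo (SY.lo⁻lo c))

      kept-∈ : ∀ {c c'} → Kept c c' → c ∈ₛ Y × c' ∈ₛ SY'.X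
      kept-∈ (μ-box h) = SY.hi∈ (ins z≤n (<-≤-trans (<outer h) (μ⊆α _))) , SY'.hi∈ h
      kept-∈ (β-box h) = SY.lo∈ h , SY'.lo∈ h

      kept' : ∀ {c'} → c' ∈ₛ SY'.X → ∃[ c ] Kept c c'
      kept' c∈ with SY'.view c∈
      ... | SY'.isHi h = _ , μ-box h
      ... | SY'.isLo l = _ , β-box l

      kept-≺ : ∀ {c c' d d'} → Kept c c' → Kept d d' → c ≺ d → c' ≺ d'
      kept-≺ (μ-box h) (μ-box k) o = o
      kept-≺ (μ-box h) (β-box k) o = SY'.hi≺lo h
      kept-≺ (β-box {c} h) (μ-box {d} k) o = ⊥-elim (≺-asym o (SY.hi≺lo {d} {c} (ins z≤n (<-≤-trans (<outer k) (μ⊆α _)))))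
      kept-≺ (β-box h) (β-box k) o = SY'.lo-≺ (SY.lo-≺⁻ o)

      -- By `D₁` a box of μ₁ outside α₁ is the image of a satisfying box of α₂, and a kept box lies
      -- in β or in μ₂.
      f-kept : ∀ {c c'} → Kept c c' → f c ∈ₛ SX'.X
      f-kept {c} k with f c in e | SX.view (f∈ (proj₁ (kept-∈ k)))
      ... | _ | SX.isHi h = SX'.hi∈ h
      ... | _ | SX.isLo {d} l = SX'.lo∈ (ins (≮⇒≥ (bad k e)) (<outer l))
        where
        bad : ∀ {c c'} → Kept c c' → f c ≡ lo d → ¬ (proj₂ d < at μ₁ (proj₁ d))
        bad k e q with μ₁⁻ q
        ... | inj₁ z = <⇒≱ z (inner≤ l)
        bad (β-box {x} h) e q | inj₂ (_ , a , _) =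
          <⇒≱ (subst (λ y → proj₁ y < n) (trans (cong g (sym e)) (gf (SY.lo∈ h))) a) (SY.lo-row≥ x)
        bad (μ-box {x} h) e q | inj₂ (l , R) with R⇒sat l R
        ... | c , ec , c∈ , s = proj₂ (μ₂⁻ (<outer h)) (subst (λ z → SatV r m (V z) (proj₁ z) (proj₂ z)) c≡x s)
          where
          c≡x : c ≡ x
          c≡x = trans (sym (SY.hi⁻hi c)) (trans (cong hi⁻ (trans (sym ec) (trans (cong g (sym e)) (gf (SY.hi∈ (ins z≤n (<-≤-trans (<outer h) (μ⊆α _)))))))) (SY.hi⁻hi x))

      g-kept : ∀ {d} → d ∈ₛ SX'.X → ∃[ c' ] Kept (g d) c'
      g-kept {d} d∈ with g d in e | SY.view (g∈ (X'⊆X d∈))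
        where
        X'⊆X : ∀ {d} → d ∈ₛ SX'.X → d ∈ₛ X
        X'⊆X d∈ with SX'.view d∈
        ... | SX'.isHi h = SX.hi∈ h
        ... | SX'.isLo l = SX.lo∈ (ins (≤-trans (α⊆μ _) (inner≤ l)) (<outer l))
      ... | _ | SY.isLo l = _ , β-box l
      ... | _ | SY.isHi {c} h = _ , μ-box (ins z≤n (μ₂⁺ (h , no-sat (SX'.view d∈) e)))
        where
        no-sat : ∀ {d} → SX'.View d → g d ≡ hi c → ¬ SatV r m (V c) (proj₁ c) (proj₂ c)
        no-sat (SX'.isHi k) e (s , _) = <⇒≱ (SX.hi< k) (subst (λ z → m ≤ proj₁ z) (trans (cong f (sym e)) (fg (SX.hi∈ k))) s)
        no-sat (SX'.isLo k) e s = <⇒≱ (μ₁⁺ (inj₂ (k' , sat⇒R h (trans (cong f (sym e)) (fg (SX.lo∈ k'))) s))) (inner≤ k)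
          where k' = ins (≤-trans (α⊆μ _) (inner≤ k)) (<outer k)

      X'⊆X : ∀ {d} → d ∈ₛ SX'.X → d ∈ₛ X
      X'⊆X d∈ with SX'.view d∈
      ... | SX'.isHi h = SX.hi∈ h
      ... | SX'.isLo l = SX.lo∈ (ins (≤-trans (α⊆μ _) (inner≤ l)) (<outer l))

      fι : ∀ {c c'} → Kept c c' → f (ι c') ≡ f c
      fι k = cong f (proj₁ (ι-kept k))

      ιg : ∀ {d} (d∈ : d ∈ₛ SX'.X) → ι⁻ (g d) ≡ proj₁ (g-kept d∈)
      ιg d∈ = proj₂ (ι-kept (proj₂ (g-kept d∈)))

      g-order : ∀ {d e} → d ∈ₛ SX'.X → e ∈ₛ SX'.X → g d ≺ g e → ι⁻ (g d) ≺ ι⁻ (g e)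
      g-order a b o = subst₂ _≺_ (sym (ιg a)) (sym (ιg b)) (kept-≺ (proj₂ (g-kept a)) (proj₂ (g-kept b)) o)

      p' : Pict SY'.X SX'.X
      p' = record
        { f = f ∘ ι ; g = ι⁻ ∘ g
        ; f∈ = λ c∈ → let _ , k = kept' c∈ in subst (_∈ₛ SX'.X) (sym (fι k)) (f-kept k)
        ; g∈ = λ d∈ → subst (_∈ₛ SY'.X) (sym (ιg d∈)) (proj₂ (kept-∈ (proj₂ (g-kept d∈))))
        ; gf = λ c∈ → let _ , k = kept' c∈ in
            trans (cong (ι⁻ ∘ g) (fι k)) (trans (cong ι⁻ (gf (proj₁ (kept-∈ k)))) (proj₂ (ι-kept k)))
        ; fg = λ d∈ → let _ , k = g-kept d∈ in
            trans (cong (f ∘ ι) (proj₂ (ι-kept k))) (trans (fι k) (fg (X'⊆X d∈)))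
        ; f→ = λ a b → step→ (SY'.view→ a b)
        ; f↓ = λ a b → step↓ (SY'.view↓ μ₂P Pβ IsPart-[] (λ _ → z≤n) a b)
        ; g→ = λ a b → g-order a b (g→ (X'⊆X a) (X'⊆X b))
        ; g↓ = λ a b → g-order a b (g↓ (X'⊆X a) (X'⊆X b)) }
        where
        step→ : ∀ {i j} → SY'.→View i j → f (ι (i , j)) ≺ f (ι (i , suc j))
        step→ (SY'.hi→ h k) = subst₂ _≺_ (sym (fι (μ-box h))) (sym (fι (μ-box k)))
          (f→ (proj₁ (kept-∈ (μ-box h))) (proj₁ (kept-∈ (μ-box k))))
        step→ (SY'.lo→ h k) = subst₂ _≺_ (sym (fι (β-box h))) (sym (fι (β-box k))) (f→ (SY.lo∈ h) (SY.lo∈ k))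
        step↓ : ∀ {i j} → SY'.↓View μ₂P Pβ IsPart-[] (λ _ → z≤n) i j → f (ι (i , j)) ≺ f (ι (suc i , j))
        step↓ (SY'.hi↓ h k) = subst₂ _≺_ (sym (fι (μ-box h))) (sym (fι (μ-box k)))
          (f↓ (proj₁ (kept-∈ (μ-box h))) (proj₁ (kept-∈ (μ-box k))))
        step↓ (SY'.lo↓ {i} {j} h k) = subst₂ _≺_ (sym (fι (β-box h)))
          (trans (cong (λ z → f (z , j)) (sym (+-suc n i))) (trans (sym (fι (β-box k))) (cong (λ z → f (ι (z , j))) (+-suc SY'.m i))))
          (f↓ (SY.lo∈ h) (subst (λ z → (z , j) ∈ₛ Y) (+-suc n i) (SY.lo∈ k)))

      f-a : ∀ {c} → c ∈ₛ (α₂ /ₛ μ₂) → f (hi c) ≡ lo (lo⁻ (f (hi c))) × lo⁻ (f (hi c)) ∈ₛ (μ₁ /ₛ α₁)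
      f-a {c} h with f (hi c) in e | SX.view (f∈ (SY.hi∈ (in-α h)))
      ... | _ | SX.isHi k = ⊥-elim (<⇒≱ (SX.hi< k) (subst (λ z → m ≤ proj₁ z) e (proj₁ (out-sat h))))
      ... | _ | SX.isLo {d} l = cong lo (sym (SX.lo⁻lo d)) , subst (_∈ₛ (μ₁ /ₛ α₁)) (sym (SX.lo⁻lo d))
            (ins (inner≤ l) (μ₁⁺ (inj₂ (l , sat⇒R (in-α h) e (out-sat h)))))

      g-a : ∀ {d} → d ∈ₛ (μ₁ /ₛ α₁) → g (lo d) ≡ hi (hi⁻ (g (lo d))) × hi⁻ (g (lo d)) ∈ₛ (α₂ /ₛ μ₂)
      g-a {d} h with μ₁⁻ (<outer h)
      ... | inj₁ k = ⊥-elim (<⇒≱ k (inner≤ h))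
      ... | inj₂ (l , R) = let c , e , c∈ , s = R⇒sat l R ; back = trans (cong hi⁻ e) (SY.hi⁻hi c) in
          trans e (cong hi (sym back)) , subst (_∈ₛ (α₂ /ₛ μ₂)) (sym back) (ins (≮⇒≥ λ q → proj₂ (μ₂⁻ q) s) (<outer c∈))

      inL : ∀ {d} → d ∈ₛ (μ₁ /ₛ α₁) → d ∈ₛ L₀
      inL (ins a b) = ins a (<-≤-trans b (μ⊆λ _))

      a : Pict (α₂ /ₛ μ₂) (μ₁ /ₛ α₁)
      a = record
        { f = λ c → lo⁻ (f (hi c)) ; g = λ d → hi⁻ (g (lo d))
        ; f∈ = λ h → proj₂ (f-a h) ; g∈ = λ h → proj₂ (g-a h)
        ; gf = λ {c} h → trans (cong (hi⁻ ∘ g) (sym (proj₁ (f-a h)))) (trans (cong hi⁻ (gf (SY.hi∈ (in-α h)))) (SY.hi⁻hi c))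
        ; fg = λ {d} h → trans (cong (lo⁻ ∘ f) (sym (proj₁ (g-a h)))) (trans (cong lo⁻ (fg (SX.lo∈ (inL h)))) (SX.lo⁻lo d))
        ; f→ = λ h k → SX.lo-≺⁻ (subst₂ _≺_ (proj₁ (f-a h)) (proj₁ (f-a k)) (f→ (SY.hi∈ (in-α h)) (SY.hi∈ (in-α k))))
        ; f↓ = λ h k → SX.lo-≺⁻ (subst₂ _≺_ (proj₁ (f-a h)) (proj₁ (f-a k)) (f↓ (SY.hi∈ (in-α h)) (SY.hi∈ (in-α k))))
        ; g→ = λ h k → SY.hi-≺⁻ (subst₂ _≺_ (proj₁ (g-a h)) (proj₁ (g-a k)) (g→ (SX.lo∈ (inL h)) (SX.lo∈ (inL k))))
        ; g↓ = λ {i} {j} h k → SY.hi-≺⁻ (subst₂ _≺_ (proj₁ (g-a h)) (trans (cong (λ z → g (z , j)) (sym (+-suc m i))) (proj₁ (g-a k)))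
            (g↓ (SX.lo∈ (inL h)) (subst (λ z → (z , j) ∈ₛ X) (+-suc m i) (SX.lo∈ (inL k))))) }

      glued : Glued μ₁ μ₂ p p' a
      glued = record
        { μ⊆α = μ⊆α
        ; on-μ = λ h → sym (fι (μ-box h))
        ; on-β = λ h → sym (fι (β-box h))
        ; on-a = λ h → proj₁ (f-a h)
        ; rule = λ {i} {j} h → subst (Sat r i j) (trans (cong (λ z → proj₁ z ∸ m) (proj₁ (f-a h))) (m+n∸m≡n m _)) (proj₂ (out-sat h))
        ; no-rule = λ {i} {j} h s → proj₂ (μ₂⁻ (<outer h)) (subst (λ z → SatV r m (proj₁ z) i j) (fι (μ-box h)) s) }

    -- Gluing an arrow to a picture that has no satisfying boxes

    module Glue (μ₁ μ₂ : List ℕ) (Pμ₁ : IsPart μ₁) (Pμ₂ : IsPart μ₂) (α⊆μ : ∀ i → at α₁ i ≤ at μ₁ i) (μ⊆λ : ∀ i → at μ₁ i ≤ at λ₁ i)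
      (μ⊆α : ∀ i → at μ₂ i ≤ at α₂ i)
      (p' : Pict (Star μ₂ β []) (Star λ₂ λ₁ μ₁)) (a : Pict (α₂ /ₛ μ₂) (μ₁ /ₛ α₁))
      (rule : ∀ {i j} → (i , j) ∈ₛ (α₂ /ₛ μ₂) → Sat r i j (proj₁ (Pict.f a (i , j))))
      (no-rule : ∀ {i j} → (i , j) ∈ₛ (μ₂ /ₛ []) → ¬ SatV r m (proj₁ (Pict.f p' (hi (i , j)))) i j) where

      module SY' = StarShape μ₂ β []
      module SX' = StarShape λ₂ λ₁ μ₁
      module p' = Pict p'
      module a = Pict a

      cY' : Convex SY'.X
      cY' = SY'.convex-star Pμ₂ Pβ IsPart-[] (λ _ → z≤n)

      cX' : Convex SX'.X
      cX' = SX'.convex-star Pλ₂ Pλ₁ Pμ₁ μ⊆λ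

      skew-convex : ∀ {γ δ} → IsPart γ → IsPart δ → Convex (γ /ₛ δ)
      skew-convex (x , _) (y , _) = x , y

      module Fp = Strong cX' cY' (flip p')
      module Fa = Strong (skew-convex Pμ₁ Pα₁) (skew-convex Pα₂ Pμ₂) (flip a)

      μ-in : ∀ {c} → c ∈ₛ (μ₂ /ₛ []) → c ∈ₛ A
      μ-in (ins _ q) = ins z≤n (<-≤-trans q (μ⊆α _))

      f g : Cell → Cell
      f (i , j) = if i <ᵇ n then (if (j ∸ firstRow β) <ᵇ at μ₂ i then p'.f (i , j) else lo (a.f (hi⁻ (i , j))))
                  else p'.f (SY'.lo (lo⁻Y (i , j)))

      ι : Cell → Cell
      ι c = if proj₁ c <ᵇ SY'.m then c else loY (SY'.lo⁻ c)

      g (i , j) = if i <ᵇ m then ι (p'.g (i , j)) else (if j <ᵇ at μ₁ (i ∸ m) then hi (a.g (lo⁻ (i , j))) else ι (p'.g (i , j)))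

      f-μ : ∀ {c} → c ∈ₛ (μ₂ /ₛ []) → f (hi c) ≡ p'.f (hi c)
      f-μ {i , j} h = trans (if-yes (<⇒<ᵇ (SY.hi< (μ-in h))))
        (if-yes (<⇒<ᵇ (subst (_< at μ₂ i) (sym (m+n∸n≡m j (firstRow β))) (<outer h))))

      f-a : ∀ {c} → c ∈ₛ (α₂ /ₛ μ₂) → f (hi c) ≡ lo (a.f c)
      f-a {i , j} h = trans (if-yes (<⇒<ᵇ (SY.hi< (in-α h))))
        (trans (if-no λ t → <⇒≱ (subst (_< at μ₂ i) (m+n∸n≡m j (firstRow β)) (<ᵇ⇒< _ _ t)) (inner≤ h))
          (cong (lo ∘ a.f) (SY.hi⁻hi (i , j))))

      f-β : ∀ {c} → c ∈ₛ B → f (loY c) ≡ p'.f (SY'.lo c)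
      f-β {i , j} h = trans (if-no λ t → <⇒≱ (<ᵇ⇒< _ n t) (SY.lo-row≥ (i , j))) (cong (p'.f ∘ SY'.lo) (SY.lo⁻lo (i , j)))

      data Kept : Cell → Cell → Set where
        μ-box : ∀ {c} → c ∈ₛ (μ₂ /ₛ []) → Kept (hi c) (hi c)
        β-box : ∀ {c} → c ∈ₛ B → Kept (loY c) (SY'.lo c)

      ι-kept : ∀ {c'} → c' ∈ₛ SY'.X → Kept (ι c') c'
      ι-kept c∈ with SY'.view c∈
      ... | SY'.isHi {c} h = subst (λ z → Kept z (hi c)) (sym (if-yes (<⇒<ᵇ (SY'.hi< h)))) (μ-box h)
      ... | SY'.isLo {c} l = subst (λ z → Kept z (SY'.lo c))
            (sym (trans (if-no λ t → <⇒≱ (<ᵇ⇒< _ SY'.m t) (SY'.lo-row≥ c)) (cong loY (SY'.lo⁻lo c)))) (β-box l)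

      kept-Y : ∀ {c c'} → Kept c c' → c ∈ₛ Y × c' ∈ₛ SY'.X × f c ≡ p'.f c'
      kept-Y (μ-box h) = SY.hi∈ (μ-in h) , SY'.hi∈ h , f-μ h
      kept-Y (β-box h) = SY.lo∈ h , SY'.lo∈ h , f-β h

      kept-fun : ∀ {c₁ c₂ c'} → Kept c₁ c' → Kept c₂ c' → c₁ ≡ c₂
      kept-fun k k' = go k k' refl
        where
        go : ∀ {c₁ c₂ c' d'} → Kept c₁ c' → Kept c₂ d' → c' ≡ d' → c₁ ≡ c₂
        go (μ-box h) (μ-box k) e = e
        go (μ-box h) (β-box k) e = ⊥-elim (SY'.hi≢lo h e)
        go (β-box h) (μ-box k) e = ⊥-elim (SY'.hi≢lo k (sym e))
        go (β-box {c} h) (β-box {d} k) e = cong loY (trans (sym (SY'.lo⁻lo c)) (trans (cong SY'.lo⁻ e) (SY'.lo⁻lo d)))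

      kept-≺ : ∀ {c c' d d'} → Kept c c' → Kept d d' → c' ≺ d' → c ≺ d
      kept-≺ (μ-box h) (μ-box k) o = o
      kept-≺ (μ-box h) (β-box k) o = SY.hi≺lo (μ-in h)
      kept-≺ (β-box h) (μ-box k) o = ⊥-elim (≺-asym o (SY'.hi≺lo k))
      kept-≺ (β-box h) (β-box k) o = SY.lo-≺ (SY'.lo-≺⁻ o)

      data OnY : Cell → Set where
        kept : ∀ {c c'} → Kept c c' → OnY c
        sat-box : ∀ {c} → c ∈ₛ (α₂ /ₛ μ₂) → OnY (hi c)

      onY : ∀ {c} → c ∈ₛ Y → OnY c
      onY c∈ with SY.view c∈
      ... | SY.isLo l = kept (β-box l)
      ... | SY.isHi h with split-α {μ₂} h
      ...   | inj₁ k = kept (μ-box k)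
      ...   | inj₂ k = sat-box k

      data OnX : Cell → Set where
        in-X' : ∀ {d} → d ∈ₛ SX'.X → OnX d
        in-μ₁ : ∀ {d} → d ∈ₛ (μ₁ /ₛ α₁) → OnX (lo d)

      onX : ∀ {d} → d ∈ₛ X → OnX d
      onX d∈ with SX.view d∈
      ... | SX.isHi h = in-X' (SX'.hi∈ h)
      ... | SX.isLo {i , j} l with j <? at μ₁ i
      ...   | yes h = in-μ₁ (ins (inner≤ l) h)
      ...   | no ¬h = in-X' (SX'.lo∈ (ins (≮⇒≥ ¬h) (<outer l)))

      X'-in : ∀ {d} → d ∈ₛ SX'.X → d ∈ₛ X
      X'-in d∈ with SX'.view d∈
      ... | SX'.isHi h = SX.hi∈ h
      ... | SX'.isLo l = SX.lo∈ (ins (≤-trans (α⊆μ _) (inner≤ l)) (<outer l))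

      g-X' : ∀ {d} → d ∈ₛ SX'.X → g d ≡ ι (p'.g d)
      g-X' d∈ with SX'.view d∈
      ... | SX'.isHi h = if-yes (<⇒<ᵇ (SX'.hi< h))
      ... | SX'.isLo {d} l = trans (if-no λ t → <⇒≱ (<ᵇ⇒< _ m t) (SX'.lo-row≥ d))
            (if-no λ t → <⇒≱ (subst (λ z → proj₂ d < at μ₁ (proj₁ z)) (SX.lo⁻lo d) (<ᵇ⇒< _ _ t)) (inner≤ l))

      g-μ₁ : ∀ {d} → d ∈ₛ (μ₁ /ₛ α₁) → g (lo d) ≡ hi (a.g d)
      g-μ₁ {d} h = trans (if-no λ t → <⇒≱ (<ᵇ⇒< _ m t) (SX.lo-row≥ d))
        (trans (if-yes (<⇒<ᵇ (subst (λ z → proj₂ d < at μ₁ (proj₁ z)) (sym (SX.lo⁻lo d)) (<outer h)))) (cong (hi ∘ a.g) (SX.lo⁻lo d)))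

      μ₁-in : ∀ {d} → d ∈ₛ (μ₁ /ₛ α₁) → lo d ∈ₛ X
      μ₁-in (ins q q') = SX.lo∈ (ins q (<-≤-trans q' (μ⊆λ _)))

      V : Cell → ℕ
      V c = proj₁ (f (hi c))

      V-a : ∀ {c} → c ∈ₛ (α₂ /ₛ μ₂) → V c ≡ m + proj₁ (a.f c)
      V-a h = cong proj₁ (f-a h)

      -- The critical step leads out of μ₂: the rule fails at (i , j) and holds at (i , suc j), and
      -- the two inequalities combine to the comparison of the entries. If the rule fails because
      -- the entry is below m, there is nothing to do, as the other entry is at least m.
      V-right : ∀ {i j} → (i , suc j) ∈ₛ A → V (i , j) ≤ V (i , suc j)
      V-right {i} {j} h with split-α {μ₂} (in-left (n≤1+n j) h) | split-α {μ₂} h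
      ... | inj₁ k | inj₁ k' = subst₂ _≤_ (cong proj₁ (sym (f-μ k))) (cong proj₁ (sym (f-μ k'))) (proj₁ (Fp.g-right (SY'.hi∈ k) (SY'.hi∈ k')))
      ... | inj₂ k | inj₂ k' = subst₂ _≤_ (sym (V-a k)) (sym (V-a k')) (+-monoʳ-≤ m (proj₁ (Fa.g-right k k')))
      ... | inj₂ k | inj₁ k' = ⊥-elim (<⇒≱ (<outer k') (≤-trans (inner≤ k) (n≤1+n j)))
      ... | inj₁ k | inj₂ k' with m ≤? V (i , j)
      ...   | no ¬q = subst (V (i , j) ≤_) (sym (V-a k')) (≤-trans (<⇒≤ (≰⇒> ¬q)) (m≤m+n m _))
      ...   | yes q = subst (V (i , j) ≤_) (sym (V-a k')) (subst (_≤ m + proj₁ (a.f (i , suc j))) (m+[n∸m]≡n q) (+-monoʳ-≤ m (s≤s⁻¹ (s≤s⁻¹ (+-cancelʳ-≤ j _ _ (begin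
                suc (suc (V (i , j) ∸ m)) + j  ≤⟨ ≰⇒> (λ s → no-rule k (subst (λ z → SatV r m (proj₁ z) i j) (f-μ k) (q , s))) ⟩
                r + i                          ≤⟨ rule k' ⟩
                suc (proj₁ (a.f (i , suc j))) + suc j  ≡⟨ +-suc (suc (proj₁ (a.f (i , suc j)))) j ⟩
                suc (suc (proj₁ (a.f (i , suc j)))) + j  ∎))))))
        where open ≤-Reasoning

      V-down : ∀ {i j} → (suc i , j) ∈ₛ A → V (i , j) < V (suc i , j)
      V-down {i} {j} h with split-α {μ₂} (in-up Pα₂ (n≤1+n i) h) | split-α {μ₂} h
      ... | inj₁ k | inj₁ k' = subst₂ _<_ (cong proj₁ (sym (f-μ k))) (cong proj₁ (sym (f-μ k'))) (proj₁ (Fp.g-down _ (SY'.hi∈ k) (SY'.hi∈ k') _ ≤-refl))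
      ... | inj₂ k | inj₂ k' = subst₂ _<_ (sym (V-a k)) (sym (V-a k')) (+-monoʳ-< m (proj₁ (Fa.g-down j k k' _ ≤-refl)))
      ... | inj₂ k | inj₁ k' = ⊥-elim (<⇒≱ (<outer k') (≤-trans (proj₁ Pμ₂ i) (inner≤ k)))
      ... | inj₁ k | inj₂ k' with m ≤? V (i , j)
      ...   | no ¬q = subst (V (i , j) <_) (sym (V-a k')) (<-≤-trans (≰⇒> ¬q) (m≤m+n m _))
      ...   | yes q = subst (V (i , j) <_) (sym (V-a k')) (≤-trans (≤-reflexive (cong suc (sym (m+[n∸m]≡n q))))
                (subst (_≤ m + proj₁ (a.f (suc i , j))) (+-suc m _) (+-monoʳ-≤ m (s≤s⁻¹ (s≤s⁻¹ (+-cancelʳ-≤ j _ _ (begin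
                  suc (suc (suc (V (i , j) ∸ m))) + j  ≤⟨ s≤s (≰⇒> λ s → no-rule k (subst (λ z → SatV r m (proj₁ z) i j) (f-μ k) (q , s))) ⟩
                  suc (r + i)                          ≡⟨ +-suc r i ⟨
                  r + suc i                            ≤⟨ rule k' ⟩
                  suc (proj₁ (a.f (suc i , j))) + j    ≤⟨ n≤1+n _ ⟩
                  suc (suc (proj₁ (a.f (suc i , j)))) + j  ∎)))))))
        where open ≤-Reasoning

      V-rights : ∀ {i j j'} → j ≤ j' → (i , j') ∈ₛ A → V (i , j) ≤ V (i , j')
      V-rights {j' = zero} z≤n h = ≤-refl
      V-rights {j' = suc j'} l h with m≤n⇒m<n∨m≡n l
      ... | inj₁ l' = ≤-trans (V-rights (s≤s⁻¹ l') (in-left (n≤1+n j') h)) (V-right h)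
      ... | inj₂ refl = ≤-refl

      V-downs : ∀ {i i' j} → i < i' → (i' , j) ∈ₛ A → V (i , j) < V (i' , j)
      V-downs {i' = suc i'} l h with m≤n⇒m<n∨m≡n (s≤s⁻¹ l)
      ... | inj₁ l' = <-trans (V-downs l' (in-up Pα₂ (n≤1+n i') h)) (V-down h)
      ... | inj₂ refl = V-down h

      -- In a common row of λ₁ the boxes of λ₁/μ₁ lie to the right of those of μ₁/α₁ and hence come
      -- first in ≺.
      cross-f : ∀ {x d} → x ∈ₛ SX'.X → d ∈ₛ (μ₁ /ₛ α₁) → proj₁ x ≤ m + proj₁ d → x ≺ lo d
      cross-f {d = i' , j'} x∈ h l with SX'.view x∈
      ... | SX'.isHi k = SX'.hi≺lo k
      ... | SX'.isLo {i , j} k with m≤n⇒m<n∨m≡n (+-cancelˡ-≤ m i i' l)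
      ...   | inj₁ q = SX.lo-≺ (above q)
      ...   | inj₂ refl = SX.lo-≺ (right (<-≤-trans (<outer h) (inner≤ k)))

      f-hi : ∀ {c d} → c ∈ₛ A → d ∈ₛ A → V c ≤ V d → (d ∈ₛ (μ₂ /ₛ []) → c ∈ₛ (μ₂ /ₛ [])) →
        (c ∈ₛ (μ₂ /ₛ []) → d ∈ₛ (μ₂ /ₛ []) → p'.f (hi c) ≺ p'.f (hi d)) →
        (c ∈ₛ (α₂ /ₛ μ₂) → d ∈ₛ (α₂ /ₛ μ₂) → a.f c ≺ a.f d) → f (hi c) ≺ f (hi d)
      f-hi {c} {d} c∈ d∈ l cl pp aa with split-α {μ₂} c∈ | split-α {μ₂} d∈
      ... | inj₁ k | inj₁ k' = subst₂ _≺_ (sym (f-μ k)) (sym (f-μ k')) (pp k k')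
      ... | inj₂ k | inj₂ k' = subst₂ _≺_ (sym (f-a k)) (sym (f-a k')) (SX.lo-≺ (aa k k'))
      ... | inj₂ k | inj₁ k' = ⊥-elim (<⇒≱ (<outer (cl k')) (inner≤ k))
      ... | inj₁ k | inj₂ k' = subst₂ _≺_ (sym (f-μ k)) (sym (f-a k'))
              (cross-f (p'.f∈ (SY'.hi∈ k)) (a.f∈ k') (subst₂ _≤_ (cong proj₁ (f-μ k)) (V-a k') l))

      step→ : ∀ {i j} → SY.→View i j → f (i , j) ≺ f (i , suc j)
      step→ (SY.hi→ h k) = f-hi h k (V-right k) (in-left (n≤1+n _))
        (λ x y → p'.f→ (SY'.hi∈ x) (SY'.hi∈ y)) a.f→
      step→ (SY.lo→ h k) = subst₂ _≺_ (sym (f-β h)) (sym (f-β k)) (p'.f→ (SY'.lo∈ h) (SY'.lo∈ k))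

      step↓ : ∀ {i j} → SY.↓View Pα₂ Pβ IsPart-[] (λ _ → z≤n) i j → f (i , j) ≺ f (suc i , j)
      step↓ (SY.hi↓ h k) = f-hi h k (<⇒≤ (V-down k)) (in-up Pμ₂ (n≤1+n _))
        (λ x y → p'.f↓ (SY'.hi∈ x) (SY'.hi∈ y)) a.f↓
      step↓ (SY.lo↓ {i} {j} h k) = subst₂ _≺_ (sym (f-β h))
        (trans (cong (λ z → p'.f (z , j)) (sym (+-suc SY'.m i))) (trans (sym (f-β k)) (cong (λ z → f (z , j)) (+-suc n i))))
        (p'.f↓ (SY'.lo∈ h) (subst (λ z → (z , j) ∈ₛ SY'.X) (+-suc SY'.m i) (SY'.lo∈ k)))

      g-keep : ∀ {d e} → d ∈ₛ SX'.X → e ∈ₛ SX'.X → p'.g d ≺ p'.g e → g d ≺ g e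
      g-keep x y o = subst₂ _≺_ (sym (g-X' x)) (sym (g-X' y)) (kept-≺ (ι-kept (p'.g∈ x)) (ι-kept (p'.g∈ y)) o)

      -- If e comes from β, it comes after all of α₂. Otherwise e comes from a box (i' , j') of μ₂
      -- that fails the rule with the row of e, while d comes from (i , j), which satisfies it with
      -- the row of d, and this row is not larger. So i ≥ i' implies j' < j. For i = i' this is the
      -- claim; for i > i' the entries of V would increase strictly from (i' , j') to (i , j),
      -- against the rows of d and e.
      cross-g : ∀ {d e} → d ∈ₛ (μ₁ /ₛ α₁) → e ∈ₛ SX'.L → proj₁ d ≤ proj₁ e → g (lo d) ≺ g (lo e)
      cross-g {d} {e} x y l = subst₂ _≺_ (sym (g-μ₁ x)) (sym (g-X' (SX'.lo∈ y))) (go (ι-kept (p'.g∈ (SX'.lo∈ y))) (p'.fg (SX'.lo∈ y)))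
        where
        go : ∀ {c c'} → Kept c c' → p'.f c' ≡ lo e → hi (a.g d) ≺ c
        go (β-box _) _ = SY.hi≺lo (in-α (a.g∈ x))
        go (μ-box {i' , j'} k) e≡ = SY.hi-≺ (position (a.g d) refl)
          where
          unsat : suc (proj₁ e) + j' < r + i'
          unsat = ≰⇒> λ s → no-rule k (subst (λ z → SatV r m (proj₁ z) i' j') (sym e≡)
            (m≤m+n m _ , subst (Sat r i' j') (sym (m+n∸m≡n m (proj₁ e))) s))
          position : ∀ c → a.g d ≡ c → c ≺ (i' , j')
          position (i , j) ec with <-cmp i i'
          ... | tri< q _ _ = above q
          ... | tri≈ _ refl _ = right (+-cancelˡ-< (suc (proj₁ d)) _ _ (begin-strict
                suc (proj₁ d) + j'  ≤⟨ s≤s (+-monoˡ-≤ j' l) ⟩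
                suc (proj₁ e) + j'  <⟨ unsat ⟩
                r + i               ≤⟨ satd ⟩
                suc (proj₁ d) + j   ∎))
            where
            open ≤-Reasoning
            satd : r + i ≤ suc (proj₁ d) + j
            satd = subst (λ z → Sat r i j (proj₁ z)) (trans (cong a.f (sym ec)) (a.fg x)) (rule (subst (_∈ₛ (α₂ /ₛ μ₂)) ec (a.g∈ x)))
          ... | tri> _ _ q = ⊥-elim (<⇒≱ (≤-<-trans (V-rights (<⇒≤ j'<j) (in-up Pα₂ (<⇒≤ q) ij)) (V-downs q ij)) (begin
                V (i , j)          ≡⟨ V-a ij' ⟩
                m + proj₁ (a.f (i , j))  ≡⟨ cong (λ z → m + proj₁ z) (trans (cong a.f (sym ec)) (a.fg x)) ⟩
                m + proj₁ d        ≤⟨ +-monoʳ-≤ m l ⟩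
                m + proj₁ e        ≡⟨ cong proj₁ e≡ ⟨
                proj₁ (p'.f (hi (i' , j')))  ≡⟨ cong proj₁ (f-μ k) ⟨
                V (i' , j')        ∎))
            where
            open ≤-Reasoning
            ij' : (i , j) ∈ₛ (α₂ /ₛ μ₂)
            ij' = subst (_∈ₛ (α₂ /ₛ μ₂)) ec (a.g∈ x)
            ij : (i , j) ∈ₛ A
            ij = in-α ij'
            j'<j : j' < j
            j'<j = +-cancelˡ-< (suc (proj₁ d)) _ _ (begin-strict
                suc (proj₁ d) + j'  ≤⟨ s≤s (+-monoˡ-≤ j' l) ⟩
                suc (proj₁ e) + j'  <⟨ unsat ⟩
                r + i'              ≤⟨ +-monoʳ-≤ r (<⇒≤ q) ⟩
                r + i               ≤⟨ subst (λ z → Sat r i j (proj₁ z)) (trans (cong a.f (sym ec)) (a.fg x)) (rule ij') ⟩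
                suc (proj₁ d) + j   ∎)

      g-lo : ∀ {d e} → d ∈ₛ L₀ → e ∈ₛ L₀ → proj₁ d ≤ proj₁ e → (proj₂ e < at μ₁ (proj₁ e) → proj₂ d < at μ₁ (proj₁ d)) →
        (d ∈ₛ (μ₁ /ₛ α₁) → e ∈ₛ (μ₁ /ₛ α₁) → a.g d ≺ a.g e) →
        (lo d ∈ₛ SX'.X → lo e ∈ₛ SX'.X → p'.g (lo d) ≺ p'.g (lo e)) → g (lo d) ≺ g (lo e)
      g-lo {i , j} {i' , j'} d∈ e∈ l cl aa pp with j <? at μ₁ i | j' <? at μ₁ i'
      ... | yes q | yes q' = let x = ins (inner≤ d∈) q ; y = ins (inner≤ e∈) q' in
            subst₂ _≺_ (sym (g-μ₁ x)) (sym (g-μ₁ y)) (SY.hi-≺ (aa x y))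
      ... | yes q | no ¬q' = cross-g (ins (inner≤ d∈) q) (ins (≮⇒≥ ¬q') (<outer e∈)) l
      ... | no ¬q | yes q' = ⊥-elim (¬q (cl q'))
      ... | no ¬q | no ¬q' = let x = SX'.lo∈ (ins (≮⇒≥ ¬q) (<outer d∈)) ; y = SX'.lo∈ (ins (≮⇒≥ ¬q') (<outer e∈)) in
            g-keep x y (pp x y)

      gstep→ : ∀ {i j} → SX.→View i j → g (i , j) ≺ g (i , suc j)
      gstep→ (SX.hi→ h k) = g-keep (SX'.hi∈ h) (SX'.hi∈ k) (p'.g→ (SX'.hi∈ h) (SX'.hi∈ k))
      gstep→ (SX.lo→ h k) = g-lo h k ≤-refl (<-trans (n<1+n _)) a.g→ p'.g→

      gstep↓ : ∀ {i j} → SX.↓View Pλ₂ Pλ₁ Pα₁ α⊆λ i j → g (i , j) ≺ g (suc i , j)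
      gstep↓ (SX.hi↓ h k) = g-keep (SX'.hi∈ h) (SX'.hi∈ k) (p'.g↓ (SX'.hi∈ h) (SX'.hi∈ k))
      gstep↓ (SX.lo↓ {i} {j} h k) = subst (λ z → g (m + i , j) ≺ g (z , j)) (+-suc m i)
        (g-lo h k (n≤1+n i) (λ q → <-≤-trans q (proj₁ Pμ₁ i)) a.g↓
          (λ x y → subst (λ z → p'.g (m + i , j) ≺ p'.g (z , j)) (sym (+-suc m i))
            (p'.g↓ x (subst (λ z → (z , j) ∈ₛ SX'.X) (+-suc m i) y))))

      p : Pict Y X
      p = record
        { f = f ; g = g
        ; f∈ = λ c∈ → f-in (onY c∈) ; g∈ = λ d∈ → g-in (onX d∈)
        ; gf = λ c∈ → g-f (onY c∈) ; fg = λ d∈ → f-g (onX d∈)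
        ; f→ = λ x y → step→ (SY.view→ x y)
        ; f↓ = λ x y → step↓ (SY.view↓ Pα₂ Pβ IsPart-[] (λ _ → z≤n) x y)
        ; g→ = λ x y → gstep→ (SX.view→ x y)
        ; g↓ = λ x y → gstep↓ (SX.view↓ Pλ₂ Pλ₁ Pα₁ α⊆λ x y) }
        where
        f-in : ∀ {c} → OnY c → f c ∈ₛ X
        f-in (kept k) = let _ , y , e = kept-Y k in subst (_∈ₛ X) (sym e) (X'-in (p'.f∈ y))
        f-in (sat-box h) = subst (_∈ₛ X) (sym (f-a h)) (μ₁-in (a.f∈ h))
        g-in : ∀ {d} → OnX d → g d ∈ₛ Y
        g-in (in-X' x) = subst (_∈ₛ Y) (sym (g-X' x)) (proj₁ (kept-Y (ι-kept (p'.g∈ x))))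
        g-in (in-μ₁ x) = subst (_∈ₛ Y) (sym (g-μ₁ x)) (SY.hi∈ (in-α (a.g∈ x)))
        g-f : ∀ {c} → OnY c → g (f c) ≡ c
        g-f (kept k) = let _ , y , e = kept-Y k in trans (cong g e) (trans (g-X' (p'.f∈ y))
          (trans (cong ι (p'.gf y)) (kept-fun (ι-kept y) k)))
        g-f (sat-box h) = trans (cong g (f-a h)) (trans (g-μ₁ (a.f∈ h)) (cong hi (a.gf h)))
        f-g : ∀ {d} → OnX d → f (g d) ≡ d
        f-g (in-X' x) = trans (cong f (g-X' x)) (trans (proj₂ (proj₂ (kept-Y (ι-kept (p'.g∈ x))))) (p'.fg x))
        f-g (in-μ₁ x) = trans (cong f (g-μ₁ x)) (trans (f-a (a.g∈ x)) (cong lo (a.fg x)))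

      glued : Glued μ₁ μ₂ p p' a
      glued = record { μ⊆α = μ⊆α ; on-μ = f-μ ; on-β = f-β ; on-a = f-a ; rule = rule ; no-rule = no-rule }

-- The row rules and the diffusion condition in terms of pictures

row-rule⁻ : ∀ r i j a → T (rowRule r (i , j) ℤ.≤ᵇ row1 a) → Sat r i j a
row-rule⁻ r i j a t = ℤₚ.drop‿+≤+ (subst (ℤ._≤ ℤ.+ (suc a + j)) cancel (ℤₚ.+-monoˡ-≤ (ℤ.+ j) (ℤₚ.≤ᵇ⇒≤ {rowRule r (i , j)} {row1 a} t)))
  where
  cancel : rowRule r (i , j) ℤ.+ ℤ.+ j ≡ ℤ.+ (r + i)
  cancel = trans (ℤₚ.+-assoc (ℤ.+ (r + i)) (ℤ.- ℤ.+ j) (ℤ.+ j))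
    (trans (cong (λ z → ℤ.+ (r + i) ℤ.+ z) (ℤₚ.+-inverseˡ (ℤ.+ j))) (ℤₚ.+-identityʳ _))

row-rule⁺ : ∀ r i j a → Sat r i j a → T (rowRule r (i , j) ℤ.≤ᵇ row1 a)
row-rule⁺ r i j a h = ℤₚ.≤⇒≤ᵇ (subst (rowRule r (i , j) ℤ.≤_) cancel (ℤₚ.+-monoˡ-≤ (ℤ.- ℤ.+ j) (ℤ.+≤+ h)))
  where
  cancel : ℤ.+ (suc a + j) ℤ.+ (ℤ.- ℤ.+ j) ≡ ℤ.+ suc a
  cancel = trans (ℤₚ.+-assoc (ℤ.+ suc a) (ℤ.+ j) (ℤ.- ℤ.+ j))
    (trans (cong (λ z → ℤ.+ suc a ℤ.+ z) (ℤₚ.+-inverseʳ (ℤ.+ j))) (ℤₚ.+-identityʳ _))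

module _ {S L : Skew} (p : Pict S L) where
  open Pict p

  private
    inj : ∀ {a b} → a ∈ₛ S → b ∈ₛ S → lab L (f a) ≡ lab L (f b) → a ≡ b
    inj = Std.F-inj (pict-Std p)

  posOf-tab : ∀ {c} → c ∈ₛ S → posOf S (tab p) (lab L (f c)) ≡ c
  posOf-tab m = posOf-fill (λ c → lab L (f c)) m inj

  -- The rules of the definitions run over labels, a picture runs over boxes. A label that stands at
  -- `c` in `tab p` stands at `f c` in `rl`.
  on-labels⁻ : ∀ {P : Cell → Cell → Set} → (∀ {l} → l ∈ range 1 (suc (nCells S)) → P (posOf S (tab p) l) (cellOf L l)) →
    ∀ {c} → c ∈ₛ S → P c (f c)
  on-labels⁻ {P} h {c} m = subst₂ P (posOf-tab m) (cellOf-lab (f∈ m))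
    (h (let a , b = lab-range (f∈ m) in ∈-range⁺ a (s≤s (subst (lab L (f c) ≤_) (sym (pict-size p)) b))))

  on-labels⁺ : ∀ {P : Cell → Cell → Set} → (∀ {c} → c ∈ₛ S → P c (f c)) →
    ∀ {l} → l ∈ range 1 (suc (nCells S)) → P (posOf S (tab p) l) (cellOf L l)
  on-labels⁺ {P} h m with ∈-range⁻ {1} {suc (nCells S)} m
  ... | a , b with Std.F-sur (pict-Std p) a (s≤s⁻¹ b)
  ...   | c , c∈ , refl = subst₂ P (sym (posOf-tab c∈)) (sym (cellOf-lab (f∈ c∈))) (h c∈)

barred⁻ : ∀ r α₁ γ λ₁ λ₂ (p : Pict (γ /ₛ λ₂) (λ₁ /ₛ α₁)) → T (barredRowRule r α₁ γ λ₁ λ₂ (tab p)) →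
  ∀ {i j} → (i , j) ∈ₛ (γ /ₛ λ₂) → Sat r i j (proj₁ (Pict.f p (i , j)))
barred⁻ r α₁ γ λ₁ λ₂ p t {i} {j} m =
  on-labels⁻ p {λ c d → Sat r (proj₁ c) (proj₂ c) (proj₁ d)} (λ {l} l∈ → row-rule⁻ r (rowOf (γ /ₛ λ₂) (tab p) l) (colOf (γ /ₛ λ₂) (tab p) l) (rowOf (λ₁ /ₛ α₁) (rl (λ₁ /ₛ α₁)) l) (allB⁻ t l∈)) m

barred⁺ : ∀ r α₁ γ λ₁ λ₂ (p : Pict (γ /ₛ λ₂) (λ₁ /ₛ α₁)) →
  (∀ {i j} → (i , j) ∈ₛ (γ /ₛ λ₂) → Sat r i j (proj₁ (Pict.f p (i , j)))) → T (barredRowRule r α₁ γ λ₁ λ₂ (tab p))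
barred⁺ r α₁ γ λ₁ λ₂ p h = allB⁺ (range 1 (suc (nCells (γ /ₛ λ₂)))) λ {l} l∈ →
  row-rule⁺ r (rowOf (γ /ₛ λ₂) (tab p) l) (colOf (γ /ₛ λ₂) (tab p) l) (rowOf (λ₁ /ₛ α₁) (rl (λ₁ /ₛ α₁)) l)
    (on-labels⁺ p {λ c d → Sat r (proj₁ c) (proj₂ c) (proj₁ d)} h l∈)

rule⁻ : ∀ r α₁ α₂ β₁ β₂ (p : Pict (β₁ /ₛ α₁) (α₂ /ₛ β₂)) → T (rowRuleOK r α₁ α₂ β₁ β₂ (tab p)) →
  ∀ {i j} → (i , j) ∈ₛ (α₂ /ₛ β₂) → Sat r i j (proj₁ (Pict.g p (i , j)))
rule⁻ r α₁ α₂ β₁ β₂ p t {i} {j} m = subst (λ d → Sat r (proj₁ d) (proj₂ d) (proj₁ (Pict.g p (i , j)))) (Pict.fg p m)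
  (on-labels⁻ p {λ c d → Sat r (proj₁ d) (proj₂ d) (proj₁ c)} (λ {l} l∈ → row-rule⁻ r (proj₁ (cellOf (α₂ /ₛ β₂) l)) (proj₂ (cellOf (α₂ /ₛ β₂) l)) (rowOf (β₁ /ₛ α₁) (tab p) l) (allB⁻ t l∈)) (Pict.g∈ p m))

rule⁺ : ∀ r α₁ α₂ β₁ β₂ (p : Pict (β₁ /ₛ α₁) (α₂ /ₛ β₂)) →
  (∀ {i j} → (i , j) ∈ₛ (α₂ /ₛ β₂) → Sat r i j (proj₁ (Pict.g p (i , j)))) → T (rowRuleOK r α₁ α₂ β₁ β₂ (tab p))
rule⁺ r α₁ α₂ β₁ β₂ p h = allB⁺ (range 1 (suc (nCells (β₁ /ₛ α₁)))) λ {l} l∈ →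
  row-rule⁺ r (proj₁ (cellOf (α₂ /ₛ β₂) l)) (proj₂ (cellOf (α₂ /ₛ β₂) l)) (rowOf (β₁ /ₛ α₁) (tab p) l)
    (on-labels⁺ p {λ c d → Sat r (proj₁ d) (proj₂ d) (proj₁ c)}
      (λ {c} m → subst (λ z → Sat r (proj₁ (Pict.f p c)) (proj₂ (Pict.f p c)) (proj₁ z)) (Pict.gf p m) (h (Pict.f∈ p m))) l∈)

-- The filling with a given reading word

readStep : Skew → (List ℕ → List ℕ → List ℕ) → List ℕ → List ℕ → List ℕ
readStep sh G []       w = []
readStep sh G (i ∷ is) w = reverse (proj₁ (splitAt (rowLen sh i) w)) ++ G is (proj₂ (splitAt (rowLen sh i) w))

-- Here `w` is both a parameter of the local function and its argument, so the equation for it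
-- becomes solvable only after one unfolding, when the rest of the word is a variable of its own.
-- `readStep` is that unfolding.
mutual
  readD : Skew → List ℕ → List ℕ → List ℕ → List ℕ
  readD = _

  fromReading-readD : ∀ sh w → fromReading sh w ≡ readStep sh (readD sh w) (range 0 (length (outer sh))) w
  fromReading-readD sh w with range 0 (length (outer sh))
  ... | [] = refl
  ... | i ∷ is with proj₂ (splitAt (rowLen sh i) w)
  ...   | w' = refl

readD-step : ∀ sh w is w' → readD sh w is w' ≡ readStep sh (readD sh w) is w'
readD-step sh w []       w' = refl
readD-step sh w (i ∷ is) w' = refl

take-applyUpTo : ∀ {A : Set} (h : ℕ → A) a b → take a (applyUpTo h (a + b)) ≡ applyUpTo h a
take-applyUpTo h zero    b = refl
take-applyUpTo h (suc a) b = cong (h 0 ∷_) (take-applyUpTo (h ∘ suc) a b)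

drop-applyUpTo : ∀ {A : Set} (h : ℕ → A) a b → drop a (applyUpTo h (a + b)) ≡ applyUpTo (λ t → h (a + t)) b
drop-applyUpTo h zero    b = refl
drop-applyUpTo h (suc a) b = drop-applyUpTo (h ∘ suc) a b

fromReading-fill : ∀ sh (h : ℕ → ℕ) → fromReading sh (applyUpTo h (nCells sh)) ≡ fill sh (λ c → h (lab sh c ∸ 1))
fromReading-fill sh h = begin
    fromReading sh w                              ≡⟨ fromReading-readD sh w ⟩
    readStep sh (readD sh w) (range 0 len) w      ≡⟨ readD-step sh w (range 0 len) w ⟨
    readD sh w (range 0 len) w                    ≡⟨ cong (readD sh w (range 0 len)) (cong (applyUpTo h) (nCells-psum sh)) ⟩
    readD sh w (range 0 len) (applyUpTo h (psum (rowLen sh) len))  ≡⟨ go 0 len ⟩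
    concat (applyUpTo rowF len)                   ≡⟨ cong concat (applyUpTo-cong len λ {i} _ → rowEq i) ⟩
    concat (applyUpTo (λ i → map F (cellRow i)) len)  ≡⟨ cong concat (map-applyUpTo cellRow (map F) len) ⟨
    concat (map (map F) (applyUpTo cellRow len))  ≡⟨ concat-map (applyUpTo cellRow len) ⟩
    map F (concat (applyUpTo cellRow len))        ≡⟨ cong (map F) (cells-rows sh) ⟨
    fill sh F                                     ∎
  where
  open ≡-Reasoning
  len = length (outer sh)
  w = applyUpTo h (nCells sh)
  F : Cell → ℕ
  F c = h (lab sh c ∸ 1)
  cellRow : ℕ → List Cell
  cellRow i = map (i ,_) (range (at (inner sh) i) (at (outer sh) i))
  rowF : ℕ → List ℕ
  rowF i = reverse (applyUpTo (λ t → h (psum (rowLen sh) i + t)) (rowLen sh i))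
  go : ∀ a k → readD sh w (applyUpTo (λ i → a + i) k)
      (applyUpTo (λ t → h (psum (rowLen sh) a + t)) (psum (λ i → rowLen sh (a + i)) k))
    ≡ concat (applyUpTo (λ i → rowF (a + i)) k)
  go a zero    = refl
  go a (suc k) = cong₂ _++_
    (cong reverse (trans (cong proj₁ (splitAt-defn (rowLen sh (a + 0)) W)) (trans (cong (take (rowLen sh (a + 0)) ∘ applyUpTo H) (psum-cons f k))
      (trans (take-applyUpTo H (rowLen sh (a + 0)) _)
        (applyUpTo-cong (rowLen sh (a + 0)) λ {t} _ → cong (λ z → h (psum (rowLen sh) z + t)) (sym (+-identityʳ a)))))))
    (trans (cong₂ (readD sh w) (applyUpTo-cong k λ {i} _ → +-suc a i)
        (trans (cong proj₂ (splitAt-defn (rowLen sh (a + 0)) W)) (trans (cong (drop (rowLen sh (a + 0)) ∘ applyUpTo H) (psum-cons f k))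
          (trans (drop-applyUpTo H (rowLen sh (a + 0)) _)
          (trans (cong (applyUpTo (λ t → H (rowLen sh (a + 0) + t))) (psum-cong k λ {i} _ → cong (rowLen sh) (+-suc a i)))
            (applyUpTo-cong _ λ {t} _ → cong h (trans (sym (+-assoc (psum (rowLen sh) a) _ t))
              (cong (λ z → psum (rowLen sh) a + rowLen sh z + t) (+-identityʳ a)))))))))
      (trans (go (suc a) k) (cong concat (applyUpTo-cong k λ {i} _ → cong rowF (sym (+-suc a i))))))
    where
    H : ℕ → ℕ
    H t = h (psum (rowLen sh) a + t)
    f : ℕ → ℕ
    f i = rowLen sh (a + i)
    W = applyUpTo H (psum f (suc k))
  rowEq : ∀ i → rowF i ≡ map F (cellRow i)
  rowEq i = trans (reverse-applyUpTo-∸ _ (rowLen sh i)) (trans (applyUpTo-cong (rowLen sh i) λ {t} t< → cong h (index' t<))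
      (trans (sym (map-applyUpTo (λ t → i , at (inner sh) i + t) F (rowLen sh i)))
        (cong (map F) (sym (map-applyUpTo (λ t → at (inner sh) i + t) (i ,_) (rowLen sh i))))))
    where
    index' : ∀ {t} → t < rowLen sh i → psum (rowLen sh) i + (rowLen sh i ∸ suc t) ≡ lab sh (i , at (inner sh) i + t) ∸ 1
    index' {t} t< = trans (cong (psum (rowLen sh) i +_) (trans (∸-suc' (rowLen sh i) t) (cong (_∸ 1) (rowLen-∸ (at (outer sh) i) (at (inner sh) i) t<))))
      (sym (+-∸-assoc (psum (rowLen sh) i) (subst (1 ≤_) (rowLen-∸ (at (outer sh) i) (at (inner sh) i) t<) (m<n⇒0<n∸m t<))))
      where
      ∸-suc' : ∀ n t → n ∸ suc t ≡ (n ∸ t) ∸ 1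
      ∸-suc' n t = trans (cong (n ∸_) (+-comm 1 t)) (sym (∸-+-assoc n t 1))

mutual
  checkV : ℕ → List ℕ → List ℕ → List ℕ → List ℕ → List ℕ → List ℕ → Filling → Filling → Filling → Cell → Maybe ℕ → Bool
  checkV = _

  diffusion-check : ∀ r α₁ α₂ β γ λ₁ λ₂ t u w {i j} → T (diffusion r α₁ α₂ β γ λ₁ λ₂ t u) →
    w ∈ permutations (size γ) → T (sameTableau (proj₁ (RScols w)) γ (Utilde γ λ₂ u) ∧ sameTableau (proj₂ (RScols w)) γ t) →
    (i , j) ∈ filterᵇ (λ c → proj₁ c <ᵇ length α₂) (cells (star β α₂)) →
    checkV r α₁ α₂ β γ λ₁ λ₂ t u (fromReading (star β α₂) w) (i , j) (entryAt (star β α₂) (fromReading (star β α₂) w) (i , j)) ≡ true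
  diffusion-check r α₁ α₂ β γ λ₁ λ₂ t u w {i} {j} h w∈ s m with T-true (allB⁻ (if-true s (allB⁻ h w∈)) m)
  ... | z with fromReading (star β α₂) w
  ...   | v with entryAt (star β α₂) v (i , j)
  ...     | x = z

∈-permutations⁺ : ∀ {n w} → length w ≡ n → w ↭ range 1 (suc n) → w ∈ permutations n
∈-permutations⁺ {n} {w} refl p = ∈-filterᵇ⁺ {p = λ w → allB (λ v → count v w ≡ᵇ 1) (range 1 (suc n))}
  (∈-allWords⁺ (All.tabulate λ m → let a , b = ∈-range⁻ {1} {suc n} (Permₚ.∈-resp-↭ p m) in a , s≤s⁻¹ b))
  (allB⁺ {p = λ v → count v w ≡ᵇ 1} (range 1 (suc n)) λ {v} m → ≡⇒≡ᵇ (count v w) 1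
    (count-Unique (Unique-↭ (↭-sym p) (Unique-range 1 (suc n))) (Permₚ.∈-resp-↭ (↭-sym p) m)))

∈-permutations⁻ : ∀ n {w} → w ∈ permutations n → Unique w × length w ≡ n
∈-permutations⁻ n {w} m with ∈-filterᵇ⁻ {p = λ w → allB (λ v → count v w ≡ᵇ 1) (range 1 (suc n))} {xs = allWords n n} m
... | m' , t with ∈-allWords⁻ n n m'
...   | len , _ = Unique-↭ (pigeonhole (Unique-range 1 (suc n))
          (λ {v} v∈ → count-∈ v w λ z → case trans (sym z) (≡ᵇ⇒≡ _ _ (allB⁻ {p = λ v → count v w ≡ᵇ 1} t v∈)) of λ ())
          (≤-reflexive (trans len (sym (length-range 1 (suc n)))))) (Unique-range 1 (suc n)) , len

T-if⁺ : ∀ {b x : Bool} → (T b → T x) → T (if b then x else true)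
T-if⁺ {true}  h = h tt
T-if⁺ {false} h = tt

-- The condition runs over all words with the given pair of tableaux. By injectivity of the
-- correspondence `word p` is the only one, and its filling of β * α₂ gives each box the label of
-- its image under p. The entries above k are then the boxes sent to λ₁/α₁.
module Diffusion (r : ℕ) (α₁ α₂ β λ₁ λ₂ γ : List ℕ) (Pα₁ : IsPart α₁) (Pα₂ : IsPart α₂) (Pβ : IsPart β)
  (Pλ₁ : IsPart λ₁) (Pλ₂ : IsPart λ₂) (α⊆λ : ∀ i → at α₁ i ≤ at λ₁ i)
  (p : Pict (Star α₂ β []) (Star λ₂ λ₁ α₁)) (u t : Filling) (rel : RSrel p γ (Utilde γ λ₂ u) t)
  (size≡ : size γ ≡ nCells (Star α₂ β [])) where

  private
    module SY = StarShape α₂ β []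
    module SX = StarShape λ₂ λ₁ α₁
    open SY using (hi) renaming (X to Y; m to n)
    open SX using (X; L; m; lo)
    open Pict p
    cY : Convex Y
    cY = SY.convex-star Pα₂ Pβ IsPart-[] (λ _ → z≤n)
    cX : Convex X
    cX = SX.convex-star Pλ₂ Pλ₁ Pα₁ α⊆λ
    open Word cY cX p

    w-perm : w ∈ permutations (size γ)
    w-perm = ∈-permutations⁺ (trans w-length (sym size≡))
      (subst (λ k → w ↭ range 1 (suc k)) (sym (trans size≡ (pict-size p))) w-↭)

    Same : Cols × Cols → Set
    Same z = T (sameTableau (proj₁ z) γ (Utilde γ λ₂ u) ∧ sameTableau (proj₂ z) γ t)

    w-tableaux : T (sameTableau (proj₁ (RScols w)) γ (Utilde γ λ₂ u) ∧ sameTableau (proj₂ (RScols w)) γ t)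
    w-tableaux = subst Same (sym (RScols-RSʷ w w-unique)) $ T-∧⁺ {sameTableau (proj₁ (RSʷ w)) γ (Utilde γ λ₂ u)}
      (sameTableau⁺ (proj₁ (RSʷ w)) γ _ (RSrel.shape≡ rel) (RSrel.insertion≡ rel))
      (sameTableau⁺ (proj₂ (RSʷ w)) γ t (trans (shape⇒shapeOf (SS-Shape (Recording.Q-SS w w-unique)) (SS-Shape (RSw.P-SS w))
        (sym (RSw.same-shape w))) (RSrel.shape≡ rel)) (RSrel.recording≡ rel))

    w-only : ∀ w' → w' ∈ permutations (size γ) →
      T (sameTableau (proj₁ (RScols w')) γ (Utilde γ λ₂ u) ∧ sameTableau (proj₂ (RScols w')) γ t) → w' ≡ w
    w-only w' w'∈ s with ∈-permutations⁻ (size γ) w'∈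
    ... | uw' , _ with subst Same (RScols-RSʷ w' uw') s
    ...   | s' with sameTableau⁻ (proj₁ (RSʷ w')) γ (Utilde γ λ₂ u) (T-∧ˡ s')
        | sameTableau⁻ (proj₂ (RSʷ w')) γ t (T-∧ʳ {sameTableau (proj₁ (RSʷ w')) γ (Utilde γ λ₂ u)} s')
    ...     | a , b | _ , c = RS-same (trans a (sym (RSrel.shape≡ rel)))
        (trans b (sym (RSrel.insertion≡ rel))) (trans c (sym (RSrel.recording≡ rel)))

    entry : ∀ {c} → c ∈ₛ Y → entryAt (star β α₂) (fromReading (star β α₂) w) c ≡ just (lab X (f c))
    entry {c} m∈ = subst (λ S → entryAt S (fromReading S w) c ≡ just (lab X (f c))) (sym (star≡Star β α₂))
      (trans (cong (λ e → entryAt Y e c) (fromReading-fill Y (λ i → lab X (f (cellOf Y (suc i))))))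
        (trans (entry-fill {Y} (λ c → lab X (f (cellOf Y (suc (lab Y c ∸ 1))))) m∈)
          (cong (λ z → just (lab X (f z))) (trans (cong (cellOf Y) (lab-suc∸ m∈)) (cellOf-lab m∈)))))

    α-boxes : List Cell
    α-boxes = filterᵇ (λ c → proj₁ c <ᵇ length α₂) (cells (star β α₂))

    hi∈α : ∀ {c} → c ∈ₛ SY.H → hi c ∈ α-boxes
    hi∈α {c} h = ∈-filterᵇ⁺ {p = λ c → proj₁ c <ᵇ length α₂} (subst (λ S → hi c ∈ cells S) (sym (star≡Star β α₂)) (∈cells⁺ (SY.hi∈ h)))
      (<⇒<ᵇ (SY.hi< h))

    α⇒hi : ∀ {c} → c ∈ α-boxes → ∃[ d ] c ≡ hi d × d ∈ₛ SY.H
    α⇒hi {c} m∈ with ∈-filterᵇ⁻ {p = λ c → proj₁ c <ᵇ length α₂} {xs = cells (star β α₂)} m∈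
    ... | m' , l with SY.view (∈cells⁻ {Y} (subst (λ S → c ∈ cells S) (star≡Star β α₂) m'))
    ...   | SY.isHi h = _ , refl , h
    ...   | SY.isLo {d} _ = ⊥-elim (<⇒≱ (<ᵇ⇒< _ n l) (SY.lo-row≥ d))

    checkT : Cell → Maybe ℕ → Bool
    checkT = checkV r α₁ α₂ β γ λ₁ λ₂ t u (fromReading (star β α₂) w)

    check-big : ∀ i j {d} → d ∈ₛ L → checkT (i , j + firstRow β) (just (lab X (lo d))) ≡
      not (rowRule r (i , j) ℤ.≤ᵇ row1 (proj₁ d))
    check-big i j {d} l = trans (if-yes (<⇒<ᵇ big)) (cong₂ (λ a b → not (rowRule r (i , a) ℤ.≤ᵇ row1 (proj₁ b)))
        (m+n∸n≡m j (firstRow β)) (trans (cong (cellOf L) (trans (cong (_∸ size λ₂) (SX.lab-lo-star d)) (m+n∸m≡n (size λ₂) (lab L d)))) (cellOf-lab l)))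
      where
      big : size λ₂ < lab X (lo d)
      big = subst (size λ₂ <_) (sym (SX.lab-lo-star d)) (m<m+n (size λ₂) (proj₁ (lab-range l)))

    check-small : ∀ c {d} → d ∈ₛ SX.H → checkT c (just (lab X (SX.hi d))) ≡ true
    check-small (i , j) {d} h = if-no λ t → <⇒≱ (<ᵇ⇒< _ _ t) (subst (_≤ size λ₂) (sym (SX.lab-hi-star h))
      (≤-trans (proj₂ (lab-range h)) (≤-reflexive (trans (nCells-psum SX.H) (sym (size-psum λ₂))))))

  no-rule⁻ : T (diffusion r α₁ α₂ β γ λ₁ λ₂ t u) → ∀ {i j} → (i , j) ∈ₛ (α₂ /ₛ []) → ¬ SatV r m (proj₁ (f (hi (i , j)))) i j
  no-rule⁻ h {i} {j} c∈ (a , s) with f (hi (i , j)) in e | SX.view (f∈ (SY.hi∈ c∈))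
  ... | _ | SX.isHi k = <⇒≱ (SX.hi< k) a
  ... | _ | SX.isLo {d} l = T-not⁻ (subst T (sym (trans (sym (check-big i j l)) bool)) tt)
        (row-rule⁺ r i j (proj₁ d) (subst (Sat r i j) (m+n∸m≡n m (proj₁ d)) s))
    where
    bool : checkT (hi (i , j)) (just (lab X (lo d))) ≡ true
    bool = trans (cong (checkT (hi (i , j))) (sym (trans (entry (SY.hi∈ c∈)) (cong (just ∘ lab X) e))))
      (diffusion-check r α₁ α₂ β γ λ₁ λ₂ t u w h w-perm w-tableaux (hi∈α c∈))

  no-rule⁺ : (∀ {i j} → (i , j) ∈ₛ (α₂ /ₛ []) → ¬ SatV r m (proj₁ (f (hi (i , j)))) i j) → T (diffusion r α₁ α₂ β γ λ₁ λ₂ t u)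
  no-rule⁺ h = allB⁺ (permutations (size γ)) λ {w'} w'∈ → T-if⁺ λ s → cond w' (w-only w' w'∈ s)
    where
    box : ∀ {c} → c ∈ α-boxes → T (checkT c (entryAt (star β α₂) (fromReading (star β α₂) w) c))
    box m∈ with α⇒hi m∈
    ... | (i , j) , refl , c∈ = subst T (sym (trans (cong (checkT (hi (i , j))) (entry (SY.hi∈ c∈))) (value' (SX.view (f∈ (SY.hi∈ c∈))) refl))) tt
      where
      value' : ∀ {x} → SX.View x → f (hi (i , j)) ≡ x → checkT (hi (i , j)) (just (lab X (f (hi (i , j))))) ≡ true
      value' (SX.isHi k) e = trans (cong (checkT (hi (i , j)) ∘ just ∘ lab X) e) (check-small (hi (i , j)) k)
      value' (SX.isLo {d} l) e = trans (cong (checkT (hi (i , j)) ∘ just ∘ lab X) e) (trans (check-big i j l) (T-true (T-not⁺ λ q →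
        h c∈ (subst (λ z → SatV r m (proj₁ z) i j) (sym e)
          (m≤m+n m _ , subst (Sat r i j) (sym (m+n∸m≡n m (proj₁ d))) (row-rule⁻ r i j (proj₁ d) q))))))
    cond : ∀ w' → w' ≡ w → T (allB _ α-boxes)
    cond w' refl = allB⁺ α-boxes λ { {i , j} m∈ → box m∈ }

-- Enumerations of arrows and triples

_⊆ᵖ_ : List ℕ → List ℕ → Set
α ⊆ᵖ β = ∀ i → at α i ≤ at β i

skew-convex : ∀ {γ δ} → IsPart γ → IsPart δ → Convex (γ /ₛ δ)
skew-convex (x , _) (y , _) = x , y

size-skew : ∀ {α β} → α ⊆ᵖ β → size β ≡ size α + nCells (β /ₛ α)
size-skew {α} {β} le = begin
    size β                            ≡⟨ size-psum-≥ β (m≤m+n (length β) (length α)) ⟩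
    psum (at β) k                     ≡⟨ psum-cong k (λ {i} _ → m+[n∸m]≡n (le i)) ⟨
    psum (λ i → at α i + rowLen (β /ₛ α) i) k  ≡⟨ psum-+ (at α) (rowLen (β /ₛ α)) k ⟩
    psum (at α) k + psum (rowLen (β /ₛ α)) k   ≡⟨ cong₂ _+_ (sym (size-psum-≥ α (m≤n+m (length α) (length β))))
      (trans (psum-tail0 (rowLen (β /ₛ α)) (length β) (m≤m+n (length β) (length α))
        (λ {i} h → trans (cong (_∸ at α i) (at-≥ β h)) (0∸n≡0 (at α i)))) (sym (nCells-psum (β /ₛ α)))) ⟩
    size α + nCells (β /ₛ α)          ∎
  where
  open ≡-Reasoning
  k = length β + length α

size-straight : ∀ γ → nCells (γ /ₛ []) ≡ size γ
size-straight γ = sym (size-skew {[]} {γ} λ _ → z≤n)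

size-mono : ∀ {α β} → α ⊆ᵖ β → size α ≤ size β
size-mono {α} {β} le = subst (size α ≤_) (sym (size-skew {α} {β} le)) (m≤m+n (size α) _)

inners : List ℕ → List (List ℕ)
inners α = filterᵇ (λ β → subset β α) (partitionsUpTo (size α))

outers : List ℕ → ℕ → List (List ℕ)
outers α n = filterᵇ (subset α) (partitionsOf n)

arrowsAt : ℕ → List ℕ → List ℕ → List ℕ → List ℕ → List Filling
arrowsAt r α₁ α₂ β₂ β₁ = filterᵇ (rowRuleOK r α₁ α₂ β₁ β₂) (RW (β₁ /ₛ α₁) (α₂ /ₛ β₂))

arrowsOver : ℕ → List ℕ → List ℕ → List ℕ → List (List ℕ × Filling)
arrowsOver r α₁ α₂ β₂ = bind (outers α₁ (size α₁ + (size α₂ ∸ size β₂))) (arrowsAt r α₁ α₂ β₂)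

-- Targets (β₂ , β₁) and labels of the arrows from (α₁ , α₂) satisfying the row rule, together
-- with the empty arrow from (α₁ , α₂) to itself; similarly for triples.
Arr : ℕ → List ℕ → List ℕ → List (List ℕ × List ℕ × Filling)
Arr r α₁ α₂ = bind (inners α₂) (arrowsOver r α₁ α₂)

module _ (r : ℕ) (α₁ α₂ β γ : List ℕ) (t : Filling) where

  triplesAt : List ℕ → List ℕ → List Filling
  triplesAt λ₂ λ₁ = filterᵇ (λ u → barredRowRule r α₁ γ λ₁ λ₂ u ∧ diffusion r α₁ α₂ β γ λ₁ λ₂ t u) (RW (γ /ₛ λ₂) (λ₁ /ₛ α₁))

  triplesOver : List ℕ → List (List ℕ × Filling)
  triplesOver λ₂ = bind (outers α₁ (size α₁ + (size γ ∸ size λ₂))) (triplesAt λ₂)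

  Tri : List (List ℕ × List ℕ × Filling)
  Tri = bind (inners γ) triplesOver

∈-inners⁺ : ∀ {α β} → IsPart β → β ⊆ᵖ α → β ∈ inners α
∈-inners⁺ {α} {β} P le = ∈-filterᵇ⁺ {p = λ β → subset β α} (∈-partitionsUpTo⁺ P (size-mono {β} {α} le)) (subset⁺ β α le)

∈-inners⁻ : ∀ {α β} → β ∈ inners α → IsPart β × β ⊆ᵖ α
∈-inners⁻ {α} {β} m with ∈-filterᵇ⁻ {p = λ β → subset β α} {xs = partitionsUpTo (size α)} m
... | m' , t = proj₁ (∈-partitionsUpTo⁻ (size α) m') , subset⁻ β α t

∈-outers⁺ : ∀ {α β} → IsPart β → α ⊆ᵖ β → β ∈ outers α (size β)
∈-outers⁺ {α} {β} P le = ∈-filterᵇ⁺ {p = subset α} (∈-partitionsOf⁺ P) (subset⁺ α β le)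

∈-outers⁻ : ∀ {α n β} → β ∈ outers α n → IsPart β × α ⊆ᵖ β
∈-outers⁻ {α} {n} {β} m with ∈-filterᵇ⁻ {p = subset α} {xs = partitionsOf n} m
... | m' , t = proj₁ (∈-partitionsOf⁻ n m') , subset⁻ α β t

Unique-inners : ∀ α → Unique (inners α)
Unique-inners α = Unique-filterᵇ {p = λ β → subset β α} (Unique-partitionsUpTo (size α))

Unique-outers : ∀ α n → Unique (outers α n)
Unique-outers α n = Unique-filterᵇ {p = subset α} (Unique-partitionsOf n)

Unique-Arr : ∀ r α₁ α₂ → Unique (Arr r α₁ α₂)
Unique-Arr r α₁ α₂ = Unique-bind {f = arrowsOver r α₁ α₂} (Unique-inners α₂) λ {β₂} _ → Unique-bind {f = arrowsAt r α₁ α₂ β₂} (Unique-outers α₁ (size α₁ + (size α₂ ∸ size β₂))) λ {β₁} _ →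
  Unique-filterᵇ {p = rowRuleOK r α₁ α₂ β₁ β₂} (Unique-RW (β₁ /ₛ α₁) (α₂ /ₛ β₂))

Unique-Tri : ∀ r α₁ α₂ β γ t → Unique (Tri r α₁ α₂ β γ t)
Unique-Tri r α₁ α₂ β γ t = Unique-bind {f = triplesOver r α₁ α₂ β γ t} (Unique-inners γ) λ {λ₂} _ → Unique-bind {f = triplesAt r α₁ α₂ β γ t λ₂} (Unique-outers α₁ (size α₁ + (size γ ∸ size λ₂))) λ {λ₁} _ →
  Unique-filterᵇ {p = λ u → barredRowRule r α₁ γ λ₁ λ₂ u ∧ diffusion r α₁ α₂ β γ λ₁ λ₂ t u} (Unique-RW (γ /ₛ λ₂) (λ₁ /ₛ α₁))

outer-size : ∀ {α₁ α₂ β₁ β₂} → α₁ ⊆ᵖ β₁ → β₂ ⊆ᵖ α₂ → nCells (β₁ /ₛ α₁) ≡ nCells (α₂ /ₛ β₂) →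
  size β₁ ≡ size α₁ + (size α₂ ∸ size β₂)
outer-size {α₁} {α₂} {β₁} {β₂} le le' e = trans (size-skew {α₁} {β₁} le) (cong (size α₁ +_) (trans e
  (sym (trans (cong (_∸ size β₂) (size-skew {β₂} {α₂} le')) (m+n∸m≡n (size β₂) _)))))

module _ (r : ℕ) {α₁ α₂ : List ℕ} (Pα₁ : IsPart α₁) (Pα₂ : IsPart α₂) where

  record IsArrow (β₂ β₁ : List ℕ) (t : Filling) : Set where
    constructor arrow
    field
      Pβ₂ : IsPart β₂
      β₂⊆ : β₂ ⊆ᵖ α₂
      Pβ₁ : IsPart β₁
      ⊆β₁ : α₁ ⊆ᵖ β₁
      pict : Pict (β₁ /ₛ α₁) (α₂ /ₛ β₂)
      t≡ : t ≡ tab pict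
      rule : ∀ {i j} → (i , j) ∈ₛ (α₂ /ₛ β₂) → Sat r i j (proj₁ (Pict.g pict (i , j)))

  ∈-Arr⁺ : ∀ {β₂ β₁ t} → IsArrow β₂ β₁ t → (β₂ , β₁ , t) ∈ Arr r α₁ α₂
  ∈-Arr⁺ {β₂} {β₁} (arrow P₂ le₂ P₁ le₁ p refl h) = ∈-bind⁺ {f = arrowsOver r α₁ α₂} (∈-inners⁺ {α₂} P₂ le₂)
    (∈-bind⁺ {f = arrowsAt r α₁ α₂ β₂} (subst (λ n → β₁ ∈ outers α₁ n) (outer-size {α₁} {α₂} {β₁} {β₂} le₁ le₂ (pict-size p)) (∈-outers⁺ {α₁} P₁ le₁))
      (∈-filterᵇ⁺ {p = rowRuleOK r α₁ α₂ β₁ β₂} (tab∈RW (skew-convex P₁ Pα₁) (skew-convex Pα₂ P₂) p) (rule⁺ r α₁ α₂ β₁ β₂ p h)))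

  ∈-Arr⁻ : ∀ {β₂ β₁ t} → (β₂ , β₁ , t) ∈ Arr r α₁ α₂ → IsArrow β₂ β₁ t
  ∈-Arr⁻ {β₂} {β₁} {t} m =
    let m₂ , m' = ∈-bind⁻ {f = arrowsOver r α₁ α₂} {xs = inners α₂} m
        m₁ , m'' = ∈-bind⁻ {f = arrowsAt r α₁ α₂ β₂} {xs = outers α₁ (size α₁ + (size α₂ ∸ size β₂))} m'
        t∈ , ok = ∈-filterᵇ⁻ {p = rowRuleOK r α₁ α₂ β₁ β₂} {xs = RW (β₁ /ₛ α₁) (α₂ /ₛ β₂)} m''
        P₂ , le₂ = ∈-inners⁻ {α₂} {β₂} m₂
        P₁ , le₁ = ∈-outers⁻ {α₁} {size α₁ + (size α₂ ∸ size β₂)} {β₁} m₁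
        p , e = RW⇒pict (skew-convex P₁ Pα₁) (skew-convex Pα₂ P₂) t∈
    in arrow P₂ le₂ P₁ le₁ p e (rule⁻ r α₁ α₂ β₁ β₂ p (subst (T ∘ rowRuleOK r α₁ α₂ β₁ β₂) e ok))

module _ (r : ℕ) {α₁ : List ℕ} (α₂ β γ : List ℕ) (t : Filling) (Pα₁ : IsPart α₁) (Pγ : IsPart γ) where

  record IsTriple (λ₂ λ₁ : List ℕ) (u : Filling) : Set where
    constructor triple
    field
      Pλ₂ : IsPart λ₂
      λ₂⊆ : λ₂ ⊆ᵖ γ
      Pλ₁ : IsPart λ₁
      ⊆λ₁ : α₁ ⊆ᵖ λ₁
      pict : Pict (γ /ₛ λ₂) (λ₁ /ₛ α₁)
      u≡ : u ≡ tab pict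
      rule : ∀ {i j} → (i , j) ∈ₛ (γ /ₛ λ₂) → Sat r i j (proj₁ (Pict.f pict (i , j)))
      diffuse : T (diffusion r α₁ α₂ β γ λ₁ λ₂ t u)

  ∈-Tri⁺ : ∀ {λ₂ λ₁ u} → IsTriple λ₂ λ₁ u → (λ₂ , λ₁ , u) ∈ Tri r α₁ α₂ β γ t
  ∈-Tri⁺ {λ₂} {λ₁} (triple P₂ le₂ P₁ le₁ p refl h d) = ∈-bind⁺ {f = triplesOver r α₁ α₂ β γ t} (∈-inners⁺ {γ} P₂ le₂)
    (∈-bind⁺ {f = triplesAt r α₁ α₂ β γ t λ₂} (subst (λ n → λ₁ ∈ outers α₁ n) (outer-size {α₁} {γ} {λ₁} {λ₂} le₁ le₂ (sym (pict-size p))) (∈-outers⁺ {α₁} P₁ le₁))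
      (∈-filterᵇ⁺ {p = λ u → barredRowRule r α₁ γ λ₁ λ₂ u ∧ diffusion r α₁ α₂ β γ λ₁ λ₂ t u}
        (tab∈RW (skew-convex Pγ P₂) (skew-convex P₁ Pα₁) p)
        (T-∧⁺ {barredRowRule r α₁ γ λ₁ λ₂ (tab p)} (barred⁺ r α₁ γ λ₁ λ₂ p h) d)))

  ∈-Tri⁻ : ∀ {λ₂ λ₁ u} → (λ₂ , λ₁ , u) ∈ Tri r α₁ α₂ β γ t → IsTriple λ₂ λ₁ u
  ∈-Tri⁻ {λ₂} {λ₁} {u} m =
    let m₂ , m' = ∈-bind⁻ {f = triplesOver r α₁ α₂ β γ t} {xs = inners γ} m
        m₁ , m'' = ∈-bind⁻ {f = triplesAt r α₁ α₂ β γ t λ₂} {xs = outers α₁ (size α₁ + (size γ ∸ size λ₂))} m'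
        u∈ , ok = ∈-filterᵇ⁻ {p = λ u → barredRowRule r α₁ γ λ₁ λ₂ u ∧ diffusion r α₁ α₂ β γ λ₁ λ₂ t u} {xs = RW (γ /ₛ λ₂) (λ₁ /ₛ α₁)} m''
        P₂ , le₂ = ∈-inners⁻ {γ} {λ₂} m₂
        P₁ , le₁ = ∈-outers⁻ {α₁} {size α₁ + (size γ ∸ size λ₂)} {λ₁} m₁
        p , e = RW⇒pict (skew-convex Pγ P₂) (skew-convex P₁ Pα₁) u∈
    in triple P₂ le₂ P₁ le₁ p e (barred⁻ r α₁ γ λ₁ λ₂ p (subst (T ∘ barredRowRule r α₁ γ λ₁ λ₂) e (T-∧ˡ ok)))
         (T-∧ʳ {barredRowRule r α₁ γ λ₁ λ₂ u} ok)

topsAt : List ℕ → List ℕ → List ℕ → List Filling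
topsAt β α₂ γ = RW (γ /ₛ []) (star β α₂)

tops : List ℕ → List ℕ → List (List ℕ × Filling)
tops β α₂ = bind (partitionsOf (size β + size α₂)) (topsAt β α₂)

Unique-tops : ∀ β α₂ → Unique (tops β α₂)
Unique-tops β α₂ = Unique-bind {f = topsAt β α₂} (Unique-partitionsOf (size β + size α₂)) λ {γ} _ → Unique-RW (γ /ₛ []) (star β α₂)

nCells-Star : ∀ β α₂ → nCells (Star α₂ β []) ≡ size β + size α₂
nCells-Star β α₂ = trans (StarShape.nCells-star α₂ β []) (trans (cong (size α₂ +_) (size-straight β)) (+-comm (size α₂) (size β)))

module _ {β α₂ : List ℕ} (Pβ : IsPart β) (Pα₂ : IsPart α₂) where

  star-convex : Convex (Star α₂ β [])
  star-convex = StarShape.convex-star α₂ β [] Pα₂ Pβ IsPart-[] (λ _ → z≤n)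

  ∈-tops⁺ : ∀ {γ} → IsPart γ → (q : Pict (γ /ₛ []) (Star α₂ β [])) → (γ , tab q) ∈ tops β α₂
  ∈-tops⁺ {γ} Pγ q = ∈-bind⁺ {f = topsAt β α₂} (subst (λ n → γ ∈ partitionsOf n) (trans (sym (size-straight γ)) (trans (pict-size q) (nCells-Star β α₂))) (∈-partitionsOf⁺ Pγ))
    (subst (λ S → tab q ∈ RW (γ /ₛ []) S) (sym (star≡Star β α₂)) (tab∈RW (straight-convex Pγ) star-convex q))

  ∈-tops⁻ : ∀ {γ t} → (γ , t) ∈ tops β α₂ → IsPart γ × size γ ≡ nCells (Star α₂ β []) × ∃[ q ] t ≡ tab {γ /ₛ []} {Star α₂ β []} q
  ∈-tops⁻ {γ} {t} m =
    let m₁ , m₂ = ∈-bind⁻ {f = topsAt β α₂} {xs = partitionsOf (size β + size α₂)} m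
        Pγ , e = ∈-partitionsOf⁻ (size β + size α₂) m₁
    in Pγ , trans e (sym (nCells-Star β α₂)) ,
       RW⇒pict (straight-convex Pγ) star-convex (subst (λ S → t ∈ RW (γ /ₛ []) S) (star≡Star β α₂) m₂)

-- The main bijection

-- The boxes of λ₂ are sent to rows less than m and are ignored by `Barred`. On γ/λ₂ the insertion
-- tableau carries the rows of `pu` shifted by m, so `Barred` says there exactly what the barred
-- rule says.
module Bridge (r : ℕ) {α₁ α₂ β λ₁ λ₂ γ : List ℕ} (Pα₁ : IsPart α₁) (Pα₂ : IsPart α₂) (Pβ : IsPart β)
  (Pλ₁ : IsPart λ₁) (Pλ₂ : IsPart λ₂) (Pγ : IsPart γ) (α⊆λ : α₁ ⊆ᵖ λ₁) (λ⊆γ : λ₂ ⊆ᵖ γ)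
  (p : Pict (Star α₂ β []) (Star λ₂ λ₁ α₁)) (pu : Pict (γ /ₛ λ₂) (λ₁ /ₛ α₁)) {t : Filling}
  (rel : RSrel p γ (Utilde γ λ₂ (tab pu)) t) where

  private
    module T = Tilde λ₂ λ₁ α₁ γ Pλ₂ Pλ₁ Pα₁ Pγ α⊆λ
    module E = T.Extend λ⊆γ pu
    open T.Extends E.extends
    m = length λ₂

    insertion : concat (rowsOf (proj₁ (RSʷ (word p)))) ≡ tab E.q
    insertion = trans (RSrel.insertion≡ rel) (sym (T.extends-tab E.extends))

    out-row : ∀ {i j} → (i , j) ∈ₛ (γ /ₛ λ₂) → proj₁ (Pict.f E.q (i , j)) ≡ m + proj₁ (Pict.f pu (i , j))
    out-row s = cong proj₁ (off-λ s)

  RowBarred : Set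
  RowBarred = Barred r m (insertAll [] (rowWord p))

  to-row : (∀ {i j} → (i , j) ∈ₛ (γ /ₛ λ₂) → Sat r i j (proj₁ (Pict.f pu (i , j)))) → RowBarred
  to-row h = barred⇐ (star-convex Pβ Pα₂) T.cX p {r} {m} E.q (RSrel.shape≡ rel) insertion λ {i} {j} c∈ → case T.split c∈ of λ
    { (inj₁ k) m≤ → ⊥-elim (<⇒≱ (StarShape.hi< λ₂ λ₁ α₁ (T.flipRow∈ k)) (subst (λ z → m ≤ proj₁ z) (proj₂ (on-λ k)) m≤))
    ; (inj₂ s) _ → subst (Sat r i j) (sym (trans (cong (_∸ m) (out-row s)) (m+n∸m≡n m _))) (h s) }

  from-row : RowBarred → ∀ {i j} → (i , j) ∈ₛ (γ /ₛ λ₂) → Sat r i j (proj₁ (Pict.f pu (i , j)))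
  from-row h {i} {j} s = subst (Sat r i j) (trans (cong (_∸ m) (out-row s)) (m+n∸m≡n m _))
    (barred⇒ (star-convex Pβ Pα₂) T.cX p {r} {m} E.q (RSrel.shape≡ rel) insertion h (T.S⊆G s)
      (subst (m ≤_) (sym (out-row s)) (m≤m+n m _)))

module Pass {α₁ α₂ β λ₁ λ₂ : List ℕ} (Pα₁ : IsPart α₁) (Pα₂ : IsPart α₂) (Pβ : IsPart β)
  (Pλ₁ : IsPart λ₁) (Pλ₂ : IsPart λ₂) (α⊆λ : α₁ ⊆ᵖ λ₁) where

  cY : Convex (Star α₂ β [])
  cY = star-convex Pβ Pα₂

  cX : Convex (Star λ₂ λ₁ α₁)
  cX = StarShape.convex-star λ₂ λ₁ α₁ Pλ₂ Pλ₁ Pα₁ α⊆λ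

  module Up {γ} (Pγ : IsPart γ) (λ⊆γ : λ₂ ⊆ᵖ γ) (pu : Pict (γ /ₛ λ₂) (λ₁ /ₛ α₁)) (pt : Pict (γ /ₛ []) (Star α₂ β [])) where
    private
      module T = Tilde λ₂ λ₁ α₁ γ Pλ₂ Pλ₁ Pα₁ Pγ α⊆λ
      module E = T.Extend λ⊆γ pu

    up : ∃[ p ] RSrel {Star α₂ β []} {Star λ₂ λ₁ α₁} p γ (Utilde γ λ₂ (tab pu)) (tab pt)
    up = subst (λ e → ∃[ p ] RSrel {Star α₂ β []} {Star λ₂ λ₁ α₁} p γ e (tab pt)) (T.extends-tab E.extends)
      (RSPict.RS-bwd cY cX Pγ E.q pt)

  module Down (p : Pict (Star α₂ β []) (Star λ₂ λ₁ α₁)) where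
    open RSPict.Fwd cY cX p public using (γ; γ-part; γ-size)
    open RSPict.Fwd cY cX p using (P-pict; Q-pict; rel)
    private
      module T = Tilde λ₂ λ₁ α₁ γ Pλ₂ Pλ₁ Pα₁ γ-part α⊆λ
      module R = T.Restrict (proj₁ P-pict)

    λ⊆γ : λ₂ ⊆ᵖ γ
    λ⊆γ = R.λ⊆γ

    pu : Pict (γ /ₛ λ₂) (λ₁ /ₛ α₁)
    pu = R.p

    pt : Pict (γ /ₛ []) (Star α₂ β [])
    pt = proj₁ Q-pict

    down : RSrel p γ (Utilde γ λ₂ (tab pu)) (tab pt)
    down = subst (λ e → RSrel p γ e (tab pt)) (T.extends-tab R.extends) rel

RSrel-fun : ∀ {Y X} {p p' : Pict Y X} {γ γ' e e' t t'} → word p ≡ word p' → RSrel p γ e t → RSrel p' γ' e' t' →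
  γ ≡ γ' × e ≡ e' × t ≡ t'
RSrel-fun q (rs a b c) (rs a' b' c') =
    trans (sym a) (trans (cong (shapeOf ∘ proj₁ ∘ RSʷ) q) a')
  , trans (sym b) (trans (cong (concat ∘ rowsOf ∘ proj₁ ∘ RSʷ) q) b')
  , trans (sym c) (trans (cong (concat ∘ rowsOf ∘ proj₂ ∘ RSʷ) q) c')

tab-flip : ∀ {A B} {p q : Pict A B} → tab p ≡ tab q → tab (flip p) ≡ tab (flip q)
tab-flip {p = p} {q} e = f≡⇒tab≡ {p = flip p} {flip q} (f≡⇒g≡ {p = p} {q} (tab≡⇒f≡ {p = p} {q} e))

Glued-resp : ∀ {r α₁ α₂ β λ₁ λ₂ μ₁ μ₂ p q p' q' a b} →
  (∀ {c} → c ∈ₛ Star α₂ β [] → Pict.f p c ≡ Pict.f q c) →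
  (∀ {c} → c ∈ₛ Star μ₂ β [] → Pict.f p' c ≡ Pict.f q' c) →
  (∀ {c} → c ∈ₛ (α₂ /ₛ μ₂) → Pict.f a c ≡ Pict.f b c) →
  Pieces.Glued r α₁ α₂ β λ₁ λ₂ μ₁ μ₂ q q' b → Pieces.Glued r α₁ α₂ β λ₁ λ₂ μ₁ μ₂ p p' a
Glued-resp {r} {α₁} {α₂} {β} {λ₁} {λ₂} {μ₁} {μ₂} e e' ea G = record
  { μ⊆α = μ⊆α
  ; on-μ = λ h → trans (e (StarShape.hi∈ α₂ β [] (ins z≤n (<-≤-trans (<outer h) (μ⊆α _))))) (trans (on-μ h) (sym (e' (StarShape.hi∈ μ₂ β [] h))))
  ; on-β = λ h → trans (e (StarShape.lo∈ α₂ β [] h)) (trans (on-β h) (sym (e' (StarShape.lo∈ μ₂ β [] h))))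
  ; on-a = λ h → trans (e (StarShape.hi∈ α₂ β [] (ins z≤n (<outer h)))) (trans (on-a h) (cong (StarShape.lo λ₂ λ₁ α₁) (sym (ea h))))
  ; rule = λ {i} {j} h → subst (λ z → Sat r i j (proj₁ z)) (sym (ea h)) (rule h)
  ; no-rule = λ {i} {j} h s → no-rule h (subst (λ z → SatV r (length λ₂) (proj₁ z) i j) (e' (StarShape.hi∈ μ₂ β [] h)) s) }
  where open Pieces.Glued G

module Main (r : ℕ) {α₁ α₂ β : List ℕ} (Pα₁ : IsPart α₁) (Pα₂ : IsPart α₂) (Pβ : IsPart β) where

  Label : Set
  Label = List ℕ × List ℕ × Filling

  -- On the left a tableau of shape γ in RW(β * α₂) and an arrow from (α₁ , γ); on the right an
  -- arrow from (α₁ , α₂) to (μ₁ , μ₂), a tableau in RW(β * μ₂) and a triple over it. Trivial arrows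
  -- and triples are included. Both sides end in a pair (λ₁ , λ₂), which the bijection preserves.
  Left Right : Set
  Left = (List ℕ × Filling) × Label
  Right = Label × (List ℕ × Filling) × Label

  leftOver : List ℕ × Filling → List Label
  leftOver (γ , _) = Arr r α₁ γ

  lefts : List Left
  lefts = bind (tops β α₂) leftOver

  rightTri : (μ : Label) → List ℕ × Filling → List Label
  rightTri (μ₂ , μ₁ , _) (γ , t) = Tri r μ₁ μ₂ β γ t

  rightOver : Label → List ((List ℕ × Filling) × Label)
  rightOver μ = bind (tops β (proj₁ μ)) (rightTri μ)

  rights : List Right
  rights = bind (Arr r α₁ α₂) rightOver

  Unique-lefts : Unique lefts
  Unique-lefts = Unique-bind {f = leftOver} (Unique-tops β α₂) λ {γt} _ → Unique-Arr r α₁ (proj₁ γt)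

  Unique-rights : Unique rights
  Unique-rights = Unique-bind {f = rightOver} (Unique-Arr r α₁ α₂) λ {μ} _ →
    Unique-bind {f = rightTri μ} (Unique-tops β (proj₁ μ)) λ {γt} _ → Unique-Tri r (proj₁ (proj₂ μ)) (proj₁ μ) β (proj₁ γt) (proj₂ γt)

  record InLeft (γ : List ℕ) (t : Filling) (λ₂ λ₁ : List ℕ) (a : Filling) : Set where
    field
      Pγ : IsPart γ
      pt : Pict (γ /ₛ []) (Star α₂ β [])
      t≡ : t ≡ tab pt
      arr : IsArrow r Pα₁ Pγ λ₂ λ₁ a
    open IsArrow arr public renaming (Pβ₂ to Pλ₂; β₂⊆ to λ⊆γ; Pβ₁ to Pλ₁; ⊆β₁ to α⊆λ; pict to b; t≡ to a≡)

  left⁻ : ∀ {γ t λ₂ λ₁ a} → ((γ , t) , λ₂ , λ₁ , a) ∈ lefts → InLeft γ t λ₂ λ₁ a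
  left⁻ m∈ = let top , lab∈ = ∈-bind⁻ {f = leftOver} {xs = tops β α₂} m∈
                 Pγ , _ , pt , e = ∈-tops⁻ Pβ Pα₂ top
             in record { Pγ = Pγ ; pt = pt ; t≡ = e ; arr = ∈-Arr⁻ r Pα₁ Pγ lab∈ }

  left⁺ : ∀ {γ λ₂ λ₁ a} (Pγ : IsPart γ) (pt : Pict (γ /ₛ []) (Star α₂ β [])) → IsArrow r Pα₁ Pγ λ₂ λ₁ a →
    ((γ , tab pt) , λ₂ , λ₁ , a) ∈ lefts
  left⁺ Pγ pt arr = ∈-bind⁺ {f = leftOver} (∈-tops⁺ Pβ Pα₂ Pγ pt) (∈-Arr⁺ r Pα₁ Pγ arr)

  record InRight (μ₂ μ₁ : List ℕ) (s : Filling) (γ : List ℕ) (t : Filling) (λ₂ λ₁ : List ℕ) (u : Filling) : Set where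
    field
      arr : IsArrow r Pα₁ Pα₂ μ₂ μ₁ s
    open IsArrow arr public renaming (Pβ₂ to Pμ₂; β₂⊆ to μ⊆α; Pβ₁ to Pμ₁; ⊆β₁ to α⊆μ; pict to c; t≡ to s≡; rule to rule-c)
    field
      Pγ : IsPart γ
      γ-size : size γ ≡ nCells (Star μ₂ β [])
      pt : Pict (γ /ₛ []) (Star μ₂ β [])
      t≡ : t ≡ tab pt
      tri : IsTriple r μ₂ β γ t Pμ₁ Pγ λ₂ λ₁ u
    open IsTriple tri public renaming (λ₂⊆ to λ⊆γ; ⊆λ₁ to μ⊆λ; pict to pu; rule to rule-u)

  right⁻ : ∀ {μ₂ μ₁ s γ t λ₂ λ₁ u} → ((μ₂ , μ₁ , s) , (γ , t) , λ₂ , λ₁ , u) ∈ rights → InRight μ₂ μ₁ s γ t λ₂ λ₁ u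
  right⁻ {μ₂} {μ₁} {s} {γ} {t} m∈ =
    let μ∈ , rest = ∈-bind⁻ {f = rightOver} {xs = Arr r α₁ α₂} m∈
        top , tri∈ = ∈-bind⁻ {f = rightTri (μ₂ , μ₁ , s)} {xs = tops β μ₂} rest
        arr = ∈-Arr⁻ r Pα₁ Pα₂ μ∈
        Pγ , e , pt , t≡ = ∈-tops⁻ Pβ (IsArrow.Pβ₂ arr) top
    in record { arr = arr ; Pγ = Pγ ; γ-size = e ; pt = pt ; t≡ = t≡
              ; tri = ∈-Tri⁻ r μ₂ β γ t (IsArrow.Pβ₁ arr) Pγ tri∈ }

  right⁺ : ∀ {μ₂ μ₁ s γ λ₂ λ₁ u} (arr : IsArrow r Pα₁ Pα₂ μ₂ μ₁ s) (Pγ : IsPart γ) (pt : Pict (γ /ₛ []) (Star μ₂ β [])) →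
    IsTriple r μ₂ β γ (tab pt) (IsArrow.Pβ₁ arr) Pγ λ₂ λ₁ u → ((μ₂ , μ₁ , s) , (γ , tab pt) , λ₂ , λ₁ , u) ∈ rights
  right⁺ {μ₂} {μ₁} {s} {γ} arr Pγ pt tri = ∈-bind⁺ {f = rightOver} (∈-Arr⁺ r Pα₁ Pα₂ arr)
    (∈-bind⁺ {f = rightTri (μ₂ , μ₁ , s)} (∈-tops⁺ Pβ (IsArrow.Pβ₂ arr) Pγ pt) (∈-Tri⁺ r μ₂ β γ (tab pt) (IsArrow.Pβ₁ arr) Pγ tri))

  -- The tableau of an arrow from (α₁ , γ) to (λ₁ , λ₂) is a picture from λ₁/α₁ to γ/λ₂, the inverse
  -- of one that could serve as U. Flipping it turns the row rule of the arrow into the barred rule;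
  -- likewise the piece split off from p is the flip of an arrow.
  data Rel : Left → Right → Set where
    rel : ∀ {γ t λ₂ λ₁ a μ₂ μ₁ s γ' t' u}
      (p : Pict (Star α₂ β []) (Star λ₂ λ₁ α₁)) (p' : Pict (Star μ₂ β []) (Star λ₂ λ₁ μ₁))
      (b : Pict (λ₁ /ₛ α₁) (γ /ₛ λ₂)) (c : Pict (μ₁ /ₛ α₁) (α₂ /ₛ μ₂)) → a ≡ tab b → s ≡ tab c →
      Pieces.Glued r α₁ α₂ β λ₁ λ₂ μ₁ μ₂ p p' (flip c) →
      RSrel p γ (Utilde γ λ₂ (tab (flip b))) t → RSrel p' γ' (Utilde γ' λ₂ u) t' →
      Rel ((γ , t) , λ₂ , λ₁ , a) ((μ₂ , μ₁ , s) , (γ' , t') , λ₂ , λ₁ , u)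

  module _ {λ₁ λ₂ μ₁ μ₂} (Pλ₁ : IsPart λ₁) (Pλ₂ : IsPart λ₂) (Pμ₁ : IsPart μ₁) (Pμ₂ : IsPart μ₂)
    (α⊆μ : α₁ ⊆ᵖ μ₁) (μ⊆λ : μ₁ ⊆ᵖ λ₁) {p : Pict (Star α₂ β []) (Star λ₂ λ₁ α₁)} {p' : Pict (Star μ₂ β []) (Star λ₂ λ₁ μ₁)}
    {a} (G : Pieces.Glued r α₁ α₂ β λ₁ λ₂ μ₁ μ₂ p p' a) where
    private
      open Pieces.Glued G
      α⊆λ : α₁ ⊆ᵖ λ₁
      α⊆λ i = ≤-trans (α⊆μ i) (μ⊆λ i)
      m = length λ₂
      module I = Invariance r m α₂ μ₂ β Pα₂ Pμ₂ (star-convex Pβ Pα₂) (star-convex Pβ Pμ₂)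
        (StarShape.convex-star λ₂ λ₁ α₁ Pλ₂ Pλ₁ Pα₁ α⊆λ) (StarShape.convex-star λ₂ λ₁ μ₁ Pλ₂ Pλ₁ Pμ₁ μ⊆λ) p p'

    Glued⇒ : Barred r m (insertAll [] (rowWord p)) → Barred r m (insertAll [] (rowWord p'))
    Glued⇒ = I.barred⇒' μ⊆α (λ h → cong proj₁ (sym (on-μ h))) (λ h → cong proj₁ (sym (on-β h))) inside outside

    Glued⇐ : Barred r m (insertAll [] (rowWord p')) → Barred r m (insertAll [] (rowWord p))
    Glued⇐ = I.barred⇐' μ⊆α (λ h → cong proj₁ (sym (on-μ h))) (λ h → cong proj₁ (sym (on-β h))) inside outside

  -- The row rule of the given arrow is a property of the insertion tableau of p (`Bridge`), passes
  -- to that of p' (`Glued⇒`), and is read off there as the barred rule of the new triple. Its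
  -- diffusion condition is `no-rule` of the gluing.
  unglued : ∀ {γ t λ₂ λ₁ a} (X : InLeft γ t λ₂ λ₁ a) → let module X = InLeft X in
    (p : Pict (Star α₂ β []) (Star λ₂ λ₁ α₁)) → RSrel p γ (Utilde γ λ₂ (tab (flip X.b))) (tab X.pt) →
    ∀ {μ₁ μ₂} → IsPart μ₁ → IsPart μ₂ → α₁ ⊆ᵖ μ₁ → μ₁ ⊆ᵖ λ₁ → μ₂ ⊆ᵖ α₂ →
    (p' : Pict (Star μ₂ β []) (Star λ₂ λ₁ μ₁)) (a' : Pict (α₂ /ₛ μ₂) (μ₁ /ₛ α₁)) →
    Pieces.Glued r α₁ α₂ β λ₁ λ₂ μ₁ μ₂ p p' a' → ∃[ y ] y ∈ rights × Rel ((γ , t) , λ₂ , λ₁ , a) y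
  unglued {γ} {λ₂ = λ₂} {λ₁} X p R {μ₁} {μ₂} μ₁P μ₂P α⊆μ μ⊆λ μ⊆α p' a' G = _ ,
      right⁺ (arrow μ₂P μ⊆α μ₁P α⊆μ (flip a') refl (Pieces.Glued.rule G)) D.γ-part D.pt
        (triple X.Pλ₂ D.λ⊆γ X.Pλ₁ μ⊆λ D.pu refl
          (Bridge.from-row r μ₁P μ₂P Pβ X.Pλ₁ X.Pλ₂ D.γ-part μ⊆λ D.λ⊆γ p' D.pu D.down
            (Glued⇒ X.Pλ₁ X.Pλ₂ μ₁P μ₂P α⊆μ μ⊆λ G
              (Bridge.to-row r Pα₁ Pα₂ Pβ X.Pλ₁ X.Pλ₂ X.Pγ X.α⊆λ X.λ⊆γ p (flip X.b) R X.rule)))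
          (Diffusion.no-rule⁺ r μ₁ μ₂ β λ₁ λ₂ D.γ μ₁P μ₂P Pβ X.Pλ₁ X.Pλ₂ μ⊆λ p' (tab D.pu) (tab D.pt) D.down D.γ-size (Pieces.Glued.no-rule G))) ,
      rel p p' X.b (flip a') X.a≡ refl G (subst (RSrel p γ (Utilde γ λ₂ (tab (flip X.b)))) (sym X.t≡) R) D.down
    where
    module X = InLeft X
    module D = Pass.Down μ₁P μ₂P Pβ X.Pλ₁ X.Pλ₂ μ⊆λ p'

  total : ∀ {x} → x ∈ lefts → ∃[ y ] y ∈ rights × Rel x y
  total {(γ , t) , λ₂ , λ₁ , a} m∈ = unglued X p (proj₂ found) U.μ₁P U.μ₂P U.α⊆μ U.μ⊆λ U.μ⊆α U.p' U.a U.glued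
    where
    X = left⁻ m∈
    module X = InLeft X
    found = Pass.Up.up Pα₁ Pα₂ Pβ X.Pλ₁ X.Pλ₂ X.α⊆λ X.Pγ X.λ⊆γ (flip X.b) X.pt
    p = proj₁ found
    module U = Pieces.Unglue r α₁ α₂ β λ₁ λ₂ Pα₁ Pα₂ Pβ X.Pλ₁ X.Pλ₂ X.α⊆λ p

  glued : ∀ {μ₂ μ₁ s γ t λ₂ λ₁ u} (Y : InRight μ₂ μ₁ s γ t λ₂ λ₁ u) → let module Y = InRight Y in
    (p' : Pict (Star μ₂ β []) (Star λ₂ λ₁ μ₁)) → RSrel p' γ (Utilde γ λ₂ (tab Y.pu)) (tab Y.pt) →
    (p : Pict (Star α₂ β []) (Star λ₂ λ₁ α₁)) → Pieces.Glued r α₁ α₂ β λ₁ λ₂ μ₁ μ₂ p p' (flip Y.c) →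
    ∃[ x ] x ∈ lefts × Rel x ((μ₂ , μ₁ , s) , (γ , t) , λ₂ , λ₁ , u)
  glued {γ = γ} {λ₂ = λ₂} Y p' R p G = _ ,
      left⁺ D.γ-part D.pt (arrow Y.Pλ₂ D.λ⊆γ Y.Pλ₁ α⊆λ (flip D.pu) refl
        (Bridge.from-row r Pα₁ Pα₂ Pβ Y.Pλ₁ Y.Pλ₂ D.γ-part α⊆λ D.λ⊆γ p D.pu D.down
          (Glued⇐ Y.Pλ₁ Y.Pλ₂ Y.Pμ₁ Y.Pμ₂ Y.α⊆μ Y.μ⊆λ G
            (Bridge.to-row r Y.Pμ₁ Y.Pμ₂ Pβ Y.Pλ₁ Y.Pλ₂ Y.Pγ Y.μ⊆λ Y.λ⊆γ p' Y.pu R Y.rule-u)))) ,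
      rel p p' (flip D.pu) Y.c refl Y.s≡ G D.down (subst₂ (λ v t → RSrel p' γ (Utilde γ λ₂ v) t) (sym Y.u≡) (sym Y.t≡) R)
    where
    module Y = InRight Y
    α⊆λ = λ i → ≤-trans (Y.α⊆μ i) (Y.μ⊆λ i)
    module D = Pass.Down Pα₁ Pα₂ Pβ Y.Pλ₁ Y.Pλ₂ α⊆λ p

  onto : ∀ {y} → y ∈ rights → ∃[ x ] x ∈ lefts × Rel x y
  onto {(μ₂ , μ₁ , s) , (γ , t) , λ₂ , λ₁ , u} m∈ = glued Y p' (proj₂ found) G.p G.glued
    where
    Y = right⁻ m∈
    module Y = InRight Y
    found = Pass.Up.up Y.Pμ₁ Y.Pμ₂ Pβ Y.Pλ₁ Y.Pλ₂ Y.μ⊆λ Y.Pγ Y.λ⊆γ Y.pu Y.pt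
    p' = proj₁ found
    module G = Pieces.Glue r α₁ α₂ β λ₁ λ₂ Pα₁ Pα₂ Pβ Y.Pλ₁ Y.Pλ₂ (λ i → ≤-trans (Y.α⊆μ i) (Y.μ⊆λ i)) μ₁ μ₂ Y.Pμ₁ Y.Pμ₂ Y.α⊆μ Y.μ⊆λ Y.μ⊆α p' (flip Y.c) Y.rule-c
      (Diffusion.no-rule⁻ r μ₁ μ₂ β λ₁ λ₂ γ Y.Pμ₁ Y.Pμ₂ Pβ Y.Pλ₁ Y.Pλ₂ Y.μ⊆λ p' (tab Y.pu) (tab Y.pt) (proj₂ found) Y.γ-size
        (subst₂ (λ v t → T (diffusion r μ₁ μ₂ β γ λ₁ λ₂ t v)) Y.u≡ Y.t≡ Y.diffuse))

  module _ {λ₂ λ₁ : List ℕ} {p : Pict (Star α₂ β []) (Star λ₂ λ₁ α₁)} where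

    private
      G-type : ∀ {μ₂ μ₁} → Pict (Star μ₂ β []) (Star λ₂ λ₁ μ₁) → Pict (μ₁ /ₛ α₁) (α₂ /ₛ μ₂) → Set
      G-type {μ₂} {μ₁} p' c = Pieces.Glued r α₁ α₂ β λ₁ λ₂ μ₁ μ₂ p p' (flip c)

    -- Uniqueness comes in stages, used in the order `same-μ₂`, `same-μ₁`, `same-γ`: the pictures,
    -- and then the tableaux, can be compared only after the shapes over which they are typed have
    -- been identified.
    same-γ : ∀ {μ₂ μ₁ s s' γ γ' t t' u u'} → γ ≡ γ' → t ≡ t' → s ≡ s' →
      InRight μ₂ μ₁ s γ t λ₂ λ₁ u → InRight μ₂ μ₁ s' γ' t' λ₂ λ₁ u' → Utilde γ λ₂ u ≡ Utilde γ' λ₂ u' →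
      ((μ₂ , μ₁ , s) , (γ , t) , λ₂ , λ₁ , u) ≡ ((μ₂ , μ₁ , s') , (γ' , t') , λ₂ , λ₁ , u')
    same-γ {μ₂} {μ₁} {s} {γ = γ} {t = t} refl refl refl IY IY' e =
      cong (λ u → (μ₂ , μ₁ , s) , (γ , t) , λ₂ , λ₁ , u) (trans Y.u≡ (trans (Tilde.Utilde-inj λ₂ λ₁ μ₁ γ Y.Pλ₂ Y.Pλ₁ Y.Pμ₁ Y.Pγ Y.μ⊆λ
        {Y.pu} {Y'.pu} (trans (cong (Utilde γ λ₂) (sym Y.u≡)) (trans e (cong (Utilde γ λ₂) Y'.u≡)))) (sym Y'.u≡)))
      where
      module Y = InRight IY
      module Y' = InRight IY'

    same-μ₁ : ∀ {μ₂ μ₁ ν₁ s s' γ γ' t t' u u' p' q' c c'} → μ₁ ≡ ν₁ →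
      InRight μ₂ μ₁ s γ t λ₂ λ₁ u → InRight μ₂ ν₁ s' γ' t' λ₂ λ₁ u' →
      s ≡ tab c → s' ≡ tab c' → G-type {μ₂} {μ₁} p' c → G-type {μ₂} {ν₁} q' c' →
      RSrel p' γ (Utilde γ λ₂ u) t → RSrel q' γ' (Utilde γ' λ₂ u') t' →
      ((μ₂ , μ₁ , s) , (γ , t) , λ₂ , λ₁ , u) ≡ ((μ₂ , ν₁ , s') , (γ' , t') , λ₂ , λ₁ , u')
    same-μ₁ {p' = p'} {q'} {c} {c'} refl IY IY' e e' G G' R R' =
      let a , b , d = RSrel-fun (word-cong p' q' (Pieces.Glued-p'-fun r α₁ α₂ β λ₁ λ₂ G G')) R R'
      in same-γ a d (trans e (trans (tab-flip {p = flip c} {flip c'} (f≡⇒tab≡ {p = flip c} {flip c'} (Pieces.Glued-a-fun r α₁ α₂ β λ₁ λ₂ G G'))) (sym e'))) IY IY' b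

    same-μ₂ : ∀ {μ₂ μ₁ ν₂ ν₁ s s' γ γ' t t' u u' p' q' c c'} → μ₂ ≡ ν₂ →
      InRight μ₂ μ₁ s γ t λ₂ λ₁ u → InRight ν₂ ν₁ s' γ' t' λ₂ λ₁ u' →
      s ≡ tab c → s' ≡ tab c' → G-type {μ₂} {μ₁} p' c → G-type {ν₂} {ν₁} q' c' →
      RSrel p' γ (Utilde γ λ₂ u) t → RSrel q' γ' (Utilde γ' λ₂ u') t' →
      ((μ₂ , μ₁ , s) , (γ , t) , λ₂ , λ₁ , u) ≡ ((ν₂ , ν₁ , s') , (γ' , t') , λ₂ , λ₁ , u')
    same-μ₂ {p' = p'} {q'} {c} {c'} refl IY IY' e e' G G' =
      same-μ₁ {p' = p'} {q'} {c} {c'} (Pieces.Glued-μ₁-fun r α₁ α₂ β λ₁ λ₂ (InRight.Pμ₁ IY) (InRight.Pμ₁ IY') (InRight.α⊆μ IY) (InRight.α⊆μ IY') G G')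
        IY IY' e e' G G'

  functional : ∀ {x y y'} → x ∈ lefts → y ∈ rights → y' ∈ rights → Rel x y → Rel x y' → y ≡ y'
  functional x∈ y∈ y'∈ (rel {γ} {t} {λ₂} {λ₁} p p' b c ea es G R₁ R₂) (rel q q' b' c' ea' es' G' R₁' R₂') =
      same-μ₂ {p' = p'} {q'} {c} {c'} (Pieces.Glued-μ₂-fun r α₁ α₂ β λ₁ λ₂ (InRight.Pμ₂ IY) (InRight.Pμ₂ IY') G G'') IY IY' es es' G G'' R₂ R₂'
    where
    module X = InLeft (left⁻ x∈)
    IY = right⁻ y∈
    IY' = right⁻ y'∈
    p≗q : ∀ {z} → z ∈ₛ Star α₂ β [] → Pict.f p z ≡ Pict.f q z
    p≗q = RSPict.RS-inj (star-convex Pβ Pα₂) (StarShape.convex-star λ₂ λ₁ α₁ X.Pλ₂ X.Pλ₁ Pα₁ X.α⊆λ) p q R₁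
      (subst (λ e → RSrel q γ (Utilde γ λ₂ e) t) (tab-flip {p = b'} {b} (trans (sym ea') ea)) R₁')
    G'' = Glued-resp {p = p} {q = q} {p' = q'} {q' = q'} {a = flip c'} {b = flip c'} p≗q (λ _ → refl) (λ _ → refl) G'

  same-left : ∀ {γ γ' t t' λ₂ λ₁ a a'} → γ ≡ γ' → t ≡ t' → InLeft γ t λ₂ λ₁ a → InLeft γ' t' λ₂ λ₁ a' →
    (b : Pict (λ₁ /ₛ α₁) (γ /ₛ λ₂)) (b' : Pict (λ₁ /ₛ α₁) (γ' /ₛ λ₂)) → a ≡ tab b → a' ≡ tab b' →
    Utilde γ λ₂ (tab (flip b)) ≡ Utilde γ' λ₂ (tab (flip b')) → ((γ , t) , λ₂ , λ₁ , a) ≡ ((γ' , t') , λ₂ , λ₁ , a')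
  same-left {γ} {t = t} {λ₂ = λ₂} {λ₁} refl refl IX IX' b b' e e' h = cong (λ a → (γ , t) , λ₂ , λ₁ , a)
    (trans e (trans (tab-flip {p = flip b} {flip b'} (Tilde.Utilde-inj λ₂ λ₁ α₁ γ X.Pλ₂ X.Pλ₁ Pα₁ X.Pγ X.α⊆λ {flip b} {flip b'} h)) (sym e')))
    where module X = InLeft IX

  injective : ∀ {x x' y} → x ∈ lefts → x' ∈ lefts → y ∈ rights → Rel x y → Rel x' y → x ≡ x'
  injective x∈ x'∈ y∈ (rel {λ₂ = λ₂} {λ₁} {μ₂ = μ₂} {μ₁} p p' b c ea es G R₁ R₂) (rel q q' b' c' ea' es' G' R₁' R₂') =
      let e , h , e' = RSrel-fun (word-cong p q (Pieces.Glued-p-fun r α₁ α₂ β λ₁ λ₂ G G'')) R₁ R₁'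
      in same-left e e' (left⁻ x∈) (left⁻ x'∈) b b' ea ea' h
    where
    module Y = InRight (right⁻ y∈)
    p'≗q' : ∀ {z} → z ∈ₛ Star μ₂ β [] → Pict.f p' z ≡ Pict.f q' z
    p'≗q' = RSPict.RS-inj (star-convex Pβ Y.Pμ₂) (StarShape.convex-star λ₂ λ₁ μ₁ Y.Pλ₂ Y.Pλ₁ Y.Pμ₁ Y.μ⊆λ) p' q' R₂ R₂'
    G'' = Glued-resp {p = q} {q = q} {p' = p'} {q' = q'} {a = flip c} {b = flip c'} (λ _ → refl) p'≗q'
      (tab≡⇒f≡ {p = flip c} {flip c'} (tab-flip {p = c} {c'} (trans (sym es) es'))) G'

  target : Label → List ℕ × List ℕ
  target (β₂ , β₁ , _) = β₁ , β₂

  main-sum : ∀ (F : List ℕ × List ℕ → ℤ) → ΣL (F ∘ target ∘ proj₂) lefts ≡ ΣL (F ∘ target ∘ proj₂ ∘ proj₂) rights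
  main-sum F = ΣL-rel Rel {F ∘ target ∘ proj₂} {F ∘ target ∘ proj₂ ∘ proj₂} Unique-lefts Unique-rights total onto functional injective λ { (rel _ _ _ _ _ _ _ _ _) → refl }

-- Products of Schur polynomials

count-++ : ∀ v xs ys → count v (xs ++ ys) ≡ count v xs + count v ys
count-++ v xs ys = trans (cong length (filter-++ (λ x → T? (x ≡ᵇ v)) xs ys)) (length-++ (filterᵇ (λ x → x ≡ᵇ v) xs))

count-↭ : ∀ v {xs ys} → xs ↭ ys → count v xs ≡ count v ys
count-↭ v p = Permₚ.↭-length (Permₚ.filter-↭ (λ x → T? (x ≡ᵇ v)) p)

content : ℕ → List ℕ → List ℕ
content N e = map (λ v → count v e) (range 1 (suc N))

SSYT : ℕ → List ℕ → List Filling
SSYT N γ = filterᵇ (isSSYT γ) (allWords N (size γ))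

mutual
  leD : List ℕ → Filling → Maybe ℕ → Maybe ℕ → Bool
  leD = _

  isSSYT-right : ∀ γ e {i j} → T (isSSYT γ e) → (i , j) ∈ₛ (γ /ₛ []) →
    leD γ e (entryAt (γ /ₛ []) e (i , j)) (entryAt (γ /ₛ []) e (i , suc j)) ≡ true
  isSSYT-right γ e {i} {j} h m with T-true (T-∧ˡ {b = lessIfPresent (entryAt (γ /ₛ []) e (i , j)) (entryAt (γ /ₛ []) e (suc i , j))}
    (allB⁻ {xs = cells (γ /ₛ [])} (T-∧ʳ {length e ≡ᵇ nCells (γ /ₛ [])} h) (∈cells⁺ m)))
  ... | z with entryAt (γ /ₛ []) e (i , j) | entryAt (γ /ₛ []) e (i , suc j)
  ...   | x | y = z

isSSYT-down : ∀ γ e {i j} → T (isSSYT γ e) → (i , j) ∈ₛ (γ /ₛ []) →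
  T (lessIfPresent (entryAt (γ /ₛ []) e (i , j)) (entryAt (γ /ₛ []) e (suc i , j)))
isSSYT-down γ e {i} {j} h m = T-∧ʳ {leD γ e (entryAt (γ /ₛ []) e (i , j)) (entryAt (γ /ₛ []) e (i , suc j))}
  (allB⁻ {xs = cells (γ /ₛ [])} (T-∧ʳ {length e ≡ᵇ nCells (γ /ₛ [])} h) (∈cells⁺ m))

record Semi (N : ℕ) (γ : List ℕ) (F : Cell → ℕ) : Set where
  field
    range' : ∀ {c} → c ∈ₛ (γ /ₛ []) → 1 ≤ F c × F c ≤ N
    right' : ∀ {i j} → (i , suc j) ∈ₛ (γ /ₛ []) → F (i , j) ≤ F (i , suc j)
    down' : ∀ {i j} → (suc i , j) ∈ₛ (γ /ₛ []) → F (i , j) < F (suc i , j)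

∈-SSYT⁺ : ∀ {N γ F} → IsPart γ → Semi N γ F → fill (γ /ₛ []) F ∈ SSYT N γ
∈-SSYT⁺ {N} {γ} {F} Pγ S = ∈-filterᵇ⁺ {p = isSSYT γ}
    (subst (λ l → fill (γ /ₛ []) F ∈ allWords N l) (trans (length-map F (cells (γ /ₛ []))) (size-straight γ))
      (∈-allWords⁺ (All.tabulate λ m → case ∈-map⁻ F m of λ { (c , c∈ , refl) → range' (∈cells⁻ c∈) })))
    (T-∧⁺ {length e ≡ᵇ nCells (γ /ₛ [])} (≡⇒≡ᵇ _ _ (length-map F (cells (γ /ₛ []))))
      (allB⁺ (cells (γ /ₛ [])) λ { {i , j} m → T-∧⁺ {leD γ e (entryAt (γ /ₛ []) e (i , j)) (entryAt (γ /ₛ []) e (i , suc j))}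
        (le (∈cells⁻ m)) (lt (∈cells⁻ m)) }))
  where
  open Semi S
  e : Filling
  e = fill (γ /ₛ []) F
  le : ∀ {i j} → (i , j) ∈ₛ (γ /ₛ []) → T (leD γ e (entryAt (γ /ₛ []) e (i , j)) (entryAt (γ /ₛ []) e (i , suc j)))
  le {i} {j} m with (i , suc j) ∈ₛ? (γ /ₛ [])
  ... | yes k = subst₂ (λ x y → T (leD γ e x y)) (sym (entry-fill F m)) (sym (entry-fill F k)) (≤⇒≤ᵇ (right' k))
  ... | no ¬k = subst₂ (λ x y → T (leD γ e x y)) (sym (entry-fill F m)) (sym (entry-∉ {γ /ₛ []} F ¬k)) tt
  lt : ∀ {i j} → (i , j) ∈ₛ (γ /ₛ []) → T (lessIfPresent (entryAt (γ /ₛ []) e (i , j)) (entryAt (γ /ₛ []) e (suc i , j)))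
  lt {i} {j} m with (suc i , j) ∈ₛ? (γ /ₛ [])
  ... | yes k = subst₂ (λ x y → T (lessIfPresent x y)) (sym (entry-fill F m)) (sym (entry-fill F k)) (<⇒<ᵇ (down' k))
  ... | no ¬k = subst₂ (λ x y → T (lessIfPresent x y)) (sym (entry-fill F m)) (sym (entry-∉ {γ /ₛ []} F ¬k)) tt

entryOf : List ℕ → Filling → Cell → ℕ
entryOf γ e c = fromMaybe 0 (entryAt (γ /ₛ []) e c)

∈-SSYT⁻ : ∀ {N γ e} → IsPart γ → e ∈ SSYT N γ → e ≡ fill (γ /ₛ []) (entryOf γ e) × Semi N γ (entryOf γ e)
∈-SSYT⁻ {N} {γ} {e} Pγ m∈ with ∈-filterᵇ⁻ {p = isSSYT γ} {xs = allWords N (size γ)} m∈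
... | m' , t with ∈-allWords⁻ N (size γ) m'
...   | len , rng = ef , record
    { range' = λ {c} m → All.lookup rng (subst (F c ∈_) (sym ef) (∈-map⁺ F (∈cells⁺ m)))
    ; right' = λ {i} {j} m → let m₀ = in-left (n≤1+n j) m in ≤ᵇ⇒≤ (F (i , j)) (F (i , suc j))
        (subst T (trans (sym (isSSYT-right γ e t m₀)) (cong₂ (leD γ e) (en m₀) (en m))) tt)
    ; down' = λ {i} {j} m → let m₀ = in-up Pγ (n≤1+n i) m in <ᵇ⇒< (F (i , j)) (F (suc i , j))
        (subst₂ (λ x y → T (lessIfPresent x y)) (en m₀) (en m) (isSSYT-down γ e t m₀)) }
  where
  F : Cell → ℕ
  F = entryOf γ e
  ef : e ≡ fill (γ /ₛ []) F
  ef = as-fill (γ /ₛ []) e (trans len (sym (size-straight γ)))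
  en : ∀ {c} → c ∈ₛ (γ /ₛ []) → entryAt (γ /ₛ []) e c ≡ just (F c)
  en {c} m = trans (cong (λ z → entryAt (γ /ₛ []) z c) ef) (entry-fill F m)

Unique-SSYT : ∀ N γ → Unique (SSYT N γ)
Unique-SSYT N γ = Unique-filterᵇ {p = isSSYT γ} (Unique-allWords N (size γ))

-- Standardisation: equal letters are made distinct, decreasing from left to right.

hat : ℕ → List ℕ → List ℕ
hat n []      = []
hat n (x ∷ w) = x * suc n + length w ∷ hat n w

hat-∈ : ∀ {n z} w → z ∈ hat n w → ∃[ x ] ∃[ l ] z ≡ x * suc n + l × l < length w
hat-∈ (x ∷ w) (here refl) = x , length w , refl , ≤-refl
hat-∈ (x ∷ w) (there m) with hat-∈ w m
... | y , l , e , h = y , l , e , m<n⇒m<1+n h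

-- The remainder l counts the letters that follow, and n bounds it. Division by suc n thus gives
-- back the letter; it is the monotone relabelling to which `Relabel` is applied.
hat-/ : ∀ {n} x {l} → l ≤ n → (x * suc n + l) / suc n ≡ x
hat-/ {n} x {l} h = trans (+-distrib-/-∣ˡ l (n∣m*n x))
  (trans (cong₂ _+_ (m*n/n≡m x (suc n)) (m<n⇒m/n≡0 (s≤s h))) (+-identityʳ x))

hat-map : ∀ {n} w → length w ≤ suc n → map (_/ suc n) (hat n w) ≡ w
hat-map [] h = refl
hat-map {n} (x ∷ w) (s≤s h) = cong₂ _∷_ (hat-/ x h) (hat-map w (m≤n⇒m≤1+n h))

hat-at : ∀ {n} w i {x} → atM w i ≡ just x → atM (hat n w) i ≡ just (x * suc n + (length w ∸ suc i))
hat-at (x ∷ w) zero refl = refl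
hat-at (x ∷ w) (suc i) e = hat-at w i e

hat-length : ∀ n w → length (hat n w) ≡ length w
hat-length n [] = refl
hat-length n (x ∷ w) = cong suc (hat-length n w)

hat-refl : ∀ {n} w → length w ≤ suc n → AllPairs (λ y x → x / suc n ≤ y / suc n → x ≤ y) (hat n w)
hat-refl [] h = []
hat-refl {n} (x ∷ w) (s≤s h) = All.tabulate (λ m q → first (hat-∈ w m) q) ∷ hat-refl w (m≤n⇒m≤1+n h)
  where
  first : ∀ {z} → ∃[ y ] ∃[ l ] z ≡ y * suc n + l × l < length w → z / suc n ≤ (x * suc n + length w) / suc n → z ≤ x * suc n + length w
  first (y , l , refl , l<) q = +-mono-≤ (*-monoˡ-≤ (suc n) (subst₂ _≤_ (hat-/ y (≤-trans (<⇒≤ l<) h)) (hat-/ x h) q)) (<⇒≤ l<)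

hat-unique : ∀ {n} w → length w ≤ suc n → Unique (hat n w)
hat-unique [] h = []
hat-unique {n} (x ∷ w) (s≤s h) = Unique-∷ (λ m → bad (hat-∈ w m)) (hat-unique w (m≤n⇒m≤1+n h))
  where
  bad : ¬ (∃[ y ] ∃[ l ] x * suc n + length w ≡ y * suc n + l × l < length w)
  bad (y , l , e , l<) with trans (sym (hat-/ x h)) (trans (cong (_/ suc n) e) (hat-/ y (≤-trans (<⇒≤ l<) h)))
  ... | refl = <-irrefl (sym (+-cancelˡ-≡ (x * suc n) _ _ e)) l<

module Hat {n : ℕ} (w : List ℕ) (h : length w ≤ suc n) where

  ŵ : List ℕ
  ŵ = hat n w

  Q≡ : proj₂ (RSʷ w) ≡ proj₂ (RSʷ ŵ)
  Q≡ = trans (cong (proj₂ ∘ RSʷ) (sym (hat-map w h)))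
    (cong proj₂ (Relabel.RSʷ-φ (_/ suc n) (/-monoˡ-≤ (suc n)) ŵ (hat-refl w h)))

  lt-left : ∀ {p q x y} → atM w p ≡ just x → atM w q ≡ just y → q < p → x ≤ y → x * suc n + (length w ∸ suc p) < y * suc n + (length w ∸ suc q)
  lt-left e e' l x≤y = +-mono-≤-< (*-monoˡ-≤ (suc n) x≤y) (∸-monoʳ-< (s≤s l) (atM-just w e))

  lt-strict : ∀ {p q x y} → atM w p ≡ just x → x < y → x * suc n + (length w ∸ suc p) < y * suc n + (length w ∸ suc q)
  lt-strict {p} {q} {x} {y} e x<y = <-≤-trans (+-monoʳ-< (x * suc n) (s≤s (≤-trans (∸-monoʳ-≤ (length w) (s≤s z≤n)) (∸-monoˡ-≤ 1 h))))
    (≤-trans (≤-reflexive (+-comm (x * suc n) (suc n))) (≤-trans (*-monoˡ-≤ (suc n) x<y) (m≤m+n _ _)))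

  lt⇒≤ : ∀ {p q x y} → atM w p ≡ just x → atM w q ≡ just y → x * suc n + (length w ∸ suc p) < y * suc n + (length w ∸ suc q) → x ≤ y
  lt⇒≤ {p} {q} {x} {y} e e' l = ≮⇒≥ λ y<x → <-asym l (lt-strict {q} {p} {y} {x} e' y<x)

  lt⇒< : ∀ {p q x y} → atM w p ≡ just x → atM w q ≡ just y → p < q → x * suc n + (length w ∸ suc p) < y * suc n + (length w ∸ suc q) → x < y
  lt⇒< e e' p<q l = ≰⇒> λ y≤x → <-asym l (lt-left e' e p<q y≤x)

-- The Littlewood–Richardson rule

atM-value : ∀ (xs : List ℕ) {i} → i < length xs → atM xs i ≡ just (fromMaybe 0 (atM xs i))
atM-value xs {i} h with atM xs i | atM-< xs h
... | just x | _ = refl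
... | nothing | _ , ()

-- A pair of semistandard tableaux of shapes α and β is a filling of β * α. Its reading word has a
-- semistandard insertion tableau with the same content, of some shape γ; the recording tableau,
-- which is also that of the standardised word, is a picture from γ to β * α. So γ occurs as often
-- as `RW` has such pictures.
module LR (N : ℕ) {α β : List ℕ} (Pα : IsPart α) (Pβ : IsPart β) where

  open StarShape α β [] renaming (X to Y; L to B; b to width)

  cY : Convex Y
  cY = star-convex Pβ Pα

  size-Y : ℕ
  size-Y = nCells Y

  pick : Filling → Filling → Cell → ℕ
  pick e₂ e₃ c = if proj₁ c <ᵇ m then entryOf α e₂ (hi⁻ c) else entryOf β e₃ (lo⁻ c)

  pick-hi : ∀ {e₂ e₃ c} → c ∈ₛ H → pick e₂ e₃ (hi c) ≡ entryOf α e₂ c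
  pick-hi {e₂} {c = c} h = trans (if-yes (<⇒<ᵇ (hi< h))) (cong (entryOf α e₂) (hi⁻hi c))

  pick-lo : ∀ {e₂ e₃} c → pick e₂ e₃ (lo c) ≡ entryOf β e₃ c
  pick-lo {e₃ = e₃} c = trans (if-no λ t → <⇒≱ (<ᵇ⇒< _ m t) (lo-row≥ c)) (cong (entryOf β e₃) (lo⁻lo c))

  reading : Filling → Filling → List ℕ
  reading e₂ e₃ = applyUpTo (λ i → pick e₂ e₃ (cellOf Y (suc i))) size-Y

  reading-length : ∀ e₂ e₃ → length (reading e₂ e₃) ≡ size-Y
  reading-length e₂ e₃ = length-applyUpTo _ size-Y

  reading-at : ∀ {e₂ e₃ c} → c ∈ₛ Y → atM (reading e₂ e₃) (lab Y c ∸ 1) ≡ just (pick e₂ e₃ c)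
  reading-at {e₂} {e₃} h = trans (atM-applyUpTo _ size-Y (lab∸< h))
    (cong (just ∘ pick e₂ e₃) (trans (cong (cellOf Y) (lab-suc∸ h)) (cellOf-lab h)))

  parts-↭ : cells Y ↭ map hi (cells H) ++ map lo (cells B)
  parts-↭ = ↭-same (Unique-cells Y)
    (Uₚ.++⁺ (Uₚ.map⁺ (λ {x} {y} e → trans (sym (hi⁻hi x)) (trans (cong hi⁻ e) (hi⁻hi y))) (Unique-cells H))
      (Uₚ.map⁺ (λ {x} {y} e → trans (sym (lo⁻lo x)) (trans (cong lo⁻ e) (lo⁻lo y))) (Unique-cells B))
      λ (a , b) → disjoint (∈-map⁻ hi a) (∈-map⁻ lo b))
    (λ h → into (view (∈cells⁻ h)))
    (λ h → case ∈-++⁻ (map hi (cells H)) h of λ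
      { (inj₁ a) → case ∈-map⁻ hi a of λ { (c , c∈ , refl) → ∈cells⁺ (hi∈ (∈cells⁻ c∈)) }
      ; (inj₂ a) → case ∈-map⁻ lo a of λ { (c , c∈ , refl) → ∈cells⁺ (lo∈ (∈cells⁻ c∈)) } })
    where
    disjoint : ∀ {z} → ∃[ c ] c ∈ cells H × z ≡ hi c → ∃[ d ] d ∈ cells B × z ≡ lo d → ⊥
    disjoint (c , c∈ , refl) (d , d∈ , e) = hi≢lo (∈cells⁻ c∈) e
    into : ∀ {z} → View z → z ∈ map hi (cells H) ++ map lo (cells B)
    into (isHi h) = ∈-++⁺ˡ (∈-map⁺ hi (∈cells⁺ h))
    into (isLo l) = ∈-++⁺ʳ (map hi (cells H)) (∈-map⁺ lo (∈cells⁺ l))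

  reading-↭ : ∀ {e₂ e₃} → e₂ ≡ fill H (entryOf α e₂) → e₃ ≡ fill B (entryOf β e₃) → reading e₂ e₃ ↭ e₂ ++ e₃
  reading-↭ {e₂} {e₃} eq₂ eq₃ = subst₂ _↭_ (map-applyUpTo _ (pick e₂ e₃) size-Y) right-eq
      (Permₚ.map⁺ (pick e₂ e₃) (↭-trans (cellOf-↭ Y) parts-↭))
    where
    right-eq : map (pick e₂ e₃) (map hi (cells H) ++ map lo (cells B)) ≡ e₂ ++ e₃
    right-eq = trans (map-++ (pick e₂ e₃) (map hi (cells H)) _) (cong₂ _++_
      (trans (sym (map-∘ (cells H))) (trans (map-cong-∈ (cells H) (λ h → pick-hi (∈cells⁻ h))) (sym eq₂)))
      (trans (sym (map-∘ (cells B))) (trans (map-cong-∈ (cells B) (λ {c} _ → pick-lo c)) (sym eq₃))))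

  record Rel (x : Filling × Filling) (y : (List ℕ × Filling) × Filling) : Set where
    field
      shape≡ : shapeOf (proj₁ (RSʷ (reading (proj₁ x) (proj₂ x)))) ≡ proj₁ (proj₁ y)
      insertion≡ : concat (rowsOf (proj₁ (RSʷ (reading (proj₁ x) (proj₂ x))))) ≡ proj₂ y
      recording≡ : concat (rowsOf (proj₂ (RSʷ (reading (proj₁ x) (proj₂ x))))) ≡ proj₂ (proj₁ y)
      content≡ : proj₂ y ↭ proj₁ x ++ proj₂ x

  pairs : List (Filling × Filling)
  pairs = bind (SSYT N α) λ _ → SSYT N β

  overTop : List ℕ × Filling → List Filling
  overTop (γ , _) = SSYT N γ

  products : List ((List ℕ × Filling) × Filling)
  products = bind (tops β α) overTop

  module _ (w : List ℕ) (len : length w ≡ size-Y) where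
    open Hat {size-Y} w (≤-trans (≤-reflexive len) (n≤1+n _)) public

    private
      get : ∀ {c x} → c ∈ₛ Y → ∀ {p} → lab Y c ≡ suc p → atM w (lab Y c ∸ 1) ≡ just x →
        ∀ {z} → atM ŵ p ≡ just z → atM w p ≡ just x × z ≡ x * suc size-Y + (length w ∸ suc p)
      get {x = x} c∈ {p} e a b = a' , just-injective (trans (sym b) (hat-at w p a'))
        where a' = trans (cong (λ l → atM w (l ∸ 1)) (sym e)) a

    -- Of two boxes in a row the right one is read first and receives the larger remainder, so
    -- weakly increasing rows become strictly increasing. Down a column the letters already differ.
    hat-increasing : (F : Cell → ℕ) → (∀ {c} → c ∈ₛ Y → atM w (lab Y c ∸ 1) ≡ just (F c)) →
      (∀ {i j j'} → (i , j) ∈ₛ Y → (i , j') ∈ₛ Y → j < j' → F (i , j) ≤ F (i , j')) →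
      (∀ {i j} → (i , j) ∈ₛ Y → (suc i , j) ∈ₛ Y → F (i , j) < F (suc i , j)) → Increasing Y ŵ
    hat-increasing F at-F rowF colF c e e' = go c refl refl e e'
      where
      go : ∀ {a b p q x y} → Con Y a b → a ≡ suc p → b ≡ suc q → atM ŵ p ≡ just x → atM ŵ q ≡ just y → x < y
      go {p = p} {q} (rowC {i} {j} {j'} k l j<) ea eb e e' with get k ea (at-F k) e | get l eb (at-F l) e'
      ... | a , refl | b , refl = lt-left a b (s≤s⁻¹ (subst₂ _<_ eb ea (lab-mono l k (right j<)))) (rowF k l j<)
      go (colC k l) ea eb e e' with get k ea (at-F k) e | get l eb (at-F l) e'
      ... | a , refl | b , refl = lt-strict a (colF k l)

    increasing-row : Increasing Y ŵ → ∀ {c d x y} → c ∈ₛ Y → d ∈ₛ Y → Con Y (lab Y c) (lab Y d) →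
      atM w (lab Y c ∸ 1) ≡ just x → atM w (lab Y d ∸ 1) ≡ just y → x ≤ y
    increasing-row inc {c} {d} k l con a b = lt⇒≤ a b
      (inc (subst₂ (Con Y) (sym (lab-suc∸ k)) (sym (lab-suc∸ l)) con) (hat-at w (lab Y c ∸ 1) a) (hat-at w (lab Y d ∸ 1) b))

    increasing-col : Increasing Y ŵ → ∀ {i j x y} → (i , j) ∈ₛ Y → (suc i , j) ∈ₛ Y →
      atM w (lab Y (i , j) ∸ 1) ≡ just x → atM w (lab Y (suc i , j) ∸ 1) ≡ just y → x < y
    increasing-col inc {i} {j} k l a b = lt⇒< a b (lab∸-≺ k l (above ≤-refl))
      (inc (subst₂ (Con Y) (sym (lab-suc∸ k)) (sym (lab-suc∸ l)) (colC k l)) (hat-at w (lab Y (i , j) ∸ 1) a) (hat-at w (lab Y (suc i , j) ∸ 1) b))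

  rights : ∀ {γ F} → Semi N γ F → ∀ {i j j'} → j < j' → (i , j') ∈ₛ (γ /ₛ []) → F (i , j) ≤ F (i , j')
  rights S {j' = suc j'} l h with m≤n⇒m<n∨m≡n (s≤s⁻¹ l)
  ... | inj₁ l' = ≤-trans (rights S l' (in-left (n≤1+n j') h)) (Semi.right' S h)
  ... | inj₂ refl = Semi.right' S h

  total : ∀ {x} → x ∈ pairs → ∃[ y ] y ∈ products × Rel x y
  total {e₂ , e₃} x∈ = _ , ∈-bind⁺ {f = overTop} (∈-tops⁺ Pβ Pα γP (proj₁ pq)) e∈ ,
      record { shape≡ = refl ; insertion≡ = rowsOf-fill okP ; recording≡ = trans (cong (concat ∘ rowsOf) Q≡') (sym (proj₂ pq))
             ; content≡ = ↭-trans (subst (_↭ concat P) (rowsOf-fill okP) (rowsOf-↭ okP))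
                 (↭-trans (RSw.P-entries w) (reading-↭ (proj₁ s₂) (proj₁ s₃))) }
    where
    mem = ∈-bind⁻ {f = λ _ → SSYT N β} {xs = SSYT N α} x∈
    s₂ = ∈-SSYT⁻ {N} {α} {e₂} Pα (proj₁ mem)
    s₃ = ∈-SSYT⁻ {N} {β} {e₃} Pβ (proj₂ mem)
    w = reading e₂ e₃
    len = reading-length e₂ e₃
    P = proj₁ (RSʷ w)
    okP : OK P
    okP = SS-Shape (RSw.P-SS w)
    γP = shapeOf-isPart okP
    F = pick e₂ e₃
    w' = ŵ w len
    uw' : Unique w'
    uw' = hat-unique w (≤-trans (≤-reflexive len) (n≤1+n _))
    Q≡' : proj₂ (RSʷ w) ≡ proj₂ (RSʷ w')
    Q≡' = Q≡ w len
    F-row : ∀ {i j j'} → (i , j) ∈ₛ Y → (i , j') ∈ₛ Y → j < j' → F (i , j) ≤ F (i , j')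
    F-row {i} {j} {j'} k l lt with view k
    ... | isHi {i , j₀} h = subst₂ _≤_ (sym (pick-hi {e₂} {e₃} h)) (trans (sym (pick-hi {e₂} {e₃} h')) (cong (λ z → F (i , z)) j'≡))
          (rights (proj₂ s₂) (+-cancelʳ-< width _ _ (subst (j₀ + width <_) (sym j'≡) lt)) h')
      where
      j'≡ : j' ∸ width + width ≡ j'
      j'≡ = m∸n+n≡m (≤-trans (m≤n+m width j₀) (<⇒≤ lt))
      h' : (i , j' ∸ width) ∈ₛ H
      h' = hi∈⁻ (hi< h) (subst (λ z → (i , z) ∈ₛ Y) (sym j'≡) l)
    ... | isLo {i , j} h = subst₂ _≤_ (sym (pick-lo {e₂} {e₃} (i , j))) (sym (pick-lo {e₂} {e₃} (i , j'))) (rights (proj₂ s₃) lt (lo∈⁻ l))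
    F-col : ∀ {i j} → (i , j) ∈ₛ Y → (suc i , j) ∈ₛ Y → F (i , j) < F (suc i , j)
    F-col k l with view↓ Pα Pβ IsPart-[] (λ _ → z≤n) k l
    ... | hi↓ h h' = subst₂ _<_ (sym (pick-hi {e₂} {e₃} h)) (sym (pick-hi {e₂} {e₃} h')) (Semi.down' (proj₂ s₂) h')
    ... | lo↓ {i} {j} h h' = subst₂ _<_ (sym (pick-lo {e₂} {e₃} (i , j))) (sym (trans (cong (λ z → F (z , j)) (sym (+-suc m i))) (pick-lo {e₂} {e₃} (suc i , j)))) (Semi.down' (proj₂ s₃) h')
    inc : Increasing Y w'
    inc = hat-increasing w len F reading-at F-row F-col
    found = Recording.Inc⇒Q w' uw' cY (trans (hat-length size-Y w) len) inc
    pq : ∃[ q ] tab {shapeOf P /ₛ []} {Y} q ≡ concat (rowsOf (proj₂ (RSʷ w')))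
    pq = subst (λ g → ∃[ q ] tab {g /ₛ []} {Y} q ≡ concat (rowsOf (proj₂ (RSʷ w'))))
      (trans (cong shapeOf (sym Q≡')) (shape⇒shapeOf (subst Shape (RSw.same-shape w) okP) okP (sym (RSw.same-shape w)))) found
    e∈ : fill (shapeOf P /ₛ []) (value okP) ∈ SSYT N (shapeOf P)
    e∈ = ∈-SSYT⁺ γP record
      { range' = λ {c} h → All.lookup rng (Permₚ.∈-resp-↭ (RSw.P-entries w) (ent-∈ {P} {c} (ent-value okP h)))
      ; right' = λ h → SS-right {P} (RSw.P-SS w) (ent-value okP (in-left (n≤1+n _) h)) (ent-value okP h)
      ; down' = λ h → SS-down {P} (RSw.P-SS w) (ent-value okP (in-up γP (n≤1+n _) h)) (ent-value okP h) }
      where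
      rngF : ∀ {γ F e} → e ≡ fill (γ /ₛ []) F → Semi N γ F → All (λ v → 1 ≤ v × v ≤ N) e
      rngF refl S = All.tabulate λ m → case ∈-map⁻ _ m of λ { (c , c∈ , refl) → Semi.range' S (∈cells⁻ c∈) }
      rng : All (λ v → 1 ≤ v × v ≤ N) w
      rng = Permₚ.All-resp-↭ (↭-sym (reading-↭ {e₂} {e₃} (proj₁ s₂) (proj₁ s₃))) (Allₚ.++⁺ (rngF (proj₁ s₂) (proj₂ s₂)) (rngF (proj₁ s₃) (proj₂ s₃)))

  onto : ∀ {y} → y ∈ products → ∃[ x ] x ∈ pairs × Rel x y
  onto {(γ , t) , e} y∈ = (e₂ , e₃) , ∈-bind⁺ {f = λ _ → SSYT N β} (∈-SSYT⁺ Pα semi₂) (∈-SSYT⁺ Pβ semi₃) ,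
      record { shape≡ = trans (cong (shapeOf ∘ proj₁) RS≡) (colsOf-shape γ E γP)
             ; insertion≡ = trans (cong (concat ∘ rowsOf ∘ proj₁) RS≡) (trans (colsOf-fill γ E γP) (sym (proj₁ s)))
             ; recording≡ = trans (cong (concat ∘ rowsOf ∘ proj₂) RS≡) (trans (colsOf-fill γ FQ γP) (sym (proj₂ (proj₂ (proj₂ top)))))
             ; content≡ = ↭-trans (subst (_↭ concat P) (trans (colsOf-fill γ E γP) (sym (proj₁ s))) (rowsOf-↭ (colsOf-OK γ E γP)))
                 (↭-trans (subst (λ z → concat z ↭ reading e₂ e₃) (cong proj₁ RS≡) (RSw.P-entries (reading e₂ e₃)))
                   (reading-↭ {e₂} {e₃} (as-entry α hi) (as-entry β lo))) }
    where
    mem = ∈-bind⁻ {f = overTop} {xs = tops β α} y∈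
    top = ∈-tops⁻ Pβ Pα (proj₁ mem)
    γP = proj₁ top
    pt : Pict (γ /ₛ []) Y
    pt = proj₁ (proj₂ (proj₂ top))
    s = ∈-SSYT⁻ {N} {γ} {e} γP (proj₂ mem)
    E FQ : Cell → ℕ
    E = entryOf γ e
    FQ c = lab Y (Pict.f pt c)
    P Q : Cols
    P = colsOf γ E γP
    Q = colsOf γ FQ γP
    sP : SS P
    sP = colsOf-SS γ E γP (λ _ h → Semi.right' (proj₂ s) h) (λ _ h → Semi.down' (proj₂ s) h)
    sQ : SS Q
    sQ = pictCols-SS γP pt
    same : shapeOf P ≡ shapeOf Q
    same = trans (colsOf-shape γ E γP) (sym (colsOf-shape γ FQ γP))
    found = RSʷ-sur size-Y P Q sP sQ (shapeOf⇒shape (SS-Shape sP) (SS-Shape sQ) same) (pictCols-↭ γP pt)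
    w = proj₁ found
    w-RS : RSʷ w ≡ (P , Q)
    w-RS = proj₁ (proj₂ found)
    len : length w ≡ size-Y
    len = proj₂ (proj₂ found)
    w' = ŵ w len
    uw' : Unique w'
    uw' = hat-unique w (≤-trans (≤-reflexive len) (n≤1+n _))
    Q' : proj₂ (RSʷ w') ≡ Q
    Q' = trans (sym (Q≡ w len)) (cong proj₂ w-RS)
    transport : ∀ {C : Cols} (z : Pict (γ /ₛ []) Y) → shapeOf C ≡ γ → tab z ≡ concat (rowsOf C) →
      Σ (Pict (shapeOf C /ₛ []) Y) λ z' → tab z' ≡ concat (rowsOf C)
    transport z refl e = z , e
    inc : Increasing Y w'
    inc = let z , e = transport {C = proj₂ (RSʷ w')} pt (trans (cong shapeOf Q') (colsOf-shape γ FQ γP))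
                (sym (trans (cong (concat ∘ rowsOf) Q') (colsOf-fill γ FQ γP))) in
      Recording.Q⇒Inc w' uw' cY (trans (hat-length size-Y w) len) z e
    v : Cell → ℕ
    v c = fromMaybe 0 (atM w (lab Y c ∸ 1))
    at-v : ∀ {c} → c ∈ₛ Y → atM w (lab Y c ∸ 1) ≡ just (v c)
    at-v {c} h = atM-value w (subst (lab Y c ∸ 1 <_) (sym len) (lab∸< h))
    e₂ e₃ : Filling
    e₂ = fill H (v ∘ hi)
    e₃ = fill B (v ∘ lo)
    as-entry : ∀ γ (h : Cell → Cell) → fill (γ /ₛ []) (v ∘ h) ≡ fill (γ /ₛ []) (entryOf γ (fill (γ /ₛ []) (v ∘ h)))
    as-entry γ h = fill-cong {γ /ₛ []} λ m → sym (cong (fromMaybe 0) (entry-fill (v ∘ h) m))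
    w-range : ∀ {c} → c ∈ₛ Y → 1 ≤ v c × v c ≤ N
    w-range {c} h = let d , d∈ , eq = ent-P (Permₚ.∈-resp-↭ (↭-sym (subst (λ z → concat z ↭ w) (cong proj₁ w-RS) (RSw.P-entries w))) (atM-∈ {xs = w} {lab Y c ∸ 1} (at-v h))) in
        subst (λ z → 1 ≤ z × z ≤ N) (sym eq) (Semi.range' (proj₂ s) d∈)
      where
      ent-P : ∀ {x} → x ∈ concat P → ∃[ d ] d ∈ₛ (γ /ₛ []) × x ≡ E d
      ent-P x∈ = let d , e = ∈-ent {P} x∈ in d , ent-colsOf γ E γP e
    semi₂ : Semi N α (v ∘ hi)
    semi₂ = record { range' = λ h → w-range (hi∈ h)
      ; right' = λ h → let k = hi∈ (in-left (n≤1+n _) h) ; l = hi∈ h in increasing-row w len inc k l (rowC k l ≤-refl) (at-v k) (at-v l)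
      ; down' = λ h → let k = hi∈ (in-up Pα (n≤1+n _) h) ; l = hi∈ h in increasing-col w len inc k l (at-v k) (at-v l) }
    semi₃ : Semi N β (v ∘ lo)
    semi₃ = record { range' = λ h → w-range (lo∈ h)
      ; right' = λ h → let k = lo∈ (in-left (n≤1+n _) h) ; l = lo∈ h in increasing-row w len inc k l (rowC k l ≤-refl) (at-v k) (at-v l)
      ; down' = λ {i} {j} h → let k = lo∈ (in-up Pβ (n≤1+n _) h) ; l = lo∈ h in
          subst (λ z → v (lo (i , j)) < v (z , j)) (sym (+-suc m i)) (increasing-col w len inc k (subst (λ z → (z , j) ∈ₛ Y) (+-suc m i) l) (at-v k)
            (at-v (subst (λ z → (z , j) ∈ₛ Y) (+-suc m i) l))) }
    reading≡ : reading e₂ e₃ ≡ w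
    reading≡ = lab-ext {Y} (reading-length e₂ e₃) len λ c∈ →
        trans (reading-at {e₂} {e₃} c∈) (trans (cong just (pick-v (view c∈))) (sym (at-v c∈)))
      where
      pick-v : ∀ {c} → View c → pick e₂ e₃ c ≡ v c
      pick-v (isHi h) = trans (pick-hi {e₂} {e₃} h) (cong (fromMaybe 0) (entry-fill (v ∘ hi) h))
      pick-v (isLo {c} h) = trans (pick-lo {e₂} {e₃} c) (cong (fromMaybe 0) (entry-fill (v ∘ lo) h))
    RS≡ : RSʷ (reading e₂ e₃) ≡ (P , Q)
    RS≡ = trans (cong RSʷ reading≡) w-RS

  functional : ∀ {x y y'} → Rel x y → Rel x y' → y ≡ y'
  functional R R' = cong₂ _,_ (cong₂ _,_ (trans (sym (Rel.shape≡ R)) (Rel.shape≡ R')) (trans (sym (Rel.recording≡ R)) (Rel.recording≡ R')))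
    (trans (sym (Rel.insertion≡ R)) (Rel.insertion≡ R'))

  injective : ∀ {x x' y} → x ∈ pairs → x' ∈ pairs → Rel x y → Rel x' y → x ≡ x'
  injective {e₂ , e₃} {e₂' , e₃'} x∈ x'∈ R R' = cong₂ _,_
      (trans (proj₁ (∈-SSYT⁻ {N} {α} {e₂} Pα (proj₁ mem))) (trans (fill-cong {H} λ h →
        trans (sym (pick-hi {e₂} {e₃} h)) (trans (picks (hi∈ h)) (pick-hi {e₂'} {e₃'} h))) (sym (proj₁ (∈-SSYT⁻ {N} {α} {e₂'} Pα (proj₁ mem'))))))
      (trans (proj₁ (∈-SSYT⁻ {N} {β} {e₃} Pβ (proj₂ mem))) (trans (fill-cong {B} λ {c} h →
        trans (sym (pick-lo {e₂} {e₃} c)) (trans (picks (lo∈ h)) (pick-lo {e₂'} {e₃'} c))) (sym (proj₁ (∈-SSYT⁻ {N} {β} {e₃'} Pβ (proj₂ mem'))))))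
    where
    mem = ∈-bind⁻ {f = λ _ → SSYT N β} {xs = SSYT N α} x∈
    mem' = ∈-bind⁻ {f = λ _ → SSYT N β} {xs = SSYT N α} x'∈
    words : reading e₂ e₃ ≡ reading e₂' e₃'
    words = RS-same (trans (Rel.shape≡ R) (sym (Rel.shape≡ R'))) (trans (Rel.insertion≡ R) (sym (Rel.insertion≡ R')))
      (trans (Rel.recording≡ R) (sym (Rel.recording≡ R')))
    picks : ∀ {c} → c ∈ₛ Y → pick e₂ e₃ c ≡ pick e₂' e₃' c
    picks {c} h = just-injective (trans (sym (reading-at {e₂} {e₃} h)) (trans (cong (λ w → atM w (lab Y c ∸ 1)) words) (reading-at {e₂'} {e₃'} h)))

  LR-sum : (F : Filling × Filling → ℤ) (G : Filling → ℤ) →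
    (∀ {e₂ e₃ e} → e ↭ e₂ ++ e₃ → F (e₂ , e₃) ≡ G e) → ΣL F pairs ≡ ΣL (G ∘ proj₂) products
  LR-sum F G h = ΣL-rel Rel {F} {G ∘ proj₂}
    (Unique-bind {f = λ _ → SSYT N β} (Unique-SSYT N α) (λ _ → Unique-SSYT N β))
    (Unique-bind {f = overTop} (Unique-tops β α) (λ {γt} _ → Unique-SSYT N (proj₁ γt)))
    total onto (λ _ _ _ → functional) (λ x∈ x'∈ _ → injective x∈ x'∈) (λ R → h (Rel.content≡ R))

-- Coefficients

δ : Mono → ℤ × Mono → ℤ
δ m (c , n) = if eqList n m then c else ℤ.0ℤ

coeff-Σ : ∀ p m → coeff p m ≡ ΣL (δ m) p
coeff-Σ [] m = refl
coeff-Σ ((c , n) ∷ p) m with eqList n m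
... | true  = cong (λ z → c ℤ.+ z) (coeff-Σ p m)
... | false = trans (coeff-Σ p m) (sym (ℤₚ.+-identityˡ _))

_⊗_ : ℤ × Mono → ℤ × Mono → ℤ × Mono
(c , m) ⊗ (d , n) = c ℤ.* d , zipWith _+_ m n

mulP-Σ : ∀ (G : ℤ × Mono → ℤ) p q → ΣL G (mulP p q) ≡ ΣL (λ t → ΣL (λ s → G (t ⊗ s)) q) p
mulP-Σ G p q = trans (ΣL-concatMap G _ p) (ΣL-cong p λ { {c , m} _ → trans (ΣL-map G _ q) (ΣL-cong q λ { {d , n} _ → refl }) })

-- The recursion for τ subtracts, so this is what a functional on terms must fulfil for it to be
-- summed. The two instances are the coefficient of a monomial and the coefficient after
-- multiplication by a fixed polynomial.
Odd : (ℤ × Mono → ℤ) → Set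
Odd G = ∀ c n → G (ℤ.- c , n) ≡ ℤ.- G (c , n)

ΣL-neg : ∀ {A : Set} (f : A → ℤ) xs → ΣL (λ x → ℤ.- f x) xs ≡ ℤ.- ΣL f xs
ΣL-neg f []       = refl
ΣL-neg f (x ∷ xs) = trans (cong (λ z → ℤ.- f x ℤ.+ z) (ΣL-neg f xs)) (sym (ℤₚ.neg-distrib-+ (f x) _))

ΣL-negP : ∀ {G} → Odd G → ∀ p → ΣL G (negP p) ≡ ℤ.- ΣL G p
ΣL-negP {G} odd p = trans (ΣL-map G _ p) (trans (ΣL-cong p λ { {c , n} _ → odd c n }) (ΣL-neg G p))

δ-odd : ∀ m → Odd (δ m)
δ-odd m c n with eqList n m
... | true  = refl
... | false = refl

δ-times : Mono → Poly → ℤ × Mono → ℤ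
δ-times m q t = ΣL (λ s → δ m (t ⊗ s)) q

δ-times-odd : ∀ m q → Odd (δ-times m q)
δ-times-odd m q c n = trans (ΣL-cong q λ { {d , k} _ → trans (cong (λ z → δ m (z , zipWith _+_ n k)) (sym (ℤₚ.neg-distribˡ-* c d)))
  (δ-odd m (c ℤ.* d) (zipWith _+_ n k)) }) (ΣL-neg (λ s → δ m ((c , n) ⊗ s)) q)

ΣL-swap : ∀ {A B : Set} (f : A → B → ℤ) xs ys → ΣL (λ x → ΣL (f x) ys) xs ≡ ΣL (λ y → ΣL (λ x → f x y) xs) ys
ΣL-swap f [] ys = zeros ys
  where
  zeros : ∀ {A : Set} (ys : List A) → ℤ.0ℤ ≡ ΣL (λ _ → ℤ.0ℤ) ys
  zeros [] = refl
  zeros (y ∷ ys) = trans (zeros ys) (sym (ℤₚ.+-identityˡ _))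
ΣL-swap f (x ∷ xs) ys = trans (cong (λ z → ΣL (f x) ys ℤ.+ z) (ΣL-swap f xs ys)) (merge ys)
  where
  merge : ∀ ys → ΣL (f x) ys ℤ.+ ΣL (λ y → ΣL (λ x → f x y) xs) ys ≡ ΣL (λ y → f x y ℤ.+ ΣL (λ x → f x y) xs) ys
  merge [] = refl
  merge (y ∷ ys) = trans (interchange (f x y) _ _ _) (cong (λ z → f x y ℤ.+ ΣL (λ x → f x y) xs ℤ.+ z) (merge ys))
    where
    interchange : ∀ a b c d → (a ℤ.+ b) ℤ.+ (c ℤ.+ d) ≡ (a ℤ.+ c) ℤ.+ (b ℤ.+ d)
    interchange a b c d = trans (ℤₚ.+-assoc a b (c ℤ.+ d)) (trans (cong (λ z → a ℤ.+ z)
      (trans (sym (ℤₚ.+-assoc b c d)) (trans (cong (λ z → z ℤ.+ d) (ℤₚ.+-comm b c)) (ℤₚ.+-assoc c b d)))) (sym (ℤₚ.+-assoc a c (b ℤ.+ d))))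

xTerm yTerm : ℕ → Filling → ℤ × Mono
xTerm N e = ℤ.1ℤ , content N e ++ replicate N 0
yTerm N e = ℤ.1ℤ , replicate N 0 ++ content N e

s2-Σ : ∀ G N α₁ α₂ → ΣL G (s2 N α₁ α₂) ≡ ΣL (λ e₁ → ΣL (λ e₂ → G (xTerm N e₁ ⊗ yTerm N e₂)) (SSYT N α₂)) (SSYT N α₁)
s2-Σ G N α₁ α₂ = trans (mulP-Σ G (schurX N α₁) (schurY N α₂))
  (trans (ΣL-map (λ t → ΣL (λ s → G (t ⊗ s)) (schurY N α₂)) (xTerm N) (SSYT N α₁))
    (ΣL-cong (SSYT N α₁) λ {e₁} _ → ΣL-map (λ s → G (xTerm N e₁ ⊗ s)) (yTerm N) (SSYT N α₂)))

zipWith-++ : ∀ (a b c d : List ℕ) → length a ≡ length c → zipWith _+_ (a ++ b) (c ++ d) ≡ zipWith _+_ a c ++ zipWith _+_ b d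
zipWith-++ [] b [] d e = refl
zipWith-++ (x ∷ a) b (y ∷ c) d e = cong (x + y ∷_) (zipWith-++ a b c d (suc-injective e))

zipWith-maps : ∀ (f g : ℕ → ℕ) xs → zipWith _+_ (map f xs) (map g xs) ≡ map (λ v → f v + g v) xs
zipWith-maps f g [] = refl
zipWith-maps f g (x ∷ xs) = cong (f x + g x ∷_) (zipWith-maps f g xs)

replicate-map : ∀ N → replicate N 0 ≡ map (λ _ → 0) (range 1 (suc N))
replicate-map N = trans (go N) (sym (map-applyUpTo (λ i → 1 + i) (λ _ → 0) N))
  where
  go : ∀ N → replicate N 0 ≡ applyUpTo (λ _ → 0) N
  go zero    = refl
  go (suc N) = cong (0 ∷_) (go N)

module Monomials (N : ℕ) where
  vs : List ℕ
  vs = range 1 (suc N)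

  two : (f g : ℕ → ℕ) → List ℕ
  two f g = map f vs ++ map g vs

  zip-two : ∀ f g f' g' → zipWith _+_ (two f g) (two f' g') ≡ two (λ v → f v + f' v) (λ v → g v + g' v)
  zip-two f g f' g' = trans (zipWith-++ (map f vs) (map g vs) (map f' vs) (map g' vs) (trans (length-map f vs) (sym (length-map f' vs))))
    (cong₂ _++_ (zipWith-maps f f' vs) (zipWith-maps g g' vs))

  two-cong : ∀ {f g f' g'} → (∀ v → f v ≡ f' v) → (∀ v → g v ≡ g' v) → two f g ≡ two f' g'
  two-cong h k = cong₂ _++_ (map-cong h vs) (map-cong k vs)

  x-two : ∀ e → proj₂ (xTerm N e) ≡ two (λ v → count v e) (λ _ → 0)
  x-two e = cong (content N e ++_) (replicate-map N)

  y-two : ∀ e → proj₂ (yTerm N e) ≡ two (λ _ → 0) (λ v → count v e)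
  y-two e = cong (_++ content N e) (replicate-map N)

  xy-two : ∀ e e' → proj₂ (xTerm N e ⊗ yTerm N e') ≡ two (λ v → count v e) (λ v → count v e')
  xy-two e e' = trans (cong₂ (zipWith _+_) (x-two e) (y-two e')) (trans (zip-two (λ v → count v e) (λ _ → 0) (λ _ → 0) (λ v → count v e'))
    (two-cong (λ v → +-identityʳ (count v e)) (λ v → refl)))

  product-term : ∀ e₁ {e₂ e₃ e} → e ↭ e₂ ++ e₃ → (xTerm N e₁ ⊗ yTerm N e₂) ⊗ (xTerm N [] ⊗ yTerm N e₃) ≡ xTerm N e₁ ⊗ yTerm N e
  product-term e₁ {e₂} {e₃} {e} p = cong (ℤ.1ℤ ,_) (trans (cong₂ (zipWith _+_) (xy-two e₁ e₂) (xy-two [] e₃))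
    (trans (zip-two (λ v → count v e₁) (λ v → count v e₂) (λ _ → 0) (λ v → count v e₃))
      (trans (two-cong (λ v → +-identityʳ (count v e₁)) (λ v → trans (sym (count-++ v e₂ e₃)) (sym (count-↭ v p)))) (sym (xy-two e₁ e)))))

-- The factor for (∅ , β) concerns only the y variables, so the tableau e₁ of the x variables is
-- carried along and the Littlewood-Richardson rule acts for each e₁ separately.
LR-product : ∀ N m {α₁ α₂ β} → IsPart α₂ → IsPart β →
  ΣL (δ-times m (s2 N [] β)) (s2 N α₁ α₂) ≡ ΣL (λ γt → ΣL (δ m) (s2 N α₁ (proj₁ γt))) (tops β α₂)
LR-product N m {α₁} {α₂} {β} Pα₂ Pβ = begin
    ΣL (δ-times m (s2 N [] β)) (s2 N α₁ α₂)
      ≡⟨ s2-Σ (δ-times m (s2 N [] β)) N α₁ α₂ ⟩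
    ΣL (λ e₁ → ΣL (λ e₂ → δ-times m (s2 N [] β) (xTerm N e₁ ⊗ yTerm N e₂)) (SSYT N α₂)) (SSYT N α₁)
      ≡⟨ ΣL-cong (SSYT N α₁) (λ {e₁} _ → per e₁) ⟩
    ΣL (λ e₁ → ΣL (λ γt → ΣL (λ e → δ m (xTerm N e₁ ⊗ yTerm N e)) (SSYT N (proj₁ γt))) (tops β α₂)) (SSYT N α₁)
      ≡⟨ ΣL-swap (λ e₁ γt → ΣL (λ e → δ m (xTerm N e₁ ⊗ yTerm N e)) (SSYT N (proj₁ γt))) (SSYT N α₁) (tops β α₂) ⟩
    ΣL (λ γt → ΣL (λ e₁ → ΣL (λ e → δ m (xTerm N e₁ ⊗ yTerm N e)) (SSYT N (proj₁ γt))) (SSYT N α₁)) (tops β α₂)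
      ≡⟨ ΣL-cong (tops β α₂) (λ {γt} _ → s2-Σ (δ m) N α₁ (proj₁ γt)) ⟨
    ΣL (λ γt → ΣL (δ m) (s2 N α₁ (proj₁ γt))) (tops β α₂) ∎
  where
  open ≡-Reasoning
  open LR N Pα₂ Pβ
  per : ∀ e₁ → ΣL (λ e₂ → δ-times m (s2 N [] β) (xTerm N e₁ ⊗ yTerm N e₂)) (SSYT N α₂)
    ≡ ΣL (λ γt → ΣL (λ e → δ m (xTerm N e₁ ⊗ yTerm N e)) (SSYT N (proj₁ γt))) (tops β α₂)
  per e₁ = begin
    ΣL (λ e₂ → δ-times m (s2 N [] β) (xTerm N e₁ ⊗ yTerm N e₂)) (SSYT N α₂)
      -- The empty shape has the empty filling as its only tableau, so the sum over the x part of
      -- the second factor has a single summand.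
      ≡⟨ ΣL-cong (SSYT N α₂) (λ {e₂} _ → trans (s2-Σ (λ s → δ m ((xTerm N e₁ ⊗ yTerm N e₂) ⊗ s)) N [] β) (ℤₚ.+-identityʳ (ΣL (λ e₃ → term (e₂ , e₃)) (SSYT N β)))) ⟩
    ΣL (λ e₂ → ΣL (λ e₃ → term (e₂ , e₃)) (SSYT N β)) (SSYT N α₂)
      ≡⟨ ΣL-bind term (SSYT N α₂) (λ _ → SSYT N β) ⟨
    ΣL term pairs
      ≡⟨ LR-sum term (λ e → δ m (xTerm N e₁ ⊗ yTerm N e)) (λ {e₂} {e₃} p → cong (δ m) (Monomials.product-term N e₁ {e₂} {e₃} p)) ⟩
    ΣL ((λ e → δ m (xTerm N e₁ ⊗ yTerm N e)) ∘ proj₂) products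
      ≡⟨ ΣL-bind _ (tops β α₂) overTop ⟩
    ΣL (λ γt → ΣL (λ e → δ m (xTerm N e₁ ⊗ yTerm N e)) (SSYT N (proj₁ γt))) (tops β α₂) ∎
    where
    term : Filling × Filling → ℤ
    term (e₂ , e₃) = δ m ((xTerm N e₁ ⊗ yTerm N e₂) ⊗ (xTerm N [] ⊗ yTerm N e₃))

-- The recursion

no-cells : ∀ α → cells (α /ₛ α) ≡ []
no-cells α with cells (α /ₛ α) in e
... | [] = refl
... | c ∷ _ with ∈cells⁻ {α /ₛ α} {c} (subst (c ∈_) (sym e) (here refl))
...   | ins p q = ⊥-elim (<⇒≱ q p)

trivial-pict : ∀ α β → Pict (α /ₛ α) (β /ₛ β)
trivial-pict α β = record { f = id ; g = id ; f∈ = bad ; g∈ = bad ; gf = λ _ → refl ; fg = λ _ → refl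
    ; f→ = λ p _ → bad p ; f↓ = λ p _ → bad p ; g→ = λ p _ → bad p ; g↓ = λ p _ → bad p }
  where
  bad : ∀ {γ c} {A : Set} → c ∈ₛ (γ /ₛ γ) → A
  bad (ins p q) = ⊥-elim (<⇒≱ q p)

tab-trivial : ∀ {α B} (p : Pict (α /ₛ α) B) → tab p ≡ []
tab-trivial {α} {B} p = cong (map (λ c → lab B (Pict.f p c))) (no-cells α)

not-self : ∀ {α i j} {A : Set} → (i , j) ∈ₛ (α /ₛ α) → A
not-self (ins p q) = ⊥-elim (<⇒≱ q p)

ΣL-single : ∀ {A : Set} (k : ℤ) {xs : List A} {x} → Unique xs → x ∈ xs → (∀ {y} → y ∈ xs → y ≡ x) → ΣL (λ _ → k) xs ≡ k
ΣL-single k {xs} {x} u m h = trans (ΣL-↭ (λ _ → k) (↭-same u ([] ∷ []) (λ y∈ → here (h y∈)) λ { (here refl) → m })) (ℤₚ.+-identityʳ k)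

ΣL-split : ∀ {A : Set} {f g : A → ℤ} {k xs a} → Unique xs → a ∈ xs → f a ≡ k ℤ.+ g a →
  (∀ {x} → x ∈ xs → x ≢ a → f x ≡ g x) → ΣL f xs ≡ k ℤ.+ ΣL g xs
ΣL-split {f = f} {g} {k} {x ∷ xs} u (here refl) e h = trans (cong₂ ℤ._+_ e
  (ΣL-cong xs λ y∈ → h (there y∈) λ { refl → Unique-head∉ u y∈ })) (ℤₚ.+-assoc k (g x) _)
ΣL-split {f = f} {g} {k} {x ∷ xs} u@(_ ∷ u') (there m) e h = begin
    f x ℤ.+ ΣL f xs            ≡⟨ cong₂ ℤ._+_ (h (here refl) λ { refl → Unique-head∉ u m }) (ΣL-split {f = f} {g} {k} u' m e (h ∘ there)) ⟩
    g x ℤ.+ (k ℤ.+ ΣL g xs)    ≡⟨ ℤₚ.+-assoc (g x) k _ ⟨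
    g x ℤ.+ k ℤ.+ ΣL g xs      ≡⟨ cong (λ z → z ℤ.+ ΣL g xs) (ℤₚ.+-comm (g x) k) ⟩
    k ℤ.+ g x ℤ.+ ΣL g xs      ≡⟨ ℤₚ.+-assoc k (g x) _ ⟩
    k ℤ.+ (g x ℤ.+ ΣL g xs)    ∎
  where open ≡-Reasoning

target : List ℕ × List ℕ × Filling → List ℕ × List ℕ
target (β₂ , β₁ , _) = β₁ , β₂

-- Takes the trivial arrow or triple, whose tableau is the empty filling, out of an enumeration that
-- includes it. What remains has the form of the definitions, which exclude it by an `if`.
module Split (α₁ α₂ : List ℕ) (O : List ℕ → List (List ℕ)) (X : List ℕ → List ℕ → List Filling)
  (uO : ∀ β₂ → Unique (O β₂)) (α₂∈ : α₂ ∈ inners α₂) (α₁∈ : α₁ ∈ O α₂)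
  (uX : Unique (X α₂ α₁)) ([]∈ : [] ∈ X α₂ α₁) (only : ∀ {t} → t ∈ X α₂ α₁ → t ≡ []) (F : List ℕ × List ℕ → ℤ) where

  same : List ℕ → List ℕ → Bool
  same β₁ β₂ = eqList β₁ α₁ ∧ eqList β₂ α₂

  full others : List ℕ → List ℕ → ℤ
  full β₂ β₁ = ΣL (λ _ → F (β₁ , β₂)) (X β₂ β₁)
  others β₂ β₁ = if same β₁ β₂ then ℤ.0ℤ else full β₂ β₁

  rest : ℤ
  rest = ΣL (λ β₂ → ΣL (others β₂) (O β₂)) (inners α₂)

  split-sum : ΣL (F ∘ target) (bind (inners α₂) λ β₂ → bind (O β₂) (X β₂)) ≡ F (α₁ , α₂) ℤ.+ rest
  split-sum = trans (ΣL-bind (F ∘ target) (inners α₂) (λ β₂ → bind (O β₂) (X β₂)))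
    (trans (ΣL-cong (inners α₂) λ {β₂} _ → ΣL-bind (λ z → F (target (β₂ , z))) (O β₂) (X β₂))
      (ΣL-split {f = λ β₂ → ΣL (full β₂) (O β₂)} {λ β₂ → ΣL (others β₂) (O β₂)} {F (α₁ , α₂)} (Unique-inners α₂) α₂∈
        (ΣL-split {f = full α₂} {others α₂} {F (α₁ , α₂)} (uO α₂) α₁∈
          (trans (ΣL-single (F (α₁ , α₂)) uX []∈ only)
            (sym (trans (cong (λ z → F (α₁ , α₂) ℤ.+ z) (if-yes {x = ℤ.0ℤ} {full α₂ α₁} both)) (ℤₚ.+-identityʳ (F (α₁ , α₂))))))
          λ {β₁} _ n → sym (if-no {x = ℤ.0ℤ} {full α₂ β₁} λ t → n (eqList⇒≡ β₁ α₁ (T-∧ˡ t))))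
        λ {β₂} _ n → ΣL-cong (O β₂) λ {β₁} _ → sym (if-no {x = ℤ.0ℤ} {full β₂ β₁} λ t → n (eqList⇒≡ β₂ α₂ (T-∧ʳ {eqList β₁ α₁} t)))))
    where
    both : T (same α₁ α₂)
    both = T-∧⁺ {eqList α₁ α₁} (eqList-refl α₁) (eqList-refl α₂)

ΣL-if : ∀ {A : Set} (f : A → ℤ) (b : Bool) xs → ΣL f (if b then [] else xs) ≡ (if b then ℤ.0ℤ else ΣL f xs)
ΣL-if f true  xs = refl
ΣL-if f false xs = refl

module _ (r : ℕ) {α₁ α₂ : List ℕ} (Pα₁ : IsPart α₁) (Pα₂ : IsPart α₂) where

  outers-self : α₁ ∈ outers α₁ (size α₁ + (size α₂ ∸ size α₂))
  outers-self = subst (λ n → α₁ ∈ outers α₁ n) (sym (trans (cong (size α₁ +_) (n∸n≡0 (size α₂))) (+-identityʳ _))) (∈-outers⁺ {α₁} Pα₁ (λ _ → ≤-refl))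

  arrows-self : [] ∈ arrowsAt r α₁ α₂ α₂ α₁
  arrows-self = subst (_∈ arrowsAt r α₁ α₂ α₂ α₁) (tab-trivial (trivial-pict α₁ α₂))
    (∈-filterᵇ⁺ {p = rowRuleOK r α₁ α₂ α₁ α₂} (tab∈RW (skew-convex Pα₁ Pα₁) (skew-convex Pα₂ Pα₂) (trivial-pict α₁ α₂))
      (rule⁺ r α₁ α₂ α₁ α₂ (trivial-pict α₁ α₂) not-self))

  RW-self : ∀ {B t} → Convex B → t ∈ RW (α₁ /ₛ α₁) B → t ≡ []
  RW-self {B} cB m = let p , e = RW⇒pict {α₁ /ₛ α₁} {B} (skew-convex Pα₁ Pα₁) cB m in trans e (tab-trivial p)

  arrows-only : ∀ {t} → t ∈ arrowsAt r α₁ α₂ α₂ α₁ → t ≡ []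
  arrows-only m = RW-self {α₂ /ₛ α₂} (skew-convex Pα₂ Pα₂) (proj₁ (∈-filterᵇ⁻ {p = rowRuleOK r α₁ α₂ α₁ α₂} {xs = RW (α₁ /ₛ α₁) (α₂ /ₛ α₂)} m))

  targets-sum : ∀ F → ΣL (F ∘ target) (Arr r α₁ α₂) ≡ F (α₁ , α₂) ℤ.+ ΣL F (ruleTargets r α₁ α₂)
  targets-sum F = trans split-sum (cong (λ z → F (α₁ , α₂) ℤ.+ z) (sym others-sum))
    where
    open Split α₁ α₂ (λ β₂ → outers α₁ (size α₁ + (size α₂ ∸ size β₂))) (arrowsAt r α₁ α₂) (λ β₂ → Unique-outers α₁ (size α₁ + (size α₂ ∸ size β₂)))
      (∈-inners⁺ {α₂} Pα₂ (λ _ → ≤-refl)) outers-self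
      (Unique-filterᵇ {p = rowRuleOK r α₁ α₂ α₁ α₂} (Unique-RW (α₁ /ₛ α₁) (α₂ /ₛ α₂))) arrows-self arrows-only F
    over : List ℕ → List ℕ → List (List ℕ × List ℕ)
    over β₂ β₁ = if same β₁ β₂ then [] else map (λ _ → β₁ , β₂) (arrowsAt r α₁ α₂ β₂ β₁)
    overs : List ℕ → List (List ℕ × List ℕ)
    overs β₂ = concatMap (over β₂) (outers α₁ (size α₁ + (size α₂ ∸ size β₂)))
    others-sum : ΣL F (concatMap overs (inners α₂)) ≡ rest
    others-sum = trans (ΣL-concatMap F overs (inners α₂)) (ΣL-cong (inners α₂) λ {β₂} _ →
      trans (ΣL-concatMap F (over β₂) (outers α₁ (size α₁ + (size α₂ ∸ size β₂))))
        (ΣL-cong (outers α₁ (size α₁ + (size α₂ ∸ size β₂))) λ {β₁} _ →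
          trans (ΣL-if F (same β₁ β₂) (map (λ _ → β₁ , β₂) (arrowsAt r α₁ α₂ β₂ β₁)))
            (cong (λ z → if same β₁ β₂ then ℤ.0ℤ else z) (ΣL-map F (λ _ → β₁ , β₂) (arrowsAt r α₁ α₂ β₂ β₁)))))

  ruleTargets⁻ : ∀ {β₁ β₂} → (β₁ , β₂) ∈ ruleTargets r α₁ α₂ → ∃[ t ] IsArrow r Pα₁ Pα₂ β₂ β₁ t × ¬ (β₁ ≡ α₁ × β₂ ≡ α₂)
  ruleTargets⁻ {β₁} {β₂} m with concatMap-∈ (inners α₂) m
  ... | β₂' , m₂ , m' with concatMap-∈ (outers α₁ (size α₁ + (size α₂ ∸ size β₂'))) m'
  ...   | β₁' , m₁ , m'' with eqList β₁' α₁ ∧ eqList β₂' α₂ in e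
  ...     | false with ∈-map⁻ (λ _ → β₁' , β₂') m''
  ...       | t , t∈ , refl = t , ∈-Arr⁻ r Pα₁ Pα₂ (∈-bind⁺ {f = arrowsOver r α₁ α₂} m₂ (∈-bind⁺ {f = arrowsAt r α₁ α₂ β₂} m₁ t∈)) ,
              λ { (refl , refl) → subst T e (T-∧⁺ {eqList α₁ α₁} (eqList-refl α₁) (eqList-refl α₂)) }

  -- If |β₂| = |α₂|, then α₂/β₂ has no boxes, hence neither has β₁/α₁, and the arrow is trivial.
  arrow-smaller : ∀ {β₁ β₂ t} → IsArrow r Pα₁ Pα₂ β₂ β₁ t → ¬ (β₁ ≡ α₁ × β₂ ≡ α₂) → size β₂ < size α₂
  arrow-smaller {β₁} {β₂} A n = ≤∧≢⇒< (size-mono {β₂} {α₂} β₂⊆) λ e → n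
      (sym (at-ext Pα₁ Pβ₁ (equal {α₁} {β₁} ⊆β₁ (trans (pict-size pict) (no-more e)))) , at-ext Pβ₂ Pα₂ (equal {β₂} {α₂} β₂⊆ (no-more e)))
    where
    open IsArrow A
    no-more : size β₂ ≡ size α₂ → nCells (α₂ /ₛ β₂) ≡ 0
    no-more e = +-cancelˡ-≡ (size β₂) _ _ (trans (sym (size-skew {β₂} {α₂} β₂⊆)) (trans (sym e) (sym (+-identityʳ _))))
    equal : ∀ {γ δ} → γ ⊆ᵖ δ → nCells (δ /ₛ γ) ≡ 0 → ∀ i → at γ i ≡ at δ i
    equal {γ} {δ} le z i = ≤-antisym (le i) (≤-from-< λ {j} h → ≰⇒> λ q → empty (cells (δ /ₛ γ)) z (∈cells⁺ {δ /ₛ γ} {i , j} (ins q h)))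
      where
      empty : ∀ (cs : List Cell) → length cs ≡ 0 → ∀ {c} → ¬ (c ∈ cs)
      empty [] _ ()

  targets-smaller : ∀ {β₁ β₂} → (β₁ , β₂) ∈ ruleTargets r α₁ α₂ → IsPart β₁ × IsPart β₂ × size β₂ < size α₂
  targets-smaller m = let t , A , n = ruleTargets⁻ m in IsArrow.Pβ₁ A , IsArrow.Pβ₂ A , arrow-smaller A n

concatMap-cong-∈ : ∀ {A B : Set} {f g : A → List B} xs → (∀ {x} → x ∈ xs → f x ≡ g x) → concatMap f xs ≡ concatMap g xs
concatMap-cong-∈ xs h = cong concat (map-cong-∈ xs h)

τfuel-suc : ∀ f N r α₁ α₂ → τfuel (suc f) N r α₁ α₂ ≡
  s2 N α₁ α₂ ++ negP (concatMap (λ z → τfuel f N r (proj₁ z) (proj₂ z)) (ruleTargets r α₁ α₂))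
τfuel-suc f N r α₁ α₂ = refl

-- By `targets-smaller` the second partition shrinks along every arrow, so any fuel above |α₂| is
-- never exhausted.
τ-fuel : ∀ f f' N r {α₁ α₂} → IsPart α₁ → IsPart α₂ → size α₂ < f → size α₂ < f' → τfuel f N r α₁ α₂ ≡ τfuel f' N r α₁ α₂
τ-fuel (suc f) (suc f') N r {α₁} {α₂} P Q h h' = cong (λ z → s2 N α₁ α₂ ++ negP z)
  (concatMap-cong-∈ {f = λ z → τfuel f N r (proj₁ z) (proj₂ z)} {λ z → τfuel f' N r (proj₁ z) (proj₂ z)} (ruleTargets r α₁ α₂)
    λ m → let P' , Q' , l = targets-smaller r P Q m in τ-fuel f f' N r P' Q' (<-≤-trans l (s≤s⁻¹ h)) (<-≤-trans l (s≤s⁻¹ h')))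

-- In terms of sums over arrows the recursion for τ reads s = Σ τ, including the trivial arrow.
τ-recursion : ∀ {G} → Odd G → ∀ N r {α₁ α₂} → IsPart α₁ → IsPart α₂ →
  ΣL G (s2 N α₁ α₂) ≡ ΣL (λ a → ΣL G (τ N r (proj₁ (target a)) (proj₂ (target a)))) (Arr r α₁ α₂)
τ-recursion {G} odd N r {α₁} {α₂} P Q = sym (trans (targets-sum r P Q F) (begin
    ΣL G (τ N r α₁ α₂) ℤ.+ ΣL F (ruleTargets r α₁ α₂)
      ≡⟨ cong (λ z → z ℤ.+ ΣL F (ruleTargets r α₁ α₂)) unfold ⟩
    ΣL G (s2 N α₁ α₂) ℤ.+ (ℤ.- ΣL F (ruleTargets r α₁ α₂)) ℤ.+ ΣL F (ruleTargets r α₁ α₂)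
      ≡⟨ ℤₚ.+-assoc (ΣL G (s2 N α₁ α₂)) _ _ ⟩
    ΣL G (s2 N α₁ α₂) ℤ.+ (ℤ.- ΣL F (ruleTargets r α₁ α₂) ℤ.+ ΣL F (ruleTargets r α₁ α₂))
      ≡⟨ cong (λ z → ΣL G (s2 N α₁ α₂) ℤ.+ z) (ℤₚ.+-inverseˡ (ΣL F (ruleTargets r α₁ α₂))) ⟩
    ΣL G (s2 N α₁ α₂) ℤ.+ ℤ.0ℤ
      ≡⟨ ℤₚ.+-identityʳ _ ⟩
    ΣL G (s2 N α₁ α₂) ∎))
  where
  open ≡-Reasoning
  F : List ℕ × List ℕ → ℤ
  F (β₁ , β₂) = ΣL G (τ N r β₁ β₂)
  unfold : ΣL G (τ N r α₁ α₂) ≡ ΣL G (s2 N α₁ α₂) ℤ.+ (ℤ.- ΣL F (ruleTargets r α₁ α₂))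
  unfold = trans (cong (ΣL G) (τfuel-suc (size α₂) N r α₁ α₂)) (trans (ΣL-++ G (s2 N α₁ α₂) (negP tails))
    (cong (λ z → ΣL G (s2 N α₁ α₂) ℤ.+ z) (trans (ΣL-negP odd tails) (cong ℤ.-_
      (trans (ΣL-concatMap G each (ruleTargets r α₁ α₂)) (ΣL-cong (ruleTargets r α₁ α₂) λ {z} m →
        let P' , Q' , l = targets-smaller r P Q m in cong (ΣL G) (τ-fuel (size α₂) (suc (size (proj₂ z))) N r P' Q' l ≤-refl)))))))
    where
    each : List ℕ × List ℕ → Poly
    each z = τfuel (size α₂) N r (proj₁ z) (proj₂ z)
    tails : Poly
    tails = concatMap each (ruleTargets r α₁ α₂)

module _ (r : ℕ) {α₁ α₂ β γ : List ℕ} (Pα₁ : IsPart α₁) (Pα₂ : IsPart α₂) (Pβ : IsPart β) {t : Filling} (top : (γ , t) ∈ tops β α₂) where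

  private
    Pγ = proj₁ (∈-tops⁻ Pβ Pα₂ top)
    γ-size = proj₁ (proj₂ (∈-tops⁻ Pβ Pα₂ top))
    pt = proj₁ (proj₂ (proj₂ (∈-tops⁻ Pβ Pα₂ top)))
    t≡ = proj₂ (proj₂ (proj₂ (∈-tops⁻ Pβ Pα₂ top)))
    p₀ = trivial-pict γ α₁

    -- With λ₁ = α₁ the lower part of X is empty, so every box of α₂ is sent to the upper part and
    -- no entry exceeds k.
    trivial-diffusion : T (diffusion r α₁ α₂ β γ α₁ γ t (tab p₀))
    trivial-diffusion = Diffusion.no-rule⁺ r α₁ α₂ β α₁ γ γ Pα₁ Pα₂ Pβ Pα₁ Pγ (λ _ → ≤-refl) (proj₁ found) (tab p₀) t
        (subst (RSrel (proj₁ found) γ (Utilde γ γ (tab p₀))) (sym t≡) (proj₂ found)) γ-size all-hi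
      where
      found = Pass.Up.up Pα₁ Pα₂ Pβ Pα₁ Pγ (λ _ → ≤-refl) Pγ (λ _ → ≤-refl) p₀ pt
      module SX = StarShape γ α₁ α₁
      all-hi : ∀ {i j} → (i , j) ∈ₛ (α₂ /ₛ []) → ¬ SatV r (length γ) (proj₁ (Pict.f (proj₁ found) (StarShape.hi α₂ β [] (i , j)))) i j
      all-hi {i} {j} m = go (SX.view (Pict.f∈ (proj₁ found) (StarShape.hi∈ α₂ β [] m)))
        where
        go : ∀ {c} → SX.View c → ¬ SatV r (length γ) (proj₁ c) i j
        go (SX.isHi h) (a , _) = <⇒≱ (SX.hi< h) a
        go (SX.isLo l) _ = not-self l

    ok : Filling → Bool
    ok u = barredRowRule r α₁ γ α₁ γ u ∧ diffusion r α₁ α₂ β γ α₁ γ t u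

  triples-self : [] ∈ triplesAt r α₁ α₂ β γ t γ α₁
  triples-self = subst (_∈ triplesAt r α₁ α₂ β γ t γ α₁) (tab-trivial p₀)
    (∈-filterᵇ⁺ {p = ok} (tab∈RW (skew-convex Pγ Pγ) (skew-convex Pα₁ Pα₁) p₀)
      (T-∧⁺ {barredRowRule r α₁ γ α₁ γ (tab p₀)} (barred⁺ r α₁ γ α₁ γ p₀ not-self) trivial-diffusion))

  triples-only : ∀ {u} → u ∈ triplesAt r α₁ α₂ β γ t γ α₁ → u ≡ []
  triples-only m = RW-self r Pγ Pα₁ {α₁ /ₛ α₁} (skew-convex Pα₁ Pα₁) (proj₁ (∈-filterᵇ⁻ {p = ok} {xs = RW (γ /ₛ γ) (α₁ /ₛ α₁)} m))

  triples-sum : ∀ G N → ΣL (λ a → ΣL G (τ N r (proj₁ (target a)) (proj₂ (target a)))) (Tri r α₁ α₂ β γ t)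
    ≡ ΣL G (τ N r α₁ γ ++ innerTriples N r α₁ α₂ β γ t)
  triples-sum G N = trans split-sum (sym (trans (ΣL-++ G (τ N r α₁ γ) (innerTriples N r α₁ α₂ β γ t)) (cong (λ z → ΣL G (τ N r α₁ γ) ℤ.+ z) others-sum)))
    where
    open Split α₁ γ (λ ν → outers α₁ (size α₁ + (size γ ∸ size ν))) (triplesAt r α₁ α₂ β γ t) (λ ν → Unique-outers α₁ (size α₁ + (size γ ∸ size ν)))
      (∈-inners⁺ {γ} Pγ (λ _ → ≤-refl)) (outers-self r Pα₁ Pγ)
      (Unique-filterᵇ {p = ok} (Unique-RW (γ /ₛ γ) (α₁ /ₛ α₁))) triples-self triples-only (λ z → ΣL G (τ N r (proj₁ z) (proj₂ z)))
    over : List ℕ → List ℕ → Poly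
    over λ₂ λ₁ = if same λ₁ λ₂ then [] else concatMap (λ _ → τ N r λ₁ λ₂) (triplesAt r α₁ α₂ β γ t λ₂ λ₁)
    overs : List ℕ → Poly
    overs λ₂ = concatMap (over λ₂) (outers α₁ (size α₁ + (size γ ∸ size λ₂)))
    others-sum : ΣL G (concatMap overs (inners γ)) ≡ rest
    others-sum = trans (ΣL-concatMap G overs (inners γ)) (ΣL-cong (inners γ) λ {λ₂} _ →
      trans (ΣL-concatMap G (over λ₂) (outers α₁ (size α₁ + (size γ ∸ size λ₂))))
        (ΣL-cong (outers α₁ (size α₁ + (size γ ∸ size λ₂))) λ {λ₁} _ →
          trans (ΣL-if G (same λ₁ λ₂) (concatMap (λ _ → τ N r λ₁ λ₂) (triplesAt r α₁ α₂ β γ t λ₂ λ₁)))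
            (cong (λ z → if same λ₁ λ₂ then ℤ.0ℤ else z) (ΣL-concatMap G (λ _ → τ N r λ₁ λ₂) (triplesAt r α₁ α₂ β γ t λ₂ λ₁)))))

-- No box of β satisfies the row rule with an entry in the first row, and such an entry exists
-- for every non-trivial arrow from (∅ , β).
no-targets : ∀ r {β} → IsPart β → firstRow β < r → ruleTargets r [] β ≡ []
no-targets r {β} Pβ h with ruleTargets r [] β in e
... | [] = refl
... | (β₁ , β₂) ∷ _ = ⊥-elim (impossible (ruleTargets⁻ r IsPart-[] Pβ (subst ((β₁ , β₂) ∈_) (sym e) (here refl))))
  where
  impossible : ¬ (∃[ t ] IsArrow r IsPart-[] Pβ β₂ β₁ t × ¬ (β₁ ≡ [] × β₂ ≡ β))
  impossible (t , A , n) = corner β₁ refl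
    where
    open IsArrow A
    corner : ∀ γ → β₁ ≡ γ → ⊥
    -- With β₁ = ∅ the arrow has no boxes, so |β₂| = |β|, against `arrow-smaller`.
    corner [] refl = <-irrefl (trans (sym (+-identityʳ _)) (trans (cong (size β₂ +_) (pict-size pict)) (sym (size-skew {β₂} {β} β₂⊆)))) (arrow-smaller r IsPart-[] Pβ A n)
    corner (x ∷ γ) refl = <⇒≱ h (first (f (0 , 0)) refl)
      where
      open Pict pict
      c∈ : (0 , 0) ∈ₛ ((x ∷ γ) /ₛ [])
      c∈ = ins z≤n (All.head (proj₂ Pβ₁))
      first : ∀ d → f (0 , 0) ≡ d → r ≤ firstRow β
      first (i , j) e = ≤-trans (m≤m+n r i) (≤-trans (subst (λ c → Sat r i j (proj₁ c)) (trans (cong g (sym e)) (gf c∈)) (rule d∈))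
          (≤-trans (<outer d∈) (Decr-≤ (proj₁ Pβ) z≤n)))
        where
        d∈ : (i , j) ∈ₛ (β /ₛ β₂)
        d∈ = subst (_∈ₛ (β /ₛ β₂)) e (f∈ c∈)

τ-∅ : ∀ N r {β} → IsPart β → firstRow β < r → τ N r [] β ≡ s2 N [] β
τ-∅ N r {β} Pβ h = trans (cong (λ T → s2 N [] β ++ negP (concatMap (λ z → τfuel (size β) N r (proj₁ z) (proj₂ z)) T)) (no-targets r Pβ h)) (++-identityʳ _)

module Product (N r : ℕ) {β : List ℕ} (Pβ : IsPart β) (β<r : firstRow β < r) (m : Mono) where

  G : ℤ × Mono → ℤ
  G = δ-times m (s2 N [] β)

  -- Coefficients of the monomial `m` attached to a vertex: `t` in τ, `D` in the product of τ with
  -- the polynomial of (∅ , β), `R` in the claimed right-hand side, with the leading summand counted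
  -- as the trivial triple.
  t D R : List ℕ × List ℕ → ℤ
  t z = ΣL (δ m) (τ N r (proj₁ z) (proj₂ z))
  D z = ΣL G (τ N r (proj₁ z) (proj₂ z))
  R (α₁ , α₂) = ΣL (λ γt → ΣL (t ∘ target) (Tri r α₁ α₂ β (proj₁ γt) (proj₂ γt))) (tops β α₂)

  -- `τ-recursion` is used twice: backwards at (α₁ , α₂) for the functional of the product, and
  -- forwards at each (α₁ , γ) for the plain coefficient. The Littlewood-Richardson rule stands
  -- between the two, and the bijection regroups the result by arrows leaving (α₁ , α₂).
  arrows-sum : ∀ {α₁ α₂} → IsPart α₁ → IsPart α₂ → ΣL (D ∘ target) (Arr r α₁ α₂) ≡ ΣL (R ∘ target) (Arr r α₁ α₂)
  arrows-sum {α₁} {α₂} P Q = begin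
      ΣL (D ∘ target) (Arr r α₁ α₂)
        ≡⟨ τ-recursion (δ-times-odd m (s2 N [] β)) N r P Q ⟨
      ΣL G (s2 N α₁ α₂)
        ≡⟨ LR-product N m {α₁} Q Pβ ⟩
      ΣL (λ γt → ΣL (δ m) (s2 N α₁ (proj₁ γt))) (tops β α₂)
        ≡⟨ ΣL-cong (tops β α₂) (λ {γt} h → τ-recursion (δ-odd m) N r P (proj₁ (∈-tops⁻ Pβ Q {proj₁ γt} {proj₂ γt} h))) ⟩
      ΣL (λ γt → ΣL (t ∘ target) (Arr r α₁ (proj₁ γt))) (tops β α₂)
        ≡⟨ ΣL-bind (λ x → t (target (proj₂ x))) (tops β α₂) leftOver ⟨
      ΣL (λ x → t (target (proj₂ x))) lefts
        ≡⟨ main-sum t ⟩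
      ΣL (λ x → t (target (proj₂ (proj₂ x)))) rights
        ≡⟨ ΣL-bind (λ x → t (target (proj₂ (proj₂ x)))) (Arr r α₁ α₂) rightOver ⟩
      ΣL (λ μ → ΣL (λ y → t (target (proj₂ y))) (rightOver μ)) (Arr r α₁ α₂)
        ≡⟨ ΣL-cong (Arr r α₁ α₂) (λ {μ} _ → ΣL-bind (λ y → t (target (proj₂ y))) (tops β (proj₁ μ)) (rightTri μ)) ⟩
      ΣL (R ∘ target) (Arr r α₁ α₂) ∎
    where
    open ≡-Reasoning
    open Main r P Q Pβ hiding (target)

  expand : ∀ n {α₁ α₂} → IsPart α₁ → IsPart α₂ → size α₂ < n → D (α₁ , α₂) ≡ R (α₁ , α₂)
  expand (suc n) {α₁} {α₂} P Q h = cancel (D (α₁ , α₂)) (R (α₁ , α₂)) (ΣL R (ruleTargets r α₁ α₂)) (begin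
      D (α₁ , α₂) ℤ.+ ΣL R (ruleTargets r α₁ α₂)
        ≡⟨ cong (λ z → D (α₁ , α₂) ℤ.+ z) (ΣL-cong (ruleTargets r α₁ α₂) (λ {z} μ∈ →
             let P' , Q' , l = targets-smaller r P Q μ∈ in expand n P' Q' (<-≤-trans l (s≤s⁻¹ h)))) ⟨
      D (α₁ , α₂) ℤ.+ ΣL D (ruleTargets r α₁ α₂)
        ≡⟨ targets-sum r P Q D ⟨
      ΣL (D ∘ target) (Arr r α₁ α₂)
        ≡⟨ arrows-sum P Q ⟩
      ΣL (R ∘ target) (Arr r α₁ α₂)
        ≡⟨ targets-sum r P Q R ⟩
      R (α₁ , α₂) ℤ.+ ΣL R (ruleTargets r α₁ α₂) ∎)
    where
    open ≡-Reasoning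
    cancel : ∀ a b c → a ℤ.+ c ≡ b ℤ.+ c → a ≡ b
    cancel a b c e = trans (sym (undo a)) (trans (cong (λ z → z ℤ.- c) e) (undo b))
      where
      undo : ∀ a → a ℤ.+ c ℤ.- c ≡ a
      undo a = trans (ℤₚ.+-assoc a c (ℤ.- c)) (trans (cong (λ z → a ℤ.+ z) (ℤₚ.+-inverseʳ c)) (ℤₚ.+-identityʳ a))

  rhs-sum : ∀ {α₁ α₂} → IsPart α₁ → IsPart α₂ → ΣL (δ m) (rhs N r α₁ α₂ β) ≡ R (α₁ , α₂)
  rhs-sum {α₁} {α₂} P Q = begin
      ΣL (δ m) (rhs N r α₁ α₂ β)
        ≡⟨ ΣL-concatMap (δ m) _ (partitionsOf (size β + size α₂)) ⟩
      ΣL (λ γ → ΣL (δ m) (concatMap (λ t → τ N r α₁ γ ++ innerTriples N r α₁ α₂ β γ t) (topsAt β α₂ γ))) (partitionsOf (size β + size α₂))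
        ≡⟨ ΣL-cong (partitionsOf (size β + size α₂)) (λ {γ} _ → ΣL-concatMap (δ m) (λ t → τ N r α₁ γ ++ innerTriples N r α₁ α₂ β γ t) (topsAt β α₂ γ)) ⟩
      ΣL (λ γ → ΣL (λ t → ΣL (δ m) (τ N r α₁ γ ++ innerTriples N r α₁ α₂ β γ t)) (topsAt β α₂ γ)) (partitionsOf (size β + size α₂))
        ≡⟨ ΣL-bind (λ γt → ΣL (δ m) (τ N r α₁ (proj₁ γt) ++ innerTriples N r α₁ α₂ β (proj₁ γt) (proj₂ γt))) (partitionsOf (size β + size α₂)) (topsAt β α₂) ⟨
      ΣL (λ γt → ΣL (δ m) (τ N r α₁ (proj₁ γt) ++ innerTriples N r α₁ α₂ β (proj₁ γt) (proj₂ γt))) (tops β α₂)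
        ≡⟨ ΣL-cong (tops β α₂) (λ {γt} h → triples-sum r {γ = proj₁ γt} P Q Pβ {proj₂ γt} h (δ m) N) ⟨
      R (α₁ , α₂) ∎
    where open ≡-Reasoning

mainTheorem3 : (r : ℕ) → 0 < r
    → (β : List ℕ) → T (isPartition β) → firstRow β < r
    → (α₁ α₂ : List ℕ) → T (isPartition α₁) → T (isPartition α₂)
    → (N : ℕ)
    → mulP (τ N r α₁ α₂) (τ N r [] β) ≐ rhs N r α₁ α₂ β
mainTheorem3 r _ β hβ β<r α₁ α₂ h₁ h₂ N m = begin
    coeff (mulP (τ N r α₁ α₂) (τ N r [] β)) m      ≡⟨ cong (λ q → coeff (mulP (τ N r α₁ α₂) q) m) (τ-∅ N r Pβ β<r) ⟩
    coeff (mulP (τ N r α₁ α₂) (s2 N [] β)) m       ≡⟨ coeff-Σ (mulP (τ N r α₁ α₂) (s2 N [] β)) m ⟩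
    ΣL (δ m) (mulP (τ N r α₁ α₂) (s2 N [] β))      ≡⟨ mulP-Σ (δ m) (τ N r α₁ α₂) (s2 N [] β) ⟩
    D (α₁ , α₂)                                    ≡⟨ expand (suc (size α₂)) P₁ P₂ ≤-refl ⟩
    R (α₁ , α₂)                                    ≡⟨ rhs-sum P₁ P₂ ⟨
    ΣL (δ m) (rhs N r α₁ α₂ β)                     ≡⟨ coeff-Σ (rhs N r α₁ α₂ β) m ⟨
    coeff (rhs N r α₁ α₂ β) m                      ∎
  where
  open ≡-Reasoning
  P₁ = isPartition⁻ α₁ h₁
  P₂ = isPartition⁻ α₂ h₂
  Pβ = isPartition⁻ β hβ
  open Product N r Pβ β<r m
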